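{- If $\mathsf{VP}^0=\mathsf{VNP}^0$, then $\mathsf{VP}^0_{\mathsf{nb}}=\mathsf{VNP}^0_{\mathsf{nb}}$ and $\mathsf{VP}^0_{\mathsf{nb}}=\mathsf{V\Pi P}^0$.
   Context: Arithmetic circuits have inputs that are indeterminates or constants and gates $+,-,\times$; size is the number of gates. A constant-free circuit uses only the constant $1$. The formal degree of a circuit is defined inductively: inputs have formal degree $1$, a $+$ or $-$ gate has the maximum of the formal degrees of its inputs, a $\times$ gate has the sum; the formal degree of the circuit is that of its output gate. $\mathsf{VP}^0_{\mathsf{nb}}$: families $(f_n)$ of polynomials (with a number of variables polynomial in $n$) computed by constant-free circuits of size polynomial in $n$, with no degree bound. $\mathsf{VP}^0$: families computed by constant-free circuits of size and formal degree polynomial in $n$. $\mathsf{VNP}^0$: families $(f_n(\bar x))$ such that $f_n(\bar x)=\sum_{\bar\epsilon\in\{0,1\}^{p(n)}}g_n(\bar x,\bar\epsilon)$ for some $(g_n(\bar x,\bar y))\in\mathsf{VP}^0$ and polynomial $p$ with $|\bar y|=p(n)$. $\mathsf{VNP}^0_{\mathsf{nb}}$ is defined in the same way but with $(g_n)\in\mathsf{VP}^0_{\mathsf{nb}}$. $\mathsf{V\Pi P}^0$: families $(f_n(\bar x))$ such that $f_n(\bar x)=\prod_{\bar\epsilon\in\{0,1\}^{p(n)}}g_n(\bar x,\bar\epsilon)$ for some $(g_n(\bar x,\bar y))\in\mathsf{VP}^0_{\mathsf{nb}}$ and polynomial $p$ with $|\bar y|=p(n)$. -}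

module Defs where

open import Data.Nat using (ℕ; zero; suc; _+_; _*_; _^_; _≤_; _⊔_)
open import Data.Integer as ℤ using (ℤ)
open import Data.Fin using (Fin; zero; suc)
open import Data.Vec using (Vec; []; _∷ʳ_; lookup)
open import Data.Vec.Functional using (_++_)
open import Data.List using (List; []; _∷_)
open import Data.Product using (Σ; ∃; ∃-syntax; _×_; _,_)

PolyBounded : (ℕ → ℕ) → Set
PolyBounded t = ∃[ c ] (∀ n → t n ≤ c + n ^ c)

NatPoly : Set
NatPoly = List ℕ

evalNP : NatPoly → ℕ → ℕ
evalNP []       n = 0
evalNP (a ∷ as) n = a + n * evalNP as n

-- Constant-free arithmetic circuits as straight-line programs.
-- A node referenced by a gate is an input (an indeterminate x_i, or the
-- constant 1) or an earlier gate.

data Op : Set where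
  plus minus times : Op

data Ref (k j : ℕ) : Set where
  var  : Fin k → Ref k j
  one  : Ref k j
  gate : Fin j → Ref k j

data Gates (k : ℕ) : ℕ → Set where
  []  : Gates k zero
  _▷_ : ∀ {j} → Gates k j → Op × Ref k j × Ref k j → Gates k (suc j)

record Circuit (k : ℕ) : Set where
  field
    size   : ℕ
    gates  : Gates k size
    output : Ref k size
open Circuit public

-- semantics (polynomial functions over ℤ)
opVal : Op → ℤ → ℤ → ℤ
opVal plus  a b = a ℤ.+ b
opVal minus a b = a ℤ.- b
opVal times a b = a ℤ.* b

refVal : ∀ {k j} → (Fin k → ℤ) → Vec ℤ j → Ref k j → ℤ
refVal x v (var i)  = x i
refVal x v one      = ℤ.1ℤ
refVal x v (gate g) = lookup v g

evalGates : ∀ {k j} → Gates k j → (Fin k → ℤ) → Vec ℤ j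
evalGates []              x = []
evalGates (G ▷ (o , a , b)) x =
  let v = evalGates G x in v ∷ʳ opVal o (refVal x v a) (refVal x v b)

eval : ∀ {k} → Circuit k → (Fin k → ℤ) → ℤ
eval C x = refVal x (evalGates (gates C) x) (output C)

opDeg : Op → ℕ → ℕ → ℕ
opDeg plus  a b = a ⊔ b
opDeg minus a b = a ⊔ b
opDeg times a b = a + b

refDeg : ∀ {k j} → Vec ℕ j → Ref k j → ℕ
refDeg v (var i)  = 1
refDeg v one      = 1
refDeg v (gate g) = lookup v g

degGates : ∀ {k j} → Gates k j → Vec ℕ j
degGates []                = []
degGates (G ▷ (o , a , b)) =
  let v = degGates G in v ∷ʳ opDeg o (refDeg v a) (refDeg v b)

formalDegree : ∀ {k} → Circuit k → ℕ
formalDegree C = refDeg (degGates (gates C)) (output C)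

record Family : Set where
  constructor mkFamily
  field
    vars : ℕ → ℕ
    poly : (n : ℕ) → (Fin (vars n) → ℤ) → ℤ
open Family public

Computes : ∀ {k} → Circuit k → ((Fin k → ℤ) → ℤ) → Set
Computes C f = ∀ x → eval C x ≡ f x
  where open import Relation.Binary.PropositionalEquality using (_≡_)

VP0nb : Family → Set
VP0nb F = PolyBounded (vars F) ×
  (∃[ s ] PolyBounded s ×
    (∀ n → Σ (Circuit (vars F n)) λ C → size C ≤ s n × Computes C (poly F n)))

VP0 : Family → Set
VP0 F = PolyBounded (vars F) ×
  (∃[ s ] ∃[ d ] PolyBounded s × PolyBounded d ×
    (∀ n → Σ (Circuit (vars F n)) λ C →
       size C ≤ s n × formalDegree C ≤ d n × Computes C (poly F n)))

sumCube : (m : ℕ) → ((Fin m → ℤ) → ℤ) → ℤ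
sumCube zero    h = h (λ ())
sumCube (suc m) h = sumCube m (λ e → h (λ { zero → ℤ.0ℤ ; (suc i) → e i }))
              ℤ.+ sumCube m (λ e → h (λ { zero → ℤ.1ℤ ; (suc i) → e i }))

prodCube : (m : ℕ) → ((Fin m → ℤ) → ℤ) → ℤ
prodCube zero    h = h (λ ())
prodCube (suc m) h = prodCube m (λ e → h (λ { zero → ℤ.0ℤ ; (suc i) → e i }))
               ℤ.* prodCube m (λ e → h (λ { zero → ℤ.1ℤ ; (suc i) → e i }))

open import Relation.Binary.PropositionalEquality using (_≡_)

ExtFamily : Family → NatPoly → Set
ExtFamily F p = (n : ℕ) → (Fin (vars F n + evalNP p n) → ℤ) → ℤ

extend : (F : Family) (p : NatPoly) → ExtFamily F p → Family
extend F p g = mkFamily (λ n → vars F n + evalNP p n) g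

VNP0 : Family → Set
VNP0 F = ∃[ p ] Σ (ExtFamily F p) λ g → VP0 (extend F p g) ×
  (∀ n x → poly F n x ≡ sumCube (evalNP p n) (λ e → g n (x ++ e)))

VNP0nb : Family → Set
VNP0nb F = ∃[ p ] Σ (ExtFamily F p) λ g → VP0nb (extend F p g) ×
  (∀ n x → poly F n x ≡ sumCube (evalNP p n) (λ e → g n (x ++ e)))

VΠP0 : Family → Set
VΠP0 F = ∃[ p ] Σ (ExtFamily F p) λ g → VP0nb (extend F p g) ×
  (∀ n x → poly F n x ≡ prodCube (evalNP p n) (λ e → g n (x ++ e)))

_≐_ : (Family → Set) → (Family → Set) → Set
A ≐ B = ∀ F → (A F → B F) × (B F → A F)

-- Let VNP⁰ ⊆ VP⁰.  A Boolean program of polynomial size is verified on its transcript by a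
-- polynomial of small formal degree, so exponential sums of its values have polynomial-size
-- circuits, which can be evaluated modulo a power of two by Boolean programs.  The functions with
-- polynomial-size Boolean programs are therefore closed under exponential sums, which yields
-- division, primality, discrete logarithms, and exponential products modulo primes.
--
-- A sum or product f of exponentially many values has coefficients with exponentially many bits.
-- They are packed into one integer X, the value of f at x_i = 2^(D^(i+1)), whose residues modulo
-- small primes are easy.  Chinese remaindering in the style of Hesse, Allender and Barrington
-- gives the integers Q_k closest to X/2^k up to a bounded error: 2^(-k) is approximated by N/M
-- with M a product of blocks A_j of small primes and N = Π (A_j + 1)/2, and X N/M is summed from
-- its partial fractions.  So the digits Q_k − 2 Q_{k+1} are easy, and f is the sum over k of these
-- digits times the monomial Z^k, where the bits of k select variables Z_j standing for 2^(2^j) and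
-- x_i^(2^j); repeated squaring substitutes for Z_j.

module Submission where

open import Defs
open import Data.Bool using (Bool; true; false; _∧_; _xor_; not; T)
open import Data.Nat as ℕ using (ℕ; zero; suc; _+_; _*_; _^_; _≤_; _<_; _∸_; z≤n; s≤s)
import Data.Nat.Properties as ℕₚ
open import Data.Integer as ℤ using (ℤ; +_; -[1+_])
import Data.Integer.Properties as ℤₚ
open import Data.Fin as Fin using (Fin; zero; suc; toℕ; inject₁; inject≤; fromℕ; _↑ˡ_; _↑ʳ_; splitAt)
open import Data.Fin.Relation.Unary.Top using (view; ‵fromℕ; ‵inj₁)
open import Data.Vec as Vec using (Vec; []; _∷_; _∷ʳ_; _++_; lookup; map; tabulate; head; tail; concat; replicate; allFin)
import Data.Vec.Properties as Vecₚ
open import Data.Vec.Functional using () renaming (_++_ to _++ᶠ_)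
open import Data.List as List using (List; []; _∷_)
open import Data.Product using (Σ; ∃-syntax; _×_; _,_; proj₁; proj₂)
open import Data.Sum using (_⊎_; inj₁; inj₂)
open import Data.Empty using (⊥; ⊥-elim)
open import Data.Unit using (tt)
open import Relation.Nullary using (¬_; Dec; yes; no; contradiction)
open import Relation.Binary.PropositionalEquality using (_≡_; _≢_; refl; sym; trans; cong; cong₂; subst; module ≡-Reasoning)
open import Function using (id; const)
import Data.Nat.Tactic.RingSolver as ℕSolver
import Data.Integer.Tactic.RingSolver as ℤSolver
open import Data.Nat.DivMod using (m%n<n; m≡m%n+[m/n]*n; m<n*o⇒m/o<n; m*n/n≡m; /-monoˡ-≤; m/n*n≤m; m/n≤m)
open import Data.Integer.DivMod using (_%ℕ_; _/ℕ_; a≡a%ℕn+[a/ℕn]*n; n%ℕd<d)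
import Relation.Binary
open import Data.Nat.Divisibility using (_∣_; divides; _∣?_; ∣-trans; ∣n⇒∣m*n; m∣m*n; n∣m*n; ∣⇒≤; *-pres-∣; 1∣_; m≤n⇒m!∣n!; m%n≡0⇒n∣m; n∣m⇒m%n≡0)
open import Data.Nat.Primality using (Prime; prime?; euclidsLemma; prime⇒nonTrivial; prime⇒nonZero; prime⇒irreducible; irreducible⇒prime)
open import Data.Nat.Primality.Factorisation using (factorise)
open import Data.List.Relation.Unary.All using ([]; _∷_)
open import Data.Nat using (_!)
open import Data.Nat.GCD using (gcd; gcd-GCD; gcd[m,n]∣m; gcd[m,n]∣n; module Bézout)
open import Data.Nat.Coprimality using (Coprime; coprime-Bézout)
import Data.Fin.Properties as Finₚ
open import Relation.Nullary.Decidable using (from-yes; ¬?; _×-dec_; decidable-stable)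

-- Polynomial bounds

-- Rounding X/2^k correctly would mean comparing integers with exponentially many bits, which
-- residues do not allow. Redundant digits avoid it: when every Q_k is off from X/2^k by at most
-- 7/10, each Q_k - 2 Q_{k+1} is an integer of absolute value at most 2, hence known from its
-- residue modulo 5. In the sum of these digits times 2^k the Q_k telescope, so a wrong rounding
-- inside a packed coefficient is undone by the next digit. Only the Q_k at the boundaries between
-- coefficients survive; there X/2^k lies within 1/10 of an integer, and the error bound forces Q_k
-- to be that integer. The partial fractions of X N/M have small primes as denominators, so their
-- sum is known to within 1/32 from short approximations; an exact 2^(-k) has no such expansion over
-- odd primes. A circuit of size s may have degree 2^s. This costs nothing extra, as exponents and
-- bit positions alike are addressed by polynomially many bits. Sums pass to residues at once.
-- Products do not: they need discrete logarithms, and these need prime moduli.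

pw : ℕ → ℕ → ℕ
pw k n = (2 + n) ^ k

-- The base 2 + n is at least 2 for every n, so doubling and constants are absorbed by a larger
-- exponent with no exception for small n.
Bounded : (ℕ → ℕ) → Set
Bounded t = ∃[ k ] (∀ n → t n ≤ pw k n)

pw-mono : ∀ {j k} n → j ≤ k → pw j n ≤ pw k n
pw-mono n j≤k = ℕₚ.^-monoʳ-≤ (2 + n) j≤k

1≤pw : ∀ k n → 1 ≤ pw k n
1≤pw k n = pw-mono {0} {k} n z≤n

pw-suc : ∀ k n → pw k n + pw k n ≤ pw (suc k) n
pw-suc k n = begin
  pw k n + pw k n         ≡⟨ cong (pw k n ℕ.+_) (sym (ℕₚ.+-identityʳ _)) ⟩
  2 * pw k n              ≤⟨ ℕₚ.*-monoˡ-≤ (pw k n) (ℕₚ.m≤m+n 2 n) ⟩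
  (2 + n) * pw k n        ∎
  where open ℕₚ.≤-Reasoning

pw-* : ∀ j k n → pw j n * pw k n ≡ pw (j + k) n
pw-* j k n = sym (ℕₚ.^-distribˡ-+-* (2 + n) j k)

n<pw : ∀ k n → k < pw k n
n<pw zero n = s≤s z≤n
n<pw (suc k) n = ℕₚ.≤-trans (ℕₚ.+-mono-≤ (1≤pw k n) (n<pw k n)) (pw-suc k n)

Bounded-≤ : ∀ {s t} → (∀ n → s n ≤ t n) → Bounded t → Bounded s
Bounded-≤ s≤t (k , h) = k , λ n → ℕₚ.≤-trans (s≤t n) (h n)

Bounded-const : ∀ c → Bounded (λ _ → c)
Bounded-const c = c , λ n → ℕₚ.<⇒≤ (n<pw c n)

Bounded-pw : ∀ k → Bounded (pw k)
Bounded-pw k = k , λ n → ℕₚ.≤-refl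

Bounded-+ : ∀ {s t} → Bounded s → Bounded t → Bounded (λ n → s n + t n)
Bounded-+ (j , h) (k , h') = suc (j + k) , λ n → ℕₚ.≤-trans
  (ℕₚ.+-mono-≤ (ℕₚ.≤-trans (h n) (pw-mono n (ℕₚ.m≤m+n j k))) (ℕₚ.≤-trans (h' n) (pw-mono n (ℕₚ.m≤n+m k j))))
  (pw-suc (j + k) n)

Bounded-* : ∀ {s t} → Bounded s → Bounded t → Bounded (λ n → s n * t n)
Bounded-* (j , h) (k , h') = j + k , λ n → ℕₚ.≤-trans (ℕₚ.*-mono-≤ (h n) (h' n)) (ℕₚ.≤-reflexive (pw-* j k n))

Bounded⇒PolyBounded : ∀ {t} → Bounded t → PolyBounded t
Bounded⇒PolyBounded {t} (k , h) = c , λ n → ℕₚ.≤-trans (h n) (bound n)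
  where
  open ℕₚ.≤-Reasoning
  c : ℕ
  c = 3 ^ k + 2 * k
  3^k≤c : 3 ^ k ≤ c
  3^k≤c = ℕₚ.m≤m+n (3 ^ k) (2 * k)
  bound : ∀ n → pw k n ≤ c + n ^ c
  bound 0 = ℕₚ.≤-trans (ℕₚ.^-monoˡ-≤ k {2} {3} (s≤s (s≤s z≤n))) (ℕₚ.≤-trans 3^k≤c (ℕₚ.m≤m+n c _))
  bound 1 = ℕₚ.≤-trans 3^k≤c (ℕₚ.m≤m+n c _)
  bound n@(suc (suc m)) = begin
    (2 + n) ^ k         ≤⟨ ℕₚ.^-monoˡ-≤ k 2+n≤n^2 ⟩
    (n ^ 2) ^ k         ≡⟨ ℕₚ.^-*-assoc n 2 k ⟩
    n ^ (2 * k)         ≤⟨ ℕₚ.^-monoʳ-≤ n (ℕₚ.m≤n+m (2 * k) (3 ^ k)) ⟩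
    n ^ c               ≤⟨ ℕₚ.m≤n+m (n ^ c) c ⟩
    c + n ^ c           ∎
    where
    2+n≤n^2 : 2 + n ≤ n ^ 2
    2+n≤n^2 = begin
      2 + n             ≤⟨ ℕₚ.+-monoˡ-≤ n (s≤s (s≤s (z≤n {m}))) ⟩
      n + n             ≡⟨ lem n ⟩
      2 * n             ≤⟨ ℕₚ.*-monoˡ-≤ n (s≤s (s≤s (z≤n {m}))) ⟩
      n * n             ≡⟨ lem2 n ⟩
      n ^ 2             ∎
      where
      lem : ∀ a → a + a ≡ 2 * a
      lem = ℕSolver.solve-∀
      lem2 : ∀ a → a * a ≡ a * (a * 1)
      lem2 = ℕSolver.solve-∀

PolyBounded⇒Bounded : ∀ {t} → PolyBounded t → Bounded t
PolyBounded⇒Bounded (c , h) = Bounded-≤ h (Bounded-+ (Bounded-const c) (c , λ n → ℕₚ.^-monoˡ-≤ c (ℕₚ.m≤n+m n 2)))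

addNP : NatPoly → NatPoly → NatPoly
addNP []       q        = q
addNP (a ∷ p)  []       = a ∷ p
addNP (a ∷ p)  (b ∷ q)  = a + b ∷ addNP p q

evalNP-add : ∀ p q n → evalNP (addNP p q) n ≡ evalNP p n + evalNP q n
evalNP-add []      q       n = refl
evalNP-add (a ∷ p) []      n = sym (ℕₚ.+-identityʳ _)
evalNP-add (a ∷ p) (b ∷ q) n rewrite evalNP-add p q n = lem a b n (evalNP p n) (evalNP q n)
  where
  lem : ∀ a b n x y → a + b + n * (x + y) ≡ a + n * x + (b + n * y)
  lem = ℕSolver.solve-∀

-- Multiplication by 2 + n on coefficient lists. The number of summation variables in `VNP0` must be
-- the value of a `NatPoly`, so counts of such variables are made of numbers `pw k n` exactly, not
-- just bounded by them.
pwNP : ℕ → NatPoly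
pwNP zero    = 1 ∷ []
pwNP (suc k) = addNP (addNP (pwNP k) (pwNP k)) (0 ∷ pwNP k)

evalNP-pw : ∀ k n → evalNP (pwNP k) n ≡ pw k n
evalNP-pw zero n = cong suc (ℕₚ.*-zeroʳ n)
evalNP-pw (suc k) n
  rewrite evalNP-add (addNP (pwNP k) (pwNP k)) (0 ∷ pwNP k) n | evalNP-add (pwNP k) (pwNP k) n | evalNP-pw k n
  = lem n (pw k n)
  where
  lem : ∀ n x → x + x + n * x ≡ x + (x + n * x)
  lem = ℕSolver.solve-∀

-- Straight-line programs and their composition

-- Straight-line programs whose newest wire has index zero; ret selects the outputs.
data Code (m : ℕ) : ℕ → Set where
  ret  : ∀ {i} → Vec (Fin i) m → Code m i
  step : ∀ {i} → Op → Fin i → Fin i → Code m (suc i) → Code m i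

gateCount : ∀ {m i} → Code m i → ℕ
gateCount (ret _)        = 0
gateCount (step _ _ _ C) = suc (gateCount C)

-- The value set is a parameter because one program is read in several ways: over integers,
-- Booleans, formal degrees, pairs of a value and a degree, and lists of monomials.
run : ∀ {V : Set} (op : Op → V → V → V) {m i} → Code m i → Vec V i → Vec V m
run op (ret σ)        v = map (lookup v) σ
run op (step o a b C) v = run op C (op o (lookup v a) (lookup v b) ∷ v)

run-hom : ∀ {V W : Set} (op : Op → V → V → V) (op′ : Op → W → W → W) (h : V → W) →
  (∀ o a b → h (op o a b) ≡ op′ o (h a) (h b)) →
  ∀ {m i} (C : Code m i) v → map h (run op C v) ≡ run op′ C (map h v)
run-hom op op′ h hom (ret σ) v =
  trans (sym (Vecₚ.map-∘ h (lookup v) σ)) (Vecₚ.map-cong (λ i → sym (Vecₚ.lookup-map i h v)) σ)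
run-hom op op′ h hom (step o a b C) v =
  trans (run-hom op op′ h hom C _)
        (cong (λ z → run op′ C (z ∷ map h v))
              (trans (hom o _ _) (cong₂ (op′ o) (sym (Vecₚ.lookup-map a h v)) (sym (Vecₚ.lookup-map b h v)))))

weakenWires : ∀ {j i} → Vec (Fin j) i → Vec (Fin (suc j)) i
weakenWires = map suc

ren : ∀ {m i j} → Vec (Fin j) i → Code m i → Code m j
ren τ (ret σ)        = ret (map (lookup τ) σ)
ren τ (step o a b C) = step o (lookup τ a) (lookup τ b) (ren (zero ∷ weakenWires τ) C)

gateCount-ren : ∀ {m i j} (τ : Vec (Fin j) i) (C : Code m i) → gateCount (ren τ C) ≡ gateCount C
gateCount-ren τ (ret σ)        = refl
gateCount-ren τ (step o a b C) = cong suc (gateCount-ren _ C)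

map-lookup-weaken : ∀ {V : Set} {i j} (x : V) (v : Vec V j) (τ : Vec (Fin j) i) →
  map (lookup (x ∷ v)) (weakenWires τ) ≡ map (lookup v) τ
map-lookup-weaken x v τ = sym (Vecₚ.map-∘ (lookup (x ∷ v)) suc τ)

run-ren : ∀ {V : Set} (op : Op → V → V → V) {m i j} (τ : Vec (Fin j) i) (C : Code m i) (v : Vec V j) →
  run op (ren τ C) v ≡ run op C (map (lookup v) τ)
run-ren op τ (ret σ) v =
  trans (sym (Vecₚ.map-∘ (lookup v) (lookup τ) σ)) (Vecₚ.map-cong (λ i → sym (Vecₚ.lookup-map i (lookup v) τ)) σ)
run-ren op τ (step o a b C) v =
  trans (run-ren op (zero ∷ weakenWires τ) C _)
    (cong₂ (λ x u → run op C (x ∷ u))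
      (cong₂ (op o) (sym (Vecₚ.lookup-map a (lookup v) τ)) (sym (Vecₚ.lookup-map b (lookup v) τ)))
      (map-lookup-weaken _ v τ))

-- `ρ` lists the wires of the surrounding program that `D` still sees after the outputs of `C`; each
-- gate of `C` shifts them by one.
bind : ∀ {m l i j} → Code m j → Vec (Fin j) i → Code l (m + i) → Code l j
bind (ret σ)        ρ D = ren (σ ++ ρ) D
bind (step o a b C) ρ D = step o a b (bind C (weakenWires ρ) D)

gateCount-bind : ∀ {m l i j} (C : Code m j) (ρ : Vec (Fin j) i) (D : Code l (m + i)) →
  gateCount (bind C ρ D) ≡ gateCount C + gateCount D
gateCount-bind (ret σ)        ρ D = gateCount-ren _ D
gateCount-bind (step o a b C) ρ D = cong suc (gateCount-bind C _ D)

run-bind : ∀ {V : Set} (op : Op → V → V → V) {m l i j} (C : Code m j) (ρ : Vec (Fin j) i) (D : Code l (m + i)) v →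
  run op (bind C ρ D) v ≡ run op D (run op C v ++ map (lookup v) ρ)
run-bind op (ret σ) ρ D v =
  trans (run-ren op (σ ++ ρ) D v) (cong (run op D) (Vecₚ.map-++ (lookup v) σ ρ))
run-bind op (step o a b C) ρ D v =
  trans (run-bind op C _ D _) (cong (λ u → run op D (run op C _ ++ u)) (map-lookup-weaken _ v ρ))

addOutput : ∀ {m i} → Fin i → Code m i → Code (suc m) i
addOutput w (ret σ)        = ret (w ∷ σ)
addOutput w (step o a b C) = step o a b (addOutput (suc w) C)

gateCount-addOutput : ∀ {m i} (w : Fin i) (C : Code m i) → gateCount (addOutput w C) ≡ gateCount C
gateCount-addOutput w (ret σ)        = refl
gateCount-addOutput w (step o a b C) = cong suc (gateCount-addOutput (suc w) C)

run-addOutput : ∀ {V : Set} (op : Op → V → V → V) {m i} (w : Fin i) (C : Code m i) v →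
  run op (addOutput w C) v ≡ lookup v w ∷ run op C v
run-addOutput op w (ret σ)        v = refl
run-addOutput op w (step o a b C) v = run-addOutput op (suc w) C _

-- Programs described by the functions on their wires

infix 8 _⟨_⟩
_⟨_⟩ : ∀ {I V : Set} {m} → Vec (I → V) m → I → Vec V m
fs ⟨ x ⟩ = map (λ f → f x) fs

-- The context `Γ` names, for each wire, the function of the input that the wire carries. Programs
-- are then assembled from functions, and wire numbers stay hidden.
record Has {I V : Set} {i} (Γ : Vec (I → V) i) (f : I → V) : Set where
  constructor has
  field
    wire : Fin i
    hit  : ∀ x → lookup (Γ ⟨ x ⟩) wire ≡ f x

record HasV {I V : Set} {i m} (Γ : Vec (I → V) i) (fs : Vec (I → V) m) : Set where
  constructor hasV
  field
    wires : Vec (Fin i) m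
    hits  : ∀ x → map (lookup (Γ ⟨ x ⟩)) wires ≡ fs ⟨ x ⟩

module _ {I V : Set} where

  here : ∀ {i} {Γ : Vec (I → V) i} {f} → Has (f ∷ Γ) f
  here = has zero (λ x → refl)

  there : ∀ {i} {Γ : Vec (I → V) i} {f g} → Has Γ f → Has (g ∷ Γ) f
  there (has w h) = has (suc w) h

  skip : ∀ {i m} {Γ : Vec (I → V) i} (gs : Vec (I → V) m) {f} → Has Γ f → Has (gs ++ Γ) f
  skip []       p = p
  skip (g ∷ gs) p = there (skip gs p)

  thereV : ∀ {i m} {Γ : Vec (I → V) i} {fs : Vec (I → V) m} {g} → HasV Γ fs → HasV (g ∷ Γ) fs
  thereV {Γ = Γ} {g = g} (hasV σ h) = hasV (weakenWires σ) (λ x → trans (map-lookup-weaken (g x) (Γ ⟨ x ⟩) σ) (h x))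

  skipV : ∀ {i m l} {Γ : Vec (I → V) i} {fs : Vec (I → V) m} (gs : Vec (I → V) l) → HasV Γ fs → HasV (gs ++ Γ) fs
  skipV []       p = p
  skipV (g ∷ gs) p = thereV (skipV gs p)

  nilV : ∀ {i} {Γ : Vec (I → V) i} → HasV Γ []
  nilV = hasV [] (λ x → refl)

  consV : ∀ {i m} {Γ : Vec (I → V) i} {f} {fs : Vec (I → V) m} → Has Γ f → HasV Γ fs → HasV Γ (f ∷ fs)
  consV (has w h) (hasV σ k) = hasV (w ∷ σ) (λ x → cong₂ _∷_ (h x) (k x))

  headV : ∀ {i m} {Γ : Vec (I → V) i} {f} {fs : Vec (I → V) m} → HasV Γ (f ∷ fs) → Has Γ f
  headV (hasV (w ∷ σ) h) = has w (λ x → Vecₚ.∷-injectiveˡ (h x))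

  tailV : ∀ {i m} {Γ : Vec (I → V) i} {f} {fs : Vec (I → V) m} → HasV Γ (f ∷ fs) → HasV Γ fs
  tailV (hasV (w ∷ σ) h) = hasV σ (λ x → Vecₚ.∷-injectiveʳ (h x))

  appendV : ∀ {i m l} {Γ : Vec (I → V) i} {fs : Vec (I → V) m} {gs : Vec (I → V) l} →
    HasV Γ fs → HasV Γ gs → HasV Γ (fs ++ gs)
  appendV {Γ = Γ} {fs} {gs} (hasV σ h) (hasV τ k) = hasV (σ ++ τ) (λ x →
    trans (Vecₚ.map-++ (lookup (Γ ⟨ x ⟩)) σ τ) (trans (cong₂ _++_ (h x) (k x)) (sym (Vecₚ.map-++ (λ f → f x) fs gs))))

  hereV : ∀ {i m} {Γ : Vec (I → V) i} (fs : Vec (I → V) m) → HasV (fs ++ Γ) fs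
  hereV []       = nilV
  hereV (f ∷ fs) = consV here (thereV (hereV fs))

  allV : ∀ {i} {Γ : Vec (I → V) i} → HasV Γ Γ
  allV {i} {Γ} = hasV (allFin i) (λ x → Vecₚ.map-lookup-allFin (Γ ⟨ x ⟩))

  lookupV : ∀ {i m} {Γ : Vec (I → V) i} {fs : Vec (I → V) m} → HasV Γ fs → (w : Fin m) → Has Γ (lookup fs w)
  lookupV {Γ = Γ} {fs} (hasV σ h) w = has (lookup σ w) (λ x →
    trans (sym (Vecₚ.lookup-map w _ σ)) (trans (cong (λ u → lookup u w) (h x)) (Vecₚ.lookup-map w _ fs)))

record Computable {I V : Set} (op : Op → V → V → V) {i m} (Γ : Vec (I → V) i) (s : ℕ) (fs : Vec (I → V) m) : Set where
  constructor computable
  field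
    code    : Code m i
    small   : gateCount code ≤ s
    correct : ∀ x → run op code (Γ ⟨ x ⟩) ≡ fs ⟨ x ⟩
open Computable public

module _ {I V : Set} {op : Op → V → V → V} where

  C-ret : ∀ {i m} {Γ : Vec (I → V) i} {fs : Vec (I → V) m} → HasV Γ fs → Computable op Γ 0 fs
  C-ret (hasV σ h) = computable (ret σ) z≤n h

  C-step : ∀ {i m s} {Γ : Vec (I → V) i} {fs : Vec (I → V) m} {f g} o → Has Γ f → Has Γ g →
    Computable op ((λ x → op o (f x) (g x)) ∷ Γ) s fs → Computable op Γ (suc s) fs
  C-step {Γ = Γ} o (has a p) (has b q) (computable C sm cr) = computable (step o a b C) (s≤s sm)
    (λ x → trans (cong (λ z → run op C (z ∷ Γ ⟨ x ⟩)) (cong₂ (op o) (p x) (q x))) (cr x))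

  C-let : ∀ {i m l s t} {Γ : Vec (I → V) i} {fs : Vec (I → V) m} {gs : Vec (I → V) l} →
    Computable op Γ s fs → Computable op (fs ++ Γ) t gs → Computable op Γ (s + t) gs
  C-let {i} {Γ = Γ} {fs} (computable C sm cr) (computable D sm′ cr′) = computable (bind C (allFin i) D)
    (ℕₚ.≤-trans (ℕₚ.≤-reflexive (gateCount-bind C _ D)) (ℕₚ.+-mono-≤ sm sm′))
    (λ x → trans (run-bind op C (allFin i) D (Γ ⟨ x ⟩))
       (trans (cong (run op D) (trans (cong₂ _++_ (cr x) (Vecₚ.map-lookup-allFin (Γ ⟨ x ⟩))) (sym (Vecₚ.map-++ (λ f → f x) fs Γ)))) (cr′ x)))

  C-cons : ∀ {i m s} {Γ : Vec (I → V) i} {fs : Vec (I → V) m} {f} → Has Γ f → Computable op Γ s fs → Computable op Γ s (f ∷ fs)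
  C-cons (has w h) (computable C sm cr) = computable (addOutput w C) (ℕₚ.≤-trans (ℕₚ.≤-reflexive (gateCount-addOutput w C)) sm)
    (λ x → trans (run-addOutput op w C _) (cong₂ _∷_ (h x) (cr x)))

  C-mono : ∀ {i m s t} {Γ : Vec (I → V) i} {fs : Vec (I → V) m} → s ≤ t → Computable op Γ s fs → Computable op Γ t fs
  C-mono s≤t (computable C sm cr) = computable C (ℕₚ.≤-trans sm s≤t) cr

  C-ext : ∀ {i m s} {Γ : Vec (I → V) i} {fs gs : Vec (I → V) m} → (∀ x → fs ⟨ x ⟩ ≡ gs ⟨ x ⟩) →
    Computable op Γ s fs → Computable op Γ s gs
  C-ext e (computable C sm cr) = computable C sm (λ x → trans (cr x) (e x))

  C-move : ∀ {i j m s} {Γ : Vec (I → V) i} {Δ : Vec (I → V) j} {fs : Vec (I → V) m} → HasV Δ Γ →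
    Computable op Γ s fs → Computable op Δ s fs
  C-move (hasV σ h) (computable C sm cr) = computable (ren σ C) (ℕₚ.≤-trans (ℕₚ.≤-reflexive (gateCount-ren σ C)) sm)
    (λ x → trans (run-ren op σ C _) (trans (cong (run op C) (h x)) (cr x)))

  C-op : ∀ {i s t} {Γ : Vec (I → V) i} {f g} o → Computable op Γ s (f ∷ []) → Computable op Γ t (g ∷ []) →
    Computable op Γ (s + (t + 1)) ((λ x → op o (f x) (g x)) ∷ [])
  C-op o p q = C-let p (C-let (C-move (thereV allV) q) (C-step o (there here) here (C-ret (hereV (_ ∷ [])))))

  C-call : ∀ {i j m} {Γ : Vec (I → V) i} (C : Code m j) {gs : Vec (I → V) j} → HasV Γ gs →
    {fs : Vec (I → V) m} → (∀ x → run op C (gs ⟨ x ⟩) ≡ fs ⟨ x ⟩) → Computable op Γ (gateCount C) fs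
  C-call C h e = C-move h (computable C ℕₚ.≤-refl e)

-- Translation between programs and circuits

lookup-∷ʳ-inject₁ : ∀ {A : Set} {n} (v : Vec A n) a i → lookup (v ∷ʳ a) (inject₁ i) ≡ lookup v i
lookup-∷ʳ-inject₁ (x ∷ v) a zero    = refl
lookup-∷ʳ-inject₁ (x ∷ v) a (suc i) = lookup-∷ʳ-inject₁ v a i

lookup-∷ʳ-fromℕ : ∀ {A : Set} {n} (v : Vec A n) a → lookup (v ∷ʳ a) (fromℕ n) ≡ a
lookup-∷ʳ-fromℕ []      a = refl
lookup-∷ʳ-fromℕ (x ∷ v) a = lookup-∷ʳ-fromℕ v a

weakenRef : ∀ {k j} → Ref k j → Ref k (suc j)
weakenRef (var i)  = var i
weakenRef one      = one
weakenRef (gate g) = gate (inject₁ g)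

refVal-weaken : ∀ {k j} (x : Fin k → ℤ) (v : Vec ℤ j) a r → refVal x (v ∷ʳ a) (weakenRef r) ≡ refVal x v r
refVal-weaken x v a (var i)  = refl
refVal-weaken x v a one      = refl
refVal-weaken x v a (gate g) = lookup-∷ʳ-inject₁ v a g

refDeg-weaken : ∀ {k j} (v : Vec ℕ j) a (r : Ref k j) → refDeg (v ∷ʳ a) (weakenRef r) ≡ refDeg v r
refDeg-weaken v a (var i)  = refl
refDeg-weaken v a one      = refl
refDeg-weaken v a (gate g) = lookup-∷ʳ-inject₁ v a g

-- `τ` gives the circuit reference that stands for each wire. A circuit grows at its end and a
-- program at its front, hence `fromℕ` for the new gate and `weakenRef` for the old ones.
appendCode : ∀ {k i j} → Gates k j → Vec (Ref k j) i → Code 1 i → Circuit k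
appendCode         G τ (ret (w ∷ []))  = record { size = _ ; gates = G ; output = lookup τ w }
appendCode {j = j} G τ (step o a b C) =
  appendCode (G ▷ (o , lookup τ a , lookup τ b)) (gate (fromℕ j) ∷ map weakenRef τ) C

size-appendCode : ∀ {k i j} (G : Gates k j) (τ : Vec (Ref k j) i) (C : Code 1 i) →
  size (appendCode G τ C) ≡ j + gateCount C
size-appendCode G τ (ret (w ∷ []))  = sym (ℕₚ.+-identityʳ _)
size-appendCode G τ (step o a b C) = trans (size-appendCode _ _ C) (sym (ℕₚ.+-suc _ _))

eval-appendCode : ∀ {k i j} (G : Gates k j) (τ : Vec (Ref k j) i) (C : Code 1 i) x →
  run opVal C (map (refVal x (evalGates G x)) τ) ≡ eval (appendCode G τ C) x ∷ []
eval-appendCode G τ (ret (w ∷ []))  x = cong (_∷ []) (Vecₚ.lookup-map w _ τ)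
eval-appendCode G τ (step o a b C) x = trans
  (cong₂ (λ z u → run opVal C (z ∷ u))
    (trans (cong₂ (opVal o) (Vecₚ.lookup-map a _ τ) (Vecₚ.lookup-map b _ τ)) (sym (lookup-∷ʳ-fromℕ (evalGates G x) _)))
    (trans (Vecₚ.map-cong (λ r → sym (refVal-weaken x (evalGates G x) _ r)) τ) (Vecₚ.map-∘ _ weakenRef τ)))
  (eval-appendCode _ _ C x)

formalDegree-appendCode : ∀ {k i j} (G : Gates k j) (τ : Vec (Ref k j) i) (C : Code 1 i) →
  run opDeg C (map (refDeg (degGates G)) τ) ≡ formalDegree (appendCode G τ C) ∷ []
formalDegree-appendCode G τ (ret (w ∷ []))  = cong (_∷ []) (Vecₚ.lookup-map w _ τ)
formalDegree-appendCode G τ (step o a b C) = trans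
  (cong₂ (λ z u → run opDeg C (z ∷ u))
    (trans (cong₂ (opDeg o) (Vecₚ.lookup-map a _ τ) (Vecₚ.lookup-map b _ τ)) (sym (lookup-∷ʳ-fromℕ (degGates G) _)))
    (trans (Vecₚ.map-cong (λ r → sym (refDeg-weaken (degGates G) _ r)) τ) (Vecₚ.map-∘ _ weakenRef τ)))
  (formalDegree-appendCode _ _ C)

-- Fixes the convention for arithmetic programs: wire 0 carries the constant 1, the following wires
-- carry the variables.
toCircuit : ∀ {k} → Code 1 (suc k) → Circuit k
toCircuit C = appendCode [] (one ∷ tabulate var) C

size-toCircuit : ∀ {k} (C : Code 1 (suc k)) → size (toCircuit C) ≡ gateCount C
size-toCircuit C = size-appendCode [] _ C

eval-toCircuit : ∀ {k} (C : Code 1 (suc k)) x → run opVal C (ℤ.1ℤ ∷ tabulate x) ≡ eval (toCircuit C) x ∷ []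
eval-toCircuit C x = trans (cong (λ u → run opVal C (ℤ.1ℤ ∷ u)) (Vecₚ.tabulate-∘ (refVal x []) var))
  (eval-appendCode [] (one ∷ tabulate var) C x)

formalDegree-toCircuit : ∀ {k} (C : Code 1 (suc k)) → run opDeg C (replicate (suc k) 1) ≡ formalDegree (toCircuit C) ∷ []
formalDegree-toCircuit {k} C = trans
  (cong (λ u → run opDeg C (1 ∷ u)) (trans (sym (tabulate-const k)) (Vecₚ.tabulate-∘ (refDeg []) (var {k} {0}))))
  (formalDegree-appendCode [] (one ∷ tabulate var) C)
  where
  tabulate-const : ∀ m → tabulate {n = m} (λ _ → 1) ≡ replicate m 1
  tabulate-const zero    = refl
  tabulate-const (suc m) = cong (1 ∷_) (tabulate-const m)

-- Reverses the order of the gates: the last gate of the circuit becomes wire 0.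
gateWire : ∀ {j} l → Fin j → Fin (j + l)
gateWire {suc j} l g with view g
... | ‵fromℕ         = zero
... | ‵inj₁ {i = g′} _ = suc (gateWire l g′)

refWire : ∀ {k} j → Ref k j → Fin (j + suc k)
refWire j (var i)  = j ↑ʳ suc i
refWire j one      = j ↑ʳ zero
refWire j (gate g) = gateWire _ g

prependGates : ∀ {k j m} → Gates k j → Code m (j + suc k) → Code m (suc k)
prependGates []                         C = C
prependGates {j = suc j} (G ▷ (o , a , b)) C = prependGates G (step o (refWire j a) (refWire j b) C)

gateWires : ∀ {k j} → Gates k j → (Fin k → ℤ) → Vec ℤ (j + suc k)
gateWires []                x = ℤ.1ℤ ∷ tabulate x
gateWires (G ▷ (o , a , b)) x =
  opVal o (refVal x (evalGates G x) a) (refVal x (evalGates G x) b) ∷ gateWires G x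

lookup-gateWires-input : ∀ {k j} (G : Gates k j) x i → lookup (gateWires G x) (j ↑ʳ i) ≡ lookup (ℤ.1ℤ ∷ tabulate x) i
lookup-gateWires-input []      x i = refl
lookup-gateWires-input (G ▷ _) x i = lookup-gateWires-input G x i

lookup-gateWires-gate : ∀ {k j} (G : Gates k j) x (g : Fin j) → lookup (gateWires G x) (gateWire (suc k) g) ≡ lookup (evalGates G x) g
lookup-gateWires-gate (G ▷ _) x g with view g
... | ‵fromℕ           = sym (lookup-∷ʳ-fromℕ (evalGates G x) _)
... | ‵inj₁ {i = g′} _ = trans (lookup-gateWires-gate G x g′) (sym (lookup-∷ʳ-inject₁ (evalGates G x) _ g′))

lookup-gateWires : ∀ {k j} (G : Gates k j) x r → lookup (gateWires G x) (refWire j r) ≡ refVal x (evalGates G x) r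
lookup-gateWires G x (var i)  = trans (lookup-gateWires-input G x (suc i)) (Vecₚ.lookup∘tabulate x i)
lookup-gateWires G x one      = lookup-gateWires-input G x zero
lookup-gateWires G x (gate g) = lookup-gateWires-gate G x g

run-prependGates : ∀ {k j m} (G : Gates k j) (C : Code m (j + suc k)) x →
  run opVal (prependGates G C) (ℤ.1ℤ ∷ tabulate x) ≡ run opVal C (gateWires G x)
run-prependGates []                C x = refl
run-prependGates (G ▷ (o , a , b)) C x = trans (run-prependGates G _ x)
  (cong (λ z → run opVal C (z ∷ gateWires G x)) (cong₂ (opVal o) (lookup-gateWires G x a) (lookup-gateWires G x b)))

gateCount-prependGates : ∀ {k j m} (G : Gates k j) (C : Code m (j + suc k)) → gateCount (prependGates G C) ≡ j + gateCount C
gateCount-prependGates []      C = refl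
gateCount-prependGates (G ▷ _) C = trans (gateCount-prependGates G _) (ℕₚ.+-suc _ _)

fromCircuit : ∀ {k} → Circuit k → Code 1 (suc k)
fromCircuit C = prependGates (gates C) (ret (refWire (size C) (output C) ∷ []))

run-fromCircuit : ∀ {k} (C : Circuit k) x → run opVal (fromCircuit C) (ℤ.1ℤ ∷ tabulate x) ≡ eval C x ∷ []
run-fromCircuit C x = trans (run-prependGates (gates C) _ x) (cong (_∷ []) (lookup-gateWires (gates C) x (output C)))

gateCount-fromCircuit : ∀ {k} (C : Circuit k) → gateCount (fromCircuit C) ≡ size C
gateCount-fromCircuit C = trans (gateCount-prependGates (gates C) _) (ℕₚ.+-identityʳ _)

-- Assignments that agree pointwise need not be equal as functions. A program takes them as vectors,
-- and there pointwise agreement is equality.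
eval-cong : ∀ {k} (C : Circuit k) {x y : Fin k → ℤ} → (∀ i → x i ≡ y i) → eval C x ≡ eval C y
eval-cong C {x} {y} e = Vecₚ.∷-injectiveˡ (trans (sym (run-fromCircuit C x))
  (trans (cong (λ u → run opVal (fromCircuit C) (ℤ.1ℤ ∷ u)) (Vecₚ.tabulate-cong e)) (run-fromCircuit C y)))

-- Sums and products over Boolean cubes

b2z : Bool → ℤ
b2z false = ℤ.0ℤ
b2z true  = ℤ.1ℤ

b2n : Bool → ℕ
b2n false = 0
b2n true  = 1

+b2n : ∀ b → + b2n b ≡ b2z b
+b2n false = refl
+b2n true  = refl

cube : {A : Set} → (A → A → A) → (m : ℕ) → (Vec Bool m → A) → A
cube _∙_ zero    h = h []
cube _∙_ (suc m) h = cube _∙_ m (λ e → h (false ∷ e)) ∙ cube _∙_ m (λ e → h (true ∷ e))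

cube-cong : {A : Set} (_∙_ : A → A → A) → ∀ m {h h′ : Vec Bool m → A} → (∀ e → h e ≡ h′ e) → cube _∙_ m h ≡ cube _∙_ m h′
cube-cong _∙_ zero    e = e []
cube-cong _∙_ (suc m) e = cong₂ _∙_ (cube-cong _∙_ m (λ v → e (false ∷ v))) (cube-cong _∙_ m (λ v → e (true ∷ v)))

cube-hom : {A B : Set} (_∙_ : A → A → A) (_∘′_ : B → B → B) (φ : A → B) → (∀ a b → φ (a ∙ b) ≡ φ a ∘′ φ b) →
  ∀ m (h : Vec Bool m → A) → φ (cube _∙_ m h) ≡ cube _∘′_ m (λ e → φ (h e))
cube-hom _∙_ _∘′_ φ hom zero    h = refl
cube-hom _∙_ _∘′_ φ hom (suc m) h = trans (hom _ _) (cong₂ _∘′_ (cube-hom _∙_ _∘′_ φ hom m _) (cube-hom _∙_ _∘′_ φ hom m _))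

cube-++ : {A : Set} (_∙_ : A → A → A) → ∀ m n (h : Vec Bool (m + n) → A) →
  cube _∙_ (m + n) h ≡ cube _∙_ m (λ e → cube _∙_ n (λ y → h (e ++ y)))
cube-++ _∙_ zero    n h = refl
cube-++ _∙_ (suc m) n h = cong₂ _∙_ (cube-++ _∙_ m n (λ e → h (false ∷ e))) (cube-++ _∙_ m n (λ e → h (true ∷ e)))

Extensional : ∀ {m} → ((Fin m → ℤ) → ℤ) → Set
Extensional h = ∀ {x y} → (∀ i → x i ≡ y i) → h x ≡ h y

-- The assignments built by `sumCube` agree with lookups in a Boolean vector only pointwise, so `h`
-- has to respect pointwise agreement.
sumCube≡cube : ∀ m (h : (Fin m → ℤ) → ℤ) → Extensional h →
  sumCube m h ≡ cube ℤ._+_ m (λ e → h (λ i → b2z (lookup e i)))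
sumCube≡cube zero    h ext = ext (λ ())
sumCube≡cube (suc m) h ext = cong₂ ℤ._+_
  (trans (sumCube≡cube m _ (λ e → ext (λ { zero → refl ; (suc i) → e i })))
         (cube-cong ℤ._+_ m (λ e → ext (λ { zero → refl ; (suc i) → refl }))))
  (trans (sumCube≡cube m _ (λ e → ext (λ { zero → refl ; (suc i) → e i })))
         (cube-cong ℤ._+_ m (λ e → ext (λ { zero → refl ; (suc i) → refl }))))

prodCube≡cube : ∀ m (h : (Fin m → ℤ) → ℤ) → Extensional h →
  prodCube m h ≡ cube ℤ._*_ m (λ e → h (λ i → b2z (lookup e i)))
prodCube≡cube zero    h ext = ext (λ ())
prodCube≡cube (suc m) h ext = cong₂ ℤ._*_
  (trans (prodCube≡cube m _ (λ e → ext (λ { zero → refl ; (suc i) → e i })))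
         (cube-cong ℤ._*_ m (λ e → ext (λ { zero → refl ; (suc i) → refl }))))
  (trans (prodCube≡cube m _ (λ e → ext (λ { zero → refl ; (suc i) → e i })))
         (cube-cong ℤ._*_ m (λ e → ext (λ { zero → refl ; (suc i) → refl }))))

-- Little-endian.
num : ∀ {m} → Vec Bool m → ℕ
num []      = 0
num (b ∷ v) = b2n b + 2 * num v

-- Summing over the transcripts of a Boolean program

opBool : Op → Bool → Bool → Bool
opBool plus  a b = a xor b
opBool minus a b = a xor b
opBool times a b = a ∧ b

module _ {V : Set} (op : Op → V → V → V) (1# : V) where

  -- Exclusive or of Booleans is a + b - 2ab.
  gateValue : Op → V → V → V
  gateValue times a b = op times a b
  gateValue _     a b = op minus (op plus a b) (op plus (op times a b) (op times a b))

  -- On Booleans, the indicator of y being the value of the gate.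
  gateCheck : Op → V → V → V → V
  gateCheck o a b y = op minus 1# (op times (op minus y (gateValue o a b)) (op minus y (gateValue o a b)))

  -- The number whose little-endian digits are given. The constant 0 has to be made as 1 - 1, since
  -- 1 is the only constant available.
  horner : ∀ {m} → Vec V m → V
  horner []      = op minus 1# 1#
  horner (b ∷ v) = op plus b (op plus (horner v) (horner v))

  -- On Boolean `ys` the product vanishes unless `ys` lists the true gate values, and then it is the
  -- number output by the program. Since each gate value has a variable of its own, gates are
  -- checked independently of each other instead of being nested.
  transcript : ∀ {m i} (C : Code m i) → Vec V i → Vec V (gateCount C) → V
  transcript (ret σ)        v []       = horner (map (lookup v) σ)
  transcript (step o a b C) v (y ∷ ys) = op times (gateCheck o (lookup v a) (lookup v b) y) (transcript C (y ∷ v) ys)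

  -- For Boolean e this is the product of the Z_j with e_j = 1.
  monomial : ∀ {w} → Vec V w → Vec V w → V
  monomial []      []      = 1#
  monomial (Z ∷ Zs) (e ∷ es) = op times (op plus 1# (op times e (op minus Z 1#))) (monomial Zs es)

module _ {V W : Set} (op : Op → V → V → V) (op′ : Op → W → W → W) (h : V → W)
  (hom : ∀ o a b → h (op o a b) ≡ op′ o (h a) (h b)) (1# : V) where

  gateValue-hom : ∀ o a b → h (gateValue op 1# o a b) ≡ gateValue op′ (h 1#) o (h a) (h b)
  gateValue-hom times a b = hom _ _ _
  gateValue-hom plus  a b = trans (hom _ _ _) (cong₂ (op′ _) (hom _ _ _) (trans (hom _ _ _) (cong₂ (op′ _) (hom _ _ _) (hom _ _ _))))
  gateValue-hom minus a b = trans (hom _ _ _) (cong₂ (op′ _) (hom _ _ _) (trans (hom _ _ _) (cong₂ (op′ _) (hom _ _ _) (hom _ _ _))))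

  gateCheck-hom : ∀ o a b y → h (gateCheck op 1# o a b y) ≡ gateCheck op′ (h 1#) o (h a) (h b) (h y)
  gateCheck-hom o a b y = trans (hom _ _ _) (cong (op′ _ _) (trans (hom _ _ _) (cong₂ (op′ _) d d)))
    where
    d : h (op minus y (gateValue op 1# o a b)) ≡ op′ minus (h y) (gateValue op′ (h 1#) o (h a) (h b))
    d = trans (hom _ _ _) (cong (op′ _ _) (gateValue-hom o a b))

  horner-hom : ∀ {m} (v : Vec V m) → h (horner op 1# v) ≡ horner op′ (h 1#) (map h v)
  horner-hom []      = hom _ _ _
  horner-hom (b ∷ v) = trans (hom _ _ _) (cong (op′ _ _) (trans (hom _ _ _) (cong₂ (op′ _) (horner-hom v) (horner-hom v))))

  transcript-hom : ∀ {m i} (C : Code m i) v y → h (transcript op 1# C v y) ≡ transcript op′ (h 1#) C (map h v) (map h y)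
  transcript-hom (ret σ) v [] = trans (horner-hom (map (lookup v) σ))
    (cong (horner op′ (h 1#)) (trans (sym (Vecₚ.map-∘ h (lookup v) σ)) (Vecₚ.map-cong (λ i → sym (Vecₚ.lookup-map i h v)) σ)))
  transcript-hom (step o a b C) v (y ∷ ys) = trans (hom _ _ _) (cong₂ (op′ _)
    (trans (gateCheck-hom o _ _ y) (cong₂ (λ p q → gateCheck op′ (h 1#) o p q (h y)) (sym (Vecₚ.lookup-map a h v)) (sym (Vecₚ.lookup-map b h v))))
    (transcript-hom C (y ∷ v) ys))

  monomial-hom : ∀ {w} (Z e : Vec V w) → h (monomial op 1# Z e) ≡ monomial op′ (h 1#) (map h Z) (map h e)
  monomial-hom []      []      = refl
  monomial-hom (Z ∷ Zs) (e ∷ es) = trans (hom _ _ _) (cong₂ (op′ _)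
    (trans (hom _ _ _) (cong (op′ _ _) (trans (hom _ _ _) (cong (op′ _ _) (hom _ _ _)))))
    (monomial-hom Zs es))

module _ where
  lookup-ones : ∀ {n} (i : Fin n) → lookup (replicate n 1) i ≡ 1
  lookup-ones i = Vecₚ.lookup-replicate i 1

  horner-deg : ∀ {m i} (σ : Vec (Fin i) m) → horner opDeg 1 (map (lookup (replicate i 1)) σ) ≡ 1
  horner-deg []      = refl
  horner-deg (w ∷ σ) rewrite horner-deg σ | lookup-ones w = refl

  gateCheck-deg : ∀ o → gateCheck opDeg 1 o 1 1 1 ≡ 4
  gateCheck-deg plus  = refl
  gateCheck-deg minus = refl
  gateCheck-deg times = refl

  -- A check is 1 minus the square of an expression of degree 2, so each gate contributes 4 and the
  -- output contributes 1. Nesting the gates instead could double the degree at each of them.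
  transcript-deg : ∀ {m i} (C : Code m i) → transcript opDeg 1 C (replicate i 1) (replicate (gateCount C) 1) ≡ gateCount C * 4 + 1
  transcript-deg (ret σ) = horner-deg σ
  transcript-deg (step o a b C)
    rewrite lookup-ones a | lookup-ones b | gateCheck-deg o | transcript-deg C = refl

  monomial-deg : ∀ w → monomial opDeg 1 (replicate w 1) (replicate w 1) ≡ w * 2 + 1
  monomial-deg zero    = refl
  monomial-deg (suc w) rewrite monomial-deg w = refl

cube-*ˡ : ∀ m c (h : Vec Bool m → ℤ) → cube ℤ._+_ m (λ e → c ℤ.* h e) ≡ c ℤ.* cube ℤ._+_ m h
cube-*ˡ m c h = sym (cube-hom ℤ._+_ ℤ._+_ (c ℤ.*_) (ℤₚ.*-distribˡ-+ c) m h)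

gateCheck-Bool : ∀ o a b y → gateCheck opVal ℤ.1ℤ o (b2z a) (b2z b) (b2z y) ≡ b2z (not (y xor opBool o a b))
gateCheck-Bool plus  false false false = refl
gateCheck-Bool plus  false false true  = refl
gateCheck-Bool plus  false true  false = refl
gateCheck-Bool plus  false true  true  = refl
gateCheck-Bool plus  true  false false = refl
gateCheck-Bool plus  true  false true  = refl
gateCheck-Bool plus  true  true  false = refl
gateCheck-Bool plus  true  true  true  = refl
gateCheck-Bool minus false false false = refl
gateCheck-Bool minus false false true  = refl
gateCheck-Bool minus false true  false = refl
gateCheck-Bool minus false true  true  = refl
gateCheck-Bool minus true  false false = refl
gateCheck-Bool minus true  false true  = refl
gateCheck-Bool minus true  true  false = refl
gateCheck-Bool minus true  true  true  = refl
gateCheck-Bool times false false false = refl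
gateCheck-Bool times false false true  = refl
gateCheck-Bool times false true  false = refl
gateCheck-Bool times false true  true  = refl
gateCheck-Bool times true  false false = refl
gateCheck-Bool times true  false true  = refl
gateCheck-Bool times true  true  false = refl
gateCheck-Bool times true  true  true  = refl

horner-Bool : ∀ {m} (v : Vec Bool m) → horner opVal ℤ.1ℤ (map b2z v) ≡ + num v
horner-Bool []      = refl
horner-Bool (b ∷ v) = begin
  b2z b ℤ.+ (horner opVal ℤ.1ℤ (map b2z v) ℤ.+ horner opVal ℤ.1ℤ (map b2z v))
    ≡⟨ cong₂ (λ p q → p ℤ.+ (q ℤ.+ q)) (sym (+b2n b)) (horner-Bool v) ⟩
  + b2n b ℤ.+ (+ num v ℤ.+ + num v)
    ≡⟨ cong (λ q → + b2n b ℤ.+ + (num v + q)) (sym (ℕₚ.+-identityʳ (num v))) ⟩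
  + (b2n b + 2 * num v) ∎
  where open ≡-Reasoning

-- Exactly one assignment of the gate values passes all the checks.
transcript-sum : ∀ {m i} (C : Code m i) (v : Vec Bool i) →
  cube ℤ._+_ (gateCount C) (λ y → transcript opVal ℤ.1ℤ C (map b2z v) (map b2z y)) ≡ + num (run opBool C v)
transcript-sum (ret σ) v = trans
  (cong (horner opVal ℤ.1ℤ) (trans (Vecₚ.map-cong (λ i → Vecₚ.lookup-map i b2z v) σ) (Vecₚ.map-∘ b2z (lookup v) σ)))
  (horner-Bool (map (lookup v) σ))
transcript-sum (step o a b C) v = trans
  (cong₂ ℤ._+_ (branch false) (branch true)) (select (opBool o (lookup v a) (lookup v b)))
  where
  rest : Bool → ℤ
  rest y = + num (run opBool C (y ∷ v))
  branch : ∀ y → cube ℤ._+_ (gateCount C) (λ ys → transcript opVal ℤ.1ℤ (step o a b C) (map b2z v) (map b2z (y ∷ ys)))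
    ≡ b2z (not (y xor opBool o (lookup v a) (lookup v b))) ℤ.* rest y
  branch y = trans (cube-*ˡ (gateCount C) (gateCheck opVal ℤ.1ℤ o (lookup (map b2z v) a) (lookup (map b2z v) b) (b2z y)) (λ ys → transcript opVal ℤ.1ℤ C (map b2z (y ∷ v)) (map b2z ys))) (cong₂ ℤ._*_ {u = cube ℤ._+_ (gateCount C) _} {v = rest y}
    (trans (cong₂ (λ p q → gateCheck opVal ℤ.1ℤ o p q (b2z y)) (Vecₚ.lookup-map a b2z v) (Vecₚ.lookup-map b b2z v)) (gateCheck-Bool o _ _ y))
    (transcript-sum C (y ∷ v)))
  select : ∀ r → b2z (not (false xor r)) ℤ.* rest false ℤ.+ b2z (not (true xor r)) ℤ.* rest true ≡ rest r
  select false = trans (ℤₚ.+-identityʳ _) (ℤₚ.*-identityˡ _)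
  select true  = trans (ℤₚ.+-identityˡ _) (ℤₚ.*-identityˡ _)

-- Squares the newest wire and ignores the result. The transcript needs one summation variable per
-- gate, and their number has to be a prescribed polynomial of n.
pad : ∀ {m i} → ℕ → Code m (suc i) → Code m (suc i)
pad zero    C = C
pad (suc d) C = step times zero zero (ren (weakenWires (allFin _)) (pad d C))

gateCount-pad : ∀ {m i} d (C : Code m (suc i)) → gateCount (pad d C) ≡ d + gateCount C
gateCount-pad zero    C = refl
gateCount-pad (suc d) C = cong suc (trans (gateCount-ren _ (pad d C)) (gateCount-pad d C))

run-pad : ∀ {V : Set} (op : Op → V → V → V) {m i} d (C : Code m (suc i)) v → run op (pad d C) v ≡ run op C v
run-pad op zero    C v = refl
run-pad op (suc d) C v = trans (run-ren op (weakenWires (allFin _)) (pad d C) _)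
  (trans (cong (run op (pad d C)) (trans (map-lookup-weaken _ v (allFin _)) (Vecₚ.map-lookup-allFin v))) (run-pad op d C v))

padTo : ∀ {m i} (C : Code m (suc i)) {S} → gateCount C ≤ S →
  Σ (Code m (suc i)) λ C′ → gateCount C′ ≡ S × (∀ v → run opBool C′ v ≡ run opBool C v)
padTo C {S} C≤S = pad (S ∸ gateCount C) C , trans (gateCount-pad _ C) (ℕₚ.m∸n+n≡m C≤S) , run-pad opBool (S ∸ gateCount C) C

module _ {I V : Set} {op : Op → V → V → V} {i} {Γ : Vec (I → V) i} where

  C-wire : ∀ {f} → Has Γ f → Computable op Γ 0 (f ∷ [])
  C-wire h = C-ret (consV h nilV)

  C-dup : ∀ {s f} o → Computable op Γ s (f ∷ []) → Computable op Γ (s + 1) ((λ x → op o (f x) (f x)) ∷ [])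
  C-dup o p = C-let p (C-step o here here (C-ret (hereV (_ ∷ []))))

block : ∀ {I V : Set} {m} → (I → Vec V m) → Vec (I → V) m
block f = tabulate (λ j x → lookup (f x) j)

block-⟨⟩ : ∀ {I V : Set} {m} (f : I → Vec V m) x → block f ⟨ x ⟩ ≡ f x
block-⟨⟩ f x = trans (sym (Vecₚ.tabulate-∘ (λ g → g x) (λ j x → lookup (f x) j))) (Vecₚ.tabulate∘lookup (f x))

module _ {I V : Set} (op : Op → V → V → V) (1# : V) {i} {Γ : Vec (I → V) i} (has1 : Has Γ (const 1#)) where

  C-gateValue : ∀ {f g} o → Has Γ f → Has Γ g → Computable op Γ 5 ((λ x → gateValue op 1# o (f x) (g x)) ∷ [])
  C-gateValue times p q = C-mono (s≤s z≤n) (C-op times (C-wire p) (C-wire q))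
  C-gateValue plus  p q = C-op minus (C-op plus (C-wire p) (C-wire q)) (C-op plus (C-op times (C-wire p) (C-wire q)) (C-op times (C-wire p) (C-wire q)))
  C-gateValue minus p q = C-op minus (C-op plus (C-wire p) (C-wire q)) (C-op plus (C-op times (C-wire p) (C-wire q)) (C-op times (C-wire p) (C-wire q)))

  C-gateCheck : ∀ {f g y} o → Has Γ f → Has Γ g → Has Γ y → Computable op Γ 8 ((λ x → gateCheck op 1# o (f x) (g x) (y x)) ∷ [])
  C-gateCheck o p q r = C-op minus (C-wire has1) (C-dup times (C-op minus (C-wire r) (C-gateValue o p q)))

  C-horner : ∀ {m} {vs : Vec (I → V) m} → HasV Γ vs → Computable op Γ (m * 2 + 1) ((λ x → horner op 1# (vs ⟨ x ⟩)) ∷ [])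
  C-horner {zero}  {[]}     _ = C-op minus (C-wire has1) (C-wire has1)
  C-horner {suc m} {b ∷ vs} p = C-mono (ℕₚ.≤-reflexive (lem (m * 2 + 1)))
    (C-op plus (C-wire (headV p)) (C-dup plus (C-horner (tailV p))))
    where
    lem : ∀ t → t + 1 + 1 ≡ suc (suc t)
    lem = ℕSolver.solve-∀

  C-monomial : ∀ {w} {Z e : Vec (I → V) w} → HasV Γ Z → HasV Γ e → Computable op Γ (w * 4) ((λ x → monomial op 1# (Z ⟨ x ⟩) (e ⟨ x ⟩)) ∷ [])
  C-monomial {zero}  {[]}    {[]}    p q = C-wire has1
  C-monomial {suc w} {_ ∷ _} {_ ∷ _} p q = C-mono (ℕₚ.≤-reflexive (cong (λ z → 3 + z) (ℕₚ.+-comm (w * 4) 1)))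
    (C-op times (C-op plus (C-wire has1) (C-op times (C-wire (headV q)) (C-op minus (C-wire (headV p)) (C-wire has1))))
      (C-monomial (tailV p) (tailV q)))

C-transcript : ∀ {I V : Set} (op : Op → V → V → V) (1# : V) {i} {Γ : Vec (I → V) i} → Has Γ (const 1#) →
  ∀ {m j} (C : Code m j) {vs : Vec (I → V) j} {ys} → HasV Γ vs → HasV Γ ys →
  Computable op Γ (gateCount C * 9 + (m * 2 + 1)) ((λ x → transcript op 1# C (vs ⟨ x ⟩) (ys ⟨ x ⟩)) ∷ [])
C-transcript op 1# {Γ = Γ} has1 (ret σ) {vs} {[]} (hasV τ h) q = C-ext
  (λ x → cong (λ u → horner op 1# u ∷ []) (trans (sym (Vecₚ.map-∘ _ (lookup vs) σ)) (Vecₚ.map-cong (λ i → sym (Vecₚ.lookup-map i _ vs)) σ)))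
  (C-horner op 1# has1 {vs = map (lookup vs) σ} (hasV (map (lookup τ) σ) (λ x →
    trans (sym (Vecₚ.map-∘ _ (lookup τ) σ)) (trans (Vecₚ.map-cong (λ i → Has.hit (lookupV {Γ = Γ} (hasV {fs = vs} τ h) i) x) σ) (Vecₚ.map-∘ _ (lookup vs) σ)))))
C-transcript op 1# {Γ = Γ} has1 {m} (step o a b C) {vs} {y ∷ ys} p q = C-mono (ℕₚ.≤-reflexive (lem (gateCount C * 9) (m * 2 + 1))) (C-ext
  (λ x → cong₂ (λ r s → op times (gateCheck op 1# o r s (y x)) (transcript op 1# C (y x ∷ vs ⟨ x ⟩) (ys ⟨ x ⟩)) ∷ []) (sym (Vecₚ.lookup-map a _ vs)) (sym (Vecₚ.lookup-map b _ vs)))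
  (C-op times (C-gateCheck op 1# has1 o (lookupV p a) (lookupV p b) (headV q)) (C-transcript op 1# has1 C (consV (headV q) p) (tailV q))))
  where
  lem : ∀ t r → 8 + (t + r + 1) ≡ 9 + t + r
  lem = ℕSolver.solve-∀

-- Values and formal degrees are computed side by side, so that a single construction of the summand
-- yields, through the two projections, both its value and its degree.
opPair : Op → ℤ × ℕ → ℤ × ℕ → ℤ × ℕ
opPair o (a , d) (b , e) = opVal o a b , opDeg o d e

withDeg : ℤ → ℤ × ℕ
withDeg a = a , 1

map-proj₁-withDeg : ∀ {n} (v : Vec ℤ n) → map proj₁ (map withDeg v) ≡ v
map-proj₁-withDeg v = trans (sym (Vecₚ.map-∘ proj₁ withDeg v)) (Vecₚ.map-id v)

map-proj₂-withDeg : ∀ {n} (v : Vec ℤ n) → map proj₂ (map withDeg v) ≡ replicate n 1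
map-proj₂-withDeg v = trans (sym (Vecₚ.map-∘ proj₂ withDeg v)) (Vecₚ.map-const v 1)

-- The free variables are the weights `Z` and the Boolean parameters `z`; the summation variables
-- are the bits `e` and the transcript `y`. The bits `e` both select the monomial in `Z` and are
-- inputs of `C`, which explains their common length `w`.
module SummandCircuit {w k m} (C : Code m (1 + (w + k))) where
  S = gateCount C

  Input : Set
  Input = Vec (ℤ × ℕ) w × Vec (ℤ × ℕ) k × Vec (ℤ × ℕ) w × Vec (ℤ × ℕ) S

  summandSize : ℕ
  summandSize = w * 4 + ((S * 9 + (m * 2 + 1)) + 1)

  inZ ine : Input → Vec (ℤ × ℕ) w
  inZ = proj₁
  ine x = proj₁ (proj₂ (proj₂ x))
  inz : Input → Vec (ℤ × ℕ) k
  inz x = proj₁ (proj₂ x)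
  iny : Input → Vec (ℤ × ℕ) S
  iny x = proj₂ (proj₂ (proj₂ x))

  ΓZ Γe : Vec (Input → ℤ × ℕ) w
  ΓZ = block inZ
  Γe = block ine
  Γz : Vec (Input → ℤ × ℕ) k
  Γz = block inz
  Γy : Vec (Input → ℤ × ℕ) S
  Γy = block iny

  Γ : Vec (Input → ℤ × ℕ) (1 + ((w + k) + (w + S)))
  Γ = const (ℤ.1ℤ , 1) ∷ (ΓZ ++ Γz) ++ (Γe ++ Γy)

  Γ-⟨⟩ : ∀ Z z e y → Γ ⟨ Z , z , e , y ⟩ ≡ (ℤ.1ℤ , 1) ∷ (Z ++ z) ++ (e ++ y)
  Γ-⟨⟩ Z z e y = cong (_ ∷_) (trans (Vecₚ.map-++ _ (ΓZ ++ Γz) _) (cong₂ _++_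
    (trans (Vecₚ.map-++ _ ΓZ Γz) (cong₂ _++_ (block-⟨⟩ inZ x) (block-⟨⟩ inz x)))
    (trans (Vecₚ.map-++ _ Γe Γy) (cong₂ _++_ (block-⟨⟩ ine x) (block-⟨⟩ iny x)))))
    where
    x : Input
    x = Z , z , e , y

  summand : Input → ℤ × ℕ
  summand x = opPair times (monomial opPair (ℤ.1ℤ , 1) (ΓZ ⟨ x ⟩) (Γe ⟨ x ⟩))
    (transcript opPair (ℤ.1ℤ , 1) C (((const (ℤ.1ℤ , 1)) ∷ Γe ++ Γz) ⟨ x ⟩) (Γy ⟨ x ⟩))

  summandCode : Computable opPair Γ summandSize (summand ∷ [])
  summandCode = C-op times (C-monomial opPair _ here (thereV hasZ) hase)
    (C-transcript opPair _ here C (consV here (appendV hase hasz)) hasy)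
    where
    hasZ : HasV ((ΓZ ++ Γz) ++ (Γe ++ Γy)) ΓZ
    hasZ = hasV (map (_↑ˡ (w + S)) (map (_↑ˡ k) (allFin w))) λ x → go x
      where
      go : ∀ x → map (lookup (((ΓZ ++ Γz) ++ (Γe ++ Γy)) ⟨ x ⟩)) (map (_↑ˡ (w + S)) (map (_↑ˡ k) (allFin w))) ≡ ΓZ ⟨ x ⟩
      go x = trans (trans (cong (map _) (sym (Vecₚ.map-∘ _ _ (allFin w)))) (sym (Vecₚ.map-∘ _ _ (allFin w))))
        (trans (Vecₚ.map-cong (λ j → trans (cong (λ u → lookup u ((j ↑ˡ k) ↑ˡ (w + S))) (Vecₚ.map-++ _ (ΓZ ++ Γz) _))
          (trans (Vecₚ.lookup-++ˡ ((ΓZ ++ Γz) ⟨ x ⟩) _ (j ↑ˡ k)) (trans (cong (λ u → lookup u (j ↑ˡ k)) (Vecₚ.map-++ _ ΓZ Γz)) (Vecₚ.lookup-++ˡ (ΓZ ⟨ x ⟩) _ j)))) (allFin w))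
          (Vecₚ.map-lookup-allFin (ΓZ ⟨ x ⟩)))
    hasz : HasV Γ Γz
    hasz = thereV (hasV (map (_↑ˡ (w + S)) (map (w ↑ʳ_) (allFin k))) λ x →
      trans (trans (cong (map _) (sym (Vecₚ.map-∘ _ _ (allFin k)))) (sym (Vecₚ.map-∘ _ _ (allFin k))))
        (trans (Vecₚ.map-cong (λ j → trans (cong (λ u → lookup u ((w ↑ʳ j) ↑ˡ (w + S))) (Vecₚ.map-++ _ (ΓZ ++ Γz) _))
          (trans (Vecₚ.lookup-++ˡ ((ΓZ ++ Γz) ⟨ x ⟩) _ (w ↑ʳ j)) (trans (cong (λ u → lookup u (w ↑ʳ j)) (Vecₚ.map-++ _ ΓZ Γz)) (Vecₚ.lookup-++ʳ (ΓZ ⟨ x ⟩) _ j)))) (allFin k))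
          (Vecₚ.map-lookup-allFin (Γz ⟨ x ⟩))))
    hase : HasV Γ Γe
    hase = thereV (skipV (ΓZ ++ Γz) (hasV (map (_↑ˡ S) (allFin w)) λ x →
      trans (sym (Vecₚ.map-∘ _ _ (allFin w))) (trans (Vecₚ.map-cong (λ j → trans (cong (λ u → lookup u (j ↑ˡ S)) (Vecₚ.map-++ _ Γe Γy))
        (Vecₚ.lookup-++ˡ (Γe ⟨ x ⟩) _ j)) (allFin w)) (Vecₚ.map-lookup-allFin (Γe ⟨ x ⟩)))))
    hasy : HasV Γ Γy
    hasy = thereV (skipV (ΓZ ++ Γz) (skipV Γe allV))

  summand-hom : ∀ {V : Set} (op : Op → V → V → V) (h : ℤ × ℕ → V) → (∀ o a b → h (opPair o a b) ≡ op o (h a) (h b)) → ∀ Z z e y →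
    run op (code summandCode) (h (ℤ.1ℤ , 1) ∷ (map h Z ++ map h z) ++ (map h e ++ map h y)) ≡
      op times (monomial op (h (ℤ.1ℤ , 1)) (map h Z) (map h e)) (transcript op (h (ℤ.1ℤ , 1)) C (h (ℤ.1ℤ , 1) ∷ map h e ++ map h z) (map h y)) ∷ []
  summand-hom op h hom Z z e y = begin
    run op (code summandCode) (h (ℤ.1ℤ , 1) ∷ (map h Z ++ map h z) ++ (map h e ++ map h y))
      ≡⟨ cong (λ u → run op (code summandCode) (h (ℤ.1ℤ , 1) ∷ u)) (sym (trans (Vecₚ.map-++ h (Z ++ z) _) (cong₂ _++_ (Vecₚ.map-++ h Z z) (Vecₚ.map-++ h e y)))) ⟩
    run op (code summandCode) (map h ((ℤ.1ℤ , 1) ∷ (Z ++ z) ++ (e ++ y)))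
      ≡⟨ sym (run-hom opPair op h hom (code summandCode) _) ⟩
    map h (run opPair (code summandCode) ((ℤ.1ℤ , 1) ∷ (Z ++ z) ++ (e ++ y)))
      ≡⟨ cong (map h) (trans (cong (run opPair (code summandCode)) (sym (Γ-⟨⟩ Z z e y))) (correct summandCode x)) ⟩
    h (summand x) ∷ []
      ≡⟨ cong (_∷ []) (hom times (monomial opPair (ℤ.1ℤ , 1) (ΓZ ⟨ x ⟩) (Γe ⟨ x ⟩)) (transcript opPair (ℤ.1ℤ , 1) C ((const (ℤ.1ℤ , 1) ∷ Γe ++ Γz) ⟨ x ⟩) (Γy ⟨ x ⟩))) ⟩
    op times (h (monomial opPair (ℤ.1ℤ , 1) (ΓZ ⟨ x ⟩) (Γe ⟨ x ⟩))) (h (transcript opPair (ℤ.1ℤ , 1) C ((const (ℤ.1ℤ , 1) ∷ Γe ++ Γz) ⟨ x ⟩) (Γy ⟨ x ⟩))) ∷ []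
      ≡⟨ cong₂ (λ p q → op times p q ∷ [])
          (trans (monomial-hom opPair op h hom (ℤ.1ℤ , 1) (ΓZ ⟨ x ⟩) (Γe ⟨ x ⟩)) (cong₂ (λ p q → monomial op (h (ℤ.1ℤ , 1)) (map h p) (map h q)) (block-⟨⟩ inZ x) (block-⟨⟩ ine x)))
          (trans (transcript-hom opPair op h hom (ℤ.1ℤ , 1) C _ _) (cong₂ (λ p q → transcript op (h (ℤ.1ℤ , 1)) C (h (ℤ.1ℤ , 1) ∷ p) (map h q))
            (trans (cong (map h) (trans (Vecₚ.map-++ _ Γe Γz) (cong₂ _++_ (block-⟨⟩ ine x) (block-⟨⟩ inz x)))) (Vecₚ.map-++ h e z)) (block-⟨⟩ iny x))) ⟩
    op times (monomial op (h (ℤ.1ℤ , 1)) (map h Z) (map h e)) (transcript op (h (ℤ.1ℤ , 1)) C (h (ℤ.1ℤ , 1) ∷ map h e ++ map h z) (map h y)) ∷ [] ∎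
    where
    open ≡-Reasoning
    x : Input
    x = Z , z , e , y

  summandValue : ∀ Z z e y → run opVal (code summandCode) (ℤ.1ℤ ∷ (Z ++ z) ++ (e ++ y)) ≡
    monomial opVal ℤ.1ℤ Z e ℤ.* transcript opVal ℤ.1ℤ C (ℤ.1ℤ ∷ e ++ z) y ∷ []
  summandValue Z z e y = subst (λ F → F)
    (cong₂ _≡_
      (cong₂ (λ p q → run opVal (code summandCode) (ℤ.1ℤ ∷ p ++ q)) (cong₂ _++_ (map-proj₁-withDeg Z) (map-proj₁-withDeg z)) (cong₂ _++_ (map-proj₁-withDeg e) (map-proj₁-withDeg y)))
      (cong₂ (λ p q → p ℤ.* q ∷ []) (cong₂ (monomial opVal ℤ.1ℤ) (map-proj₁-withDeg Z) (map-proj₁-withDeg e))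
        (cong₂ (λ p q → transcript opVal ℤ.1ℤ C (ℤ.1ℤ ∷ p) q) (cong₂ _++_ (map-proj₁-withDeg e) (map-proj₁-withDeg z)) (map-proj₁-withDeg y))))
    (summand-hom opVal proj₁ (λ o a b → refl) (map withDeg Z) (map withDeg z) (map withDeg e) (map withDeg y))

  replicate-++ : ∀ a b → replicate a 1 ++ replicate b 1 ≡ replicate (a + b) 1
  replicate-++ zero    b = refl
  replicate-++ (suc a) b = cong (1 ∷_) (replicate-++ a b)

  summandDegree : run opDeg (code summandCode) (replicate (1 + ((w + k) + (w + S))) 1) ≡ (w * 2 + 1) + (S * 4 + 1) ∷ []
  summandDegree = trans
    (cong (λ u → run opDeg (code summandCode) (1 ∷ u)) (sym (trans
      (cong₂ _++_ (trans (cong₂ _++_ (ones w) (ones k)) (replicate-++ w k)) (trans (cong₂ _++_ (ones w) (ones S)) (replicate-++ w S))) (replicate-++ (w + k) (w + S)))))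
    (trans (summand-hom opDeg proj₂ (λ o a b → refl) (dummy w) (dummy k) (dummy w) (dummy S))
      (cong₂ (λ p q → p + q ∷ []) (trans (cong₂ (monomial opDeg 1) (ones w) (ones w)) (monomial-deg w))
        (trans (cong₂ (λ p q → transcript opDeg 1 C (1 ∷ p) q) (trans (cong₂ _++_ (ones w) (ones k)) (replicate-++ w k)) (ones S)) (transcript-deg C))))
    where
    dummy : ∀ n → Vec (ℤ × ℕ) n
    dummy n = map withDeg (replicate n ℤ.0ℤ)
    ones : ∀ n → map proj₂ (dummy n) ≡ replicate n 1
    ones n = map-proj₂-withDeg (replicate n ℤ.0ℤ)

tabulate-++ᶠ : ∀ {A : Set} {m n} (x : Fin m → A) (y : Fin n → A) → tabulate (x ++ᶠ y) ≡ tabulate x ++ tabulate y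
tabulate-++ᶠ {m = zero}  x y = refl
tabulate-++ᶠ {m = suc m} x y = cong (x zero ∷_) (trans (Vecₚ.tabulate-cong (lem x y)) (tabulate-++ᶠ (λ i → x (suc i)) y))
  where
  lem : ∀ {A : Set} {m n} (x : Fin (suc m) → A) (y : Fin n → A) i → (x ++ᶠ y) (suc i) ≡ ((λ j → x (suc j)) ++ᶠ y) i
  lem {m = m} x y i with splitAt m i
  ... | inj₁ _ = refl
  ... | inj₂ _ = refl

-- Serves twice: with all weights 1 it is an exponential sum of numbers, and with weights left as
-- variables it is the polynomial whose coefficient at Z^e is the number that `C` computes from `e`.
weightedSum : ∀ {w k m} → Code m (1 + (w + k)) → Vec ℤ w → Vec Bool k → ℤ
weightedSum {w} C Z z = cube ℤ._+_ w (λ e → monomial opVal ℤ.1ℤ Z (map b2z e) ℤ.* + num (run opBool C (true ∷ e ++ z)))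

summandCircuit : ∀ {w k m} (C : Code m (1 + (w + k))) {E} → E ≡ w + gateCount C →
  Σ (Circuit ((w + k) + E)) λ G → size G ≤ SummandCircuit.summandSize {w} {k} C × formalDegree G ≤ (w * 2 + 1) + (gateCount C * 4 + 1) ×
    (∀ Z z → sumCube E (λ e → eval G (lookup (Z ++ map b2z z) ++ᶠ e)) ≡ weightedSum {w} C Z z)
summandCircuit {w} {k} C refl = G , ℕₚ.≤-trans (ℕₚ.≤-reflexive (size-toCircuit _)) (small summandCode) ,
  ℕₚ.≤-reflexive (sym (Vecₚ.∷-injectiveˡ (trans (sym summandDegree) (formalDegree-toCircuit (code summandCode))))) , value
  where
  open SummandCircuit {w} {k} C
  G : Circuit ((w + k) + (w + gateCount C))
  G = toCircuit (code summandCode)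
  value : ∀ Z z → sumCube (w + S) (λ e → eval G (lookup (Z ++ map b2z z) ++ᶠ e)) ≡ weightedSum {w} C Z z
  value Z z = begin
    sumCube (w + S) (λ e → eval G (lookup (Z ++ map b2z z) ++ᶠ e))
      ≡⟨ sumCube≡cube (w + S) _ (λ {x} {y} e → eval-cong G (λ i → congr {x} {y} e i)) ⟩
    cube ℤ._+_ (w + S) (λ e → eval G (lookup (Z ++ map b2z z) ++ᶠ (λ i → b2z (lookup e i))))
      ≡⟨ cube-++ ℤ._+_ w S _ ⟩
    cube ℤ._+_ w (λ e → cube ℤ._+_ S (λ y → eval G (lookup (Z ++ map b2z z) ++ᶠ (λ i → b2z (lookup (e ++ y) i)))))
      ≡⟨ cube-cong ℤ._+_ w (λ e → trans (cube-cong ℤ._+_ S (λ y → point e y)) (trans (cube-*ˡ S (monomial opVal ℤ.1ℤ Z (map b2z e)) (λ y → transcript opVal ℤ.1ℤ C (ℤ.1ℤ ∷ map b2z e ++ map b2z z) (map b2z y)))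
           (cong (monomial opVal ℤ.1ℤ Z (map b2z e) ℤ.*_) (trans (cube-cong ℤ._+_ S (λ y → cong (λ u → transcript opVal ℤ.1ℤ C (ℤ.1ℤ ∷ u) (map b2z y)) (sym (Vecₚ.map-++ b2z e z)))) (transcript-sum C (true ∷ e ++ z)))))) ⟩
    weightedSum {w} C Z z ∎
    where
    open ≡-Reasoning
    congr : ∀ {x y : Fin (w + S) → ℤ} → (∀ i → x i ≡ y i) → ∀ i →
      (lookup (Z ++ map b2z z) ++ᶠ x) i ≡ (lookup (Z ++ map b2z z) ++ᶠ y) i
    congr e i with splitAt (w + k) i
    ... | inj₁ _ = refl
    ... | inj₂ j = e j
    point : ∀ e y → eval G (lookup (Z ++ map b2z z) ++ᶠ (λ i → b2z (lookup (e ++ y) i)))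
      ≡ monomial opVal ℤ.1ℤ Z (map b2z e) ℤ.* transcript opVal ℤ.1ℤ C (ℤ.1ℤ ∷ map b2z e ++ map b2z z) (map b2z y)
    point e y = Vecₚ.∷-injectiveˡ (trans (sym (eval-toCircuit (code summandCode) (lookup (Z ++ map b2z z) ++ᶠ (λ i → b2z (lookup (e ++ y) i))))) (trans
      (cong (λ u → run opVal (code summandCode) (ℤ.1ℤ ∷ u)) (trans (tabulate-++ᶠ (lookup (Z ++ map b2z z)) _) (cong₂ _++_ (Vecₚ.tabulate∘lookup (Z ++ map b2z z))
        (trans (Vecₚ.tabulate-∘ b2z (lookup (e ++ y))) (trans (cong (map b2z) (Vecₚ.tabulate∘lookup (e ++ y))) (Vecₚ.map-++ b2z e y))))))
      (summandValue Z (map b2z z) (map b2z e) (map b2z y))))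

Collapse : Set
Collapse = ∀ F → VNP0 F → VP0 F

-- The only place where the hypothesis VNP⁰ ⊆ VP⁰ enters.
sumCodes : Collapse → ∀ a {k m : ℕ → ℕ} → Bounded k → Bounded m → (C : ∀ n → Code (m n) (1 + (pw a n + k n))) →
  Bounded (λ n → gateCount (C n)) →
  Σ (∀ n → Code 1 (1 + (pw a n + k n))) λ D → Bounded (λ n → gateCount (D n)) ×
    (∀ n Z z → run opVal (D n) (ℤ.1ℤ ∷ Z ++ map b2z z) ≡ weightedSum {pw a n} (C n) Z z ∷ [])
sumCodes collapse a {k} {m} kB mB C (c , C≤) = D , DB , value
  where
  -- `pw a n` variables for the bits `e` and `pw c n` for the transcript, the length to which `C n`
  -- is padded.
  P : NatPoly
  P = addNP (pwNP a) (pwNP c)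
  C′ : ∀ n → Σ (Code (m n) (1 + (pw a n + k n))) λ C′ → gateCount C′ ≡ pw c n × (∀ v → run opBool C′ v ≡ run opBool (C n) v)
  C′ n = padTo (C n) (C≤ n)
  G : ∀ n → _
  G n = summandCircuit {pw a n} {k n} (proj₁ (C′ n)) {evalNP P n}
    (trans (evalNP-add (pwNP a) (pwNP c) n) (cong₂ _+_ (evalNP-pw a n) (trans (evalNP-pw c n) (sym (proj₁ (proj₂ (C′ n)))))))
  F : Family
  F = mkFamily (λ n → pw a n + k n) (λ n x → sumCube (evalNP P n) (λ e → eval (proj₁ (G n)) (x ++ᶠ e)))
  aB : Bounded (pw a)
  aB = Bounded-pw a
  PB : Bounded (evalNP P)
  PB = Bounded-≤ (λ n → ℕₚ.≤-reflexive (trans (evalNP-add (pwNP a) (pwNP c) n) (cong₂ _+_ (evalNP-pw a n) (evalNP-pw c n)))) (Bounded-+ aB (Bounded-pw c))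
  F∈VNP0 : VNP0 F
  F∈VNP0 = P , (λ n → eval (proj₁ (G n))) ,
    (Bounded⇒PolyBounded (Bounded-+ (Bounded-+ aB kB) PB) , (λ n → size (proj₁ (G n))) , (λ n → formalDegree (proj₁ (G n))) ,
     Bounded⇒PolyBounded (Bounded-≤ (λ n → ℕₚ.≤-trans (proj₁ (proj₂ (G n))) (ℕₚ.≤-reflexive (cong (λ S → pw a n * 4 + (S * 9 + (m n * 2 + 1) + 1)) (proj₁ (proj₂ (C′ n))))))
       (Bounded-+ (Bounded-* aB (Bounded-const 4)) (Bounded-+ (Bounded-+ (Bounded-* (Bounded-pw c) (Bounded-const 9)) (Bounded-+ (Bounded-* mB (Bounded-const 2)) (Bounded-const 1))) (Bounded-const 1)))) ,
     Bounded⇒PolyBounded (Bounded-≤ (λ n → ℕₚ.≤-trans (proj₁ (proj₂ (proj₂ (G n)))) (ℕₚ.≤-reflexive (cong (λ S → pw a n * 2 + 1 + (S * 4 + 1)) (proj₁ (proj₂ (C′ n))))))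
       (Bounded-+ (Bounded-+ (Bounded-* aB (Bounded-const 2)) (Bounded-const 1)) (Bounded-+ (Bounded-* (Bounded-pw c) (Bounded-const 4)) (Bounded-const 1)))) ,
     (λ n → proj₁ (G n) , ℕₚ.≤-refl , ℕₚ.≤-refl , λ x → refl)) ,
    λ n x → refl
  F∈VP0 : VP0 F
  F∈VP0 = collapse F F∈VNP0
  s : ℕ → ℕ
  s = proj₁ (proj₂ F∈VP0)
  sB : Bounded s
  sB = PolyBounded⇒Bounded (proj₁ (proj₂ (proj₂ (proj₂ F∈VP0))))
  circ : ∀ n → Σ (Circuit (pw a n + k n)) λ K → size K ≤ s n × _ × Computes K (poly F n)
  circ = proj₂ (proj₂ (proj₂ (proj₂ (proj₂ F∈VP0))))
  D : ∀ n → Code 1 (1 + (pw a n + k n))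
  D n = fromCircuit (proj₁ (circ n))
  DB : Bounded (λ n → gateCount (D n))
  DB = Bounded-≤ (λ n → ℕₚ.≤-trans (ℕₚ.≤-reflexive (gateCount-fromCircuit (proj₁ (circ n)))) (proj₁ (proj₂ (circ n)))) sB
  value : ∀ n Z z → run opVal (D n) (ℤ.1ℤ ∷ Z ++ map b2z z) ≡ weightedSum {pw a n} (C n) Z z ∷ []
  value n Z z = begin
    run opVal (D n) (ℤ.1ℤ ∷ Z ++ map b2z z)
      ≡⟨ cong (λ u → run opVal (D n) (ℤ.1ℤ ∷ u)) (sym (Vecₚ.tabulate∘lookup _)) ⟩
    run opVal (D n) (ℤ.1ℤ ∷ tabulate (lookup (Z ++ map b2z z)))
      ≡⟨ run-fromCircuit (proj₁ (circ n)) _ ⟩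
    eval (proj₁ (circ n)) (lookup (Z ++ map b2z z)) ∷ []
      ≡⟨ cong (_∷ []) (proj₂ (proj₂ (proj₂ (circ n))) _) ⟩
    sumCube (evalNP P n) (λ e → eval (proj₁ (G n)) (lookup (Z ++ map b2z z) ++ᶠ e)) ∷ []
      ≡⟨ cong (_∷ []) (trans (proj₂ (proj₂ (proj₂ (G n))) Z z) (cube-cong ℤ._+_ (pw a n) (λ e → cong (λ u → monomial opVal ℤ.1ℤ Z (map b2z e) ℤ.* + num u) (proj₂ (proj₂ (C′ n)) _)))) ⟩
    weightedSum {pw a n} (C n) Z z ∷ [] ∎
    where open ≡-Reasoning

-- Boolean programs for modular arithmetic

infix 4 _≋_[_]
-- With the quotient kept as data a congruence is an equation between integers, and its closure
-- properties become ring identities.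
record _≋_[_] (a b m : ℤ) : Set where
  constructor cong-by
  field
    quot : ℤ
    diff : a ≡ b ℤ.+ quot ℤ.* m
open _≋_[_] public

≋-refl : ∀ {m a} → a ≋ a [ m ]
≋-refl {m} {a} = cong-by ℤ.0ℤ (lem a m)
  where
  lem : ∀ a m → a ≡ a ℤ.+ ℤ.0ℤ ℤ.* m
  lem = ℤSolver.solve-∀

≋-reflexive : ∀ {m a b} → a ≡ b → a ≋ b [ m ]
≋-reflexive refl = ≋-refl

≋-sym : ∀ {m a b} → a ≋ b [ m ] → b ≋ a [ m ]
≋-sym {m} {b = b} (cong-by q refl) = cong-by (ℤ.- q) (lem b q m)
  where
  lem : ∀ b q m → b ≡ b ℤ.+ q ℤ.* m ℤ.+ (ℤ.- q) ℤ.* m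
  lem = ℤSolver.solve-∀

≋-trans : ∀ {m a b c} → a ≋ b [ m ] → b ≋ c [ m ] → a ≋ c [ m ]
≋-trans {m} {c = c} (cong-by q refl) (cong-by r refl) = cong-by (r ℤ.+ q) (lem c q r m)
  where
  lem : ∀ c q r m → c ℤ.+ r ℤ.* m ℤ.+ q ℤ.* m ≡ c ℤ.+ (r ℤ.+ q) ℤ.* m
  lem = ℤSolver.solve-∀

≋-opVal : ∀ {m} o {a b c d} → a ≋ b [ m ] → c ≋ d [ m ] → opVal o a c ≋ opVal o b d [ m ]
≋-opVal {m} plus {b = b} {d = d} (cong-by q refl) (cong-by r refl) = cong-by (q ℤ.+ r) (lem b d q r m)
  where
  lem : ∀ b d q r m → b ℤ.+ q ℤ.* m ℤ.+ (d ℤ.+ r ℤ.* m) ≡ b ℤ.+ d ℤ.+ (q ℤ.+ r) ℤ.* m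
  lem = ℤSolver.solve-∀
≋-opVal {m} minus {b = b} {d = d} (cong-by q refl) (cong-by r refl) = cong-by (q ℤ.- r) (lem b d q r m)
  where
  lem : ∀ b d q r m → b ℤ.+ q ℤ.* m ℤ.- (d ℤ.+ r ℤ.* m) ≡ b ℤ.- d ℤ.+ (q ℤ.- r) ℤ.* m
  lem = ℤSolver.solve-∀
≋-opVal {m} times {b = b} {d = d} (cong-by q refl) (cong-by r refl) = cong-by (b ℤ.* r ℤ.+ q ℤ.* d ℤ.+ q ℤ.* r ℤ.* m) (lem b d q r m)
  where
  lem : ∀ b d q r m → (b ℤ.+ q ℤ.* m) ℤ.* (d ℤ.+ r ℤ.* m) ≡ b ℤ.* d ℤ.+ (b ℤ.* r ℤ.+ q ℤ.* d ℤ.+ q ℤ.* r ℤ.* m) ℤ.* m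
  lem = ℤSolver.solve-∀

≋-+ : ∀ {m a b c d} → a ≋ b [ m ] → c ≋ d [ m ] → a ℤ.+ c ≋ b ℤ.+ d [ m ]
≋-+ = ≋-opVal plus

≋-* : ∀ {m a b c d} → a ≋ b [ m ] → c ≋ d [ m ] → a ℤ.* c ≋ b ℤ.* d [ m ]
≋-* = ≋-opVal times

≋-sub : ∀ {m a b c d} → a ≋ b [ m ] → c ≋ d [ m ] → a ℤ.- c ≋ b ℤ.- d [ m ]
≋-sub = ≋-opVal minus

≋-+M : ∀ {m a} k → a ℤ.+ k ℤ.* m ≋ a [ m ]
≋-+M k = cong-by k refl

<-unique : ∀ {M a b} → a < M → b < M → + a ≋ + b [ + M ] → a ≡ b
<-unique {M} {a} {b} a<M b<M (cong-by (+ zero) e) = ℤₚ.+-injective (trans e (ℤₚ.+-identityʳ _))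
<-unique {M} {a} {b} a<M b<M (cong-by (+ suc k) e) = contradiction a<M (ℕₚ.≤⇒≯ (subst (M ≤_) (sym a≡) (ℕₚ.≤-trans (ℕₚ.m≤m+n M (k * M)) (ℕₚ.m≤n+m _ b))))
  where
  a≡ : a ≡ b + suc k * M
  a≡ = ℤₚ.+-injective (trans e (cong (λ z → + b ℤ.+ z) (sym (ℤₚ.pos-* (suc k) M))))
<-unique {M} {a} {b} a<M b<M (cong-by -[1+ k ] e) = contradiction b<M (ℕₚ.≤⇒≯ (subst (M ≤_) (sym b≡) (ℕₚ.≤-trans (ℕₚ.m≤m+n M (k * M)) (ℕₚ.m≤n+m _ a))))
  where
  lem : ∀ b q m → b ≡ b ℤ.+ (ℤ.- q) ℤ.* m ℤ.+ q ℤ.* m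
  lem = ℤSolver.solve-∀
  b≡ : b ≡ a + suc k * M
  b≡ = ℤₚ.+-injective (trans (lem (+ b) (+ suc k) (+ M)) (cong₂ ℤ._+_ (sym e) (sym (ℤₚ.pos-* (suc k) M))))

num<2^ : ∀ {m} (v : Vec Bool m) → num v < 2 ^ m
num<2^ []      = s≤s z≤n
num<2^ {suc m} (b ∷ v) = begin-strict
  b2n b + 2 * num v   <⟨ ℕₚ.+-monoˡ-< (2 * num v) (b<2 b) ⟩
  2 + 2 * num v       ≡⟨ lem (num v) ⟩
  2 * suc (num v)     ≤⟨ ℕₚ.*-monoʳ-≤ 2 (num<2^ v) ⟩
  2 * 2 ^ m           ∎
  where
  open ℕₚ.≤-Reasoning
  b<2 : ∀ b → b2n b < 2
  b<2 false = s≤s z≤n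
  b<2 true  = s≤s (s≤s z≤n)
  lem : ∀ x → 2 + 2 * x ≡ 2 * suc x
  lem = ℕSolver.solve-∀

2^ : ℕ → ℤ
2^ t = + (2 ^ t)

2^-suc : ∀ t → 2^ (suc t) ≡ + 2 ℤ.* 2^ t
2^-suc t = ℤₚ.pos-* 2 (2 ^ t)

+num : ∀ {m} b (v : Vec Bool m) → + num (b ∷ v) ≡ b2z b ℤ.+ + 2 ℤ.* + num v
+num b v = cong₂ ℤ._+_ (+b2n b) (ℤₚ.pos-* 2 (num v))

≋-∷ : ∀ {t a b c} → a ≋ b [ 2^ t ] → c ℤ.+ + 2 ℤ.* a ≋ c ℤ.+ + 2 ℤ.* b [ 2^ (suc t) ]
≋-∷ {t} {b = b} {c} (cong-by q refl) = cong-by q (trans (lem c b q (2^ t)) (cong (λ z → c ℤ.+ + 2 ℤ.* b ℤ.+ q ℤ.* z) (sym (2^-suc t))))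
  where
  lem : ∀ c b q m → c ℤ.+ + 2 ℤ.* (b ℤ.+ q ℤ.* m) ≡ c ℤ.+ + 2 ℤ.* b ℤ.+ q ℤ.* (+ 2 ℤ.* m)
  lem = ℤSolver.solve-∀

arithSize : ℕ → ℕ
arithSize w = w * 6 + w * (w * 6)

arithSize-bounded : ∀ k → Bounded (λ n → arithSize (pw k n))
arithSize-bounded k = Bounded-+ b (Bounded-* (Bounded-pw k) b)
  where
  b : Bounded (λ n → pw k n * 6)
  b = Bounded-* (Bounded-pw k) (Bounded-const 6)

module _ {I : Set} where

  -- A ripple-carry adder. The two terms of the carry are never both true, so exclusive or takes the
  -- place of disjunction.
  addFs : ∀ {w} → Vec (I → Bool) w → Vec (I → Bool) w → (I → Bool) → Vec (I → Bool) w
  addFs []       []       c = []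
  addFs (a ∷ as) (b ∷ bs) c = (λ x → (a x xor b x) xor c x) ∷ addFs as bs (λ x → (a x ∧ b x) xor ((a x xor b x) ∧ c x))

  C-add : ∀ {w i} {Γ : Vec (I → Bool) i} {as bs : Vec (I → Bool) w} {c} → HasV Γ as → HasV Γ bs → Has Γ c →
    Computable opBool Γ (w * 5) (addFs as bs c)
  C-add {as = []}     {[]}     p q r = C-ret nilV
  C-add {as = a ∷ as} {b ∷ bs} p q r =
    C-step plus (headV p) (headV q) (C-step plus here (there r)
      (C-step times (there (there (headV p))) (there (there (headV q))) (C-step times (there (there here)) (there (there (there r)))
        (C-step plus (there here) here
          (C-cons (there (there (there here))) (C-add (up (tailV p)) (up (tailV q)) here))))))
    where
    up : ∀ {m i} {Γ : Vec (I → Bool) i} {fs : Vec (I → Bool) m} {a b c d e} → HasV Γ fs → HasV (a ∷ b ∷ c ∷ d ∷ e ∷ Γ) fs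
    up h = thereV (thereV (thereV (thereV (thereV h))))

  addFs-num : ∀ {w} (as bs : Vec (I → Bool) w) c x →
    + num (addFs as bs c ⟨ x ⟩) ≋ + num (as ⟨ x ⟩) ℤ.+ + num (bs ⟨ x ⟩) ℤ.+ b2z (c x) [ 2^ w ]
  addFs-num []       []       c x = cong-by (ℤ.- b2z (c x)) (lem (b2z (c x)))
    where
    lem : ∀ c → ℤ.0ℤ ≡ ℤ.0ℤ ℤ.+ ℤ.0ℤ ℤ.+ c ℤ.+ (ℤ.- c) ℤ.* (+ 1)
    lem = ℤSolver.solve-∀
  addFs-num {suc w} (a ∷ as) (b ∷ bs) c x = ≋-trans (≋-reflexive (+num ((a x xor b x) xor c x) (addFs as bs c′ ⟨ x ⟩)))
    (≋-trans (≋-∷ {w} {c = b2z ((a x xor b x) xor c x)} (addFs-num as bs c′ x)) (≋-reflexive (begin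
      b2z ((a x xor b x) xor c x) ℤ.+ + 2 ℤ.* (A ℤ.+ B ℤ.+ b2z ((a x ∧ b x) xor ((a x xor b x) ∧ c x)))
        ≡⟨ carry (a x) (b x) (c x) A B ⟩
      (b2z (a x) ℤ.+ + 2 ℤ.* A) ℤ.+ (b2z (b x) ℤ.+ + 2 ℤ.* B) ℤ.+ b2z (c x)
        ≡⟨ cong₂ (λ p q → p ℤ.+ q ℤ.+ b2z (c x)) (sym (+num (a x) (as ⟨ x ⟩))) (sym (+num (b x) (bs ⟨ x ⟩))) ⟩
      + num ((a ∷ as) ⟨ x ⟩) ℤ.+ + num ((b ∷ bs) ⟨ x ⟩) ℤ.+ b2z (c x) ∎)))
    where
    open ≡-Reasoning
    c′ : I → Bool
    c′ = λ x → (a x ∧ b x) xor ((a x xor b x) ∧ c x)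
    A B : ℤ
    A = + num (as ⟨ x ⟩)
    B = + num (bs ⟨ x ⟩)
    lem : ∀ p q a b c A B → p ℤ.+ + 2 ℤ.* q ≡ a ℤ.+ b ℤ.+ c → p ℤ.+ + 2 ℤ.* (A ℤ.+ B ℤ.+ q) ≡ (a ℤ.+ + 2 ℤ.* A) ℤ.+ (b ℤ.+ + 2 ℤ.* B) ℤ.+ c
    lem p q a b c A B e = trans (l1 p q A B) (trans (cong (ℤ._+ (+ 2 ℤ.* A ℤ.+ + 2 ℤ.* B)) e) (l2 a b c A B))
      where
      l1 : ∀ p q A B → p ℤ.+ + 2 ℤ.* (A ℤ.+ B ℤ.+ q) ≡ p ℤ.+ + 2 ℤ.* q ℤ.+ (+ 2 ℤ.* A ℤ.+ + 2 ℤ.* B)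
      l1 = ℤSolver.solve-∀
      l2 : ∀ a b c A B → a ℤ.+ b ℤ.+ c ℤ.+ (+ 2 ℤ.* A ℤ.+ + 2 ℤ.* B) ≡ (a ℤ.+ + 2 ℤ.* A) ℤ.+ (b ℤ.+ + 2 ℤ.* B) ℤ.+ c
      l2 = ℤSolver.solve-∀
    full : ∀ a b c → b2z ((a xor b) xor c) ℤ.+ + 2 ℤ.* b2z ((a ∧ b) xor ((a xor b) ∧ c)) ≡ b2z a ℤ.+ b2z b ℤ.+ b2z c
    full false false false = refl
    full false false true  = refl
    full false true  false = refl
    full false true  true  = refl
    full true  false false = refl
    full true  false true  = refl
    full true  true  false = refl
    full true  true  true  = refl
    carry : ∀ a b c A B → b2z ((a xor b) xor c) ℤ.+ + 2 ℤ.* (A ℤ.+ B ℤ.+ b2z ((a ∧ b) xor ((a xor b) ∧ c)))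
      ≡ (b2z a ℤ.+ + 2 ℤ.* A) ℤ.+ (b2z b ℤ.+ + 2 ℤ.* B) ℤ.+ b2z c
    carry a b c A B = lem (b2z ((a xor b) xor c)) (b2z ((a ∧ b) xor ((a xor b) ∧ c))) (b2z a) (b2z b) (b2z c) A B (full a b c)

  F0 F1 : I → Bool
  F0 = const false
  F1 = const true

  scaleFs : ∀ {w} → (I → Bool) → Vec (I → Bool) w → Vec (I → Bool) w
  scaleFs a []       = []
  scaleFs a (b ∷ bs) = (λ x → a x ∧ b x) ∷ scaleFs a bs

  C-scale : ∀ {w i} {Γ : Vec (I → Bool) i} {a} {bs : Vec (I → Bool) w} → Has Γ a → HasV Γ bs → Computable opBool Γ w (scaleFs a bs)
  C-scale {bs = []}     p q = C-ret nilV
  C-scale {bs = b ∷ bs} p q = C-step times p (headV q) (C-cons here (C-scale (there p) (thereV (tailV q))))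

  scaleFs-num : ∀ {w} a (bs : Vec (I → Bool) w) x → + num (scaleFs a bs ⟨ x ⟩) ≡ b2z (a x) ℤ.* + num (bs ⟨ x ⟩)
  scaleFs-num a bs x with a x in eq
  ... | false = cong +_ (zeros bs)
    where
    zeros : ∀ {w} (bs : Vec (I → Bool) w) → num (scaleFs a bs ⟨ x ⟩) ≡ 0
    zeros []       = refl
    zeros (b ∷ bs) rewrite eq | zeros bs = refl
  ... | true  = trans (cong +_ (same bs)) (sym (ℤₚ.*-identityˡ _))
    where
    same : ∀ {w} (bs : Vec (I → Bool) w) → num (scaleFs a bs ⟨ x ⟩) ≡ num (bs ⟨ x ⟩)
    same []       = refl
    same (b ∷ bs) rewrite eq | same bs = refl

  shiftIn : ∀ {w} → (I → Bool) → Vec (I → Bool) w → Vec (I → Bool) w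
  shiftIn c []       = []
  shiftIn c (b ∷ bs) = c ∷ shiftIn b bs

  shiftIn-has : ∀ {w i} {Γ : Vec (I → Bool) i} {c} {bs : Vec (I → Bool) w} → Has Γ c → HasV Γ bs → HasV Γ (shiftIn c bs)
  shiftIn-has {bs = []}     p q = nilV
  shiftIn-has {bs = b ∷ bs} p q = consV p (shiftIn-has (headV q) (tailV q))

  shiftIn-num : ∀ {w} c (bs : Vec (I → Bool) w) x → + num (shiftIn c bs ⟨ x ⟩) ≋ b2z (c x) ℤ.+ + 2 ℤ.* + num (bs ⟨ x ⟩) [ 2^ w ]
  shiftIn-num c []       x = cong-by (ℤ.- b2z (c x)) (lem (b2z (c x)))
    where
    lem : ∀ c → ℤ.0ℤ ≡ c ℤ.+ + 2 ℤ.* ℤ.0ℤ ℤ.+ (ℤ.- c) ℤ.* (+ 1)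
    lem = ℤSolver.solve-∀
  shiftIn-num {suc w} c (b ∷ bs) x = ≋-trans (≋-reflexive (+num (c x) (shiftIn b bs ⟨ x ⟩))) (≋-trans (≋-∷ {w} {c = b2z (c x)} (shiftIn-num b bs x))
    (≋-reflexive (cong (λ z → b2z (c x) ℤ.+ + 2 ℤ.* z) (sym (+num (b x) (bs ⟨ x ⟩))))))

  mulFs : ∀ {m w} → Vec (I → Bool) m → Vec (I → Bool) w → Vec (I → Bool) w
  mulFs []       bs = replicate _ F0
  mulFs (a ∷ as) bs = addFs (scaleFs a bs) (shiftIn F0 (mulFs as bs)) F0

  replicate-has : ∀ {i} {Γ : Vec (I → Bool) i} {c} w → Has Γ c → HasV Γ (replicate w c)
  replicate-has zero    p = nilV
  replicate-has (suc w) p = consV p (replicate-has w p)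

  replicate-num : ∀ w x → num (replicate w F0 ⟨ x ⟩) ≡ 0
  replicate-num zero    x = refl
  replicate-num (suc w) x rewrite replicate-num w x = refl

  C-mul : ∀ {m w i} {Γ : Vec (I → Bool) i} {as : Vec (I → Bool) m} {bs : Vec (I → Bool) w} → Has Γ F0 → HasV Γ as → HasV Γ bs →
    Computable opBool Γ (m * (w * 6)) (mulFs as bs)
  C-mul {w = w} {as = []}     z p q = C-ret (replicate-has w z)
  C-mul {suc m} {w} {as = a ∷ as} {bs} z p q = C-mono (ℕₚ.≤-reflexive (lem w (m * (w * 6))))
    (C-let (C-mul z (tailV p) q) (C-let (C-scale (skip (mulFs as bs) (headV p)) (skipV (mulFs as bs) q))
      (C-add (hereV _) (skipV (scaleFs a bs) (shiftIn-has (skip (mulFs as bs) z) (hereV (mulFs as bs)))) (skip (scaleFs a bs) (skip (mulFs as bs) z)))))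
    where
    lem : ∀ w t → t + (w + w * 5) ≡ w * 6 + t
    lem = ℕSolver.solve-∀

  mulFs-num : ∀ {m w} (as : Vec (I → Bool) m) (bs : Vec (I → Bool) w) x →
    + num (mulFs as bs ⟨ x ⟩) ≋ + num (as ⟨ x ⟩) ℤ.* + num (bs ⟨ x ⟩) [ 2^ w ]
  mulFs-num {w = w} [] bs x = ≋-reflexive (trans (cong +_ (replicate-num w x)) (sym (ℤₚ.*-zeroˡ (+ num (bs ⟨ x ⟩)))))
  mulFs-num (a ∷ as) bs x = ≋-trans (addFs-num (scaleFs a bs) _ F0 x)
    (≋-trans (≋-+ (≋-+ (≋-reflexive (scaleFs-num a bs x)) (≋-trans (shiftIn-num F0 (mulFs as bs) x) (≋-+ (≋-refl {a = ℤ.0ℤ}) (≋-* (≋-refl {a = + 2}) (mulFs-num as bs x))))) (≋-refl {a = ℤ.0ℤ}))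
      (≋-reflexive (trans (lem (b2z (a x)) (+ num (as ⟨ x ⟩)) (+ num (bs ⟨ x ⟩))) (cong (ℤ._* + num (bs ⟨ x ⟩)) (sym (+num (a x) (as ⟨ x ⟩)))))))
    where
    lem : ∀ a A B → a ℤ.* B ℤ.+ (ℤ.0ℤ ℤ.+ + 2 ℤ.* (A ℤ.* B)) ℤ.+ ℤ.0ℤ ≡ (a ℤ.+ + 2 ℤ.* A) ℤ.* B
    lem = ℤSolver.solve-∀

  notFs : ∀ {w} → Vec (I → Bool) w → Vec (I → Bool) w
  notFs []       = []
  notFs (b ∷ bs) = (λ x → b x xor true) ∷ notFs bs

  C-not : ∀ {w i} {Γ : Vec (I → Bool) i} {bs : Vec (I → Bool) w} → Has Γ F1 → HasV Γ bs → Computable opBool Γ w (notFs bs)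
  C-not {bs = []}     p q = C-ret nilV
  C-not {bs = b ∷ bs} p q = C-step plus (headV q) p (C-cons here (C-not (there p) (thereV (tailV q))))

  -- Complementing all bits turns b into 2^w - 1 - b. Subtraction modulo 2^w is therefore addition
  -- of the complement with incoming carry 1.
  notFs-num : ∀ {w} (bs : Vec (I → Bool) w) x → + num (notFs bs ⟨ x ⟩) ℤ.+ ℤ.1ℤ ≡ 2^ w ℤ.- + num (bs ⟨ x ⟩)
  notFs-num []       x = refl
  notFs-num {suc w} (b ∷ bs) x = begin
    + num (notFs (b ∷ bs) ⟨ x ⟩) ℤ.+ ℤ.1ℤ   ≡⟨ cong (ℤ._+ ℤ.1ℤ) (+num (b x xor true) (notFs bs ⟨ x ⟩)) ⟩
    b2z (b x xor true) ℤ.+ + 2 ℤ.* N ℤ.+ ℤ.1ℤ  ≡⟨ l1 (b2z (b x xor true)) N ⟩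
    b2z (b x xor true) ℤ.- ℤ.1ℤ ℤ.+ + 2 ℤ.* (N ℤ.+ ℤ.1ℤ) ≡⟨ cong₂ (λ p q → p ℤ.+ + 2 ℤ.* q) (neg (b x)) (notFs-num bs x) ⟩
    ℤ.- b2z (b x) ℤ.+ + 2 ℤ.* (2^ w ℤ.- B)  ≡⟨ l2 (b2z (b x)) (2^ w) B ⟩
    + 2 ℤ.* 2^ w ℤ.- (b2z (b x) ℤ.+ + 2 ℤ.* B)  ≡⟨ cong₂ ℤ._-_ (sym (2^-suc w)) (sym (+num (b x) (bs ⟨ x ⟩))) ⟩
    2^ (suc w) ℤ.- + num ((b ∷ bs) ⟨ x ⟩) ∎
    where
    open ≡-Reasoning
    N B : ℤ
    N = + num (notFs bs ⟨ x ⟩)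
    B = + num (bs ⟨ x ⟩)
    neg : ∀ b → b2z (b xor true) ℤ.- ℤ.1ℤ ≡ ℤ.- b2z b
    neg false = refl
    neg true  = refl
    l1 : ∀ p N → p ℤ.+ + 2 ℤ.* N ℤ.+ ℤ.1ℤ ≡ p ℤ.- ℤ.1ℤ ℤ.+ + 2 ℤ.* (N ℤ.+ ℤ.1ℤ)
    l1 = ℤSolver.solve-∀
    l2 : ∀ b T B → ℤ.- b ℤ.+ + 2 ℤ.* (T ℤ.- B) ≡ + 2 ℤ.* T ℤ.- (b ℤ.+ + 2 ℤ.* B)
    l2 = ℤSolver.solve-∀

  arithFs : ∀ {w} → Op → Vec (I → Bool) w → Vec (I → Bool) w → Vec (I → Bool) w
  arithFs plus  as bs = addFs as bs F0
  arithFs minus as bs = addFs as (notFs bs) F1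
  arithFs times as bs = mulFs as bs

  C-arith : ∀ {w i} {Γ : Vec (I → Bool) i} {as bs : Vec (I → Bool) w} o → Has Γ F0 → Has Γ F1 → HasV Γ as → HasV Γ bs →
    Computable opBool Γ (arithSize w) (arithFs o as bs)
  C-arith {w} plus  z o p q = C-mono (ℕₚ.≤-trans (ℕₚ.*-monoʳ-≤ w (ℕₚ.n≤1+n 5)) (ℕₚ.m≤m+n _ _)) (C-add p q z)
  C-arith {w} minus z o p q = C-mono (ℕₚ.≤-trans (ℕₚ.≤-reflexive (lem w)) (ℕₚ.m≤m+n _ _)) (C-let (C-not o q) (C-add (skipV _ p) (hereV _) (skip _ o)))
    where
    lem : ∀ w → w + w * 5 ≡ w * 6
    lem = ℕSolver.solve-∀
  C-arith {w} times z o p q = C-mono (ℕₚ.m≤n+m _ _) (C-mul z p q)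

  arithFs-num : ∀ {w} o (as bs : Vec (I → Bool) w) x →
    + num (arithFs o as bs ⟨ x ⟩) ≋ opVal o (+ num (as ⟨ x ⟩)) (+ num (bs ⟨ x ⟩)) [ 2^ w ]
  arithFs-num plus  as bs x = ≋-trans (addFs-num as bs F0 x) (≋-reflexive (ℤₚ.+-identityʳ _))
  arithFs-num times as bs x = mulFs-num as bs x
  arithFs-num {w} minus as bs x = ≋-trans (addFs-num as (notFs bs) F1 x)
    (cong-by ℤ.1ℤ (trans (lem (+ num (as ⟨ x ⟩)) (+ num (notFs bs ⟨ x ⟩))) (trans (cong (λ z → + num (as ⟨ x ⟩) ℤ.+ z) (notFs-num bs x)) (lem2 (+ num (as ⟨ x ⟩)) (2^ w) (+ num (bs ⟨ x ⟩))))))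
    where
    lem : ∀ a b → a ℤ.+ b ℤ.+ ℤ.1ℤ ≡ a ℤ.+ (b ℤ.+ ℤ.1ℤ)
    lem = ℤSolver.solve-∀
    lem2 : ∀ a T b → a ℤ.+ (T ℤ.- b) ≡ a ℤ.- b ℤ.+ ℤ.1ℤ ℤ.* T
    lem2 = ℤSolver.solve-∀

  resize : ∀ {w} t → Vec (I → Bool) w → Vec (I → Bool) t
  resize zero    as       = []
  resize (suc t) []       = F0 ∷ resize t []
  resize (suc t) (a ∷ as) = a ∷ resize t as

  resize-has : ∀ {w i} {Γ : Vec (I → Bool) i} t {as : Vec (I → Bool) w} → Has Γ F0 → HasV Γ as → HasV Γ (resize t as)
  resize-has zero             z p = nilV
  resize-has (suc t) {[]}     z p = consV z (resize-has t z p)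
  resize-has (suc t) {a ∷ as} z p = consV (headV p) (resize-has t z (tailV p))

  resize-≋ : ∀ {w} t (as : Vec (I → Bool) w) x → + num (resize t as ⟨ x ⟩) ≋ + num (as ⟨ x ⟩) [ 2^ t ]
  resize-≋ zero    as       x = cong-by (ℤ.- + num (as ⟨ x ⟩)) (lem (+ num (as ⟨ x ⟩)))
    where
    lem : ∀ c → ℤ.0ℤ ≡ c ℤ.+ (ℤ.- c) ℤ.* (+ 1)
    lem = ℤSolver.solve-∀
  resize-≋ (suc t) []       x = ≋-trans (≋-reflexive (+num false (resize t [] ⟨ x ⟩))) (≋-∷ {t} {c = ℤ.0ℤ} (resize-≋ t [] x))
  resize-≋ (suc t) (a ∷ as) x = ≋-trans (≋-reflexive (+num (a x) (resize t as ⟨ x ⟩))) (≋-trans (≋-∷ {t} {c = b2z (a x)} (resize-≋ t as x)) (≋-reflexive (sym (+num (a x) (as ⟨ x ⟩)))))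

  resize-num : ∀ {w} t (as : Vec (I → Bool) w) x → num (as ⟨ x ⟩) < 2 ^ t → num (resize t as ⟨ x ⟩) ≡ num (as ⟨ x ⟩)
  resize-num t as x h = <-unique (num<2^ (resize t as ⟨ x ⟩)) h (resize-≋ t as x)

  -- Decides whether the first number is less than the second plus `c`. Where the two bits differ
  -- the bit of the second number becomes the new state, and where they agree the old state is kept;
  -- later, more significant positions thus override earlier ones.
  ltFs : ∀ {w} → (I → Bool) → Vec (I → Bool) w → Vec (I → Bool) w → I → Bool
  ltFs c []       []       = c
  ltFs c (a ∷ as) (b ∷ bs) = ltFs (λ x → c x xor ((a x xor b x) ∧ (c x xor b x))) as bs

  C-lt : ∀ {w i} {Γ : Vec (I → Bool) i} {c} {as bs : Vec (I → Bool) w} → Has Γ c → HasV Γ as → HasV Γ bs →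
    Computable opBool Γ (w * 4) (ltFs c as bs ∷ [])
  C-lt {as = []}     {[]}     r p q = C-ret (consV r nilV)
  C-lt {as = a ∷ as} {b ∷ bs} r p q = C-step plus (headV p) (headV q) (C-step plus (there r) (there (headV q))
    (C-step times (there here) here (C-step plus (there (there (there r))) here (C-lt here (up (tailV p)) (up (tailV q))))))
    where
    up : ∀ {m i} {Γ : Vec (I → Bool) i} {fs : Vec (I → Bool) m} {a b c d} → HasV Γ fs → HasV (a ∷ b ∷ c ∷ d ∷ Γ) fs
    up h = thereV (thereV (thereV (thereV h)))

<ᵇ-cong : ∀ {a b c d} → (a < b → c < d) → (c < d → a < b) → (a ℕ.<ᵇ b) ≡ (c ℕ.<ᵇ d)
<ᵇ-cong {a} {b} {c} {d} f g with a ℕ.<ᵇ b in p | c ℕ.<ᵇ d in q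
... | false | false = refl
... | true  | true  = refl
... | true  | false = ⊥-elim (subst T q (ℕₚ.<⇒<ᵇ (f (ℕₚ.<ᵇ⇒< a b (subst T (sym p) tt)))))
... | false | true  = ⊥-elim (subst T p (ℕₚ.<⇒<ᵇ (g (ℕₚ.<ᵇ⇒< c d (subst T (sym q) tt)))))

-- The two hypotheses say that δ is (s - a)/2 rounded up, which is what remains of the lowest
-- position after division by 2.
<ᵇ-halve : ∀ {a s δ} A B → s ≤ 2 * δ + a → suc a + 2 * δ ≤ 2 + s → (a + 2 * A ℕ.<ᵇ s + 2 * B) ≡ (A ℕ.<ᵇ B + δ)
<ᵇ-halve {a} {s} {δ} A B h h′ = <ᵇ-cong
  (λ p → ℕₚ.*-cancelˡ-< 2 A (B + δ) (ℕₚ.+-cancelˡ-< a (2 * A) (2 * (B + δ)) (begin-strict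
    a + 2 * A             <⟨ p ⟩
    s + 2 * B             ≤⟨ ℕₚ.+-monoˡ-≤ (2 * B) h ⟩
    2 * δ + a + 2 * B     ≡⟨ l1 a B δ ⟩
    a + 2 * (B + δ)       ∎)))
  (λ p → ℕₚ.+-cancelˡ-≤ 2 (suc (a + 2 * A)) (s + 2 * B) (begin
    2 + suc (a + 2 * A)        ≡⟨ l2 a A ⟩
    suc a + 2 * suc A          ≤⟨ ℕₚ.+-monoʳ-≤ (suc a) (ℕₚ.*-monoʳ-≤ 2 p) ⟩
    suc a + 2 * (B + δ)        ≡⟨ l3 a B δ ⟩
    suc a + 2 * δ + 2 * B      ≤⟨ ℕₚ.+-monoˡ-≤ (2 * B) h′ ⟩
    2 + (s + 2 * B)            ∎))
  where
  open ℕₚ.≤-Reasoning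
  l1 : ∀ a B δ → 2 * δ + a + 2 * B ≡ a + 2 * (B + δ)
  l1 = ℕSolver.solve-∀
  l2 : ∀ a A → 2 + suc (a + 2 * A) ≡ suc a + 2 * suc A
  l2 = ℕSolver.solve-∀
  l3 : ∀ a B δ → suc a + 2 * (B + δ) ≡ suc a + 2 * δ + 2 * B
  l3 = ℕSolver.solve-∀

ltFs-num : ∀ {I : Set} {w} c (as bs : Vec (I → Bool) w) x → ltFs c as bs x ≡ (num (as ⟨ x ⟩) ℕ.<ᵇ num (bs ⟨ x ⟩) + b2n (c x))
ltFs-num c [] [] x with c x
... | false = refl
... | true  = refl
ltFs-num c (a ∷ as) (b ∷ bs) x = trans (ltFs-num _ as bs x) (step′ (a x) (b x) (c x) (num (as ⟨ x ⟩)) (num (bs ⟨ x ⟩)))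
  where
  move : ∀ b B c → b + c + 2 * B ≡ b + 2 * B + c
  move = ℕSolver.solve-∀
  halve : ∀ a b c δ A B → b2n b + b2n c ≤ 2 * b2n δ + b2n a → suc (b2n a) + 2 * b2n δ ≤ 2 + (b2n b + b2n c) →
    (A ℕ.<ᵇ B + b2n δ) ≡ (b2n a + 2 * A ℕ.<ᵇ b2n b + 2 * B + b2n c)
  halve a b c δ A B h h′ = trans (sym (<ᵇ-halve {b2n a} {b2n b + b2n c} {b2n δ} A B h h′)) (cong (b2n a + 2 * A ℕ.<ᵇ_) (move (b2n b) B (b2n c)))
  step′ : ∀ a b c A B → (A ℕ.<ᵇ B + b2n (c xor ((a xor b) ∧ (c xor b)))) ≡ (b2n a + 2 * A ℕ.<ᵇ b2n b + 2 * B + b2n c)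
  step′ false false false A B = halve false false false false A B z≤n (s≤s z≤n)
  step′ false false true  A B = halve false false true true A B (s≤s z≤n) (s≤s (s≤s (s≤s z≤n)))
  step′ false true  false A B = halve false true false true A B (s≤s z≤n) (s≤s (s≤s (s≤s z≤n)))
  step′ false true  true  A B = halve false true true true A B (s≤s (s≤s z≤n)) (s≤s (s≤s (s≤s z≤n)))
  step′ true  false false A B = halve true false false false A B z≤n (s≤s (s≤s z≤n))
  step′ true  false true  A B = halve true false true false A B (s≤s z≤n) (s≤s (s≤s z≤n))
  step′ true  true  false A B = halve true true false false A B (s≤s z≤n) (s≤s (s≤s z≤n))
  step′ true  true  true  A B = halve true true true true A B (s≤s (s≤s z≤n)) (s≤s (s≤s (s≤s (s≤s z≤n))))

-- Each wire over `W` becomes a word of `w` bits related to its value by `R`, and `gadget` replaces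
-- a gate by a Boolean program that preserves `R`. The relation is congruence modulo a power of two
-- at first, and later modulo a number computed from the input, whose word is passed in `ps`.
module _ {I W : Set} {w l : ℕ} (opW : Op → W → W → W) (R : I → W → Vec Bool w → Set) (ps : Vec (I → Bool) l) (g : ℕ)
  (gadget : ∀ o {f f′ : I → W} {as bs : Vec (I → Bool) w} → (∀ x → R x (f x) (as ⟨ x ⟩)) → (∀ x → R x (f′ x) (bs ⟨ x ⟩)) →
    Σ (Vec (I → Bool) w) λ cs → (∀ x → R x (opW o (f x) (f′ x)) (cs ⟨ x ⟩)) ×
      (∀ {i} {Γ : Vec (I → Bool) i} → HasV Γ ps → HasV Γ as → HasV Γ bs → Computable opBool Γ g cs)) where

  simulate : ∀ {i j} (C : Code 1 i) {Γ : Vec (I → Bool) j} → HasV Γ ps → (zs : Vec (I → W) i) (words : Vec (Vec (I → Bool) w) i) →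
    (∀ u x → R x (lookup (zs ⟨ x ⟩) u) (lookup words u ⟨ x ⟩)) → (∀ u → HasV Γ (lookup words u)) →
    Σ (Vec (I → Bool) w) λ cs → (∀ x → R x (head (run opW C (zs ⟨ x ⟩))) (cs ⟨ x ⟩)) × Computable opBool Γ (gateCount C * g) cs
  simulate (ret (u ∷ [])) hp zs words rel hw = lookup words u , rel u , C-ret (hw u)
  simulate (step o a b C) hp zs words rel hw =
    let cs , csR , csC = gadget o (rel a) (rel b)
        ds , dsR , dsC = simulate C (skipV cs hp) ((λ x → opW o (lookup (zs ⟨ x ⟩) a) (lookup (zs ⟨ x ⟩) b)) ∷ zs) (cs ∷ words)
          (λ { zero → csR ; (suc u) → rel u }) (λ { zero → hereV cs ; (suc u) → skipV cs (hw u) })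
    in ds , dsR , C-let (csC hp (hw a) (hw b)) dsC

-- Functions with small Boolean programs

module _ {I V : Set} where

  splitV : ∀ {m l i} {Γ : Vec (I → V) i} (fs : Vec (I → V) m) {gs : Vec (I → V) l} → HasV Γ (fs ++ gs) → HasV Γ fs × HasV Γ gs
  splitV []       h = nilV , h
  splitV (f ∷ fs) h = let p , q = splitV fs (tailV h) in consV (headV h) p , q

  concatV : ∀ {m l i} {Γ : Vec (I → V) i} (ws : Vec (Vec (I → V) m) l) → HasV Γ (concat ws) → ∀ u → HasV Γ (lookup ws u)
  concatV (w ∷ ws) h zero    = proj₁ (splitV w h)
  concatV (w ∷ ws) h (suc u) = concatV ws (proj₂ (splitV w h)) u

  unconcatV : ∀ {m l i} {Γ : Vec (I → V) i} (ws : Vec (Vec (I → V) m) l) → (∀ u → HasV Γ (lookup ws u)) → HasV Γ (concat ws)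
  unconcatV []       h = nilV
  unconcatV (w ∷ ws) h = appendV (h zero) (unconcatV ws (λ u → h (suc u)))

  concat-⟨⟩ : ∀ {m l} (ws : Vec (Vec (I → V) m) l) x → concat ws ⟨ x ⟩ ≡ concat (map (_⟨ x ⟩) ws)
  concat-⟨⟩ ws x = Vecₚ.map-concat (λ f → f x) ws

Words : ℕ → ℕ → Set
Words r w = Vec (Vec Bool w) r

inputWords : ∀ {r w} → Vec (Vec (Words r w → Bool) w) r
inputWords = tabulate (λ i → block (λ x → lookup x i))

inputWords-⟨⟩ : ∀ {r w} (x : Words r w) → map (_⟨ x ⟩) inputWords ≡ x
inputWords-⟨⟩ x = trans (sym (Vecₚ.tabulate-∘ (_⟨ x ⟩) _)) (trans (Vecₚ.tabulate-cong (λ i → block-⟨⟩ (λ x → lookup x i) x)) (Vecₚ.tabulate∘lookup x))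

inputs : ∀ r w → Vec (Words r w → Bool) (1 + r * w)
inputs r w = F1 ∷ concat (inputWords {r} {w})

inputs-⟨⟩ : ∀ {r w} (x : Words r w) → inputs r w ⟨ x ⟩ ≡ true ∷ concat x
inputs-⟨⟩ x = cong (true ∷_) (trans (concat-⟨⟩ inputWords x) (cong concat (inputWords-⟨⟩ x)))

record WordFunction (r w w′ s : ℕ) (f : Vec ℕ r → ℕ) : Set where
  constructor wordFunction
  field
    result   : Vec (Words r w → Bool) w′
    program  : Computable opBool (inputs r w) s result
    computes : ∀ x → num (result ⟨ x ⟩) ≡ f (map num x)
open WordFunction public

-- Functions of numbers with polynomially many bits that have Boolean programs of polynomial size.
Easy : ∀ {r} → (ℕ → Vec ℕ r → ℕ) → Set
Easy {r} f = ∀ a → Σ ℕ λ b → Σ (ℕ → ℕ) λ s → Bounded s × (∀ n → WordFunction r (pw a n) (pw b n) (s n) (f n))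

-- The outputs are defined by running the code on the given words, because `result` consists of
-- functions of another type of inputs.
call : ∀ {r w w′ s f} → WordFunction r w w′ s f → ∀ {I : Set} {i} {Γ : Vec (I → Bool) i} (ws : Vec (Vec (I → Bool) w) r) →
  HasV Γ (concat ws) → Has Γ F1 → Σ (Vec (I → Bool) w′) λ cs → Computable opBool Γ s cs × (∀ x → num (cs ⟨ x ⟩) ≡ f (map num (map (_⟨ x ⟩) ws)))
call {r} {w} (wordFunction res (computable C sm cr) nm) {I} {Γ = Γ} ws hw h1 = cs ,
  C-mono sm (C-call C {gs = F1 ∷ concat ws} (consV h1 hw) (λ x → sym (block-⟨⟩ (λ x → run opBool C ((F1 ∷ concat ws) ⟨ x ⟩)) x))) ,
  λ x → trans (cong num (trans (block-⟨⟩ (λ x → run opBool C ((F1 ∷ concat ws) ⟨ x ⟩)) x)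
    (trans (cong (λ u → run opBool C (true ∷ u)) (concat-⟨⟩ ws x)) (trans (cong (run opBool C) (sym (inputs-⟨⟩ (map (_⟨ x ⟩) ws)))) (cr (map (_⟨ x ⟩) ws)))))) (nm (map (_⟨ x ⟩) ws))
  where
  cs : Vec (I → Bool) _
  cs = block (λ x → run opBool C ((F1 ∷ concat ws) ⟨ x ⟩))

easy-ext : ∀ {r} {f g : ℕ → Vec ℕ r → ℕ} → (∀ n v → f n v ≡ g n v) → Easy f → Easy g
easy-ext e ef a = let b , s , sB , W = ef a in b , s , sB , λ n →
  wordFunction (result (W n)) (program (W n)) (λ x → trans (computes (W n) x) (e n _))

2^-bound : ∀ {r w w′ s f} → WordFunction r w w′ s f → ∀ x → f (map num x) < 2 ^ w′
2^-bound W x = subst (_< _) (computes W x) (num<2^ (result W ⟨ x ⟩))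

lookup-map-num : ∀ {r w} (x : Words r w) i → num (lookup x i) ≡ lookup (map num x) i
lookup-map-num x i = sym (Vecₚ.lookup-map i num x)

easy-var : ∀ {r} (i : Fin r) → Easy (λ n v → lookup v i)
easy-var i a = a , (λ _ → 0) , Bounded-const 0 , λ n → wordFunction (lookup inputWords i)
  (C-ret (thereV (concatV inputWords allV i)))
  (λ x → trans (cong num (trans (sym (Vecₚ.lookup-map i (_⟨ x ⟩) inputWords)) (cong (λ u → lookup u i) (inputWords-⟨⟩ x)))) (lookup-map-num x i))

bits : ∀ w → ℕ → Vec Bool w
bits zero    c = []
bits (suc w) c = (c ℕ.% 2 ℕ.≡ᵇ 1) ∷ bits w (c ℕ./ 2)

num-bits : ∀ w c → c < 2 ^ w → num (bits w c) ≡ c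
num-bits zero    zero    h = refl
num-bits zero    (suc c) (s≤s ())
num-bits (suc w) c h = begin
  b2n (c ℕ.% 2 ℕ.≡ᵇ 1) + 2 * num (bits w (c ℕ./ 2)) ≡⟨ cong₂ (λ p q → p + 2 * q) (bit (c ℕ.% 2) (m%n<n c 2)) (num-bits w (c ℕ./ 2) (m<n*o⇒m/o<n (subst (c <_) (ℕₚ.*-comm 2 (2 ^ w)) h))) ⟩
  c ℕ.% 2 + 2 * (c ℕ./ 2) ≡⟨ cong (λ z → c ℕ.% 2 + z) (ℕₚ.*-comm 2 (c ℕ./ 2)) ⟩
  c ℕ.% 2 + (c ℕ./ 2) * 2 ≡⟨ sym (m≡m%n+[m/n]*n c 2) ⟩
  c ∎
  where
  open ≡-Reasoning
  bit : ∀ r → r < 2 → b2n (r ℕ.≡ᵇ 1) ≡ r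
  bit 0 _ = refl
  bit 1 _ = refl
  bit (suc (suc r)) (s≤s (s≤s ()))

constFs : ∀ {I : Set} {w} → Vec Bool w → Vec (I → Bool) w
constFs []       = []
constFs (b ∷ bs) = const b ∷ constFs bs

constFs-⟨⟩ : ∀ {I : Set} {w} (bs : Vec Bool w) (x : I) → constFs bs ⟨ x ⟩ ≡ bs
constFs-⟨⟩ []       x = refl
constFs-⟨⟩ (b ∷ bs) x = cong (b ∷_) (constFs-⟨⟩ bs x)

constFs-has : ∀ {I : Set} {w i} {Γ : Vec (I → Bool) i} → Has Γ F0 → Has Γ F1 → (bs : Vec Bool w) → HasV Γ (constFs bs)
constFs-has z o []           = nilV
constFs-has z o (false ∷ bs) = consV z (constFs-has z o bs)
constFs-has z o (true ∷ bs)  = consV o (constFs-has z o bs)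

C-false : ∀ {I : Set} {i m s} {Γ : Vec (I → Bool) i} {fs : Vec (I → Bool) m} → Has Γ F1 → Computable opBool (F0 ∷ Γ) s fs → Computable opBool Γ (suc s) fs
C-false h p = C-step plus h h p

-- The constant may depend on n in any way: the Boolean programs need not be uniform in n.
easy-const : ∀ {r} e (c : ℕ → ℕ) → (∀ n → c n < 2 ^ pw e n) → Easy {r} (λ n v → c n)
easy-const e c c< a = e , (λ _ → 1) , Bounded-const 1 , λ n → wordFunction (constFs (bits (pw e n) (c n)))
  (C-false here (C-ret (constFs-has here (there here) (bits (pw e n) (c n)))))
  (λ x → trans (cong num (constFs-⟨⟩ (bits (pw e n) (c n)) x)) (num-bits (pw e n) (c n) (c< n)))

easy-lit : ∀ {r} c → Easy {r} (λ n v → c)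
easy-lit c = easy-const c (λ _ → c) (λ n → ℕₚ.<-trans (n<2^ c) (ℕₚ.^-monoʳ-< 2 (s≤s (s≤s z≤n)) (n<pw c n)))
  where
  n<2^ : ∀ c → c < 2 ^ c
  n<2^ zero    = s≤s z≤n
  n<2^ (suc c) = ℕₚ.≤-trans (ℕₚ.+-mono-≤ (ℕₚ.m^n>0 2 c) (n<2^ c)) (ℕₚ.≤-reflexive (cong (λ z → 2 ^ c + z) (sym (ℕₚ.+-identityʳ _))))

pw-sum : ∀ b b′ n → pw b n + pw b′ n ≤ pw (suc (b + b′)) n
pw-sum b b′ n = proj₂ (Bounded-+ (Bounded-pw b) (Bounded-pw b′)) n

easy-weaken : ∀ {r} {f : ℕ → Vec ℕ r → ℕ} → Easy f → Easy {suc r} (λ n v → f n (tail v))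
easy-weaken {r} {f} ef a = let b , s , sB , W = ef a in b , s , sB , λ n →
  let ws = tail (inputWords {suc r} {pw a n})
      cs , csC , csN = call (W n) ws (thereV (proj₂ (splitV (head (inputWords {suc r} {pw a n})) allV))) here
  in wordFunction cs csC (λ { (y ∷ x) → trans (csN (y ∷ x)) (cong (f n) (cong (map num) (Vecₚ.∷-injectiveʳ (inputWords-⟨⟩ (y ∷ x))))) })

module _ {r} {f g : ℕ → Vec ℕ r → ℕ} (ef : Easy f) (eg : Easy g) where

  -- Both arguments are extended to a common width. The gadget may still use that they come from
  -- shorter words, which is how overflow is excluded.
  easy-pair : (h : ℕ → ℕ → ℕ) → (∀ b b′ → Σ ℕ λ c → Σ (ℕ → ℕ) λ s → Bounded s × (∀ n {I : Set} {i} {Γ : Vec (I → Bool) i} →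
      (as bs : Vec (I → Bool) (pw (suc (b + b′)) n)) → HasV Γ as → HasV Γ bs → Has Γ F0 → Has Γ F1 →
      Σ (Vec (I → Bool) (pw c n)) λ cs → Computable opBool Γ (s n) cs ×
        (∀ x → num (as ⟨ x ⟩) < 2 ^ pw b n → num (bs ⟨ x ⟩) < 2 ^ pw b′ n → num (cs ⟨ x ⟩) ≡ h (num (as ⟨ x ⟩)) (num (bs ⟨ x ⟩))))) →
    Easy (λ n v → h (f n v) (g n v))
  easy-pair h gad a =
    let b , s , sB , W = ef a
        b′ , s′ , sB′ , W′ = eg a
        c , t , tB , G = gad b b′
    in c , (λ n → suc (s n + (s′ n + t n))) , Bounded-+ (Bounded-const 1) (Bounded-+ sB (Bounded-+ sB′ tB)) , λ n →
      let as = result (W n)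
          bs = result (W′ n)
          T′ = pw (suc (b + b′)) n
          cs , csC , csN = G n {Γ = bs ++ as ++ F0 ∷ inputs r (pw a n)} (resize T′ as) (resize T′ bs)
                  (resize-has T′ (skip bs (skip as here)) (skipV bs (hereV as))) (resize-has T′ (skip bs (skip as here)) (hereV bs)) (skip bs (skip as here)) (skip bs (skip as (there here)))
          big : pw b n ≤ T′
          big = ℕₚ.≤-trans (ℕₚ.m≤m+n _ _) (pw-sum b b′ n)
          big′ : pw b′ n ≤ T′
          big′ = ℕₚ.≤-trans (ℕₚ.m≤n+m _ _) (pw-sum b b′ n)
          ra : ∀ x → num (resize T′ as ⟨ x ⟩) ≡ num (as ⟨ x ⟩)
          ra x = resize-num T′ as x (ℕₚ.<-≤-trans (num<2^ (as ⟨ x ⟩)) (ℕₚ.^-monoʳ-≤ 2 big))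
          rb : ∀ x → num (resize T′ bs ⟨ x ⟩) ≡ num (bs ⟨ x ⟩)
          rb x = resize-num T′ bs x (ℕₚ.<-≤-trans (num<2^ (bs ⟨ x ⟩)) (ℕₚ.^-monoʳ-≤ 2 big′))
      in wordFunction cs (C-false here (C-let (C-move (thereV allV) (program (W n))) (C-let (C-move (skipV as (thereV allV)) (program (W′ n))) csC)))
        (λ x → trans (csN x (subst (_< _) (sym (ra x)) (num<2^ (as ⟨ x ⟩))) (subst (_< _) (sym (rb x)) (num<2^ (bs ⟨ x ⟩))))
          (cong₂ h (trans (ra x) (computes (W n) x)) (trans (rb x) (computes (W′ n) x))))

  -- The word operation is correct only modulo a power of two. The bound on `h a b` makes the result
  -- its own residue.
  easy-arith : ∀ o (h : ℕ → ℕ → ℕ) → (∀ a b → opVal o (+ a) (+ b) ≡ + h a b) → (∀ {u v a b} → 1 ≤ u → 1 ≤ v → a < 2 ^ u → b < 2 ^ v → h a b < 2 ^ (u + v)) →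
    Easy (λ n v → h (f n v) (g n v))
  easy-arith o h exact small = easy-pair h λ b b′ → suc (b + b′) , (λ n → arithSize (pw (suc (b + b′)) n)) ,
    arithSize-bounded (suc (b + b′)) ,
    λ n as bs ha hb hz ho → arithFs o as bs , C-arith o hz ho ha hb ,
      λ x a< b< → <-unique (num<2^ (arithFs o as bs ⟨ x ⟩)) (ℕₚ.<-≤-trans (small (1≤pw b n) (1≤pw b′ n) a< b<) (ℕₚ.^-monoʳ-≤ 2 (pw-sum b b′ n)))
        (≋-trans (arithFs-num o as bs x) (≋-reflexive (exact _ _)))

  abstract
   easy-+ : Easy (λ n v → f n v + g n v)
   easy-+ = easy-arith plus _+_ (λ a b → refl) λ {u} {v} {a} {b} 1≤u 1≤v a< b< → begin-strict
     a + b                 <⟨ ℕₚ.+-mono-< a< b< ⟩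
     2 ^ u + 2 ^ v         ≤⟨ lem (2 ^ u) (2 ^ v) (ℕₚ.^-monoʳ-≤ 2 1≤u) (ℕₚ.^-monoʳ-≤ 2 1≤v) ⟩
     2 ^ u * 2 ^ v         ≡⟨ sym (ℕₚ.^-distribˡ-+-* 2 u v) ⟩
     2 ^ (u + v)           ∎
     where
     open ℕₚ.≤-Reasoning
     lem : ∀ a b → 2 ≤ a → 2 ≤ b → a + b ≤ a * b
     lem (suc (suc a)) (suc (suc b)) _ _ = ℕₚ.≤-trans (ℕₚ.m≤m+n _ (a * b + a + b)) (ℕₚ.≤-reflexive (l a b))
       where
       l : ∀ a b → 2 + a + (2 + b) + (a * b + a + b) ≡ (2 + a) * (2 + b)
       l = ℕSolver.solve-∀
     lem (suc zero) _ (s≤s ()) _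
     lem (suc (suc a)) (suc zero) _ (s≤s ())

   easy-* : Easy (λ n v → f n v * g n v)
   easy-* = easy-arith times _*_ (λ a b → sym (ℤₚ.pos-* a b)) λ {u} {v} _ _ a< b< →
     ℕₚ.<-≤-trans (ℕₚ.*-mono-< a< b<) (ℕₚ.≤-reflexive (sym (ℕₚ.^-distribˡ-+-* 2 u v)))

   easy-< : Easy (λ n v → b2n (f n v ℕ.<ᵇ g n v))
   easy-< = easy-pair (λ a b → b2n (a ℕ.<ᵇ b)) λ b b′ → 0 , (λ n → pw (suc (b + b′)) n * 4) , Bounded-* (Bounded-pw (suc (b + b′))) (Bounded-const 4) ,
     λ n as bs ha hb hz ho → (ltFs F0 as bs ∷ []) , C-lt hz ha hb ,
       λ x _ _ → trans (ℕₚ.+-identityʳ _) (cong b2n (trans (ltFs-num F0 as bs x) (cong (num (as ⟨ x ⟩) ℕ.<ᵇ_) (ℕₚ.+-identityʳ (num (bs ⟨ x ⟩))))))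

-- Closure under exponential sums

Σ< : ℕ → (ℕ → ℕ) → ℕ
Σ< zero    h = 0
Σ< (suc k) h = h k + Σ< k h

Σ<-cong : ∀ k {h h′} → (∀ z → z < k → h z ≡ h′ z) → Σ< k h ≡ Σ< k h′
Σ<-cong zero    e = refl
Σ<-cong (suc k) e = cong₂ _+_ (e k ℕₚ.≤-refl) (Σ<-cong k (λ z z<k → e z (ℕₚ.m<n⇒m<1+n z<k)))

Σ<-even-odd : ∀ k h → Σ< (2 * k) h ≡ Σ< k (λ y → h (2 * y)) + Σ< k (λ y → h (1 + 2 * y))
Σ<-even-odd zero    h = refl
Σ<-even-odd (suc k) h = trans (cong (λ m → Σ< m h) (l k)) (trans (cong (λ z → h (1 + 2 * k) + (h (2 * k) + z)) (Σ<-even-odd k h))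
  (l2 (h (1 + 2 * k)) (h (2 * k)) (Σ< k (λ y → h (2 * y))) _))
  where
  l : ∀ k → 2 * suc k ≡ suc (suc (2 * k))
  l = ℕSolver.solve-∀
  l2 : ∀ a b c d → a + (b + (c + d)) ≡ b + c + (a + d)
  l2 = ℕSolver.solve-∀

cube-Σ< : ∀ w h → cube _+_ w (λ e → h (num e)) ≡ Σ< (2 ^ w) h
cube-Σ< zero    h = sym (ℕₚ.+-identityʳ _)
cube-Σ< (suc w) h = trans (cong₂ _+_ (cube-Σ< w (λ y → h (2 * y))) (cube-Σ< w (λ y → h (1 + 2 * y)))) (sym (Σ<-even-odd (2 ^ w) h))

-- Turns an upper limit that depends on the data into an indicator factor, so that the sum runs over
-- a full cube.
Σ<-restrict : ∀ K g h → g ≤ K → Σ< K (λ z → b2n (z ℕ.<ᵇ g) * h z) ≡ Σ< g h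
Σ<-restrict zero    zero    h z≤n = refl
Σ<-restrict (suc K) g h g≤1+K with ℕₚ.m≤n⇒m<n∨m≡n g≤1+K
... | inj₂ refl = Σ<-cong (suc K) (λ z z<g → trans (cong (λ b → b2n b * h z) (<ᵇ-true z<g)) (ℕₚ.+-identityʳ _))
  where
  <ᵇ-true : ∀ {a b} → a < b → (a ℕ.<ᵇ b) ≡ true
  <ᵇ-true {a} {b} p with a ℕ.<ᵇ b in q
  ... | true  = refl
  ... | false = ⊥-elim (subst T q (ℕₚ.<⇒<ᵇ p))
... | inj₁ (s≤s g≤K) = trans (cong (λ b → b2n b * h K + Σ< K (λ z → b2n (z ℕ.<ᵇ g) * h z)) <ᵇ-false) (Σ<-restrict K g h g≤K)
  where
  <ᵇ-false : (K ℕ.<ᵇ g) ≡ false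
  <ᵇ-false with K ℕ.<ᵇ g in q
  ... | false = refl
  ... | true  = contradiction (ℕₚ.<ᵇ⇒< K g (subst T (sym q) tt)) (ℕₚ.≤⇒≯ g≤K)

monomial-ones : ∀ {w} (e : Vec ℤ w) → monomial opVal ℤ.1ℤ (replicate w ℤ.1ℤ) e ≡ ℤ.1ℤ
monomial-ones []      = refl
monomial-ones (e ∷ es) rewrite monomial-ones es = lem e
  where
  lem : ∀ e → (ℤ.1ℤ ℤ.+ e ℤ.* (ℤ.1ℤ ℤ.- ℤ.1ℤ)) ℤ.* ℤ.1ℤ ≡ ℤ.1ℤ
  lem = ℤSolver.solve-∀

boolWord : ∀ {I : Set} t → (I → Bool) → Vec (I → Bool) t
boolWord t b = resize t (b ∷ [])

boolWord-num : ∀ {I : Set} {t} (b : I → Bool) x → 1 ≤ t → num (boolWord t b ⟨ x ⟩) ≡ b2n (b x)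
boolWord-num {t = t} b x 1≤t = trans (resize-num t (b ∷ []) x (ℕₚ.<-≤-trans (num<2^ (b x ∷ [])) (ℕₚ.^-monoʳ-≤ 2 1≤t))) (ℕₚ.+-identityʳ _)

-- The intermediate values of `D` may have exponentially many bits. Only the last t bits are kept,
-- which is compatible with the ring operations.
simulate-2^ : ∀ {I : Set} {i j} t → 1 ≤ t → (D : Code 1 i) {Γ : Vec (I → Bool) j} → Has Γ F1 → (bs : Vec (I → Bool) i) → HasV Γ bs →
  Σ (Vec (I → Bool) t) λ cs → Computable opBool Γ (suc (gateCount D * arithSize t)) cs ×
    (∀ x → + num (cs ⟨ x ⟩) ≋ head (run opVal D (map b2z (bs ⟨ x ⟩))) [ 2^ t ])
simulate-2^ {I} t 1≤t D {Γ} h1 bs hb =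
  let cs , csR , csC = simulate {w = t} opVal (λ x z u → + num u ≋ z [ 2^ t ]) (F1 ∷ F0 ∷ []) (arithSize t)
        (λ o {f} {f′} {as} {bs} ra rb → arithFs o as bs , (λ x → ≋-trans (arithFs-num o as bs x) (≋-opVal o (ra x) (rb x))) ,
          (λ hp ha hb → C-arith o (headV (tailV hp)) (headV hp) ha hb))
        D {F0 ∷ Γ} (consV (there h1) (consV here nilV)) (map (λ b x → b2z (b x)) bs) (map (boolWord t) bs)
        (λ u x → ≋-reflexive (trans (cong (λ w → + num (w ⟨ x ⟩)) (Vecₚ.lookup-map u (boolWord t) bs))
           (trans (cong +_ (boolWord-num {t = t} (lookup bs u) x 1≤t)) (trans (+b2n _) (sym (trans (Vecₚ.lookup-map u (λ f → f x) (map (λ b x → b2z (b x)) bs)) (cong (λ f → f x) (Vecₚ.lookup-map u (λ b x → b2z (b x)) bs))))))))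
        (λ u → subst (HasV _) (sym (Vecₚ.lookup-map u (boolWord t) bs)) (resize-has t here (consV (there (lookupV hb u)) nilV)))
  in cs , C-false h1 csC , λ x → ≋-trans (csR x) (≋-reflexive (cong (λ v → head (run opVal D v)) (trans (sym (Vecₚ.map-∘ (λ f → f x) (λ b x → b2z (b x)) bs)) (Vecₚ.map-∘ b2z (λ f → f x) bs))))

module _ (collapse : Collapse) where

  -- The summand, cut off at `g` by an indicator, is a Boolean program on the bits of z and v.
  -- `sumCodes` with all weights 1 gives an arithmetic program for its sum over all words z, and
  -- this is run modulo a power of two above the sum, which turns it back into a Boolean program.
  easy-Σ-construction : ∀ {r} {g : ℕ → Vec ℕ r → ℕ} {f : ℕ → Vec ℕ (suc r) → ℕ} → Easy g → Easy f → Easy (λ n v → Σ< (g n v) (λ z → f n (z ∷ v)))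
  easy-Σ-construction {r} {g} {f} eg ef a = T′ , (λ n → suc (gateCount (D n) * arithSize (pw T′ n))) ,
      Bounded-+ (Bounded-const 1) (Bounded-* DB (arithSize-bounded T′)) ,
      word
    where
    b B : ℕ
    b = proj₁ (eg a)
    B = a + b
    Wg : ∀ n → _
    Wg = proj₂ (proj₂ (proj₂ (eg a)))
    f′ : ℕ → Vec ℕ (suc r) → ℕ
    f′ n v = b2n (lookup v zero ℕ.<ᵇ g n (tail v)) * f n v
    abstract
     ef′ : Easy f′
     ef′ = easy-* (easy-< (easy-var zero) (easy-weaken eg)) ef
    b′ : ℕ
    b′ = proj₁ (ef′ B)
    s : ℕ → ℕ
    s = proj₁ (proj₂ (ef′ B))
    sB : Bounded s
    sB = proj₁ (proj₂ (proj₂ (ef′ B)))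
    Wf : ∀ n → WordFunction (suc r) (pw B n) (pw b′ n) (s n) (f′ n)
    Wf = proj₂ (proj₂ (proj₂ (ef′ B)))
    In : ℕ → Set
    In n = Vec Bool (pw b n) × Words r (pw a n)
    zWord : ∀ n → Vec (In n → Bool) (pw b n)
    zWord n = block proj₁
    vWords : ∀ n → Vec (Vec (In n → Bool) (pw a n)) r
    vWords n = tabulate (λ i → block (λ x → lookup (proj₂ x) i))
    vWords-⟨⟩ : ∀ n x → map (_⟨ x ⟩) (vWords n) ≡ proj₂ x
    vWords-⟨⟩ n x = trans (sym (Vecₚ.tabulate-∘ (_⟨ x ⟩) _)) (trans (Vecₚ.tabulate-cong (λ i → block-⟨⟩ (λ x → lookup (proj₂ x) i) x)) (Vecₚ.tabulate∘lookup (proj₂ x)))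
    ctx : ∀ n → Vec (In n → Bool) (1 + (pw b n + r * pw a n))
    ctx n = F1 ∷ zWord n ++ concat (vWords n)
    ctx-⟨⟩ : ∀ n x → ctx n ⟨ x ⟩ ≡ true ∷ proj₁ x ++ concat (proj₂ x)
    ctx-⟨⟩ n x = cong (true ∷_) (trans (Vecₚ.map-++ _ (zWord n) _) (cong₂ _++_ (block-⟨⟩ proj₁ x) (trans (concat-⟨⟩ (vWords n) x) (cong concat (vWords-⟨⟩ n x)))))
    args : ∀ n → Vec (Vec (In n → Bool) (pw B n)) (suc r)
    args n = resize (pw B n) (zWord n) ∷ map (resize (pw B n)) (vWords n)
    body : ∀ n → Σ (Vec (In n → Bool) (pw b′ n)) λ cs → Computable opBool (F0 ∷ ctx n) (s n) cs × (∀ x → num (cs ⟨ x ⟩) ≡ f′ n (map num (map (_⟨ x ⟩) (args n))))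
    body n = call (Wf n) (args n) (unconcatV (args n) λ
      { zero → resize-has (pw B n) here (thereV (thereV (proj₁ (splitV (zWord n) allV))))
      ; (suc u) → subst (HasV _) (sym (Vecₚ.lookup-map u (resize (pw B n)) (vWords n)))
          (resize-has (pw B n) here (thereV (thereV (concatV (vWords n) (proj₂ (splitV (zWord n) allV)) u)))) }) (there here)
    args-num : ∀ n x → map num (map (_⟨ x ⟩) (args n)) ≡ num (proj₁ x) ∷ map num (proj₂ x)
    args-num n x = cong₂ _∷_ (trans (resize-num (pw B n) (zWord n) x (ℕₚ.<-≤-trans (num<2^ (zWord n ⟨ x ⟩)) (ℕₚ.^-monoʳ-≤ 2 (pw-mono n (ℕₚ.m≤n+m b a))))) (cong num (block-⟨⟩ proj₁ x)))
      (trans (sym (Vecₚ.map-∘ num (_⟨ x ⟩) _)) (trans (sym (Vecₚ.map-∘ (λ u → num (u ⟨ x ⟩)) (resize (pw B n)) (vWords n)))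
        (trans (Vecₚ.map-cong (λ w → resize-num (pw B n) w x (ℕₚ.<-≤-trans (num<2^ (w ⟨ x ⟩)) (ℕₚ.^-monoʳ-≤ 2 (pw-mono n (ℕₚ.m≤m+n a b))))) (vWords n))
          (trans (Vecₚ.map-∘ num (_⟨ x ⟩) (vWords n)) (cong (map num) (vWords-⟨⟩ n x))))))
    abstract
     prog : ∀ n → Computable opBool (ctx n) (suc (s n)) (proj₁ (body n))
     prog n = C-false here (proj₁ (proj₂ (body n)))
    C : ∀ n → Code (pw b′ n) (1 + (pw b n + r * pw a n))
    C n = code (prog n)
    C-value : ∀ n e v → num (run opBool (C n) (true ∷ e ++ concat v)) ≡ f′ n (num e ∷ map num v)
    C-value n e v = begin
      num (run opBool (C n) (true ∷ e ++ concat v)) ≡⟨ cong (λ u → num (run opBool (C n) u)) (sym (ctx-⟨⟩ n (e , v))) ⟩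
      num (run opBool (C n) (ctx n ⟨ e , v ⟩))      ≡⟨ cong num (correct (prog n) (e , v)) ⟩
      num (proj₁ (body n) ⟨ e , v ⟩)                ≡⟨ proj₂ (proj₂ (body n)) (e , v) ⟩
      f′ n (map num (map (_⟨ e , v ⟩) (args n)))    ≡⟨ cong (f′ n) (args-num n (e , v)) ⟩
      f′ n (num e ∷ map num v)                      ∎
      where open ≡-Reasoning
    SC : Σ (∀ n → Code 1 (1 + (pw b n + r * pw a n))) λ D → Bounded (λ n → gateCount (D n)) ×
      (∀ n Z z → run opVal (D n) (ℤ.1ℤ ∷ Z ++ map b2z z) ≡ weightedSum {pw b n} (C n) Z z ∷ [])
    SC = sumCodes collapse b {λ n → r * pw a n} {pw b′} (Bounded-* (Bounded-const r) (Bounded-pw a)) (Bounded-pw b′) C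
      (Bounded-≤ (λ n → small (prog n)) (Bounded-+ (Bounded-const 1) sB))
    D : ∀ n → Code 1 (1 + (pw b n + r * pw a n))
    D = proj₁ SC
    DB : Bounded (λ n → gateCount (D n))
    DB = proj₁ (proj₂ SC)
    -- There are 2^(pw b n) summands, each below 2^(pw b′ n). Hence the sum has at most pw b n + pw
    -- b′ n bits, and nothing is lost modulo 2^(pw T′ n).
    T′ : ℕ
    T′ = suc (b + b′)
    total : ∀ n v → weightedSum {pw b n} (C n) (replicate _ ℤ.1ℤ) (concat v) ≡ + Σ< (g n (map num v)) (λ z → f n (z ∷ map num v))
    total n v = begin
      weightedSum {pw b n} (C n) (replicate _ ℤ.1ℤ) (concat v)
        ≡⟨ cube-cong ℤ._+_ (pw b n) (λ e → trans (cong₂ ℤ._*_ (monomial-ones (map b2z e)) (cong +_ (C-value n e v))) (ℤₚ.*-identityˡ _)) ⟩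
      cube ℤ._+_ (pw b n) (λ e → + f′ n (num e ∷ map num v))
        ≡⟨ sym (cube-hom _+_ ℤ._+_ +_ (λ _ _ → refl) (pw b n) _) ⟩
      + cube _+_ (pw b n) (λ e → f′ n (num e ∷ map num v))
        ≡⟨ cong +_ (cube-Σ< (pw b n) (λ z → f′ n (z ∷ map num v))) ⟩
      + Σ< (2 ^ pw b n) (λ z → f′ n (z ∷ map num v))
        ≡⟨ cong +_ (Σ<-restrict (2 ^ pw b n) (g n (map num v)) (λ z → f n (z ∷ map num v)) (ℕₚ.<⇒≤ (2^-bound (Wg n) v))) ⟩
      + Σ< (g n (map num v)) (λ z → f n (z ∷ map num v)) ∎
      where open ≡-Reasoning
    total< : ∀ n v → Σ< (g n (map num v)) (λ z → f n (z ∷ map num v)) < 2 ^ pw T′ n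
    total< n v = begin-strict
      Σ< (g n (map num v)) (λ z → f n (z ∷ map num v))
        ≡⟨ sym (Σ<-restrict (2 ^ pw b n) (g n (map num v)) (λ z → f n (z ∷ map num v)) (ℕₚ.<⇒≤ (2^-bound (Wg n) v))) ⟩
      Σ< (2 ^ pw b n) (λ z → f′ n (z ∷ map num v))
        ≡⟨ sym (cube-Σ< (pw b n) (λ z → f′ n (z ∷ map num v))) ⟩
      cube _+_ (pw b n) (λ e → f′ n (num e ∷ map num v))
        <⟨ cube-< (pw b n) (λ e → subst (_< 2 ^ pw b′ n) (C-value n e v) (num<2^ {pw b′ n} (run opBool (C n) (true ∷ e ++ concat v)))) ⟩
      2 ^ pw b n * 2 ^ pw b′ n
        ≡⟨ sym (ℕₚ.^-distribˡ-+-* 2 (pw b n) (pw b′ n)) ⟩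
      2 ^ (pw b n + pw b′ n)
        ≤⟨ ℕₚ.^-monoʳ-≤ 2 (pw-sum b b′ n) ⟩
      2 ^ pw T′ n ∎
      where
      open ℕₚ.≤-Reasoning
      cube-< : ∀ w {h : Vec Bool w → ℕ} {K} → (∀ e → h e < K) → cube _+_ w h < 2 ^ w * K
      cube-< zero    {h} {K} p = subst (h [] <_) (sym (ℕₚ.+-identityʳ K)) (p [])
      cube-< (suc w) {h} {K} p = ℕₚ.<-≤-trans (ℕₚ.+-mono-< (cube-< w (λ e → p (false ∷ e))) (cube-< w (λ e → p (true ∷ e))))
        (ℕₚ.≤-reflexive (l (2 ^ w) K))
        where
        l : ∀ x K → x * K + x * K ≡ (2 * x) * K
        l = ℕSolver.solve-∀
    word : ∀ n → WordFunction r (pw a n) (pw T′ n) _ (λ v → Σ< (g n v) (λ z → f n (z ∷ v)))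
    word n =
      let ws = inputWords {r} {pw a n}
          bs = F1 ∷ replicate (pw b n) F1 ++ concat ws
          cs , csC , csN = simulate-2^ (pw T′ n) (1≤pw T′ n) (D n) here bs (consV here (appendV (replicate-has (pw b n) here) (thereV allV)))
      in wordFunction cs csC λ x → <-unique (num<2^ (cs ⟨ x ⟩)) (total< n x) (≋-trans (csN x) (≋-reflexive (trans
        (cong (λ u → head (run opVal (D n) (ℤ.1ℤ ∷ u))) (input n x)) (trans (cong head (proj₂ (proj₂ SC) n (replicate _ ℤ.1ℤ) (concat x))) (total n x)))))
      where
      input : ∀ n (x : Words r (pw a n)) → map b2z ((replicate (pw b n) F1 ++ concat (inputWords {r} {pw a n})) ⟨ x ⟩) ≡ replicate (pw b n) ℤ.1ℤ ++ map b2z (concat x)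
      input n x = trans (cong (map b2z) (Vecₚ.map-++ _ (replicate (pw b n) F1) _)) (trans (Vecₚ.map-++ b2z (replicate (pw b n) F1 ⟨ x ⟩) _)
        (cong₂ _++_ (trans (cong (map b2z) (Vecₚ.map-replicate _ F1 (pw b n))) (Vecₚ.map-replicate b2z true (pw b n)))
          (cong (map b2z) (trans (concat-⟨⟩ inputWords x) (cong concat (inputWords-⟨⟩ x))))))

  abstract
    easy-Σ : ∀ {r} {g : ℕ → Vec ℕ r → ℕ} {f : ℕ → Vec ℕ (suc r) → ℕ} → Easy g → Easy f → Easy (λ n v → Σ< (g n v) (λ z → f n (z ∷ v)))
    easy-Σ = easy-Σ-construction

-- Subtraction, division and powers modulo a number

lt le eq : ℕ → ℕ → ℕ
lt a b = b2n (a ℕ.<ᵇ b)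
le a b = lt a (suc b)
eq a b = le a b * le b a

lt-yes : ∀ {a b} → a < b → lt a b ≡ 1
lt-yes {a} {b} p with a ℕ.<ᵇ b in q
... | true  = refl
... | false = ⊥-elim (subst T q (ℕₚ.<⇒<ᵇ p))

lt-no : ∀ {a b} → b ≤ a → lt a b ≡ 0
lt-no {a} {b} p with a ℕ.<ᵇ b in q
... | false = refl
... | true  = contradiction (ℕₚ.<ᵇ⇒< a b (subst T (sym q) tt)) (ℕₚ.≤⇒≯ p)

eq-yes : ∀ {a b} → a ≡ b → eq a b ≡ 1
eq-yes {a} refl = cong (λ z → z * z) (lt-yes (ℕₚ.n<1+n a))

eq-no : ∀ {a b} → a ≢ b → eq a b ≡ 0
eq-no {a} {b} a≢b with ℕₚ.<-cmp a b
... | Relation.Binary.tri< a<b _ _ = trans (cong (le a b *_) (lt-no a<b)) (ℕₚ.*-zeroʳ (le a b))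
... | Relation.Binary.tri≈ _ a≡b _ = contradiction a≡b a≢b
... | Relation.Binary.tri> _ _ b<a = cong (_* le b a) (lt-no b<a)

-- Subtraction is a count, the size of the interval from y to x, and thereby an exponential sum of
-- comparisons.
Σ<-le : ∀ x y → Σ< x (λ z → le y z) ≡ x ∸ y
Σ<-le zero    y = sym (ℕₚ.0∸n≡0 y)
Σ<-le (suc x) y with ℕₚ.≤-total y x
... | inj₁ y≤x = trans (cong₂ _+_ (lt-yes (s≤s y≤x)) (Σ<-le x y)) (sym (ℕₚ.+-∸-assoc 1 y≤x))
... | inj₂ x≤y with ℕₚ.m≤n⇒m<n∨m≡n x≤y
...   | inj₁ x<y = trans (cong₂ _+_ (lt-no x<y) (trans (Σ<-le x y) (ℕₚ.m≤n⇒m∸n≡0 x≤y))) (sym (ℕₚ.m≤n⇒m∸n≡0 x<y))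
...   | inj₂ refl = trans (cong₂ _+_ (lt-yes (ℕₚ.n<1+n x)) (Σ<-le x x)) (sym (ℕₚ.+-∸-assoc 1 (ℕₚ.≤-refl {x})))

-- For divisor 0 the quotient is what the count in `Σ<-quo` yields, where every z passes the test.
-- The remainder is then set to 0 by the factor `lt 0 y` in `rem-quo`.
quo rem : ℕ → ℕ → ℕ
quo x zero    = x
quo x (suc y) = x ℕ./ suc y
rem x zero    = 0
rem x (suc y) = x ℕ.% suc y

Σ<-one : ∀ k → Σ< k (λ _ → 1) ≡ k
Σ<-one zero    = refl
Σ<-one (suc k) = cong suc (Σ<-one k)

Σ<-quo : ∀ x y → Σ< x (λ z → le (suc z * y) x) ≡ quo x y
Σ<-quo x zero = trans (Σ<-cong x (λ z _ → cong (λ t → le t x) (ℕₚ.*-zeroʳ z))) (Σ<-one x)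
Σ<-quo x y@(suc _) = trans (Σ<-cong x (λ z _ → trans (cong b2n (<ᵇ-cong (to z) (from z))) (sym (ℕₚ.*-identityʳ _))))
  (trans (Σ<-restrict x (x ℕ./ y) (λ _ → 1) (m/n≤m x y)) (Σ<-one _))
  where
  to : ∀ z → suc z * y < suc x → z < x ℕ./ y
  to z (s≤s h) = subst (_≤ x ℕ./ y) (m*n/n≡m (suc z) y) (/-monoˡ-≤ y h)
  from : ∀ z → z < x ℕ./ y → suc z * y < suc x
  from z h = s≤s (ℕₚ.≤-trans (ℕₚ.*-monoˡ-≤ y h) (m/n*n≤m x y))

rem-quo : ∀ x y → (x ∸ y * quo x y) * lt 0 y ≡ rem x y
rem-quo x zero    = ℕₚ.*-zeroʳ x
rem-quo x y@(suc _) = trans (ℕₚ.*-identityʳ _) (begin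
  x ∸ y * (x ℕ./ y)                         ≡⟨ cong₂ _∸_ (m≡m%n+[m/n]*n x y) (ℕₚ.*-comm y (x ℕ./ y)) ⟩
  x ℕ.% y + (x ℕ./ y) * y ∸ (x ℕ./ y) * y   ≡⟨ ℕₚ.m+n∸n≡m _ ((x ℕ./ y) * y) ⟩
  x ℕ.% y ∎)
  where open ≡-Reasoning

rem-≤ : ∀ x y → rem x y ≤ y
rem-≤ x zero    = z≤n
rem-≤ x (suc y) = ℕₚ.<⇒≤ (m%n<n x (suc y))

rem-< : ∀ x {y} → 1 ≤ y → rem x y < y
rem-< x {suc y} _ = m%n<n x (suc y)

rem-≋ : ∀ x {y} → 1 ≤ y → + rem x y ≋ + x [ + y ]
rem-≋ x {suc y} _ = ≋-sym (cong-by (+ (x ℕ./ suc y)) (trans (cong +_ (m≡m%n+[m/n]*n x (suc y))) (cong (λ z → + (x ℕ.% suc y) ℤ.+ z) (ℤₚ.pos-* (x ℕ./ suc y) (suc y)))))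

zmod : ℤ → ℕ → ℕ
zmod z zero    = 0
zmod z (suc p) = z %ℕ suc p

zmod-< : ∀ z {p} → 1 ≤ p → zmod z p < p
zmod-< z {suc p} _ = n%ℕd<d z (suc p)

zmod-≋ : ∀ z {p} → 1 ≤ p → + zmod z p ≋ z [ + p ]
zmod-≋ z {suc p} _ = ≋-sym (cong-by (z /ℕ suc p) (a≡a%ℕn+[a/ℕn]*n z (suc p)))

rem-zmod : ∀ x z p → (1 ≤ p → + x ≋ z [ + p ]) → rem x p ≡ zmod z p
rem-zmod x z zero    h = refl
rem-zmod x z (suc p) h = <-unique (rem-< x (s≤s z≤n)) (zmod-< z {suc p} (s≤s z≤n))
  (≋-trans (rem-≋ x {suc p} (s≤s z≤n)) (≋-trans (h (s≤s z≤n)) (≋-sym (zmod-≋ z (s≤s z≤n)))))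

module _ {r} {f g : ℕ → Vec ℕ r → ℕ} (ef : Easy f) (eg : Easy g) where abstract

  easy-lt : Easy (λ n v → lt (f n v) (g n v))
  easy-lt = easy-< ef eg

  easy-le : Easy (λ n v → le (f n v) (g n v))
  easy-le = easy-ext (λ n v → cong (λ z → lt (f n v) z) (ℕₚ.+-comm (g n v) 1)) (easy-< ef (easy-+ eg (easy-lit 1)))

module _ {r} {f g : ℕ → Vec ℕ r → ℕ} (ef : Easy f) (eg : Easy g) where abstract

  easy-eq : Easy (λ n v → eq (f n v) (g n v))
  easy-eq = easy-* (easy-le ef eg) (easy-le eg ef)

easy-suc : ∀ {r} {f : ℕ → Vec ℕ r → ℕ} → Easy f → Easy (λ n v → suc (f n v))
easy-suc ef = easy-+ (easy-lit 1) ef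

v0 : ∀ {r} → Easy {suc r} (λ n v → head v)
v0 = easy-ext (λ { n (x ∷ v) → refl }) (easy-var zero)

-- The factor p - 1 stands for -1 modulo p, so that subtraction stays within the natural numbers.
modOp : Op → ℕ → ℕ → ℕ → ℕ
modOp plus  a b p = rem (a + b) p
modOp minus a b p = rem (a + (p ∸ 1) * b) p
modOp times a b p = rem (a * b) p

modOp-≤ : ∀ o a b p → modOp o a b p ≤ p
modOp-≤ plus  a b p = rem-≤ _ p
modOp-≤ minus a b p = rem-≤ _ p
modOp-≤ times a b p = rem-≤ _ p

modOp-≋ : ∀ o {a b z y p} → 1 ≤ p → + a ≋ z [ + p ] → + b ≋ y [ + p ] → + modOp o a b p ≋ opVal o z y [ + p ]
modOp-≋ plus  {a} {b} {p = p} 1≤p ha hb = ≋-trans (rem-≋ (a + b) 1≤p) (≋-+ ha hb)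
modOp-≋ times {a} {b} {p = p} 1≤p ha hb = ≋-trans (rem-≋ (a * b) 1≤p) (≋-trans (≋-reflexive (ℤₚ.pos-* a b)) (≋-* ha hb))
modOp-≋ minus {a} {b} {p = suc p} 1≤p ha hb = ≋-trans (rem-≋ (a + p * b) 1≤p)
  (≋-trans (cong-by (+ b) (trans (cong (λ z → + a ℤ.+ z) (ℤₚ.pos-* p b)) (lem (+ a) (+ b) (+ p)))) (≋-sub ha hb))
  where
  lem : ∀ a b p → a ℤ.+ p ℤ.* b ≡ a ℤ.- b ℤ.+ b ℤ.* (ℤ.1ℤ ℤ.+ p)
  lem = ℤSolver.solve-∀

C-power : ∀ {I : Set} {w i} {Γ : Vec (I → ℤ) i} {base : I → ℤ} {es : Vec (I → ℤ) w} → Has Γ (const ℤ.1ℤ) → Has Γ base → HasV Γ es →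
  Σ (I → ℤ) λ f → Computable opVal Γ (w * 5) (f ∷ []) × (∀ x B (e : Vec Bool w) → base x ≡ + B → es ⟨ x ⟩ ≡ map b2z e → f x ≡ + (B ^ num e))
C-power {es = []}     h1 hb he = const ℤ.1ℤ , C-wire h1 , λ { x B [] _ _ → refl }
C-power {w = suc w} {base = base} {es = d ∷ es} h1 hb he =
  let f , fC , fV = C-power {es = es} (there h1) here (thereV (tailV he))
  in _ , C-mono (ℕₚ.≤-reflexive (cong (λ z → 4 + z) (ℕₚ.+-comm (w * 5) 1)))
    (C-step times hb hb (C-op times (C-op plus (C-wire (there h1)) (C-op times (C-wire (there (headV he))) (C-op minus (C-wire (there hb)) (C-wire (there h1))))) fC)) ,
    λ { x B (b ∷ e) hB hE → value x B b e hB (Vecₚ.∷-injectiveˡ hE) (fV x (B * B) e (trans (cong₂ ℤ._*_ hB hB) (sym (ℤₚ.pos-* B B))) (Vecₚ.∷-injectiveʳ hE)) }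
  where
  select : ∀ b B → ℤ.1ℤ ℤ.+ b2z b ℤ.* (+ B ℤ.- ℤ.1ℤ) ≡ + (B ^ b2n b)
  select false B = refl
  select true  B = trans (lem (+ B)) (cong +_ (sym (ℕₚ.*-identityʳ B)))
    where
    lem : ∀ B → ℤ.1ℤ ℤ.+ ℤ.1ℤ ℤ.* (B ℤ.- ℤ.1ℤ) ≡ B
    lem = ℤSolver.solve-∀
  value : ∀ x B b {w} (e : Vec Bool w) {y} → base x ≡ + B → d x ≡ b2z b → y ≡ + ((B * B) ^ num e) →
    (ℤ.1ℤ ℤ.+ d x ℤ.* (base x ℤ.- ℤ.1ℤ)) ℤ.* y ≡ + (B ^ num (b ∷ e))
  value x B b e hB hd hy = begin
    (ℤ.1ℤ ℤ.+ d x ℤ.* (base x ℤ.- ℤ.1ℤ)) ℤ.* _ ≡⟨ cong₂ ℤ._*_ (trans (cong₂ (λ p q → ℤ.1ℤ ℤ.+ p ℤ.* (q ℤ.- ℤ.1ℤ)) hd hB) (select b B)) hy ⟩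
    + (B ^ b2n b) ℤ.* + ((B * B) ^ num e) ≡⟨ sym (ℤₚ.pos-* (B ^ b2n b) _) ⟩
    + (B ^ b2n b * (B * B) ^ num e) ≡⟨ cong (λ z → + (B ^ b2n b * z)) (trans (cong (_^ num e) (cong (B *_) (sym (ℕₚ.*-identityʳ B)))) (ℕₚ.^-*-assoc B 2 (num e))) ⟩
    + (B ^ b2n b * B ^ (2 * num e)) ≡⟨ cong +_ (sym (ℕₚ.^-distribˡ-+-* B (b2n b) (2 * num e))) ⟩
    + (B ^ (b2n b + 2 * num e)) ∎
    where open ≡-Reasoning

-- The power itself has exponentially many bits, but this arithmetic program has size linear in the
-- word length; it is only ever evaluated modulo another number.
powerCode : ∀ w → Σ (Code 1 (1 + (w + (w + 0)))) λ D → gateCount D ≤ (w * 2 + 1) + w * 5 ×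
  (∀ (b e : Vec Bool w) → run opVal D (ℤ.1ℤ ∷ map b2z (b ++ (e ++ []))) ≡ + (num b ^ num e) ∷ [])
powerCode w = code prog , small prog , value
  where
  In : Set
  In = Vec ℤ w × Vec ℤ w
  bs es : Vec (In → ℤ) w
  bs = block proj₁
  es = block proj₂
  Γ : Vec (In → ℤ) (1 + (w + (w + 0)))
  Γ = const ℤ.1ℤ ∷ bs ++ (es ++ [])
  Γ-⟨⟩ : ∀ b e → Γ ⟨ b , e ⟩ ≡ ℤ.1ℤ ∷ b ++ (e ++ [])
  Γ-⟨⟩ b e = cong (ℤ.1ℤ ∷_) (trans (Vecₚ.map-++ _ bs _) (cong₂ _++_ (block-⟨⟩ proj₁ (b , e)) (trans (Vecₚ.map-++ _ es []) (cong (_++ []) (block-⟨⟩ proj₂ (b , e))))))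
  hb : HasV Γ bs
  hb = thereV (hereV bs)
  he : HasV Γ es
  he = thereV (skipV bs (hereV es))
  base : In → ℤ
  base x = horner opVal ℤ.1ℤ (bs ⟨ x ⟩)
  P : Σ (In → ℤ) λ f → Computable opVal (base ∷ Γ) (w * 5) (f ∷ []) × (∀ x B (e : Vec Bool w) → base x ≡ + B → es ⟨ x ⟩ ≡ map b2z e → f x ≡ + (B ^ num e))
  P = C-power (there here) here (thereV he)
  prog : Computable opVal Γ ((w * 2 + 1) + w * 5) (proj₁ P ∷ [])
  prog = C-let (C-horner opVal ℤ.1ℤ here hb) (proj₁ (proj₂ P))
  value : ∀ b e → run opVal (code prog) (ℤ.1ℤ ∷ map b2z (b ++ (e ++ []))) ≡ + (num b ^ num e) ∷ []
  value b e = trans (cong (run opVal (code prog)) (trans (cong (ℤ.1ℤ ∷_) (trans (Vecₚ.map-++ b2z b _) (cong (map b2z b ++_) (Vecₚ.map-++ b2z e [])))) (sym (Γ-⟨⟩ (map b2z b) (map b2z e)))))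
    (trans (correct prog (map b2z b , map b2z e)) (cong (_∷ []) (proj₂ (proj₂ P) _ (num b) e
      (trans (cong (horner opVal ℤ.1ℤ) (block-⟨⟩ proj₁ (map b2z b , map b2z e))) (horner-Bool b)) (block-⟨⟩ proj₂ (map b2z b , map b2z e)))))

module _ (collapse : Collapse) where

  module _ {r} {f g : ℕ → Vec ℕ r → ℕ} (ef : Easy f) (eg : Easy g) where abstract

    easy-∸ : Easy (λ n v → f n v ∸ g n v)
    easy-∸ = easy-ext (λ n v → Σ<-le (f n v) (g n v)) (easy-Σ collapse ef (easy-le (easy-weaken eg) v0))

    easy-quo : Easy (λ n v → quo (f n v) (g n v))
    easy-quo = easy-ext (λ n v → Σ<-quo (f n v) (g n v)) (easy-Σ collapse ef (easy-le (easy-* (easy-suc v0) (easy-weaken eg)) (easy-weaken ef)))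

  module _ {r} {f g : ℕ → Vec ℕ r → ℕ} (ef : Easy f) (eg : Easy g) where abstract

    easy-rem : Easy (λ n v → rem (f n v) (g n v))
    easy-rem = easy-ext (λ n v → rem-quo (f n v) (g n v)) (easy-* (easy-∸ ef (easy-* eg (easy-quo ef eg))) (easy-lt (easy-lit 0) eg))

  abstract
    easy-modOp : ∀ o → Easy {3} (λ n v → modOp o (lookup v zero) (lookup v (suc zero)) (lookup v (suc (suc zero))))
    easy-modOp plus  = easy-rem (easy-+ (easy-var zero) (easy-var (suc zero))) (easy-var (suc (suc zero)))
    easy-modOp minus = easy-rem (easy-+ (easy-var zero) (easy-* (easy-∸ (easy-var (suc (suc zero))) (easy-lit 1)) (easy-var (suc zero)))) (easy-var (suc (suc zero)))
    easy-modOp times = easy-rem (easy-* (easy-var zero) (easy-var (suc zero))) (easy-var (suc (suc zero)))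

  module _ (e : ℕ) (D : ∀ a n → Code 1 (1 + 2 * pw (e + a) n)) (D-bounded : ∀ a → Bounded (λ n → gateCount (D a n)))
    (G : ℕ → ℕ → ℕ → ℤ) (D-value : ∀ a n (x y : Vec Bool (pw (e + a) n)) → run opVal (D a n) (ℤ.1ℤ ∷ map b2z (x ++ (y ++ []))) ≡ G n (num x) (num y) ∷ [])
    {r} {f g p : ℕ → Vec ℕ r → ℕ} (ef : Easy f) (eg : Easy g) (ep : Easy p) where

    -- Each gate of `D` is replaced by a Boolean program for the same operation modulo p. An integer
    -- of exponential length is thus usable through its residues as soon as a short arithmetic
    -- program computes it from the bits of the arguments. Reduced words never exceed p and so fit
    -- the width.
    easy-zmod-construction : Easy (λ n v → zmod (G n (f n v) (g n v)) (p n v))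
    easy-zmod-construction a = br , (λ n → suc (s1 n + (s2 n + (s3 n + (gateCount (D c n) * S n + sr n))))) ,
        Bounded-+ (Bounded-const 1) (Bounded-+ s1B (Bounded-+ s2B (Bounded-+ s3B (Bounded-+ (Bounded-* (D-bounded c) SB) srB)))) , word
      where
      b1 b2 b3 c cM : ℕ
      b1 = proj₁ (ef a)
      b2 = proj₁ (eg a)
      b3 = proj₁ (ep a)
      c = b1 + b2 + b3
      cM = e + c
      s1 s2 s3 : ℕ → ℕ
      s1 = proj₁ (proj₂ (ef a))
      s2 = proj₁ (proj₂ (eg a))
      s3 = proj₁ (proj₂ (ep a))
      s1B : Bounded s1
      s1B = proj₁ (proj₂ (proj₂ (ef a)))
      s2B : Bounded s2
      s2B = proj₁ (proj₂ (proj₂ (eg a)))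
      s3B : Bounded s3
      s3B = proj₁ (proj₂ (proj₂ (ep a)))
      W1 : ∀ n → WordFunction r (pw a n) (pw b1 n) (s1 n) (f n)
      W1 = proj₂ (proj₂ (proj₂ (ef a)))
      W2 : ∀ n → WordFunction r (pw a n) (pw b2 n) (s2 n) (g n)
      W2 = proj₂ (proj₂ (proj₂ (eg a)))
      W3 : ∀ n → WordFunction r (pw a n) (pw b3 n) (s3 n) (p n)
      W3 = proj₂ (proj₂ (proj₂ (ep a)))
      b1≤ : b1 ≤ cM
      b1≤ = ℕₚ.≤-trans (ℕₚ.≤-trans (ℕₚ.m≤m+n b1 b2) (ℕₚ.m≤m+n _ b3)) (ℕₚ.m≤n+m c e)
      b2≤ : b2 ≤ cM
      b2≤ = ℕₚ.≤-trans (ℕₚ.≤-trans (ℕₚ.m≤n+m b2 b1) (ℕₚ.m≤m+n _ b3)) (ℕₚ.m≤n+m c e)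
      b3≤ : b3 ≤ cM
      b3≤ = ℕₚ.≤-trans (ℕₚ.m≤n+m b3 _) (ℕₚ.m≤n+m c e)
      M : ∀ o → Σ ℕ λ b → Σ (ℕ → ℕ) λ s → Bounded s × (∀ n → WordFunction 3 (pw cM n) (pw b n) (s n) (λ v → modOp o (lookup v zero) (lookup v (suc zero)) (lookup v (suc (suc zero)))))
      M o = easy-modOp o cM
      size′ : Op → ℕ → ℕ
      size′ o = proj₁ (proj₂ (M o))
      S : ℕ → ℕ
      S n = size′ plus n + size′ minus n + size′ times n
      SB : Bounded S
      SB = Bounded-+ (Bounded-+ (proj₁ (proj₂ (proj₂ (M plus)))) (proj₁ (proj₂ (proj₂ (M minus))))) (proj₁ (proj₂ (proj₂ (M times))))
      size≤S : ∀ o n → size′ o n ≤ S n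
      size≤S plus  n = ℕₚ.≤-trans (ℕₚ.m≤m+n _ _) (ℕₚ.m≤m+n _ _)
      size≤S minus n = ℕₚ.≤-trans (ℕₚ.m≤n+m _ (size′ plus n)) (ℕₚ.m≤m+n _ _)
      size≤S times n = ℕₚ.m≤n+m _ _
      R : Σ ℕ λ b → Σ (ℕ → ℕ) λ s → Bounded s × (∀ n → WordFunction 2 (pw cM n) (pw b n) (s n) (λ v → rem (lookup v zero) (lookup v (suc zero))))
      R = easy-rem (easy-var zero) (easy-var (suc zero)) cM
      br : ℕ
      br = proj₁ R
      sr : ℕ → ℕ
      sr = proj₁ (proj₂ R)
      srB : Bounded sr
      srB = proj₁ (proj₂ (proj₂ R))
      module At (n : ℕ) where
        w : ℕ
        w = pw cM n
        In : Set
        In = Words r (pw a n)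
        as : Vec (In → Bool) (pw b1 n)
        as = result (W1 n)
        bs : Vec (In → Bool) (pw b2 n)
        bs = result (W2 n)
        ps : Vec (In → Bool) (pw b3 n)
        ps = result (W3 n)
        as′ bs′ ps′ : Vec (In → Bool) w
        as′ = resize w as
        bs′ = resize w bs
        ps′ = resize w ps
        as-num : ∀ x → num (as′ ⟨ x ⟩) ≡ f n (map num x)
        as-num x = trans (resize-num w as x (ℕₚ.<-≤-trans (num<2^ (as ⟨ x ⟩)) (ℕₚ.^-monoʳ-≤ 2 (pw-mono n b1≤)))) (computes (W1 n) x)
        bs-num : ∀ x → num (bs′ ⟨ x ⟩) ≡ g n (map num x)
        bs-num x = trans (resize-num w bs x (ℕₚ.<-≤-trans (num<2^ (bs ⟨ x ⟩)) (ℕₚ.^-monoʳ-≤ 2 (pw-mono n b2≤)))) (computes (W2 n) x)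
        ps-num : ∀ x → num (ps′ ⟨ x ⟩) ≡ p n (map num x)
        ps-num x = trans (resize-num w ps x (ℕₚ.<-≤-trans (num<2^ (ps ⟨ x ⟩)) (ℕₚ.^-monoʳ-≤ 2 (pw-mono n b3≤)))) (computes (W3 n) x)
        P : In → ℕ
        P x = p n (map num x)
        P< : ∀ x → P x < 2 ^ w
        P< x = subst (_< 2 ^ w) (ps-num x) (num<2^ (ps′ ⟨ x ⟩))
        -- Nothing is demanded for modulus 0, where the final remainder is 0 whatever the word
        -- holds.
        Rel : In → ℤ → Vec Bool w → Set
        Rel x z u = 1 ≤ P x → + num u ≋ z [ + P x ]
        gadget : ∀ o {h h′ : In → ℤ} {us vs : Vec (In → Bool) w} → (∀ x → Rel x (h x) (us ⟨ x ⟩)) → (∀ x → Rel x (h′ x) (vs ⟨ x ⟩)) →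
          Σ (Vec (In → Bool) w) λ cs → (∀ x → Rel x (opVal o (h x) (h′ x)) (cs ⟨ x ⟩)) ×
            (∀ {i} {Γ : Vec (In → Bool) i} → HasV Γ (F0 ∷ F1 ∷ ps′) → HasV Γ us → HasV Γ vs → Computable opBool Γ (S n) cs)
        gadget o {h} {h′} {us} {vs} hu hv = resize w ds , rel , λ hp ku kv →
            let K = unconcatV ws (λ { zero → ku ; (suc zero) → kv ; (suc (suc zero)) → tailV (tailV hp) })
            in C-mono (ℕₚ.≤-trans (ℕₚ.≤-reflexive (ℕₚ.+-identityʳ _)) (size≤S o n))
                 (C-let (C-call′ hp K) (C-ret (resize-has w (skip ds (headV hp)) (hereV ds))))
          where
          ws : Vec (Vec (In → Bool) w) 3
          ws = us ∷ vs ∷ ps′ ∷ []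
          called : Σ (Vec (In → Bool) _) λ cs → Computable opBool (F1 ∷ concat ws) (size′ o n) cs ×
            (∀ x → num (cs ⟨ x ⟩) ≡ modOp o (num (us ⟨ x ⟩)) (num (vs ⟨ x ⟩)) (num (ps′ ⟨ x ⟩)))
          called = call (proj₂ (proj₂ (proj₂ (M o))) n) ws (thereV allV) here
          ds : Vec (In → Bool) _
          ds = proj₁ called
          C-call′ : ∀ {i} {Γ : Vec (In → Bool) i} → HasV Γ (F0 ∷ F1 ∷ ps′) → HasV Γ (concat ws) → Computable opBool Γ (size′ o n) ds
          C-call′ hp K = C-move (consV (headV (tailV hp)) K) (proj₁ (proj₂ called))
          ds-num : ∀ x → num (ds ⟨ x ⟩) ≡ modOp o (num (us ⟨ x ⟩)) (num (vs ⟨ x ⟩)) (P x)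
          ds-num x = trans (proj₂ (proj₂ called) x) (cong (modOp o _ _) (ps-num x))
          rel : ∀ x → Rel x (opVal o (h x) (h′ x)) (resize w ds ⟨ x ⟩)
          rel x 1≤P = ≋-trans (≋-reflexive (cong +_ (trans (resize-num w ds x
              (subst (_< 2 ^ w) (sym (ds-num x)) (ℕₚ.≤-<-trans (modOp-≤ o _ _ (P x)) (P< x)))) (ds-num x))))
            (modOp-≋ o 1≤P (hu x 1≤P) (hv x 1≤P))
        dbits : Vec (In → Bool) (1 + 2 * w)
        dbits = F1 ∷ as′ ++ (bs′ ++ [])
        Γ : Vec (In → Bool) _
        Γ = ps ++ bs ++ as ++ F0 ∷ inputs r (pw a n)
        h0 : Has Γ F0
        h0 = skip ps (skip bs (skip as here))
        h1 : Has Γ F1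
        h1 = skip ps (skip bs (skip as (there here)))
        hasA : HasV Γ as′
        hasA = resize-has w h0 (skipV ps (skipV bs (hereV as)))
        hbs : HasV Γ bs′
        hbs = resize-has w h0 (skipV ps (hereV bs))
        hps : HasV Γ ps′
        hps = resize-has w h0 (hereV ps)
        hd : HasV Γ dbits
        hd = consV h1 (appendV hasA (appendV hbs nilV))
        zs : Vec (In → ℤ) (1 + 2 * w)
        zs = map (λ b x → b2z (b x)) dbits
        sim : Σ (Vec (In → Bool) w) λ cs → (∀ x → Rel x (head (run opVal (D c n) (zs ⟨ x ⟩))) (cs ⟨ x ⟩)) × Computable opBool Γ (gateCount (D c n) * S n) cs
        sim = simulate opVal Rel (F0 ∷ F1 ∷ ps′) (S n) gadget (D c n) (consV h0 (consV h1 hps)) zs (map (boolWord w) dbits)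
          (λ u x _ → ≋-reflexive (trans (cong (λ w → + num (w ⟨ x ⟩)) (Vecₚ.lookup-map u (boolWord w) dbits))
             (trans (cong +_ (boolWord-num {t = w} (lookup dbits u) x (1≤pw cM n))) (trans (+b2n _)
               (sym (trans (Vecₚ.lookup-map u (λ f → f x) zs) (cong (λ f → f x) (Vecₚ.lookup-map u (λ b x → b2z (b x)) dbits))))))))
          (λ u → subst (HasV _) (sym (Vecₚ.lookup-map u (boolWord w) dbits)) (resize-has w h0 (consV (lookupV hd u) nilV)))
        out : Vec (In → Bool) w
        out = proj₁ sim
        zs-⟨⟩ : ∀ x → zs ⟨ x ⟩ ≡ ℤ.1ℤ ∷ map b2z (as′ ⟨ x ⟩ ++ (bs′ ⟨ x ⟩ ++ []))
        zs-⟨⟩ x = trans (trans (sym (Vecₚ.map-∘ (λ f → f x) (λ b x → b2z (b x)) dbits)) (Vecₚ.map-∘ b2z (λ f → f x) dbits))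
          (cong (λ u → ℤ.1ℤ ∷ map b2z u) (trans (Vecₚ.map-++ _ as′ _) (cong (as′ ⟨ x ⟩ ++_) (Vecₚ.map-++ _ bs′ []))))
        out-≋ : ∀ x → 1 ≤ P x → + num (out ⟨ x ⟩) ≋ G n (f n (map num x)) (g n (map num x)) [ + P x ]
        out-≋ x 1≤P = ≋-trans (proj₁ (proj₂ sim) x 1≤P) (≋-reflexive (trans (cong (λ u → head (run opVal (D c n) u)) (zs-⟨⟩ x))
          (trans (cong head (D-value c n (as′ ⟨ x ⟩) (bs′ ⟨ x ⟩))) (cong₂ (G n) (as-num x) (bs-num x)))))
        -- One more reduction, since a program without gates returns an input bit as it is, and for
        -- p = 1 that bit need not be reduced.
        reduce : Σ (Vec (In → Bool) (pw br n)) λ cs → Computable opBool (out ++ Γ) (sr n) cs × (∀ x → num (cs ⟨ x ⟩) ≡ rem (num (out ⟨ x ⟩)) (num (ps′ ⟨ x ⟩)))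
        reduce = call (proj₂ (proj₂ (proj₂ R)) n) (out ∷ ps′ ∷ []) (appendV (hereV out) (appendV (skipV out hps) nilV)) (skip out h1)
      word : ∀ n → WordFunction r (pw a n) (pw br n) _ (λ v → zmod (G n (f n v) (g n v)) (p n v))
      word n = wordFunction (proj₁ reduce)
        (C-false here (C-let (C-move (thereV allV) (program (W1 n))) (C-let (C-move (skipV as (thereV allV)) (program (W2 n)))
          (C-let (C-move (skipV bs (skipV as (thereV allV))) (program (W3 n))) (C-let (proj₂ (proj₂ sim)) (proj₁ (proj₂ reduce)))))))
        (λ x → trans (proj₂ (proj₂ reduce) x) (trans (cong (rem _) (ps-num x)) (rem-zmod _ _ (P x) (out-≋ x))))
        where open At n

    abstract
      easy-zmod : Easy (λ n v → zmod (G n (f n v) (g n v)) (p n v))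
      easy-zmod = easy-zmod-construction

  rem-zmod-+ : ∀ x p → zmod (+ x) p ≡ rem x p
  rem-zmod-+ x zero    = refl
  rem-zmod-+ x (suc p) = refl

  abstract
    easy-powmod : ∀ {r} {f g p : ℕ → Vec ℕ r → ℕ} → Easy f → Easy g → Easy p → Easy (λ n v → rem (f n v ^ g n v) (p n v))
    easy-powmod {f = f} {g} {p} ef eg ep = easy-ext (λ n v → rem-zmod-+ (f n v ^ g n v) (p n v)) (easy-zmod 0
      (λ a n → proj₁ (powerCode (pw a n)))
      (λ a → Bounded-≤ (λ n → proj₁ (proj₂ (powerCode (pw a n)))) (Bounded-+ (Bounded-+ (Bounded-* (Bounded-pw a) (Bounded-const 2)) (Bounded-const 1)) (Bounded-* (Bounded-pw a) (Bounded-const 5))))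
      (λ n b e → + (b ^ e)) (λ a n → proj₂ (proj₂ (powerCode (pw a n)))) ef eg ep)

-- Primitive roots

prime-divisor : ∀ k → 2 ≤ k → Σ ℕ λ q → Prime q × q ∣ k
prime-divisor k@(suc (suc _)) 2≤k with factorise k
... | record { factors = [] ; isFactorisation = () }
... | record { factors = q ∷ qs ; isFactorisation = e ; factorsPrime = pq ∷ _ } = q , pq , divides (List.foldr _*_ 1 qs) (trans e (ℕₚ.*-comm q _))
prime-divisor (suc zero) (s≤s ())

2≤prime : ∀ {p} → Prime p → 2 ≤ p
2≤prime pr = ℕ.nonTrivial⇒n>1 _ ⦃ prime⇒nonTrivial pr ⦄

^-distribʳ-* : ∀ k a b → (a * b) ^ k ≡ a ^ k * b ^ k
^-distribʳ-* zero    a b = refl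
^-distribʳ-* (suc k) a b = trans (cong (a * b *_) (^-distribʳ-* k a b)) (lem a b (a ^ k) (b ^ k))
  where
  lem : ∀ a b x y → a * b * (x * y) ≡ a * x * (b * y)
  lem = ℕSolver.solve-∀

split-power : ∀ q fuel e → 2 ≤ q → 1 ≤ e → e ≤ fuel → Σ ℕ λ v → Σ ℕ λ u → e ≡ q ^ v * u × ¬ q ∣ u
split-power q zero      e 2≤q 1≤e e≤0 = contradiction (ℕₚ.≤-trans 1≤e e≤0) λ ()
split-power q (suc fuel) e 2≤q 1≤e e≤f with q ∣? e
... | no q∤e = 0 , e , sym (ℕₚ.+-identityʳ e) , q∤e
... | yes (divides zero refl) = contradiction 1≤e λ ()
... | yes (divides k@(suc k′) refl) with split-power q fuel k 2≤q (s≤s z≤n) (ℕₚ.≤-pred (ℕₚ.≤-trans k<e e≤f))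
  where
  k<e : k < k * q
  k<e = ℕₚ.≤-trans (ℕₚ.≤-trans (s≤s (s≤s (ℕₚ.m≤n+m k′ k′))) (ℕₚ.≤-reflexive (lem k′))) (ℕₚ.*-monoʳ-≤ k 2≤q)
    where
    lem : ∀ k → 2 + (k + k) ≡ suc k * 2
    lem = ℕSolver.solve-∀
...   | v , u , e′ , q∤u = suc v , u , trans (cong (_* q) e′) (lem (q ^ v) u q) , q∤u
  where
  lem : ∀ a u q → a * u * q ≡ q * a * u
  lem = ℕSolver.solve-∀

least : ∀ {P : ℕ → Set} → (∀ n → Dec (P n)) → ∀ n → P n → Σ ℕ λ m → m ≤ n × P m × (∀ k → k < m → ¬ P k)
least {P} P? n Pn = go n n Pn ℕₚ.≤-refl
  where
  go : ∀ fuel n → P n → n ≤ fuel → Σ ℕ λ m → m ≤ n × P m × (∀ k → k < m → ¬ P k)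
  go fuel n Pn n≤f with ℕₚ.anyUpTo? P? n
  ... | no none = n , ℕₚ.≤-refl , Pn , λ k k<n Pk → none (k , k<n , Pk)
  go zero       zero Pn z≤n | yes (k , () , Pk)
  go (suc fuel) n Pn n≤f | yes (k , k<n , Pk) with go fuel k Pk (ℕₚ.≤-pred (ℕₚ.≤-trans k<n n≤f))
  ...   | m , m≤k , Pm , min = m , ℕₚ.≤-trans m≤k (ℕₚ.<⇒≤ k<n) , Pm , min

∣⇒≋0 : ∀ {p} z → p ∣ ℤ.∣ z ∣ → z ≋ ℤ.0ℤ [ + p ]
∣⇒≋0 {p} (+ a)    (divides q e) = cong-by (+ q) (trans (cong +_ e) (trans (ℤₚ.pos-* q p) (sym (ℤₚ.+-identityˡ _))))
∣⇒≋0 {p} -[1+ a ] (divides q e) = cong-by (ℤ.- + q) (trans (cong (λ z → ℤ.- (+ z)) e) (trans (cong ℤ.-_ (ℤₚ.pos-* q p)) (lem (+ q) (+ p))))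
  where
  lem : ∀ q p → ℤ.- (q ℤ.* p) ≡ ℤ.0ℤ ℤ.+ (ℤ.- q) ℤ.* p
  lem = ℤSolver.solve-∀

≋0⇒∣ : ∀ {p} z → z ≋ ℤ.0ℤ [ + p ] → p ∣ ℤ.∣ z ∣
≋0⇒∣ {p} z (cong-by q e) = divides ℤ.∣ q ∣ (trans (cong ℤ.∣_∣ (trans e (ℤₚ.+-identityˡ (q ℤ.* + p)))) (ℤₚ.abs-* q (+ p)))

≋-difference : ∀ {m x y} → x ℤ.- y ≋ ℤ.0ℤ [ m ] → x ≋ y [ m ]
≋-difference {m} {x} {y} (cong-by q e) = cong-by q (trans (lem x y) (trans (cong (λ z → y ℤ.+ z) e) (cong (λ z → y ℤ.+ z) (ℤₚ.+-identityˡ _))))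
  where
  lem : ∀ x y → x ≡ y ℤ.+ (x ℤ.- y)
  lem = ℤSolver.solve-∀

difference-≋ : ∀ {m x y} → x ≋ y [ m ] → x ℤ.- y ≋ ℤ.0ℤ [ m ]
difference-≋ {m} {x} {y} h = ≋-trans (≋-sub h (≋-refl {a = y})) (≋-reflexive (ℤₚ.+-inverseʳ y))

-- x^e + c_{e-1} x^{e-1} + ... + c_0.
monic : ∀ {e} → Vec ℤ e → ℤ → ℤ
monic []       x = ℤ.1ℤ
monic (c ∷ cs) x = c ℤ.+ x ℤ.* monic cs x

-- The quotient of Horner division by x - a, whose coefficients are the values at a of the truncated
-- polynomials. The leading coefficient 1 stays implicit, so the length of the vector is the degree.
deflate : ∀ {e} → ℤ → Vec ℤ (suc e) → Vec ℤ e
deflate a (c ∷ [])        = []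
deflate a (c ∷ cs@(_ ∷ _)) = monic cs a ∷ deflate a cs

deflate-correct : ∀ {e} a (cs : Vec ℤ (suc e)) x → monic cs x ℤ.- monic cs a ≡ (x ℤ.- a) ℤ.* monic (deflate a cs) x
deflate-correct a (c ∷ [])         x = lem c x a
  where
  lem : ∀ c x a → c ℤ.+ x ℤ.* ℤ.1ℤ ℤ.- (c ℤ.+ a ℤ.* ℤ.1ℤ) ≡ (x ℤ.- a) ℤ.* ℤ.1ℤ
  lem = ℤSolver.solve-∀
deflate-correct a (c ∷ cs@(_ ∷ _)) x = begin
  c ℤ.+ x ℤ.* P ℤ.- (c ℤ.+ a ℤ.* A)        ≡⟨ l1 c x P a A ⟩
  (x ℤ.- a) ℤ.* A ℤ.+ x ℤ.* (P ℤ.- A)      ≡⟨ cong (λ z → (x ℤ.- a) ℤ.* A ℤ.+ x ℤ.* z) (deflate-correct a cs x) ⟩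
  (x ℤ.- a) ℤ.* A ℤ.+ x ℤ.* ((x ℤ.- a) ℤ.* Q) ≡⟨ l2 x a A Q ⟩
  (x ℤ.- a) ℤ.* (A ℤ.+ x ℤ.* Q) ∎
  where
  open ≡-Reasoning
  P A Q : ℤ
  P = monic cs x
  A = monic cs a
  Q = monic (deflate a cs) x
  l1 : ∀ c x P a A → c ℤ.+ x ℤ.* P ℤ.- (c ℤ.+ a ℤ.* A) ≡ (x ℤ.- a) ℤ.* A ℤ.+ x ℤ.* (P ℤ.- A)
  l1 = ℤSolver.solve-∀
  l2 : ∀ x a A Q → (x ℤ.- a) ℤ.* A ℤ.+ x ℤ.* ((x ℤ.- a) ℤ.* Q) ≡ (x ℤ.- a) ℤ.* (A ℤ.+ x ℤ.* Q)
  l2 = ℤSolver.solve-∀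

module ModPrime {p : ℕ} (pr : Prime p) where

  2≤p : 2 ≤ p
  2≤p = 2≤prime pr

  1≤p : 1 ≤ p
  1≤p = ℕₚ.<⇒≤ 2≤p

  infix 4 _≈_
  _≈_ : ℕ → ℕ → Set
  a ≈ b = + a ≋ + b [ + p ]

  ≈-* : ∀ {a b c d} → a ≈ b → c ≈ d → a * c ≈ b * d
  ≈-* {a} {b} {c} {d} h k = ≋-trans (≋-reflexive (ℤₚ.pos-* a c)) (≋-trans (≋-* h k) (≋-reflexive (sym (ℤₚ.pos-* b d))))

  ≈-^ : ∀ {a b} k → a ≈ b → a ^ k ≈ b ^ k
  ≈-^ zero    h = ≋-refl
  ≈-^ (suc k) h = ≈-* h (≈-^ k h)

  ≈1-^ : ∀ {a} k → a ≈ 1 → a ^ k ≈ 1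
  ≈1-^ k h = ≋-trans (≈-^ k h) (≋-reflexive (cong +_ (ℕₚ.^-zeroˡ k)))

  infix 4 _≈?_
  _≈?_ : ∀ a b → Dec (a ≈ b)
  a ≈? b with rem a p ℕ.≟ rem b p
  ... | yes e = yes (≋-trans (≋-sym (rem-≋ a 1≤p)) (≋-trans (≋-reflexive (cong +_ e)) (rem-≋ b 1≤p)))
  ... | no ¬e = no λ h → ¬e (<-unique (rem-< a 1≤p) (rem-< b 1≤p) (≋-trans (rem-≋ a 1≤p) (≋-trans h (≋-sym (rem-≋ b 1≤p)))))

  Unit : ℕ → Set
  Unit a = ¬ a ≈ 0

  small-unit : ∀ {a} → 1 ≤ a → a < p → Unit a
  small-unit {a} 1≤a a<p h = contradiction (<-unique a<p 1≤p h) λ { refl → contradiction 1≤a λ () }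

  ≋-zero-product : ∀ x y → x ℤ.* y ≋ ℤ.0ℤ [ + p ] → x ≋ ℤ.0ℤ [ + p ] ⊎ y ≋ ℤ.0ℤ [ + p ]
  ≋-zero-product x y h with euclidsLemma ℤ.∣ x ∣ ℤ.∣ y ∣ pr (subst (p ∣_) (ℤₚ.abs-* x y) (≋0⇒∣ (x ℤ.* y) h))
  ... | inj₁ d = inj₁ (∣⇒≋0 x d)
  ... | inj₂ d = inj₂ (∣⇒≋0 y d)

  unit-* : ∀ {a b} → Unit a → Unit b → Unit (a * b)
  unit-* {a} {b} ua ub h with ≋-zero-product (+ a) (+ b) (≋-trans (≋-reflexive (sym (ℤₚ.pos-* a b))) h)
  ... | inj₁ k = ua k
  ... | inj₂ k = ub k

  unit-1 : Unit 1
  unit-1 = small-unit (s≤s z≤n) 2≤p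

  unit-^ : ∀ {a} k → Unit a → Unit (a ^ k)
  unit-^ zero    ua = unit-1
  unit-^ (suc k) ua = unit-* ua (unit-^ k ua)

  ≋-cancelʳ : ∀ {x y} z → ¬ z ≋ ℤ.0ℤ [ + p ] → x ℤ.* z ≋ y ℤ.* z [ + p ] → x ≋ y [ + p ]
  ≋-cancelʳ {x} {y} z uz h = pick (≋-zero-product (x ℤ.- y) z (≋-trans (≋-reflexive (lem x y z)) (difference-≋ {x = x ℤ.* z} {y = y ℤ.* z} h)))
    where
    lem : ∀ x y z → (x ℤ.- y) ℤ.* z ≡ x ℤ.* z ℤ.- y ℤ.* z
    lem = ℤSolver.solve-∀
    pick : x ℤ.- y ≋ ℤ.0ℤ [ + p ] ⊎ z ≋ ℤ.0ℤ [ + p ] → x ≋ y [ + p ]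
    pick (inj₁ k) = ≋-difference k
    pick (inj₂ k) = contradiction k uz

  ≈-cancelʳ : ∀ {a b} c → Unit c → a * c ≈ b * c → a ≈ b
  ≈-cancelʳ {a} {b} c uc h = ≋-cancelʳ (+ c) uc (≋-trans (≋-reflexive (sym (ℤₚ.pos-* a c))) (≋-trans h (≋-reflexive (ℤₚ.pos-* b c))))

  ^-collision : ∀ {a i j} → Unit a → i < j → a ^ i ≈ a ^ j → a ^ (j ∸ i) ≈ 1
  ^-collision {a} {i} {j} ua i<j h = ≈-cancelʳ (a ^ i) (unit-^ i ua) (≋-trans (≋-reflexive (cong +_ (trans (sym (ℕₚ.^-distribˡ-+-* a (j ∸ i) i)) (cong (a ^_) (ℕₚ.m∸n+n≡m (ℕₚ.<⇒≤ i<j))))))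
    (≋-trans (≋-sym h) (≋-reflexive (cong +_ (sym (ℕₚ.+-identityʳ (a ^ i)))))))

  1≤rem-unit : ∀ {a} → Unit a → 1 ≤ rem a p
  1≤rem-unit {a} ua = positive (rem a p) refl
    where
    positive : ∀ r → rem a p ≡ r → 1 ≤ r
    positive zero    h = contradiction (≋-trans (≋-sym (rem-≋ a 1≤p)) (≋-reflexive (cong +_ h))) ua
    positive (suc _) h = s≤s z≤n

  -- The shift by one leaves exactly p - 1 classes for the units, the count on which the pigeonhole
  -- arguments rest.
  residue : ∀ {a} → Unit a → Fin (p ∸ 1)
  residue {a} ua = Fin.fromℕ< {rem a p ∸ 1} (ℕₚ.∸-monoˡ-< (rem-< a 1≤p) (1≤rem-unit ua))

  residue-injective : ∀ {a b} (ua : Unit a) (ub : Unit b) → residue ua ≡ residue ub → a ≈ b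
  residue-injective {a} {b} ua ub h = ≋-trans (≋-sym (rem-≋ a 1≤p)) (≋-trans (≋-reflexive (cong +_ (pred-inj ra rb (trans (sym (Finₚ.toℕ-fromℕ< _)) (trans (cong toℕ h) (Finₚ.toℕ-fromℕ< _)))))) (rem-≋ b 1≤p))
    where
    ra : rem a p ≢ 0
    ra e = ua (≋-trans (≋-sym (rem-≋ a 1≤p)) (≋-reflexive (cong +_ e)))
    rb : rem b p ≢ 0
    rb e = ub (≋-trans (≋-sym (rem-≋ b 1≤p)) (≋-reflexive (cong +_ e)))
    pred-inj : ∀ {m n} → m ≢ 0 → n ≢ 0 → m ∸ 1 ≡ n ∸ 1 → m ≡ n
    pred-inj {zero}  m≢0 _ _ = contradiction refl m≢0
    pred-inj {suc m} {zero}  _ n≢0 _ = contradiction refl n≢0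
    pred-inj {suc m} {suc n} _ _ e = cong suc e

  -- Two of the powers with exponents below N fall into the same class, and cancelling the smaller
  -- power leaves a^t ≈ 1.
  power-collision : ∀ {N a} → Unit a → p ∸ 1 < N → Σ ℕ λ t → 1 ≤ t × t < N × a ^ t ≈ 1
  power-collision {N} {a} ua p<N with Finₚ.pigeonhole p<N (λ i → residue (unit-^ (toℕ i) ua))
  ... | i , j , i<j , h = toℕ j ∸ toℕ i , ℕₚ.m<n⇒0<n∸m i<j , ℕₚ.≤-<-trans (ℕₚ.m∸n≤m _ (toℕ i)) (Finₚ.toℕ<n j) ,
    ^-collision ua i<j (residue-injective (unit-^ (toℕ i) ua) (unit-^ (toℕ j) ua) h)

  p-1<p : p ∸ 1 < p
  p-1<p = ℕₚ.∸-monoʳ-< {p} (s≤s z≤n) 1≤p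

  ∣! : ∀ {t n} → 1 ≤ t → t ≤ n → t ∣ n !
  ∣! {suc t} _ t≤n = ∣-trans (m∣m*n (t !)) (m≤n⇒m!∣n! t≤n)

  ^-∣ : ∀ {a t e} → t ∣ e → a ^ t ≈ 1 → a ^ e ≈ 1
  ^-∣ {a} {t} (divides k refl) h = ≋-trans (≋-reflexive (cong +_ (trans (cong (a ^_) (ℕₚ.*-comm k t)) (sym (ℕₚ.^-*-assoc a t k))))) (≈1-^ k h)

  -- Over a field a polynomial has no more roots than its degree. The candidates 1, ..., e + 1 are
  -- distinct modulo p because they are below p; dividing out the largest lowers the degree by one.
  roots-bound : ∀ e (cs : Vec ℤ e) → suc e < p → ¬ (∀ i → 1 ≤ i → i ≤ suc e → monic cs (+ i) ≋ ℤ.0ℤ [ + p ])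
  roots-bound zero    []  1<p h = unit-1 (h 1 (s≤s z≤n) (s≤s z≤n))
  roots-bound (suc e) cs  lt′ h = roots-bound e (deflate (+ suc (suc e)) cs) (ℕₚ.<-trans (ℕₚ.n<1+n _) lt′) λ i 1≤i i≤ →
    case (≋-zero-product (+ i ℤ.- + suc (suc e)) (monic (deflate (+ suc (suc e)) cs) (+ i))
      (≋-trans (≋-reflexive (sym (deflate-correct (+ suc (suc e)) cs (+ i)))) (≋-trans (≋-sub (h i 1≤i (ℕₚ.m≤n⇒m≤1+n i≤)) (h (suc (suc e)) (s≤s z≤n) ℕₚ.≤-refl)) ≋-refl)))
      i≤
    where
    case : ∀ {i Q} → + i ℤ.- + suc (suc e) ≋ ℤ.0ℤ [ + p ] ⊎ Q ≋ ℤ.0ℤ [ + p ] → i ≤ suc e → Q ≋ ℤ.0ℤ [ + p ]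
    case (inj₂ k) _ = k
    case {i} (inj₁ k) i≤ = contradiction (<-unique (ℕₚ.<-trans (s≤s i≤) lt′) lt′ (≋-difference k)) (ℕₚ.<⇒≢ (s≤s i≤))

  -- Otherwise x^e - 1 would have more than e roots among 1, ..., p - 1.
  exponent-bound : ∀ e → 1 ≤ e → (∀ a → 1 ≤ a → a < p → a ^ e ≈ 1) → p ∸ 1 ≤ e
  exponent-bound (suc e) _ h with p ∸ 1 ℕ.≤? suc e
  ... | yes q = q
  ... | no ¬q = contradiction (λ i 1≤i i≤ → ≋-trans (≋-reflexive (value i)) (difference-≋ (h i 1≤i (ℕₚ.≤-<-trans i≤ sse<p))))
      (roots-bound (suc e) (ℤ.- ℤ.1ℤ ∷ replicate e ℤ.0ℤ) sse<p)
    where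
    sse<p : suc (suc e) < p
    sse<p = ℕₚ.≤-trans (s≤s (ℕₚ.≰⇒> ¬q)) (ℕₚ.≤-reflexive (ℕₚ.m+[n∸m]≡n 1≤p))
    tail-value : ∀ e i → monic (replicate e ℤ.0ℤ) (+ i) ≡ + (i ^ e)
    tail-value zero    i = refl
    tail-value (suc e) i = trans (ℤₚ.+-identityˡ _) (trans (cong (+ i ℤ.*_) (tail-value e i)) (sym (ℤₚ.pos-* i (i ^ e))))
    value : ∀ i → monic (ℤ.- ℤ.1ℤ ∷ replicate e ℤ.0ℤ) (+ i) ≡ + (i ^ suc e) ℤ.- ℤ.1ℤ
    value i = trans (cong (λ z → ℤ.- ℤ.1ℤ ℤ.+ + i ℤ.* z) (tail-value e i)) (trans (cong (λ z → ℤ.- ℤ.1ℤ ℤ.+ z) (sym (ℤₚ.pos-* i (i ^ e)))) (ℤₚ.+-comm (ℤ.- ℤ.1ℤ) (+ (i ^ suc e))))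

  Exponent : ℕ → Set
  Exponent e = 1 ≤ e × (∀ {a} → a < p → 1 ≤ a → a ^ e ≈ 1)

  exponent? : ∀ e → Dec (Exponent e)
  exponent? e = (1 ℕ.≤? e) ×-dec ℕₚ.allUpTo? (λ a → imp? (1 ℕ.≤? a) (a ^ e ≈? 1)) p
    where
    imp? : ∀ {A B : Set} → Dec A → Dec B → Dec (A → B)
    imp? (no ¬a) _       = yes λ a → contradiction a ¬a
    imp? (yes a) (yes b) = yes λ _ → b
    imp? (yes a) (no ¬b) = no λ f → ¬b (f a)

  -- By the pigeonhole principle each unit returns to 1 at some t ≤ p - 1, and all such t divide the
  -- factorial.
  exponent-exists : Exponent ((p ∸ 1) !)
  exponent-exists = 1≤! (p ∸ 1) , λ {a} a<p 1≤a →
    let t , 1≤t , t<p , h = power-collision (small-unit 1≤a a<p) p-1<p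
    in ^-∣ (∣! 1≤t (ℕₚ.≤-pred (ℕₚ.≤-trans t<p (ℕₚ.≤-reflexive (sym (ℕₚ.m+[n∸m]≡n 1≤p)))))) h
    where
    1≤! : ∀ n → 1 ≤ n !
    1≤! zero    = s≤s z≤n
    1≤! (suc n) = ℕₚ.*-mono-≤ (s≤s {n = n} z≤n) (1≤! n)

  -- The least common exponent e is shown to be the order of a single element. The pigeonhole
  -- principle then gives e ≤ p - 1 and the bound on roots gives e ≥ p - 1, so the units form a
  -- cyclic group.
  module MinimalExponent (e : ℕ) (exp : Exponent e) (minimal : ∀ k → k < e → ¬ Exponent k) where

    1≤e : 1 ≤ e
    1≤e = proj₁ exp

    a^e≈1 : ∀ {a} → Unit a → a ^ e ≈ 1
    a^e≈1 {a} ua = ≋-trans (≈-^ e (≋-sym (rem-≋ a 1≤p))) (proj₂ exp (rem-< a 1≤p) (1≤rem-unit ua))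

    quotient-pos : ∀ {q m} → e ≡ q * m → 1 ≤ m
    quotient-pos {q} {zero}  h = contradiction (subst (1 ≤_) (trans h (ℕₚ.*-zeroʳ q)) 1≤e) λ ()
    quotient-pos {q} {suc m} h = s≤s z≤n

    quotient-< : ∀ {q m} → 2 ≤ q → e ≡ q * m → m < e
    quotient-< {q} {m} 2≤q h = subst (m <_) (sym h) (ℕₚ.≤-trans (ℕₚ.≤-trans (ℕₚ.+-monoˡ-≤ m (quotient-pos {q} h)) (ℕₚ.≤-reflexive (cong (λ z → m + z) (sym (ℕₚ.+-identityʳ m))))) (ℕₚ.*-monoˡ-≤ m 2≤q))

    nonroot : ∀ {q m} → 2 ≤ q → e ≡ q * m → Σ ℕ λ a → Unit a × ¬ a ^ m ≈ 1
    nonroot {q} {m} 2≤q h with ℕₚ.anyUpTo? (λ a → (1 ℕ.≤? a) ×-dec ¬? (a ^ m ≈? 1)) p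
    ... | yes (a , a<p , 1≤a , h′) = a , small-unit 1≤a a<p , h′
    ... | no none = contradiction (quotient-pos {q} h , λ {a} a<p 1≤a → decidable-stable (a ^ m ≈? 1) (λ h′ → none (a , a<p , 1≤a , h′)))
                      (minimal m (quotient-< 2≤q h))

    -- Primes q < B no longer obstruct g from having order e, and the others were not yet touched.
    Partial : ℕ → ℕ → Set
    Partial B g = Unit g × (∀ q m → Prime q → e ≡ q * m → (q < B → ¬ g ^ m ≈ 1) × (B ≤ q → g ^ m ≈ 1))

    partial-zero : Partial 0 1
    partial-zero = unit-1 , λ q m pq h → (λ ()) , λ _ → ≈1-^ m ≋-refl

    partial-skip : ∀ {B g} → (∀ m → Prime B → ¬ e ≡ B * m) → Partial B g → Partial (suc B) g
    partial-skip {B} {g} none (ug , P) = ug , λ q m pq h → (λ q<1+B → proj₁ (P q m pq h) (ℕₚ.≤∧≢⇒< (ℕₚ.≤-pred q<1+B) (λ { refl → none m pq h }))) ,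
      λ B<q → proj₂ (P q m pq h) (ℕₚ.<⇒≤ B<q)

    prime∤prime-power : ∀ {q B} v → Prime q → Prime B → q ≢ B → ¬ q ∣ B ^ v
    prime∤prime-power zero    pq pB q≢B d = contradiction (∣⇒≤ d) (ℕₚ.<⇒≱ (2≤prime pq))
    prime∤prime-power {q} {B} (suc v) pq pB q≢B d with euclidsLemma B (B ^ v) pq d
    ... | inj₂ d′ = prime∤prime-power v pq pB q≢B d′
    ... | inj₁ d′ with prime⇒irreducible pB d′
    ...   | inj₁ q≡1 = contradiction (2≤prime pq) (subst (λ z → ¬ 2 ≤ z) (sym q≡1) λ { (s≤s ()) })
    ...   | inj₂ q≡B = q≢B q≡B

    -- Write e = B^(v+1) u with u prime to B and choose a with a^(e/B) ≠ 1. For b = a^u the power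
    -- b^(e/q) is 1 for every prime q ≠ B, because q divides u, while b^(e/B) ≠ 1. Multiplying g by
    -- b settles the prime B and disturbs no other.
    partial-use : ∀ {B g} m → Prime B → e ≡ B * m → Partial B g → Σ ℕ (Partial (suc B))
    partial-use {B} {g} m pB h (ug , P) with nonroot {B} (2≤prime pB) h | split-power B e e (2≤prime pB) 1≤e ℕₚ.≤-refl
    ... | a , ua , a^m≉1 | zero , u , e≡ , B∤u = contradiction (divides m (trans (trans (sym (trans e≡ (ℕₚ.+-identityʳ u))) h) (ℕₚ.*-comm B m))) B∤u
    ... | a , ua , a^m≉1 | suc v , u , e≡ , B∤u = g * b , unit-* ug (unit-^ u ua) , λ q m′ pq h′ → old q m′ pq h′ , new q m′ pq h′
      where
      b : ℕ
      b = a ^ u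
      split : ∀ m → (g * b) ^ m ≡ g ^ m * b ^ m
      split m = ^-distribʳ-* m g b
      m≡ : m ≡ B ^ v * u
      m≡ = ℕₚ.*-cancelˡ-≡ m (B ^ v * u) B ⦃ prime⇒nonZero pB ⦄ (trans (sym h) (trans e≡ (ℕₚ.*-assoc B (B ^ v) u)))
      other : ∀ q m′ → Prime q → e ≡ q * m′ → q ≢ B → b ^ m′ ≈ 1
      other q m′ pq h′ q≢B with euclidsLemma (B ^ suc v) u pq (divides m′ (trans (sym e≡) (trans h′ (ℕₚ.*-comm q m′))))
      ... | inj₁ d = contradiction d (prime∤prime-power (suc v) pq pB q≢B)
      ... | inj₂ (divides u′ refl) = ≋-trans (≋-reflexive (cong +_ (trans (ℕₚ.^-*-assoc a (u′ * q) m′) (cong (a ^_) (trans (lem u′ q m′) (cong (_* u′) (sym h′)))))))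
          (≋-trans (≋-reflexive (cong +_ (sym (ℕₚ.^-*-assoc a e u′)))) (≈1-^ u′ (a^e≈1 ua)))
        where
        lem : ∀ u q m → u * q * m ≡ q * m * u
        lem = ℕSolver.solve-∀
      -- Otherwise ζ = a^m would satisfy ζ^u = 1 and ζ^B = 1 with u and B coprime, and a Bézout
      -- identity would give ζ = 1.
      b^m≉1 : ¬ b ^ m ≈ 1
      b^m≉1 k = bezout (coprime-Bézout (coprime u))
        where
        ζ : ℕ
        ζ = a ^ m
        ζ^u≈1 : ζ ^ u ≈ 1
        ζ^u≈1 = ≋-trans (≋-reflexive (cong +_ (trans (ℕₚ.^-*-assoc a m u) (trans (cong (a ^_) (ℕₚ.*-comm m u)) (sym (ℕₚ.^-*-assoc a u m)))))) k
        ζ^B≈1 : ζ ^ B ≈ 1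
        ζ^B≈1 = ≋-trans (≋-reflexive (cong +_ (trans (ℕₚ.^-*-assoc a m B) (cong (a ^_) (trans (ℕₚ.*-comm m B) (sym h)))))) (a^e≈1 ua)
        coprime : ∀ u′ → Coprime u B
        coprime _ {i} (i∣u , i∣B) with prime⇒irreducible pB i∣B
        ... | inj₁ i≡1 = i≡1
        ... | inj₂ refl = contradiction i∣u B∤u
        kill : ∀ x y → ζ ^ x ≈ 1 → 1 + y ≡ x → ζ ^ y ≈ 1 → ⊥
        kill x y hx refl hy = a^m≉1 (≈-cancelʳ (ζ ^ y) (unit-^ y (unit-^ m ua)) (≋-trans hx (≋-trans (≋-sym hy) (≋-reflexive (cong +_ (sym (ℕₚ.+-identityʳ _)))))))
        bezout : Bézout.Identity.Identity 1 u B → ⊥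
        bezout (Bézout.+- x y eq) = kill (x * u) (y * B) (^-∣ {ζ} (divides x refl) ζ^u≈1) eq (^-∣ {ζ} (divides y refl) ζ^B≈1)
        bezout (Bézout.-+ x y eq) = kill (y * B) (x * u) (^-∣ {ζ} (divides y refl) ζ^B≈1) eq (^-∣ {ζ} (divides x refl) ζ^u≈1)
      combine : ∀ {x y} m′ → g ^ m′ ≈ x → b ^ m′ ≈ y → (g * b) ^ m′ ≈ x * y
      combine m′ hx hy = ≋-trans (≋-reflexive (cong +_ (split m′))) (≈-* hx hy)
      old : ∀ q m′ → Prime q → e ≡ q * m′ → q < suc B → ¬ (g * b) ^ m′ ≈ 1
      old q m′ pq h′ q<1+B k with q ℕ.≟ B
      ... | yes refl = b^m≉1 (≋-trans (≋-reflexive (cong (λ z → + (b ^ z)) (ℕₚ.*-cancelˡ-≡ m m′ B ⦃ prime⇒nonZero pB ⦄ (trans (sym h) h′))))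
            (≋-trans (≋-sym (≋-trans (combine m′ (proj₂ (P q m′ pq h′) ℕₚ.≤-refl) ≋-refl) (≋-reflexive (cong +_ (ℕₚ.+-identityʳ _))))) k))
      ... | no q≢B = proj₁ (P q m′ pq h′) (ℕₚ.≤∧≢⇒< (ℕₚ.≤-pred q<1+B) q≢B)
            (≋-trans (≋-sym (≋-trans (combine m′ ≋-refl (other q m′ pq h′ q≢B)) (≋-reflexive (cong +_ (ℕₚ.*-identityʳ _))))) k)
      new : ∀ q m′ → Prime q → e ≡ q * m′ → suc B ≤ q → (g * b) ^ m′ ≈ 1
      new q m′ pq h′ B<q = combine m′ (proj₂ (P q m′ pq h′) (ℕₚ.<⇒≤ B<q)) (other q m′ pq h′ (λ { refl → ℕₚ.<-irrefl refl B<q }))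

    partial-step : ∀ {B g} → Partial B g → Dec (Prime B) → Dec (B ∣ e) → Σ ℕ (Partial (suc B))
    partial-step {g = g} P (no ¬pB) _ = g , partial-skip (λ m pB _ → ¬pB pB) P
    partial-step {B} {g} P (yes pB) (no B∤e) = g , partial-skip (λ m _ h → B∤e (divides m (trans h (ℕₚ.*-comm B m)))) P
    partial-step {B} P (yes pB) (yes (divides m h)) = partial-use m pB (trans h (ℕₚ.*-comm m B)) P

    partial-exists : ∀ B → Σ ℕ (Partial B)
    partial-exists zero    = 1 , partial-zero
    partial-exists (suc B) = partial-step {B} {proj₁ (partial-exists B)} (proj₂ (partial-exists B)) (prime? B) (B ∣? e)

    -- If g^j = 1 for some positive j < e, then g^d = 1 for d = gcd(j, e). Any prime q dividing e/d
    -- then gives g^(e/q) = 1, which `Partial` forbids once all primes up to e are settled.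
    generator : Σ ℕ λ g → Unit g × (∀ j → 1 ≤ j → j < e → ¬ g ^ j ≈ 1)
    generator with partial-exists (suc e)
    ... | g , ug , P = g , ug , λ j 1≤j j<e k → contra j 1≤j j<e k (gcd[m,n]∣n j e)
      where
      contra : ∀ j → 1 ≤ j → j < e → g ^ j ≈ 1 → gcd j e ∣ e → ⊥
      contra j 1≤j j<e k (divides c e≡) = refute (prime-divisor c 2≤c)
        where
        d : ℕ
        d = gcd j e
        d≤j : d ≤ j
        d≤j = ∣⇒≤ ⦃ ℕ.>-nonZero 1≤j ⦄ (gcd[m,n]∣m j e)
        g^d≈1 : g ^ d ≈ 1
        g^d≈1 = from (Bézout.identity (gcd-GCD j e))
          where
          kill : ∀ x y → g ^ x ≈ 1 → d + y ≡ x → g ^ y ≈ 1 → g ^ d ≈ 1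
          kill x y hx refl hy = ≈-cancelʳ (g ^ y) (unit-^ y ug) (≋-trans (≋-reflexive (cong +_ (sym (ℕₚ.^-distribˡ-+-* g d y)))) (≋-trans hx (≋-trans (≋-sym hy) (≋-reflexive (cong +_ (sym (ℕₚ.+-identityʳ _)))))))
          from : Bézout.Identity.Identity d j e → g ^ d ≈ 1
          from (Bézout.+- x y eq) = kill (x * j) (y * e) (^-∣ {g} (divides x refl) k) eq (^-∣ {g} (divides y refl) (a^e≈1 ug))
          from (Bézout.-+ x y eq) = kill (y * e) (x * j) (^-∣ {g} (divides y refl) (a^e≈1 ug)) eq (^-∣ {g} (divides x refl) k)
        large : ∀ c → e ≡ c * d → 2 ≤ c
        large zero          e≡ = contradiction (subst (1 ≤_) e≡ 1≤e) λ ()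
        large (suc zero)    e≡ = contradiction (subst (j <_) (trans e≡ (ℕₚ.+-identityʳ d)) j<e) (ℕₚ.≤⇒≯ d≤j)
        large (suc (suc _)) e≡ = s≤s (s≤s z≤n)
        2≤c : 2 ≤ c
        2≤c = large c e≡
        refute : (Σ ℕ λ q → Prime q × q ∣ c) → ⊥
        refute (q , pq , divides c′ c≡) = proj₁ (P q (c′ * d) pq e≡′) (s≤s (∣⇒≤ ⦃ ℕ.>-nonZero 1≤e ⦄ (divides (c′ * d) (trans e≡′ (ℕₚ.*-comm q _)))))
            (^-∣ {g} (divides c′ refl) g^d≈1)
          where
          lem : ∀ c q d → c * q * d ≡ q * (c * d)
          lem = ℕSolver.solve-∀
          e≡′ : e ≡ q * (c′ * d)
          e≡′ = trans e≡ (trans (cong (_* d) c≡) (lem c′ q d))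

    e≡p-1 : e ≡ p ∸ 1
    e≡p-1 = from generator
      where
      from : (Σ ℕ λ g → Unit g × (∀ j → 1 ≤ j → j < e → ¬ g ^ j ≈ 1)) → e ≡ p ∸ 1
      from (g , ug , ord) = ℕₚ.≤-antisym (ℕₚ.≮⇒≥ too-big) (exponent-bound e 1≤e (λ a 1≤a a<p → proj₂ exp a<p 1≤a))
        where
        too-big : ¬ p ∸ 1 < e
        too-big h = let t , 1≤t , t<e , k = power-collision ug h in ord t 1≤t t<e k

  record PrimitiveRoot (g : ℕ) : Set where
    field
      unit  : Unit g
      order : ∀ j → 1 ≤ j → j < p ∸ 1 → ¬ g ^ j ≈ 1

  abstract
    minimal-exponent : Σ ℕ λ e → Exponent e × (∀ k → k < e → ¬ Exponent k)
    minimal-exponent = let e , _ , h = least exponent? ((p ∸ 1) !) exponent-exists in e , h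

  open MinimalExponent (proj₁ minimal-exponent) (proj₁ (proj₂ minimal-exponent)) (proj₂ (proj₂ minimal-exponent)) using (generator; e≡p-1; a^e≈1)

  fermat : ∀ {a} → Unit a → a ^ (p ∸ 1) ≈ 1
  fermat {a} ua = subst (λ z → a ^ z ≈ 1) e≡p-1 (a^e≈1 ua)

  primitive-root : Σ ℕ λ g → g < p × 1 ≤ g × PrimitiveRoot g
  primitive-root = rem g p , rem-< g 1≤p , 1≤rem-unit (proj₁ (proj₂ generator)) , record
      { unit = λ h → proj₁ (proj₂ generator) (≋-trans (≋-sym (rem-≋ g 1≤p)) h)
      ; order = λ j 1≤j j<p h → proj₂ (proj₂ generator) j 1≤j (subst (j <_) (sym e≡p-1) j<p) (≋-trans (≈-^ j (≋-sym (rem-≋ g 1≤p))) h) }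
    where
    g : ℕ
    g = proj₁ generator

  -- The unit a and the powers g^0, ..., g^(p-2) are p elements in p - 1 classes. Two powers cannot
  -- coincide, so the collision involves a, which is placed first.
  discrete-log : ∀ {g a} → PrimitiveRoot g → Unit a → Σ ℕ λ j → j < p ∸ 1 × g ^ j ≈ a
  discrete-log {g} {a} root ua = go (Finₚ.pigeonhole (ℕₚ.n<1+n (p ∸ 1)) place)
    where
    open PrimitiveRoot root
    place : Fin (suc (p ∸ 1)) → Fin (p ∸ 1)
    place zero    = residue ua
    place (suc i) = residue (unit-^ (toℕ i) unit)
    go : (Σ _ λ i → Σ _ λ j → i Fin.< j × place i ≡ place j) → Σ ℕ λ j → j < p ∸ 1 × g ^ j ≈ a
    go (zero  , suc j , _ , h) = toℕ j , Finₚ.toℕ<n j , ≋-sym (residue-injective ua (unit-^ (toℕ j) unit) h)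
    go (suc i , suc j , s≤s i<j , h) = contradiction (^-collision unit i<j (residue-injective (unit-^ (toℕ i) unit) (unit-^ (toℕ j) unit) h))
      (order _ (ℕₚ.m<n⇒0<n∸m i<j) (ℕₚ.≤-<-trans (ℕₚ.m∸n≤m _ (toℕ i)) (Finₚ.toℕ<n j)))

-- Primality, discrete logarithms and products modulo a prime

Π< : ℕ → (ℕ → ℕ) → ℕ
Π< zero    h = 1
Π< (suc k) h = h k * Π< k h

Π<-cong : ∀ k {h h′} → (∀ z → z < k → h z ≡ h′ z) → Π< k h ≡ Π< k h′
Π<-cong zero    e = refl
Π<-cong (suc k) e = cong₂ _*_ (e k ℕₚ.≤-refl) (Π<-cong k (λ z z<k → e z (ℕₚ.m<n⇒m<1+n z<k)))

Σ<-zero : ∀ k {h} → (∀ z → z < k → h z ≡ 0) → Σ< k h ≡ 0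
Σ<-zero zero    e = refl
Σ<-zero (suc k) e = cong₂ _+_ (e k ℕₚ.≤-refl) (Σ<-zero k (λ z z<k → e z (ℕₚ.m<n⇒m<1+n z<k)))

Σ<-zero⁻¹ : ∀ k {h} → Σ< k h ≡ 0 → ∀ z → z < k → h z ≡ 0
Σ<-zero⁻¹ (suc k) {h} e z (s≤s z≤k) with ℕₚ.m≤n⇒m<n∨m≡n z≤k
... | inj₁ z<k  = Σ<-zero⁻¹ k (ℕₚ.m+n≡0⇒n≡0 (h k) e) z z<k
... | inj₂ refl = ℕₚ.m+n≡0⇒m≡0 (h k) e

Σ<-single : ∀ k {h} z → z < k → (∀ y → y < k → y ≢ z → h y ≡ 0) → Σ< k h ≡ h z
Σ<-single (suc k) {h} z (s≤s z≤k) e with ℕₚ.m≤n⇒m<n∨m≡n z≤k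
... | inj₂ refl = trans (cong (λ t → h k + t) (Σ<-zero k (λ y y<k → e y (ℕₚ.m<n⇒m<1+n y<k) (ℕₚ.<⇒≢ y<k)))) (ℕₚ.+-identityʳ _)
... | inj₁ z<k  = trans (cong (_+ Σ< k h) (e k ℕₚ.≤-refl (λ k≡z → ℕₚ.<⇒≢ z<k (sym k≡z)))) (Σ<-single k z z<k (λ y y<k → e y (ℕₚ.m<n⇒m<1+n y<k)))

-- Predicates are coded as the numbers 0 and 1: conjunction is multiplication, and a bounded search
-- is a sum compared with 0. This keeps them within the reach of `easy-Σ`.
Bit : ℕ → Set
Bit b = b ≡ 0 ⊎ b ≡ 1

lt-bit : ∀ a b → Bit (lt a b)
lt-bit a b with a ℕ.<ᵇ b
... | false = inj₁ refl
... | true  = inj₂ refl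

*-bit : ∀ {a b} → Bit a → Bit b → Bit (a * b)
*-bit (inj₁ refl) _           = inj₁ refl
*-bit (inj₂ refl) (inj₁ refl) = inj₁ refl
*-bit (inj₂ refl) (inj₂ refl) = inj₂ refl

eq-bit : ∀ a b → Bit (eq a b)
eq-bit a b = *-bit (lt-bit a (suc b)) (lt-bit b (suc a))

*-bit⁻¹ : ∀ {a b} → Bit a → Bit b → a * b ≡ 1 → a ≡ 1 × b ≡ 1
*-bit⁻¹ (inj₂ refl) (inj₂ refl) _ = refl , refl
*-bit⁻¹ (inj₁ refl) _           ()
*-bit⁻¹ (inj₂ refl) (inj₁ refl) ()

lt-yes⁻¹ : ∀ {a b} → lt a b ≡ 1 → a < b
lt-yes⁻¹ {a} {b} h with a ℕ.<? b
... | yes p = p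
... | no ¬p = contradiction (trans (sym h) (lt-no (ℕₚ.≮⇒≥ ¬p))) λ ()

eq-yes⁻¹ : ∀ {a b} → eq a b ≡ 1 → a ≡ b
eq-yes⁻¹ {a} {b} h with a ℕ.≟ b
... | yes p = p
... | no ¬p = contradiction (trans (sym h) (eq-no ¬p)) λ ()

bit-no : ∀ {b} → Bit b → b ≢ 1 → b ≡ 0
bit-no (inj₁ h) _ = h
bit-no (inj₂ h) k = contradiction h k

-- The least z < N with P z = 1, or 0 if there is none.
mu : ℕ → (ℕ → ℕ) → ℕ
mu N P = Σ< N (λ z → z * (P z * eq (Σ< z P) 0))

mu-least : ∀ N {P} m → m < N → P m ≡ 1 → (∀ k → k < m → P k ≡ 0) → mu N P ≡ m
mu-least N {P} m m<N Pm min = trans (Σ<-single N m m<N other)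
  (trans (cong₂ (λ a b → m * (a * b)) Pm (eq-yes (Σ<-zero m min))) (ℕₚ.*-identityʳ m))
  where
  other : ∀ y → y < N → y ≢ m → y * (P y * eq (Σ< y P) 0) ≡ 0
  other y y<N y≢m with ℕₚ.<-cmp y m
  ... | Relation.Binary.tri< y<m _ _ = trans (cong (λ a → y * (a * eq (Σ< y P) 0)) (min y y<m)) (ℕₚ.*-zeroʳ y)
  ... | Relation.Binary.tri≈ _ h _ = contradiction h y≢m
  ... | Relation.Binary.tri> _ _ m<y = trans (cong (λ a → y * (P y * a)) (eq-no (λ z → contradiction (trans (sym Pm) (Σ<-zero⁻¹ y z m m<y)) λ ())))
      (trans (cong (y *_) (ℕₚ.*-zeroʳ (P y))) (ℕₚ.*-zeroʳ y))

mu-correct : ∀ N {P} → (∀ z → Bit (P z)) → ∀ w → w < N → P w ≡ 1 → mu N P < N × P (mu N P) ≡ 1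
mu-correct N {P} bit w w<N Pw =
  let m , m≤w , Pm , min = least (λ z → P z ℕ.≟ 1) w Pw
      e = mu-least N {P} m (ℕₚ.≤-<-trans m≤w w<N) Pm (λ k k<m → bit-no (bit k) (min k k<m))
  in subst (_< N) (sym e) (ℕₚ.≤-<-trans m≤w w<N) , trans (cong P e) Pm

properDivisors : ℕ → ℕ
properDivisors p = Σ< p (λ d → lt 1 d * eq (rem p d) 0)

isPrime : ℕ → ℕ
isPrime p = lt 1 p * eq (properDivisors p) 0

isPrime-bit : ∀ p → Bit (isPrime p)
isPrime-bit p = *-bit (lt-bit 1 p) (eq-bit (properDivisors p) 0)

isPrime-complete : ∀ {p} → Prime p → isPrime p ≡ 1
isPrime-complete {p} pr = cong₂ _*_ (lt-yes (2≤prime pr)) (eq-yes (Σ<-zero p no-divisor))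
  where
  no-divisor : ∀ d → d < p → lt 1 d * eq (rem p d) 0 ≡ 0
  no-divisor zero          _ = refl
  no-divisor (suc zero)    _ = refl
  no-divisor d@(suc (suc k)) d<p = trans (ℕₚ.+-identityʳ _) (eq-no λ h → case (prime⇒irreducible pr (m%n≡0⇒n∣m p d h)))
    where
    case : ¬ (d ≡ 1 ⊎ d ≡ p)
    case (inj₁ ())
    case (inj₂ refl) = ℕₚ.<-irrefl refl d<p

isPrime-sound : ∀ {p} → isPrime p ≡ 1 → Prime p
isPrime-sound {p} h = irreducible⇒prime ⦃ ℕ.n>1⇒nonTrivial 1<p ⦄ irr
  where
  split : lt 1 p ≡ 1 × eq (properDivisors p) 0 ≡ 1
  split = *-bit⁻¹ (lt-bit 1 p) (eq-bit (properDivisors p) 0) h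
  1<p : 1 < p
  1<p = lt-yes⁻¹ (proj₁ split)
  irr : ∀ {d} → d ∣ p → d ≡ 1 ⊎ d ≡ p
  irr {zero} (divides q e) = contradiction (subst (1 <_) (trans e (ℕₚ.*-zeroʳ q)) 1<p) λ ()
  irr {suc zero} _ = inj₁ refl
  irr {d@(suc (suc k))} d∣p with ℕₚ.m≤n⇒m<n∨m≡n (∣⇒≤ ⦃ ℕ.>-nonZero (ℕₚ.<⇒≤ 1<p) ⦄ d∣p)
  ... | inj₂ d≡p = inj₂ d≡p
  ... | inj₁ d<p = contradiction (trans (sym (trans (ℕₚ.+-identityʳ _) (eq-yes (n∣m⇒m%n≡0 p d d∣p)))) (Σ<-zero⁻¹ p (eq-yes⁻¹ (proj₂ split)) d d<p)) λ ()

earlyReturns : ℕ → ℕ → ℕ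
earlyReturns p g = Σ< (p ∸ 1) (λ j → lt 0 j * eq (rem (g ^ j) p) 1)

hasFullOrder : ℕ → ℕ → ℕ
hasFullOrder p g = lt 0 g * eq (earlyReturns p g) 0

gen : ℕ → ℕ
gen p = mu p (hasFullOrder p)

dlog : ℕ → ℕ → ℕ
dlog p a = mu (p ∸ 1) (λ j → eq (rem (gen p ^ j) p) (rem a p))

-- The product modulo a prime, by adding discrete logarithms.
prodMod : ℕ → ℕ → (ℕ → ℕ) → ℕ
prodMod p N f = eq (Σ< N (λ z → eq (rem (f z) p) 0)) 0 * rem (gen p ^ Σ< N (λ z → dlog p (f z))) p

module _ {p : ℕ} (pr : Prime p) where
  open ModPrime pr

  rem≡⇒≈ : ∀ {a b} → rem a p ≡ rem b p → a ≈ b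
  rem≡⇒≈ {a} {b} h = ≋-trans (≋-sym (rem-≋ a 1≤p)) (≋-trans (≋-reflexive (cong +_ h)) (rem-≋ b 1≤p))

  ≈⇒rem≡ : ∀ {a b} → a ≈ b → rem a p ≡ rem b p
  ≈⇒rem≡ {a} {b} h = <-unique (rem-< a 1≤p) (rem-< b 1≤p) (≋-trans (rem-≋ a 1≤p) (≋-trans h (≋-sym (rem-≋ b 1≤p))))

  rem-small : ∀ {a} → a < p → rem a p ≡ a
  rem-small {a} a<p = <-unique (rem-< a 1≤p) a<p (rem-≋ a 1≤p)

  rem-one : ∀ {a} → a ≈ 1 → rem a p ≡ 1
  rem-one h = trans (≈⇒rem≡ h) (rem-small 2≤p)

  gen-correct : gen p < p × PrimitiveRoot (gen p)
  gen-correct =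
    let g , g<p , 1≤g , root = primitive-root
        gen<p , full = mu-correct p (λ z → *-bit (lt-bit 0 z) (eq-bit (earlyReturns p z) 0)) g g<p (cong₂ _*_ (lt-yes 1≤g) (eq-yes (Σ<-zero (p ∸ 1) (λ j j<p → no-order g root j j<p))))
        pos , ord = *-bit⁻¹ (lt-bit 0 (gen p)) (eq-bit (earlyReturns p (gen p)) 0) full
    in gen<p , record { unit = small-unit (lt-yes⁻¹ pos) gen<p ; order = λ j 1≤j j<p h → contradiction
         (trans (sym (cong₂ _*_ (lt-yes 1≤j) (eq-yes (rem-one h)))) (Σ<-zero⁻¹ (p ∸ 1) (eq-yes⁻¹ ord) j j<p)) λ () }
    where
    no-order : ∀ g → PrimitiveRoot g → ∀ j → j < p ∸ 1 → lt 0 j * eq (rem (g ^ j) p) 1 ≡ 0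
    no-order g root zero    _   = refl
    no-order g root (suc j) j<p = trans (ℕₚ.+-identityʳ _) (eq-no (λ h → PrimitiveRoot.order root (suc j) (s≤s z≤n) j<p (rem≡⇒≈ (trans h (sym (rem-small 2≤p))))))

  dlog-correct : ∀ {a} → Unit a → gen p ^ dlog p a ≈ a
  dlog-correct {a} ua =
    let j , j<p , h = discrete-log (proj₂ gen-correct) ua
    in rem≡⇒≈ (eq-yes⁻¹ (proj₂ (mu-correct (p ∸ 1) (λ z → eq-bit (rem (gen p ^ z) p) (rem a p)) j j<p (eq-yes (≈⇒rem≡ h)))))

  Π<-zero : ∀ N f z → z < N → f z ≈ 0 → Π< N f ≈ 0
  Π<-zero (suc N) f z (s≤s z≤N) h with ℕₚ.m≤n⇒m<n∨m≡n z≤N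
  ... | inj₂ refl = ≋-trans (≈-* h (≋-refl {a = + Π< N f})) ≋-refl
  ... | inj₁ z<N  = ≋-trans (≈-* (≋-refl {a = + f N}) (Π<-zero N f z z<N h)) (≋-reflexive (cong +_ (ℕₚ.*-zeroʳ (f N))))

  Π<-dlog : ∀ N f → (∀ z → z < N → Unit (f z)) → gen p ^ Σ< N (λ z → dlog p (f z)) ≈ Π< N f
  Π<-dlog zero    f u = ≋-refl
  Π<-dlog (suc N) f u = ≋-trans (≋-reflexive (cong +_ (ℕₚ.^-distribˡ-+-* (gen p) (dlog p (f N)) _)))
    (≈-* (dlog-correct (u N ℕₚ.≤-refl)) (Π<-dlog N f (λ z z<N → u z (ℕₚ.m<n⇒m<1+n z<N))))

  prodMod-correct : ∀ N f → prodMod p N f ≡ rem (Π< N f) p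
  prodMod-correct N f with ℕₚ.anyUpTo? (λ z → rem (f z) p ℕ.≟ 0) N
  ... | yes (z , z<N , h) = trans (cong (_* rem (gen p ^ Σ< N (λ z → dlog p (f z))) p)
        (eq-no λ e → contradiction (trans (sym (eq-yes h)) (Σ<-zero⁻¹ N e z z<N)) λ ()))
      (sym (trans (≈⇒rem≡ (Π<-zero N f z z<N (rem≡⇒≈ (trans h (sym (rem-small 1≤p)))))) (rem-small 1≤p)))
  ... | no none = trans (cong₂ _*_ (eq-yes (Σ<-zero N (λ z z<N → eq-no (λ h → none (z , z<N , h)))))
        (≈⇒rem≡ (Π<-dlog N f (λ z z<N h → none (z , z<N , trans (≈⇒rem≡ h) (rem-small 1≤p)))))) (ℕₚ.+-identityʳ _)

-- Carries a predicate under a second bound variable. In `easy-mu` it is tested at all y below the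
-- current z.
easy-skip : ∀ {r} {f : ℕ → Vec ℕ (suc r) → ℕ} → Easy f → Easy {suc (suc r)} (λ n v → f n (head v ∷ tail (tail v)))
easy-skip {r} {f} ef a = let b , s , sB , W = ef a in b , s , sB , λ n →
  let iw = inputWords {suc (suc r)} {pw a n}
      p , q = splitV (head iw) {concat (tail iw)} allV
      cs , csC , csN = call (W n) (head iw ∷ tail (tail iw)) (thereV (appendV p (proj₂ (splitV (head (tail iw)) q)))) here
  in wordFunction cs csC (λ { (y ∷ z ∷ x) → trans (csN (y ∷ z ∷ x)) (cong (f n) (cong₂ (λ a b → num a ∷ map num b)
       (Vecₚ.∷-injectiveˡ (inputWords-⟨⟩ (y ∷ z ∷ x))) (Vecₚ.∷-injectiveʳ (Vecₚ.∷-injectiveʳ (inputWords-⟨⟩ (y ∷ z ∷ x)))))) })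

module _ (collapse : Collapse) where

  abstract
    easy-mu : ∀ {r} {N : ℕ → Vec ℕ r → ℕ} {P : ℕ → Vec ℕ (suc r) → ℕ} → Easy N → Easy P → Easy (λ n v → mu (N n v) (λ z → P n (z ∷ v)))
    easy-mu {P = P} eN eP = easy-Σ collapse eN (easy-ext {g = λ n v → head v * (P n v * eq (Σ< (head v) (λ y → P n (y ∷ tail v))) 0)} (λ { n (z ∷ v) → refl }) (easy-* v0 (easy-* eP (easy-eq (easy-Σ collapse v0 (easy-skip eP)) (easy-lit 0)))))

  module _ {r} {p : ℕ → Vec ℕ r → ℕ} (ep : Easy p) where abstract

    easy-isPrime : Easy (λ n v → isPrime (p n v))
    easy-isPrime = easy-* (easy-lt (easy-lit 1) ep) (easy-eq (easy-Σ collapse ep (easy-* (easy-lt (easy-lit 1) v0) (easy-eq (easy-rem collapse (easy-weaken ep) v0) (easy-lit 0)))) (easy-lit 0))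

    easy-gen : Easy (λ n v → gen (p n v))
    easy-gen = easy-mu ep (easy-* (easy-lt (easy-lit 0) v0) (easy-eq (easy-Σ collapse (easy-∸ collapse (easy-weaken ep) (easy-lit 1))
      (easy-* (easy-lt (easy-lit 0) v0) (easy-eq (easy-powmod collapse (easy-weaken v0) v0 (easy-weaken (easy-weaken ep))) (easy-lit 1)))) (easy-lit 0)))

  abstract
    easy-dlog : ∀ {r} {p a : ℕ → Vec ℕ r → ℕ} → Easy p → Easy a → Easy (λ n v → dlog (p n v) (a n v))
    easy-dlog ep ea = easy-mu (easy-∸ collapse ep (easy-lit 1)) (easy-eq (easy-powmod collapse (easy-weaken (easy-gen ep)) v0 (easy-weaken ep)) (easy-weaken (easy-rem collapse ea ep)))

    -- The product has far too many bits, but the sum of the logarithms of its factors has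
    -- polynomially many and is an admissible exponent for `easy-powmod`.
    easy-prodMod : ∀ {r} {p N : ℕ → Vec ℕ r → ℕ} {f : ℕ → Vec ℕ (suc r) → ℕ} → Easy p → Easy N → Easy f →
      Easy (λ n v → prodMod (p n v) (N n v) (λ z → f n (z ∷ v)))
    easy-prodMod ep eN ef = easy-* (easy-eq (easy-Σ collapse eN (easy-eq (easy-rem collapse ef (easy-weaken ep)) (easy-lit 0))) (easy-lit 0))
      (easy-powmod collapse (easy-gen ep) (easy-Σ collapse eN (easy-dlog (easy-weaken ep) ef)) ep)

-- Density of the primes

-- T i k is the binomial coefficient (i + k choose k).
T△ : ℕ → ℕ → ℕ
T△ zero    k       = 1
T△ (suc i) zero    = 1
T△ (suc i) (suc k) = T△ i (suc k) + T△ (suc i) k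

T△-zeroʳ : ∀ i → T△ i 0 ≡ 1
T△-zeroʳ zero    = refl
T△-zeroʳ (suc i) = refl

-- The absorption identities for binomial coefficients. Each of the two is the other one after a
-- single use of Pascal's rule, hence the mutual recursion.
T△-absorbʳ : ∀ i k → suc k * T△ i (suc k) ≡ suc (i + k) * T△ i k
T△-absorbˡ : ∀ i k → suc i * T△ (suc i) k ≡ suc (i + k) * T△ i k

T△-absorbʳ zero    k = refl
T△-absorbʳ (suc i) k = begin
  suc k * (T△ i (suc k) + T△ (suc i) k)          ≡⟨ ℕₚ.*-distribˡ-+ (suc k) (T△ i (suc k)) (T△ (suc i) k) ⟩
  suc k * T△ i (suc k) + suc k * T△ (suc i) k    ≡⟨ cong (_+ suc k * T△ (suc i) k) (trans (T△-absorbʳ i k) (sym (T△-absorbˡ i k))) ⟩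
  suc i * T△ (suc i) k + suc k * T△ (suc i) k    ≡⟨ lem i k (T△ (suc i) k) ⟩
  suc (suc i + k) * T△ (suc i) k ∎
  where
  open ≡-Reasoning
  lem : ∀ i k x → suc i * x + suc k * x ≡ suc (suc i + k) * x
  lem = ℕSolver.solve-∀

T△-absorbˡ i zero    = trans (ℕₚ.*-identityʳ (suc i)) (sym (trans (cong₂ _*_ (cong suc (ℕₚ.+-identityʳ i)) (T△-zeroʳ i)) (ℕₚ.*-identityʳ (suc i))))
T△-absorbˡ i (suc k) = begin
  suc i * (T△ i (suc k) + T△ (suc i) k)          ≡⟨ ℕₚ.*-distribˡ-+ (suc i) (T△ i (suc k)) (T△ (suc i) k) ⟩
  suc i * T△ i (suc k) + suc i * T△ (suc i) k    ≡⟨ cong (λ z → suc i * T△ i (suc k) + z) (trans (T△-absorbˡ i k) (sym (T△-absorbʳ i k))) ⟩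
  suc i * T△ i (suc k) + suc k * T△ i (suc k)    ≡⟨ lem i k (T△ i (suc k)) ⟩
  suc (i + suc k) * T△ i (suc k) ∎
  where
  open ≡-Reasoning
  lem : ∀ i k x → suc i * x + suc k * x ≡ suc (i + suc k) * x
  lem = ℕSolver.solve-∀

-- Leibniz' harmonic triangle: 1/((i+k+1) T i k) is an integer combination of 1, 1/2, ..., 1/(i+k+1).
leibniz : ∀ {D n} → (∀ j → 1 ≤ j → j ≤ suc n → j ∣ D) → ∀ k i → i + k ≤ n → suc (i + k) * T△ i k ∣ D
leibniz {D} {n} common zero    i h = subst (_∣ D) (sym (trans (cong₂ _*_ (cong suc (ℕₚ.+-identityʳ i)) (T△-zeroʳ i)) (ℕₚ.*-identityʳ (suc i))))
  (common (suc i) (s≤s z≤n) (s≤s (subst (_≤ n) (ℕₚ.+-identityʳ i) h)))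
leibniz {D} {n} common (suc k) i h = combine
  (leibniz common k i (ℕₚ.≤-trans (ℕₚ.+-monoʳ-≤ i (ℕₚ.n≤1+n k)) h))
  (leibniz common k (suc i) (subst (_≤ n) (ℕₚ.+-suc i k) h))
  where
  combine : suc (i + k) * T△ i k ∣ D → suc (suc i + k) * T△ (suc i) k ∣ D → suc (i + suc k) * T△ i (suc k) ∣ D
  -- With n = i + k, the entry 1/((n+2) T i (k+1)) is 1/((n+1) T i k) - 1/((n+2) T (i+1) k). Times D
  -- it is u - v. The equation is proved after multiplication by k + 1, which lets the absorption
  -- identities apply.
  combine (divides u hu) (divides v hv) = divides ℤ.∣ + u ℤ.- + v ∣
      (trans (cong ℤ.∣_∣ (ℤₚ.*-cancelˡ-≡ (+ suc k) (+ D) _ scaled)) (ℤₚ.abs-* (+ u ℤ.- + v) (+ (suc (i + suc k) * T△ i (suc k)))))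
    where
    open ≡-Reasoning
    A K N X Y Z Dz : ℤ
    A = + suc i
    K = + suc k
    N = + suc (i + k)
    X = + T△ i k
    Y = + T△ (suc i) k
    Z = + T△ i (suc k)
    Dz = + D
    N′ : + suc (i + suc k) ≡ ℤ.1ℤ ℤ.+ N
    N′ = cong +_ (cong suc (ℕₚ.+-suc i k))
    hu′ : Dz ≡ + u ℤ.* (N ℤ.* X)
    hu′ = trans (cong +_ hu) (trans (ℤₚ.pos-* u _) (cong (+ u ℤ.*_) (ℤₚ.pos-* (suc (i + k)) (T△ i k))))
    hv′ : Dz ≡ + v ℤ.* ((ℤ.1ℤ ℤ.+ N) ℤ.* Y)
    hv′ = trans (cong +_ hv) (trans (ℤₚ.pos-* v _) (cong (+ v ℤ.*_) (ℤₚ.pos-* (suc (suc i + k)) (T△ (suc i) k))))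
    absR : K ℤ.* Z ≡ N ℤ.* X
    absR = trans (sym (ℤₚ.pos-* (suc k) (T△ i (suc k)))) (trans (cong +_ (T△-absorbʳ i k)) (ℤₚ.pos-* (suc (i + k)) (T△ i k)))
    absL : A ℤ.* Y ≡ N ℤ.* X
    absL = trans (sym (ℤₚ.pos-* (suc i) (T△ (suc i) k))) (trans (cong +_ (T△-absorbˡ i k)) (ℤₚ.pos-* (suc (i + k)) (T△ i k)))
    A+K : K ≡ (ℤ.1ℤ ℤ.+ N) ℤ.- A
    A+K = trans (lem (+ i) (+ k)) refl
      where
      lem : ∀ i k → ℤ.1ℤ ℤ.+ k ≡ ℤ.1ℤ ℤ.+ (ℤ.1ℤ ℤ.+ (i ℤ.+ k)) ℤ.- (ℤ.1ℤ ℤ.+ i)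
      lem = ℤSolver.solve-∀
    scaled : K ℤ.* Dz ≡ K ℤ.* ((+ u ℤ.- + v) ℤ.* + (suc (i + suc k) * T△ i (suc k)))
    scaled = sym (begin
      K ℤ.* ((+ u ℤ.- + v) ℤ.* + (suc (i + suc k) * T△ i (suc k)))
        ≡⟨ cong (λ z → K ℤ.* ((+ u ℤ.- + v) ℤ.* z)) (trans (ℤₚ.pos-* (suc (i + suc k)) (T△ i (suc k))) (cong (ℤ._* Z) N′)) ⟩
      K ℤ.* ((+ u ℤ.- + v) ℤ.* ((ℤ.1ℤ ℤ.+ N) ℤ.* Z))      ≡⟨ l1 K (+ u) (+ v) N Z ⟩
      (+ u ℤ.- + v) ℤ.* ((ℤ.1ℤ ℤ.+ N) ℤ.* (K ℤ.* Z))      ≡⟨ cong (λ z → (+ u ℤ.- + v) ℤ.* ((ℤ.1ℤ ℤ.+ N) ℤ.* z)) absR ⟩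
      (+ u ℤ.- + v) ℤ.* ((ℤ.1ℤ ℤ.+ N) ℤ.* (N ℤ.* X))      ≡⟨ l2 (+ u) (+ v) N (N ℤ.* X) ⟩
      (ℤ.1ℤ ℤ.+ N) ℤ.* (+ u ℤ.* (N ℤ.* X)) ℤ.- + v ℤ.* ((ℤ.1ℤ ℤ.+ N) ℤ.* (N ℤ.* X))
        ≡⟨ cong₂ (λ p q → (ℤ.1ℤ ℤ.+ N) ℤ.* p ℤ.- + v ℤ.* ((ℤ.1ℤ ℤ.+ N) ℤ.* q)) (sym hu′) (sym absL) ⟩
      (ℤ.1ℤ ℤ.+ N) ℤ.* Dz ℤ.- + v ℤ.* ((ℤ.1ℤ ℤ.+ N) ℤ.* (A ℤ.* Y)) ≡⟨ l3 N Dz (+ v) A Y ⟩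
      (ℤ.1ℤ ℤ.+ N) ℤ.* Dz ℤ.- A ℤ.* (+ v ℤ.* ((ℤ.1ℤ ℤ.+ N) ℤ.* Y)) ≡⟨ cong (λ z → (ℤ.1ℤ ℤ.+ N) ℤ.* Dz ℤ.- A ℤ.* z) (sym hv′) ⟩
      (ℤ.1ℤ ℤ.+ N) ℤ.* Dz ℤ.- A ℤ.* Dz ≡⟨ l4 N A Dz ⟩
      ((ℤ.1ℤ ℤ.+ N) ℤ.- A) ℤ.* Dz ≡⟨ cong (ℤ._* Dz) (sym A+K) ⟩
      K ℤ.* Dz ∎)
      where
      l1 : ∀ K u v N Z → K ℤ.* ((u ℤ.- v) ℤ.* ((ℤ.1ℤ ℤ.+ N) ℤ.* Z)) ≡ (u ℤ.- v) ℤ.* ((ℤ.1ℤ ℤ.+ N) ℤ.* (K ℤ.* Z))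
      l1 = ℤSolver.solve-∀
      l2 : ∀ u v N Q → (u ℤ.- v) ℤ.* ((ℤ.1ℤ ℤ.+ N) ℤ.* Q) ≡ (ℤ.1ℤ ℤ.+ N) ℤ.* (u ℤ.* Q) ℤ.- v ℤ.* ((ℤ.1ℤ ℤ.+ N) ℤ.* Q)
      l2 = ℤSolver.solve-∀
      l3 : ∀ N D v A Y → (ℤ.1ℤ ℤ.+ N) ℤ.* D ℤ.- v ℤ.* ((ℤ.1ℤ ℤ.+ N) ℤ.* (A ℤ.* Y)) ≡ (ℤ.1ℤ ℤ.+ N) ℤ.* D ℤ.- A ℤ.* (v ℤ.* ((ℤ.1ℤ ℤ.+ N) ℤ.* Y))
      l3 = ℤSolver.solve-∀
      l4 : ∀ N A D → (ℤ.1ℤ ℤ.+ N) ℤ.* D ℤ.- A ℤ.* D ≡ ((ℤ.1ℤ ℤ.+ N) ℤ.- A) ℤ.* D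
      l4 = ℤSolver.solve-∀

2^≤T△ : ∀ k → 2 ^ k ≤ T△ k k
2^≤T△ zero    = s≤s z≤n
2^≤T△ (suc k) = ℕₚ.+-mono-≤ (ℕₚ.≤-trans (2^≤T△ k) (monoʳ k k)) (ℕₚ.≤-trans (ℕₚ.≤-reflexive (ℕₚ.+-identityʳ _)) (ℕₚ.≤-trans (2^≤T△ k) (monoˡ k k)))
  where
  monoʳ : ∀ i k → T△ i k ≤ T△ i (suc k)
  monoʳ zero    k = s≤s z≤n
  monoʳ (suc i) k = ℕₚ.m≤n+m _ _
  monoˡ : ∀ i k → T△ i k ≤ T△ (suc i) k
  monoˡ i zero    = ℕₚ.≤-reflexive (T△-zeroʳ i)
  monoˡ i (suc k) = ℕₚ.m≤m+n _ _

-- The product over the primes up to N of the largest power not above N is the least common multiple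
-- of 1, ..., N. Each factor is at most N, so a large least common multiple forces many primes.
module PrimePowers (N : ℕ) (1≤N : 1 ≤ N) where

  k<p^k : ∀ {p} → 2 ≤ p → ∀ k → k < p ^ k
  k<p^k 2≤p zero    = s≤s z≤n
  k<p^k {p} 2≤p (suc k) = ℕₚ.≤-trans (ℕₚ.+-mono-≤ (ℕₚ.≤-trans (s≤s z≤n) (k<p^k 2≤p k)) (ℕₚ.≤-trans (k<p^k 2≤p k) (ℕₚ.≤-reflexive (sym (ℕₚ.+-identityʳ _)))))
    (ℕₚ.*-monoˡ-≤ (p ^ k) 2≤p)

  overflow : ∀ {p} → 2 ≤ p → Σ ℕ λ e → e ≤ N × N < p ^ e × (∀ k → k < e → ¬ N < p ^ k)
  overflow {p} 2≤p = least (λ e → N ℕ.<? p ^ e) N (k<p^k 2≤p N)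

  top : ∀ {p} → Prime p → ℕ
  top {p} pr = p ^ (proj₁ (overflow (2≤prime pr)) ∸ 1)

  top-≤ : ∀ {p} (pr : Prime p) → top pr ≤ N
  top-≤ {p} pr = go (proj₁ (overflow (2≤prime pr))) (proj₁ (proj₂ (proj₂ (overflow (2≤prime pr))))) (proj₂ (proj₂ (proj₂ (overflow (2≤prime pr)))))
    where
    go : ∀ e → N < p ^ e → (∀ k → k < e → ¬ N < p ^ k) → p ^ (e ∸ 1) ≤ N
    go zero    h min = 1≤N
    go (suc e) h min = ℕₚ.≮⇒≥ (min e ℕₚ.≤-refl)

  top-∣ : ∀ {p} (pr : Prime p) v → p ^ v ≤ N → p ^ v ∣ top pr
  top-∣ {p} pr v h = divides (p ^ (E ∸ 1 ∸ v)) (trans (cong (p ^_) (sym (ℕₚ.m∸n+n≡m v≤))) (ℕₚ.^-distribˡ-+-* p (E ∸ 1 ∸ v) v))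
    where
    instance _ = prime⇒nonZero pr
    E : ℕ
    E = proj₁ (overflow (2≤prime pr))
    v<E : v < E
    v<E = ℕₚ.≰⇒> λ E≤v → contradiction h (ℕₚ.<⇒≱ (ℕₚ.<-≤-trans (proj₁ (proj₂ (proj₂ (overflow (2≤prime pr))))) (ℕₚ.^-monoʳ-≤ p E≤v)))
    v≤ : v ≤ E ∸ 1
    v≤ = ℕₚ.∸-monoˡ-≤ 1 v<E

  weight′ : ∀ {p} → Dec (Prime p) → ℕ
  weight′ (yes pr) = top pr
  weight′ (no _)   = 1

  weight : ℕ → ℕ
  weight p = weight′ (prime? p)

  weight-≤ : ∀ p → weight p ≤ N ^ isPrime p
  weight-≤ p with prime? p
  ... | yes pr = ℕₚ.≤-trans (top-≤ pr) (ℕₚ.≤-reflexive (sym (trans (cong (N ^_) (isPrime-complete pr)) (ℕₚ.*-identityʳ N))))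
  ... | no _   = ℕₚ.m^n>0 N ⦃ ℕ.>-nonZero 1≤N ⦄ (isPrime p)

  product-≤ : ∀ M → Π< M weight ≤ N ^ Σ< M isPrime
  product-≤ zero    = s≤s z≤n
  product-≤ (suc M) = ℕₚ.≤-trans (ℕₚ.*-mono-≤ (weight-≤ M) (product-≤ M)) (ℕₚ.≤-reflexive (sym (ℕₚ.^-distribˡ-+-* N (isPrime M) (Σ< M isPrime))))

  1≤product : ∀ M → 1 ≤ Π< M weight
  1≤product zero    = s≤s z≤n
  1≤product (suc M) = ℕₚ.*-mono-≤ (1≤weight M) (1≤product M)
    where
    1≤weight : ∀ p → 1 ≤ weight p
    1≤weight p with prime? p
    ... | yes pr = ℕₚ.m^n>0 p ⦃ prime⇒nonZero pr ⦄ (proj₁ (overflow (2≤prime pr)) ∸ 1)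
    ... | no _   = s≤s z≤n

  -- The induction strips the full power of the prime M from j. This power is at most N and
  -- therefore divides the weight of M.
  common-multiple : ∀ M j → 1 ≤ j → j ≤ N → (∀ q → Prime q → q ∣ j → q < M) → j ∣ Π< M weight
  common-multiple zero    (suc zero)     1≤j j≤N h = 1∣ 1
  common-multiple zero    j@(suc (suc k)) 1≤j j≤N h = let q , pq , q∣j = prime-divisor j (s≤s (s≤s z≤n)) in contradiction (h q pq q∣j) λ ()
  common-multiple (suc M) j 1≤j j≤N h with prime? M
  ... | no ¬pM = ∣n⇒∣m*n 1 (common-multiple M j 1≤j j≤N (λ q pq q∣j → ℕₚ.≤∧≢⇒< (ℕₚ.≤-pred (h q pq q∣j)) (λ { refl → ¬pM pq })))
  ... | yes pM with split-power M j j (2≤prime pM) 1≤j ℕₚ.≤-refl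
  ...   | v , u , refl , M∤u = *-pres-∣ (top-∣ pM v (ℕₚ.≤-trans (∣⇒≤ ⦃ ℕ.>-nonZero 1≤j ⦄ (m∣m*n u)) j≤N))
            (common-multiple M u 1≤u (ℕₚ.≤-trans (∣⇒≤ ⦃ ℕ.>-nonZero 1≤j ⦄ (n∣m*n (M ^ v))) j≤N)
              (λ q pq q∣u → ℕₚ.≤∧≢⇒< (ℕₚ.≤-pred (h q pq (∣n⇒∣m*n (M ^ v) q∣u))) (λ { refl → M∤u q∣u })))
    where
    1≤u : 1 ≤ u
    1≤u = ℕₚ.n≢0⇒n>0 λ { refl → contradiction (subst (1 ≤_) (ℕₚ.*-zeroʳ (M ^ v)) 1≤j) λ () }

-- The primes 2 and 5 must be avoided: the blocks have to be odd so that (A + 1)/2 is an integer,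
-- and the modulus has to be invertible modulo 5.
bigPrime : ℕ → ℕ
bigPrime p = isPrime p * le 6 p

bigPrime-big : ∀ p → 6 ≤ p → bigPrime p ≡ isPrime p
bigPrime-big p 6≤p = trans (cong (isPrime p *_) (lt-yes (s≤s 6≤p))) (ℕₚ.*-identityʳ (isPrime p))

-- For N = 2k + 1 = 2^(m+1) - 1 the least common multiple of 1, ..., N is divisible by 2k + 1 times
-- the central binomial coefficient, hence at least 2^k. It is also at most N to the number of
-- primes up to N.
prime-count : ∀ m → 2 ^ m ∸ 1 ≤ suc m * Σ< (2 ^ suc m) isPrime
prime-count m = ℕₚ.≮⇒≥ λ h → contradiction bound (ℕₚ.<⇒≱ (ℕₚ.^-monoʳ-< 2 (s≤s (s≤s z≤n)) h))
  where
  open ℕₚ.≤-Reasoning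
  k N : ℕ
  k = 2 ^ m ∸ 1
  N = suc (k + k)
  open PrimePowers N (s≤s z≤n)
  suc-k : suc k ≡ 2 ^ m
  suc-k = ℕₚ.m+[n∸m]≡n (ℕₚ.m^n>0 2 m)
  suc-N : suc N ≡ 2 ^ suc m
  suc-N = trans (lem k) (cong (2 *_) suc-k)
    where
    lem : ∀ k → suc (suc (k + k)) ≡ 2 * suc k
    lem = ℕSolver.solve-∀
  D : ℕ
  D = Π< (suc N) weight
  divides-D : ∀ j → 1 ≤ j → j ≤ N → j ∣ D
  divides-D j 1≤j j≤N = common-multiple (suc N) j 1≤j j≤N (λ q pq q∣j → s≤s (ℕₚ.≤-trans (∣⇒≤ ⦃ ℕ.>-nonZero 1≤j ⦄ q∣j) j≤N))
  bound : 2 ^ k ≤ 2 ^ (suc m * Σ< (2 ^ suc m) isPrime)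
  bound = begin
    2 ^ k                          ≤⟨ 2^≤T△ k ⟩
    T△ k k                         ≤⟨ ℕₚ.m≤m+n _ _ ⟩
    suc (k + k) * T△ k k           ≤⟨ ∣⇒≤ ⦃ ℕ.>-nonZero (1≤product (suc N)) ⦄ (leibniz divides-D k k ℕₚ.≤-refl) ⟩
    D                              ≤⟨ product-≤ (suc N) ⟩
    N ^ Σ< (suc N) isPrime         ≤⟨ ℕₚ.^-monoˡ-≤ (Σ< (suc N) isPrime) (ℕₚ.n≤1+n N) ⟩
    suc N ^ Σ< (suc N) isPrime     ≡⟨ cong (λ z → z ^ Σ< z isPrime) suc-N ⟩
    (2 ^ suc m) ^ Σ< (2 ^ suc m) isPrime ≡⟨ ℕₚ.^-*-assoc 2 (suc m) (Σ< (2 ^ suc m) isPrime) ⟩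
    2 ^ (suc m * Σ< (2 ^ suc m) isPrime) ∎

-- The 3 stands for the primes 2, 3 and 5.
bigPrime-count : ∀ d → Σ< (6 + d) isPrime ≤ 3 + Σ< (6 + d) bigPrime
bigPrime-count zero    = ℕₚ.≤-refl
bigPrime-count (suc d) = begin
  isPrime (6 + d) + Σ< (6 + d) isPrime        ≤⟨ ℕₚ.+-mono-≤ (ℕₚ.≤-reflexive (sym (bigPrime-big (6 + d) (ℕₚ.m≤m+n 6 d)))) (bigPrime-count d) ⟩
  bigPrime (6 + d) + (3 + Σ< (6 + d) bigPrime) ≡⟨ lem (bigPrime (6 + d)) (Σ< (6 + d) bigPrime) ⟩
  3 + (bigPrime (6 + d) + Σ< (6 + d) bigPrime) ∎
  where
  open ℕₚ.≤-Reasoning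
  lem : ∀ a b → a + (3 + b) ≡ 3 + (a + b)
  lem = ℕSolver.solve-∀

-- Take m = 2t + 11 in `prime-count` and x = 2^t. With fewer than x big primes, 2^m - 1 would be at
-- most 14x · 3x = 42x², but 2^m is 2048x².
prime-supply : ∀ t → 2 ^ t ≤ Σ< (2 ^ (2 * t + 12)) bigPrime
prime-supply t = ℕₚ.≮⇒≥ λ h → contradiction (enough h) (ℕₚ.<⇒≱ tooMany)
  where
  open ℕₚ.≤-Reasoning
  m B : ℕ
  m = 2 * t + 11
  B = Σ< (2 ^ (2 * t + 12)) bigPrime
  x : ℕ
  x = 2 ^ t
  m+1 : suc m ≡ 2 * t + 12
  m+1 = lem t
    where
    lem : ∀ t → suc (2 * t + 11) ≡ 2 * t + 12
    lem = ℕSolver.solve-∀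
  6≤ : 6 ≤ 2 ^ suc m
  6≤ = ℕₚ.≤-trans (ℕₚ.m≤m+n 6 4090) (ℕₚ.^-monoʳ-≤ 2 {12} {suc m} (subst (12 ≤_) (sym m+1) (ℕₚ.m≤n+m 12 (2 * t))))
  count : Σ< (2 ^ suc m) isPrime ≤ 3 + B
  count = subst (λ z → Σ< z isPrime ≤ 3 + Σ< z bigPrime) (ℕₚ.m+[n∸m]≡n 6≤) (bigPrime-count (2 ^ suc m ∸ 6)) |> λ h → subst (λ z → Σ< (2 ^ suc m) isPrime ≤ 3 + Σ< (2 ^ z) bigPrime) m+1 h
    where
    _|>_ : ∀ {A C : Set} → A → (A → C) → C
    a |> f = f a
  t<x : t < x
  t<x = lem t
    where
    lem : ∀ t → t < 2 ^ t
    lem zero    = s≤s z≤n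
    lem (suc t) = ℕₚ.≤-trans (ℕₚ.+-mono-≤ (ℕₚ.m^n>0 2 t) (lem t)) (ℕₚ.≤-reflexive (cong (λ z → 2 ^ t + z) (sym (ℕₚ.+-identityʳ _))))
  enough : B < x → 2 ^ m ∸ 1 ≤ (14 * x) * (3 * x)
  enough h = begin
    2 ^ m ∸ 1                        ≤⟨ prime-count m ⟩
    suc m * Σ< (2 ^ suc m) isPrime   ≤⟨ ℕₚ.*-mono-≤ m≤ (ℕₚ.≤-trans count (ℕₚ.≤-trans (ℕₚ.+-monoʳ-≤ 2 h) x3)) ⟩
    (14 * x) * (3 * x) ∎
    where
    1≤x : 1 ≤ x
    1≤x = ℕₚ.m^n>0 2 t
    x3 : 2 + x ≤ 3 * x
    x3 = ℕₚ.≤-trans (ℕₚ.+-monoˡ-≤ x (ℕₚ.*-monoʳ-≤ 2 1≤x)) (ℕₚ.≤-reflexive (lem x))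
      where
      lem : ∀ x → 2 * x + x ≡ 3 * x
      lem = ℕSolver.solve-∀
    m≤ : suc m ≤ 14 * x
    m≤ = begin
      suc m             ≡⟨ m+1 ⟩
      2 * t + 12        ≤⟨ ℕₚ.+-mono-≤ (ℕₚ.*-monoʳ-≤ 2 (ℕₚ.<⇒≤ t<x)) (ℕₚ.*-monoʳ-≤ 12 1≤x) ⟩
      2 * x + 12 * x    ≡⟨ lem x ⟩
      14 * x            ∎
      where
      lem : ∀ x → 2 * x + 12 * x ≡ 14 * x
      lem = ℕSolver.solve-∀
  tooMany : (14 * x) * (3 * x) < 2 ^ m ∸ 1
  tooMany = ℕₚ.m+n≤o⇒m≤o∸n (suc ((14 * x) * (3 * x))) (begin
    suc (14 * x * (3 * x)) + 1       ≡⟨ lem x ⟩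
    2 + 42 * (x * x)                 ≤⟨ ℕₚ.+-monoˡ-≤ _ (ℕₚ.*-monoʳ-≤ 2 (ℕₚ.*-mono-≤ (ℕₚ.m^n>0 2 t) (ℕₚ.m^n>0 2 t))) ⟩
    2 * (x * x) + 42 * (x * x)       ≤⟨ ℕₚ.≤-trans (ℕₚ.≤-reflexive (sym (ℕₚ.*-distribʳ-+ (x * x) 2 42))) (ℕₚ.*-monoˡ-≤ (x * x) (ℕₚ.m≤m+n 44 2004)) ⟩
    2048 * (x * x)                   ≡⟨ cong (2048 *_) (trans (sym (ℕₚ.^-distribˡ-+-* 2 t t)) (cong (λ z → 2 ^ (t + z)) (sym (ℕₚ.+-identityʳ t)))) ⟩
    2 ^ 11 * 2 ^ (2 * t)             ≡⟨ sym (ℕₚ.^-distribˡ-+-* 2 11 (2 * t)) ⟩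
    2 ^ (11 + 2 * t)                 ≡⟨ cong (2 ^_) (ℕₚ.+-comm 11 (2 * t)) ⟩
    2 ^ m ∎)
    where
    lem : ∀ x → suc (14 * x * (3 * x)) + 1 ≡ 2 + 42 * (x * x)
    lem = ℕSolver.solve-∀

-- Signed digits of an integer from its residues

-- The position of a big prime in their enumeration; the blocks are intervals of positions.
idx : ℕ → ℕ
idx p = Σ< p bigPrime

-- For a bit b this is p or 1, so that a product over selected primes becomes one over all p below
-- P, as `prodMod` requires.
pick : ℕ → ℕ → ℕ
pick b p = b * p + (1 ∸ b)

-- W is the number of primes per block; P bounds the primes in use; Xr gives the residues of the encoded integer.
firstBlocks inBlock : ℕ → ℕ → ℕ → ℕ
firstBlocks W k p = bigPrime p * lt (idx p) (k * W)
inBlock     W j p = bigPrime p * (le (j * W) (idx p) * lt (idx p) (suc j * W))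

blockProd modulus : ℕ → ℕ → ℕ → ℕ
blockProd W P j = Π< P (λ p → pick (inBlock W j p) p)
modulus   W P k = Π< P (λ p → pick (firstBlocks W k p) p)

-- For a selected prime p this is the modulus divided by p.
cofactor : ℕ → ℕ → ℕ → ℕ → ℕ
cofactor W P k p = Π< P (λ p′ → pick (firstBlocks W k p′ * (1 ∸ eq p p′)) p′)

-- numerator / modulus is very close to 2^{-k}.
numerator : ℕ → ℕ → ℕ → ℕ
numerator W P k = Π< k (λ j → quo (suc (blockProd W P j)) 2)

-- The block products, numerators and moduli have exponentially many bits and are only available
-- modulo a prime q. The halving in `numerator` becomes multiplication by (q + 1)/2, the inverse of
-- 2 for odd q.
blockRes numRes modRes : ℕ → ℕ → ℕ → ℕ → ℕ
blockRes W P q j = prodMod q P (λ p → pick (inBlock W j p) p)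
numRes   W P q k = prodMod q k (λ j → suc (blockRes W P q j) * quo (suc q) 2)
modRes   W P q k = prodMod q P (λ p → pick (firstBlocks W k p) p)

cofRes : ℕ → ℕ → ℕ → ℕ → ℕ → ℕ
cofRes W P q k p = prodMod q P (λ p′ → pick (firstBlocks W k p′ * (1 ∸ eq p p′)) p′)

-- The numerator over p in the partial fractions of X N/M: the residue of X N times the inverse of
-- M/p, the inverse being the power p - 2 by Fermat's theorem.
coef : ℕ → ℕ → (ℕ → ℕ) → ℕ → ℕ → ℕ
coef W P Xr k p = firstBlocks W k p * rem (Xr p * (numRes W P p k * rem (cofRes W P p k p ^ (p ∸ 2)) p)) p

-- The integer closest to Σ coef p / p, up to a small error.
rank : ℕ → ℕ → (ℕ → ℕ) → ℕ → ℕ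
rank W P Xr k = quo (Σ< P (λ p → quo (32 * P * coef W P Xr k p) p) + 16 * P) (32 * P)

-- The quotient Q of module CRT modulo 5: M Q = X N − S + r M, and M⁴ ≡ 1 as the primes dividing M exceed 5.
quotient5 : ℕ → ℕ → (ℕ → ℕ) → ℕ → ℕ
quotient5 W P Xr k = (Xr 5 * numRes W P 5 k + 4 * Σ< P (λ p → coef W P Xr k p * cofRes W P 5 k p) + rank W P Xr k * modRes W P 5 k) * modRes W P 5 k ^ 3

-- The signed digit Q_k − 2 Q_{k+1} lies between −2 and 2, so that adding 2 and reducing modulo 5 loses nothing.
digit : ℕ → ℕ → (ℕ → ℕ) → ℕ → ℕ
digit W P Xr k = rem (quotient5 W P Xr k + 3 * quotient5 W P Xr (suc k) + 2) 5

Π<-* : ∀ N f g → Π< N f * Π< N g ≡ Π< N (λ z → f z * g z)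
Π<-* zero    f g = refl
Π<-* (suc N) f g = trans (lem (f N) (Π< N f) (g N) (Π< N g)) (cong (f N * g N *_) (Π<-* N f g))
  where
  lem : ∀ a b c d → a * b * (c * d) ≡ a * c * (b * d)
  lem = ℕSolver.solve-∀

Π<-remove : ∀ N f g z → z < N → g z ≡ 1 → (∀ y → y ≢ z → g y ≡ f y) → Π< N f ≡ f z * Π< N g
Π<-remove (suc N) f g z (s≤s z≤N) gz e with ℕₚ.m≤n⇒m<n∨m≡n z≤N
... | inj₂ refl = cong (f N *_) (trans (Π<-cong N (λ y y<N → sym (e y (ℕₚ.<⇒≢ y<N)))) (sym (trans (cong (_* Π< N g) gz) (ℕₚ.+-identityʳ _))))
... | inj₁ z<N  = trans (cong₂ _*_ (sym (e N (λ N≡z → ℕₚ.<⇒≢ z<N (sym N≡z)))) (Π<-remove N f g z z<N gz e)) (lem (g N) (f z) (Π< N g))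
  where
  lem : ∀ a b c → a * (b * c) ≡ b * (a * c)
  lem = ℕSolver.solve-∀

Σ<-*ʳ : ∀ N h c → Σ< N h * c ≡ Σ< N (λ z → h z * c)
Σ<-*ʳ zero    h c = refl
Σ<-*ʳ (suc N) h c = trans (ℕₚ.*-distribʳ-+ c (h N) (Σ< N h)) (cong (λ z → h N * c + z) (Σ<-*ʳ N h c))

Σ<-mono : ∀ N {h h′} → (∀ z → z < N → h z ≤ h′ z) → Σ< N h ≤ Σ< N h′
Σ<-mono zero    e = z≤n
Σ<-mono (suc N) e = ℕₚ.+-mono-≤ (e N ℕₚ.≤-refl) (Σ<-mono N (λ z z<N → e z (ℕₚ.m<n⇒m<1+n z<N)))

Σ<-suc : ∀ N h → Σ< N (λ z → suc (h z)) ≡ Σ< N h + N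
Σ<-suc zero    h = refl
Σ<-suc (suc N) h = trans (cong (λ z → suc (h N) + z) (Σ<-suc N h)) (lem (h N) (Σ< N h) N)
  where
  lem : ∀ a b c → suc a + (b + c) ≡ a + b + suc c
  lem = ℕSolver.solve-∀

bigPrime-bit : ∀ p → Bit (bigPrime p)
bigPrime-bit p = *-bit (isPrime-bit p) (lt-bit 6 (suc p))

bigPrime-sound : ∀ {p} → bigPrime p ≡ 1 → Prime p × 6 ≤ p
bigPrime-sound {p} h = let a , b = *-bit⁻¹ (isPrime-bit p) (lt-bit 6 (suc p)) h in isPrime-sound a , ℕₚ.≤-pred (lt-yes⁻¹ b)

firstBlocks-bit : ∀ W k p → Bit (firstBlocks W k p)
firstBlocks-bit W k p = *-bit (bigPrime-bit p) (lt-bit (idx p) (k * W))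

inBlock-bit : ∀ W j p → Bit (inBlock W j p)
inBlock-bit W j p = *-bit (bigPrime-bit p) (*-bit (lt-bit (j * W) (suc (idx p))) (lt-bit (idx p) (suc j * W)))

firstBlocks-sound : ∀ W k {p} → firstBlocks W k p ≡ 1 → Prime p × 6 ≤ p
firstBlocks-sound W k {p} h = bigPrime-sound (proj₁ (*-bit⁻¹ (bigPrime-bit p) (lt-bit (idx p) (k * W)) h))

inBlock-sound : ∀ W j {p} → inBlock W j p ≡ 1 → Prime p × 6 ≤ p
inBlock-sound W j {p} h = bigPrime-sound (proj₁ (*-bit⁻¹ (bigPrime-bit p) (*-bit (lt-bit (j * W) (suc (idx p))) (lt-bit (idx p) (suc j * W))) h))

pick-0 : ∀ {b} p → b ≡ 0 → pick b p ≡ 1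
pick-0 p refl = refl

pick-1 : ∀ {b} p → b ≡ 1 → pick b p ≡ p
pick-1 p refl = trans (ℕₚ.+-identityʳ _) (ℕₚ.+-identityʳ p)

distinct-primes : ∀ {p q} → Prime p → Prime q → p ≢ q → ¬ q ∣ p
distinct-primes pp pq p≢q d with prime⇒irreducible pp d
... | inj₁ refl = contradiction (2≤prime pq) λ { (s≤s ()) }
... | inj₂ q≡p  = p≢q (sym q≡p)

module _ {q : ℕ} (pq : Prime q) where
  open ModPrime pq

  Π<-≈ : ∀ N {f g} → (∀ z → f z ≈ g z) → Π< N f ≈ Π< N g
  Π<-≈ zero    e = ≋-refl
  Π<-≈ (suc N) e = ≈-* (e N) (Π<-≈ N e)

  Π<-unit : ∀ N {f} → (∀ z → Unit (f z)) → Unit (Π< N f)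
  Π<-unit zero    u = unit-1
  Π<-unit (suc N) u = unit-* (u N) (Π<-unit N u)

  Σ<-≈0 : ∀ N {h} → (∀ z → z < N → h z ≈ 0) → Σ< N h ≈ 0
  Σ<-≈0 zero    e = ≋-refl
  Σ<-≈0 (suc N) {h} e = ≋-+ (e N ℕₚ.≤-refl) (Σ<-≈0 N (λ z z<N → e z (ℕₚ.m<n⇒m<1+n z<N)))

  Σ<-≈-single : ∀ N {h} z → z < N → (∀ y → y < N → y ≢ z → h y ≈ 0) → Σ< N h ≈ h z
  Σ<-≈-single (suc N) {h} z (s≤s z≤N) e with ℕₚ.m≤n⇒m<n∨m≡n z≤N
  ... | inj₂ refl = ≋-trans (≋-+ (≋-refl {a = + h N}) (Σ<-≈0 N (λ y y<N → e y (ℕₚ.m<n⇒m<1+n y<N) (ℕₚ.<⇒≢ y<N)))) (≋-reflexive (ℤₚ.+-identityʳ _))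
  ... | inj₁ z<N  = ≋-+ (e N ℕₚ.≤-refl (λ N≡z → ℕₚ.<⇒≢ z<N (sym N≡z))) (Σ<-≈-single N z z<N (λ y y<N → e y (ℕₚ.m<n⇒m<1+n y<N)))

  Σ<-≈ : ∀ N {h h′} → (∀ z → h z ≈ h′ z) → Σ< N h ≈ Σ< N h′
  Σ<-≈ zero    e = ≋-refl
  Σ<-≈ (suc N) e = ≋-+ (e N) (Σ<-≈ N e)

  pick-unit : ∀ {b} p → Bit b → (b ≡ 1 → Prime p × p ≢ q) → Unit (pick b p)
  pick-unit p (inj₁ refl) _ = unit-1
  pick-unit p (inj₂ refl) h u = let pp , p≢q = h refl in distinct-primes pp pq p≢q (≋0⇒∣ (+ p) (subst (_≈ 0) (pick-1 p refl) u))

  prodMod-≈ : ∀ N f → prodMod q N f ≈ Π< N f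
  prodMod-≈ N f = ≋-trans (≋-reflexive (cong +_ (prodMod-correct pq N f))) (rem-≋ (Π< N f) 1≤p)

-- The product of the earlier primes is a unit modulo the next prime, so the next prime divides the
-- quotient of Z by that product.
divisible-by-product : ∀ N {s : ℕ → ℕ} Z → (∀ p → Bit (s p)) → (∀ p → s p ≡ 1 → Prime p) →
  (∀ p → p < N → s p ≡ 1 → Z ≋ ℤ.0ℤ [ + p ]) → Z ≋ ℤ.0ℤ [ + Π< N (λ p → pick (s p) p) ]
divisible-by-product zero    Z bit pr h = cong-by Z (sym (trans (ℤₚ.+-identityˡ _) (ℤₚ.*-identityʳ Z)))
divisible-by-product (suc N) {s} Z bit pr h with divisible-by-product N Z bit pr (λ p p<N → h p (ℕₚ.m<n⇒m<1+n p<N)) | bit N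
... | ih | inj₁ sN = subst (λ m → Z ≋ ℤ.0ℤ [ + m ]) (sym (trans (cong (_* Π< N (λ p → pick (s p) p)) (pick-0 N sN)) (ℕₚ.+-identityʳ _))) ih
... | cong-by k e | inj₂ sN = finish (≋-zero-product k (+ R) (≋-trans (≋-reflexive (sym (trans e (ℤₚ.+-identityˡ _)))) (h N ℕₚ.≤-refl sN)))
  where
  open ModPrime (pr N sN)
  R : ℕ
  R = Π< N (λ p → pick (s p) p)
  R-unit : ∀ M → M ≤ N → Unit (Π< M (λ p → pick (s p) p))
  R-unit zero    _ = unit-1
  R-unit (suc M) M<N = unit-* (pick-unit (pr N sN) M (bit M) (λ sM → pr M sM , ℕₚ.<⇒≢ M<N)) (R-unit M (ℕₚ.<⇒≤ M<N))
  finish : k ≋ ℤ.0ℤ [ + N ] ⊎ + R ≋ ℤ.0ℤ [ + N ] → Z ≋ ℤ.0ℤ [ + (pick (s N) N * R) ]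
  finish (inj₂ r) = contradiction r (R-unit N ℕₚ.≤-refl)
  finish (inj₁ (cong-by k′ e′)) = cong-by k′ (begin
    Z                                   ≡⟨ trans e (ℤₚ.+-identityˡ (k ℤ.* + R)) ⟩
    k ℤ.* + R                           ≡⟨ cong (ℤ._* + R) (trans e′ (ℤₚ.+-identityˡ (k′ ℤ.* + N))) ⟩
    k′ ℤ.* + N ℤ.* + R                  ≡⟨ ℤₚ.*-assoc k′ (+ N) (+ R) ⟩
    k′ ℤ.* (+ N ℤ.* + R)                ≡⟨ cong (k′ ℤ.*_) (sym (ℤₚ.pos-* N R)) ⟩
    k′ ℤ.* + (N * R)                    ≡⟨ cong (λ z → k′ ℤ.* + (z * R)) (sym (pick-1 N sN)) ⟩
    k′ ℤ.* + (pick (s N) N * R)         ≡⟨ sym (ℤₚ.+-identityˡ _) ⟩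
    ℤ.0ℤ ℤ.+ k′ ℤ.* + (pick (s N) N * R) ∎)
    where open ≡-Reasoning

odd : ℕ → Set
odd a = rem a 2 ≡ 1

prime-odd : ∀ {p} → Prime p → 6 ≤ p → odd p
prime-odd {p} pr 6≤p with rem p 2 in e | rem-< p {2} (s≤s z≤n)
... | 1 | _ = refl
... | 0 | _ = contradiction (m%n≡0⇒n∣m p 2 e) (distinct-primes pr Data.Nat.Primality.prime[2] λ { refl → contradiction 6≤p λ { (s≤s (s≤s ())) } })
... | suc (suc _) | s≤s (s≤s ())

module _ where
  private
    p2 : Prime 2
    p2 = Data.Nat.Primality.prime[2]
  open ModPrime p2

  odd-* : ∀ {a b} → odd a → odd b → odd (a * b)
  odd-* {a} {b} ha hb = ≈⇒rem≡ p2 {a * b} {1} (≈-* {a} {1} {b} {1} (rem≡⇒≈ p2 {a} {1} ha) (rem≡⇒≈ p2 {b} {1} hb))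

Π<-odd : ∀ N {f} → (∀ z → odd (f z)) → odd (Π< N f)
Π<-odd zero    h = refl
Π<-odd (suc N) {f} h = odd-* {f N} (h N) (Π<-odd N h)

pick-odd : ∀ {b} p → Bit b → (b ≡ 1 → odd p) → odd (pick b p)
pick-odd p (inj₁ refl) h = refl
pick-odd p (inj₂ refl) h = subst odd (sym (pick-1 p refl)) (h refl)

half-odd : ∀ a → odd a → 2 * quo (suc a) 2 ≡ suc a
half-odd a h = trans (cong (2 *_) (quo-suc (m≡m%n+[m/n]*n a 2))) (trans (lem (a ℕ./ 2)) (sym (trans (cong suc (m≡m%n+[m/n]*n a 2)) (cong (λ z → suc (z + (a ℕ./ 2) * 2)) h))))
  where
  lem : ∀ q → 2 * suc q ≡ suc (1 + q * 2)
  lem = ℕSolver.solve-∀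
  quo-suc : a ≡ a ℕ.% 2 + (a ℕ./ 2) * 2 → suc a ℕ./ 2 ≡ suc (a ℕ./ 2)
  quo-suc e = trans (cong (ℕ._/ 2) (trans (cong suc (trans e (cong (_+ (a ℕ./ 2) * 2) h))) refl)) (m*n/n≡m (suc (a ℕ./ 2)) 2)

module Blocks (W P : ℕ) where

  block-odd : ∀ j → odd (blockProd W P j)
  block-odd j = Π<-odd P (λ p → pick-odd p (inBlock-bit W j p) (λ h → let pp , 6≤p = inBlock-sound W j {p} h in prime-odd {p} pp 6≤p))

  numerator-doubles : ∀ k → 2 ^ k * numerator W P k ≡ Π< k (λ j → suc (blockProd W P j))
  numerator-doubles zero    = refl
  numerator-doubles (suc k) = trans (lem (2 ^ k) (quo (suc (blockProd W P k)) 2) (numerator W P k)) (cong₂ _*_ (half-odd (blockProd W P k) (block-odd k)) (numerator-doubles k))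
    where
    lem : ∀ x h n → 2 * x * (h * n) ≡ (2 * h) * (x * n)
    lem = ℕSolver.solve-∀

  modulus-suc : ∀ k → modulus W P (suc k) ≡ blockProd W P k * modulus W P k
  modulus-suc k = trans (Π<-cong P (λ p _ → split p)) (sym (Π<-* P _ _))
    where
    cases : ∀ p {b u v w} → Bit b → (u ≡ 1 × v ≡ 0 × w ≡ 1) ⊎ (v ≡ 1 × w ≡ 0) → pick (b * u) p ≡ pick (b * (v * u)) p * pick (b * w) p
    cases p (inj₁ refl) _ = refl
    cases p (inj₂ refl) (inj₁ (refl , refl , refl)) = sym (ℕₚ.+-identityʳ (pick 1 p))
    cases p {u = u} (inj₂ refl) (inj₂ (refl , refl)) = sym (trans (ℕₚ.*-identityʳ (pick (u + 0 + 0) p)) (cong (λ z → pick z p) (ℕₚ.+-identityʳ (u + 0))))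
    compare : ∀ i → (lt i (suc k * W) ≡ 1 × le (k * W) i ≡ 0 × lt i (k * W) ≡ 1) ⊎ (le (k * W) i ≡ 1 × lt i (k * W) ≡ 0)
    compare i with ℕₚ.<-≤-connex i (k * W)
    ... | inj₁ h = inj₁ (lt-yes (ℕₚ.<-≤-trans h (ℕₚ.m≤n+m (k * W) W)) , lt-no h , lt-yes h)
    ... | inj₂ h = inj₂ (lt-yes (s≤s h) , lt-no h)
    split : ∀ p → pick (firstBlocks W (suc k) p) p ≡ pick (inBlock W k p) p * pick (firstBlocks W k p) p
    split p = cases p (bigPrime-bit p) (compare (idx p))

  modulus-product : ∀ k → modulus W P k ≡ Π< k (blockProd W P)
  modulus-product zero    = Π<-ones P (λ p → pick-0 p (trans (cong (bigPrime p *_) (lt-no (z≤n {idx p}))) (ℕₚ.*-zeroʳ (bigPrime p))))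
    where
    Π<-ones : ∀ N {f} → (∀ z → f z ≡ 1) → Π< N f ≡ 1
    Π<-ones zero    e = refl
    Π<-ones (suc N) e = cong₂ _*_ (e N) (Π<-ones N e)
  modulus-product (suc k) = trans (modulus-suc k) (cong (blockProd W P k *_) (modulus-product k))

  -- Each block with all its W primes below N contributes a factor of at least 2^W.
  block-growth : ∀ j N → 2 ^ ((idx N ∸ j * W) ℕ.⊓ W) ≤ Π< N (λ p → pick (inBlock W j p) p)
  block-growth j zero    = ℕₚ.≤-reflexive (cong (λ z → 2 ^ (z ℕ.⊓ W)) (ℕₚ.0∸n≡0 (j * W)))
  block-growth j (suc N) = grow (bigPrime-bit N)
    where
    I R : ℕ
    I = idx N
    R = Π< N (λ p → pick (inBlock W j p) p)
    pick≥1 : ∀ {b} p → Bit b → (b ≡ 1 → 1 ≤ p) → 1 ≤ pick b p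
    pick≥1 p (inj₁ refl) h = s≤s z≤n
    pick≥1 p (inj₂ refl) h = subst (1 ≤_) (sym (pick-1 p refl)) (h refl)
    keep : ∀ {x} → x ≤ R → x ≤ pick (inBlock W j N) N * R
    keep h = ℕₚ.≤-trans h (ℕₚ.≤-trans (ℕₚ.≤-reflexive (sym (ℕₚ.+-identityʳ R))) (ℕₚ.*-monoˡ-≤ R (pick≥1 N (inBlock-bit W j N) (λ h → ℕₚ.≤-trans (s≤s z≤n) (proj₂ (inBlock-sound W j h))))))
    grow : Bit (bigPrime N) → 2 ^ ((bigPrime N + I ∸ j * W) ℕ.⊓ W) ≤ pick (inBlock W j N) N * R
    grow (inj₁ b) = subst (λ z → 2 ^ ((z + I ∸ j * W) ℕ.⊓ W) ≤ pick (inBlock W j N) N * R) (sym b) (keep (block-growth j N))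
    grow (inj₂ b) with ℕₚ.<-≤-connex I (j * W)
    ... | inj₁ I<jW = subst (λ z → 2 ^ ((z + I ∸ j * W) ℕ.⊓ W) ≤ pick (inBlock W j N) N * R) (sym b)
            (keep (ℕₚ.≤-trans (ℕₚ.≤-reflexive (cong (λ z → 2 ^ (z ℕ.⊓ W)) (trans (ℕₚ.m≤n⇒m∸n≡0 I<jW) (sym (ℕₚ.m≤n⇒m∸n≡0 (ℕₚ.<⇒≤ I<jW)))))) (block-growth j N)))
    ... | inj₂ jW≤I with ℕₚ.<-≤-connex I (suc j * W)
    ...   | inj₂ full = subst (λ z → 2 ^ ((z + I ∸ j * W) ℕ.⊓ W) ≤ pick (inBlock W j N) N * R) (sym b)
              (keep (ℕₚ.≤-trans (ℕₚ.^-monoʳ-≤ 2 (ℕₚ.≤-trans (ℕₚ.m⊓n≤n (suc I ∸ j * W) W) (ℕₚ.⊓-glb (ℕₚ.m+n≤o⇒m≤o∸n W full) ℕₚ.≤-refl))) (block-growth j N)))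
    ...   | inj₁ I<end = subst (λ z → 2 ^ ((z + I ∸ j * W) ℕ.⊓ W) ≤ pick (inBlock W j N) N * R) (sym b) (begin
              2 ^ ((suc I ∸ j * W) ℕ.⊓ W)          ≤⟨ ℕₚ.^-monoʳ-≤ 2 (ℕₚ.≤-trans (ℕₚ.⊓-mono-≤ (ℕₚ.≤-reflexive (ℕₚ.+-∸-assoc 1 jW≤I)) (ℕₚ.n≤1+n W)) (ℕₚ.≤-refl {suc ((I ∸ j * W) ℕ.⊓ W)})) ⟩
              2 * 2 ^ ((I ∸ j * W) ℕ.⊓ W)          ≤⟨ ℕₚ.*-mono-≤ 2≤ (block-growth j N) ⟩
              pick (inBlock W j N) N * R ∎)
            where
            open ℕₚ.≤-Reasoning
            sel : inBlock W j N ≡ 1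
            sel = cong₂ _*_ b (cong₂ _*_ (lt-yes (s≤s jW≤I)) (lt-yes I<end))
            2≤ : 2 ≤ pick (inBlock W j N) N
            2≤ = subst (2 ≤_) (sym (pick-1 N sel)) (2≤prime (proj₁ (inBlock-sound W j sel)))

  block-large : ∀ {K} j → j < K → K * W ≤ idx P → 2 ^ W ≤ blockProd W P j
  block-large {K} j j<K h = ℕₚ.≤-trans (ℕₚ.^-monoʳ-≤ 2 (ℕₚ.⊓-glb (ℕₚ.m+n≤o⇒m≤o∸n W (ℕₚ.≤-trans (ℕₚ.*-monoˡ-≤ W j<K) h)) ℕₚ.≤-refl)) (block-growth j P)

  -- The estimate Π (1 + 1/A_j) ≤ G/(G - k) without fractions. Its step is (1 + 1/A)(G - k - 1) ≤ G
  -- - k, valid for A ≥ G.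
  product-close : ∀ {G} k → (∀ j → j < k → G ≤ blockProd W P j) → Π< k (λ j → suc (blockProd W P j)) * (G ∸ k) ≤ Π< k (blockProd W P) * G
  product-close         zero    h = ℕₚ.≤-refl
  product-close {G} (suc k) h = begin
    suc A * N * (G ∸ suc k)      ≡⟨ l1 (suc A) N (G ∸ suc k) ⟩
    suc A * (G ∸ suc k) * N      ≤⟨ ℕₚ.*-monoˡ-≤ N shrink ⟩
    A * (G ∸ k) * N              ≡⟨ l2 A (G ∸ k) N ⟩
    A * (N * (G ∸ k))            ≤⟨ ℕₚ.*-monoʳ-≤ A (product-close k (λ j j<k → h j (ℕₚ.m<n⇒m<1+n j<k))) ⟩
    A * (Π< k (blockProd W P) * G) ≡⟨ sym (ℕₚ.*-assoc A _ G) ⟩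
    A * Π< k (blockProd W P) * G ∎
    where
    open ℕₚ.≤-Reasoning
    A N : ℕ
    A = blockProd W P k
    N = Π< k (λ j → suc (blockProd W P j))
    l1 : ∀ a n g → a * n * g ≡ a * g * n
    l1 = ℕSolver.solve-∀
    l2 : ∀ a g n → a * g * n ≡ a * (n * g)
    l2 = ℕSolver.solve-∀
    shrink : suc A * (G ∸ suc k) ≤ A * (G ∸ k)
    shrink with ℕₚ.<-≤-connex k G
    ... | inj₂ G≤k = subst (λ z → suc A * z ≤ A * (G ∸ k)) (sym (ℕₚ.m≤n⇒m∸n≡0 (ℕₚ.m≤n⇒m≤1+n G≤k))) (ℕₚ.≤-trans (ℕₚ.≤-reflexive (ℕₚ.*-zeroʳ (suc A))) z≤n)
    ... | inj₁ k<G = begin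
      (G ∸ suc k) + A * (G ∸ suc k)    ≤⟨ ℕₚ.+-monoˡ-≤ _ (ℕₚ.≤-trans (ℕₚ.m∸n≤m G (suc k)) (h k ℕₚ.≤-refl)) ⟩
      A + A * (G ∸ suc k)              ≡⟨ sym (ℕₚ.*-suc A (G ∸ suc k)) ⟩
      A * suc (G ∸ suc k)              ≡⟨ cong (A *_) (sym (ℕₚ.+-∸-assoc 1 k<G)) ⟩
      A * (G ∸ k) ∎

-- Chinese remaindering with bounded error

distance-≤ : ∀ {a b c} → a ≤ b + c → b ≤ a + c → ℤ.∣ + a ℤ.- + b ∣ ≤ c
distance-≤ {a} {b} {c} h k with ℕₚ.≤-total a b
... | inj₁ a≤b = ℕₚ.≤-trans (ℕₚ.≤-reflexive (trans (cong ℤ.∣_∣ (ℤₚ.m-n≡m⊖n a b)) (ℤₚ.∣⊖∣-≤ a≤b))) (ℕₚ.m≤n+o⇒m∸n≤o b a k)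
... | inj₂ b≤a = ℕₚ.≤-trans (ℕₚ.≤-reflexive (trans (cong ℤ.∣_∣ (trans (ℤₚ.m-n≡m⊖n a b) (ℤₚ.⊖-swap a b))) (trans (ℤₚ.∣-i∣≡∣i∣ (b ℤ.⊖ a)) (ℤₚ.∣⊖∣-≤ b≤a)))) (ℕₚ.m≤n+o⇒m∸n≤o a b h)

prime5 : Prime 5
prime5 = from-yes (prime? 5)

-- `K` = 2^J bounds both the positions k and the bit length of X. By `supply` there are K complete
-- blocks of W primes below P, and X enters only through its residues modulo primes.
module CRT (J W P : ℕ) (W≡ : W ≡ 8 * 2 ^ J) (supply : 2 ^ J * W ≤ idx P) (X : ℤ) (X-small : ℤ.∣ X ∣ ≤ 2 ^ 2 ^ J)
  (Xr : ℕ → ℕ) (Xr-correct : ∀ p → Prime p → + Xr p ≋ X [ + p ]) where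

  K : ℕ
  K = 2 ^ J

  open Blocks W P

  1≤K : 1 ≤ K
  1≤K = ℕₚ.m^n>0 2 J

  1≤P : 1 ≤ P
  1≤P = positive P (ℕₚ.≤-trans (ℕₚ.*-mono-≤ 1≤K (subst (1 ≤_) (sym W≡) (ℕₚ.*-mono-≤ (s≤s (z≤n {7})) 1≤K))) supply)
    where
    positive : ∀ P → 1 ≤ idx P → 1 ≤ P
    positive (suc P) h = s≤s z≤n

  module _ {q : ℕ} (pq : Prime q) (odd-q : odd q) where
    open ModPrime pq

    numRes-≈ : ∀ k → numRes W P q k ≈ numerator W P k
    numRes-≈ k = ≋-trans (prodMod-≈ pq k _) (Π<-≈ pq k half)
      where
      half : ∀ j → suc (blockRes W P q j) * quo (suc q) 2 ≈ quo (suc (blockProd W P j)) 2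
      -- With 2H = A + 1 and 2h = q + 1 one has (A + 1) h = H (q + 1), which is H modulo q.
      half j = ≋-trans (≈-* (≋-+ (≋-refl {a = + 1}) (prodMod-≈ pq P (λ p → pick (inBlock W j p) p))) (≋-refl {a = + h}))
        (≋-trans (≋-reflexive (cong +_ (trans (cong (_* h) (sym (half-odd A (block-odd j)))) (trans (lem H h) (cong (H *_) (half-odd q odd-q))))))
          (≋-trans (≋-reflexive (trans (cong +_ (ℕₚ.*-suc H q)) (cong (λ z → + H ℤ.+ z) (ℤₚ.pos-* H q)))) (≋-+M (+ H))))
        where
        h H A : ℕ
        h = quo (suc q) 2
        A = blockProd W P j
        H = quo (suc A) 2
        lem : ∀ H h → 2 * H * h ≡ H * (2 * h)
        lem = ℕSolver.solve-∀

  module At (k : ℕ) where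

    M N S r : ℕ
    M = modulus W P k
    N = numerator W P k
    S = Σ< P (λ p → coef W P Xr k p * cofactor W P k p)
    r = rank W P Xr k

    sel : ℕ → ℕ
    sel = firstBlocks W k

    keep : ℕ → ℕ → ℕ
    keep p p′ = pick (sel p′ * (1 ∸ eq p p′)) p′

    keep-self : ∀ p → keep p p ≡ 1
    keep-self p = pick-0 p (trans (cong (λ z → sel p * (1 ∸ z)) (eq-yes {p} refl)) (ℕₚ.*-zeroʳ (sel p)))

    keep-other : ∀ p p′ → p ≢ p′ → keep p p′ ≡ pick (sel p′) p′
    keep-other p p′ p≢p′ = cong (λ z → pick z p′) (trans (cong (λ z → sel p′ * (1 ∸ z)) (eq-no p≢p′)) (ℕₚ.*-identityʳ (sel p′)))

    modulus-split : ∀ p → p < P → sel p ≡ 1 → M ≡ p * cofactor W P k p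
    modulus-split p p<P sp = trans (Π<-remove P _ (keep p) p p<P (keep-self p) (λ y y≢p → keep-other p y (λ e → y≢p (sym e))))
      (cong (_* cofactor W P k p) (pick-1 p sp))

    1≤M : 1 ≤ M
    1≤M = go P
      where
      1≤pick : ∀ {b} p → Bit b → (b ≡ 1 → 1 ≤ p) → 1 ≤ pick b p
      1≤pick p (inj₁ refl) h = s≤s z≤n
      1≤pick p (inj₂ refl) h = subst (1 ≤_) (sym (pick-1 p refl)) (h refl)
      go : ∀ N → 1 ≤ Π< N (λ p → pick (sel p) p)
      go zero    = s≤s z≤n
      go (suc N) = ℕₚ.*-mono-≤ (1≤pick N (firstBlocks-bit W k N) (λ h → ℕₚ.≤-trans (s≤s z≤n) (proj₂ (firstBlocks-sound W k h)))) (go N)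

    module _ {q : ℕ} (pq : Prime q) where
      open ModPrime pq

      cofactor-unit : Unit (cofactor W P k q)
      cofactor-unit = Π<-unit pq P unit
        where
        unit : ∀ p → Unit (keep q p)
        unit p with q ℕ.≟ p
        ... | yes refl = subst Unit (sym (keep-self p)) unit-1
        ... | no q≢p   = subst Unit (sym (keep-other q p q≢p)) (pick-unit pq p (firstBlocks-bit W k p) (λ h → proj₁ (firstBlocks-sound W k h) , λ e → q≢p (sym e)))

      cofactor-zero : ∀ p → q < P → sel q ≡ 1 → p ≢ q → cofactor W P k p ≈ 0
      cofactor-zero p q<P sq p≢q = Π<-zero pq P (keep p) q q<P (subst (_≈ 0) (sym (trans (keep-other p q p≢q) (pick-1 q sq))) (cong-by (+ 1) (lem (+ q))))
        where
        lem : ∀ q → q ≡ ℤ.0ℤ ℤ.+ (+ 1) ℤ.* q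
        lem = ℤSolver.solve-∀

      coef-inverse : odd q → sel q ≡ 1 → + (coef W P Xr k q * cofactor W P k q) ≋ X ℤ.* + N [ + q ]
      coef-inverse oq sq = ≋-trans (≋-reflexive (ℤₚ.pos-* (coef W P Xr k q) C)) (≋-trans (≋-* step₁ (≋-refl {a = + C}))
        (≋-trans (≋-reflexive (lem X (+ N) (+ (C ^ (q ∸ 2))) (+ C))) (≋-trans (≋-* (≋-refl {a = X ℤ.* + N}) inverse) (≋-reflexive (ℤₚ.*-identityʳ _)))))
        where
        C : ℕ
        C = cofactor W P k q
        lem : ∀ x n i c → x ℤ.* (n ℤ.* i) ℤ.* c ≡ x ℤ.* n ℤ.* (i ℤ.* c)
        lem = ℤSolver.solve-∀
        inverse : + (C ^ (q ∸ 2)) ℤ.* + C ≋ ℤ.1ℤ [ + q ]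
        inverse = ≋-trans (≋-reflexive (trans (sym (ℤₚ.pos-* (C ^ (q ∸ 2)) C)) (cong +_ (trans (ℕₚ.*-comm (C ^ (q ∸ 2)) C) (cong (C ^_) (trans (sym (ℕₚ.+-∸-assoc 1 2≤p)) refl)))))) (fermat cofactor-unit)
        step₁ : + coef W P Xr k q ≋ X ℤ.* (+ N ℤ.* + (C ^ (q ∸ 2))) [ + q ]
        step₁ = ≋-trans (≋-reflexive (cong +_ (trans (cong (_* rem inner q) sq) (ℕₚ.+-identityʳ _))))
          (≋-trans (rem-≋ inner 1≤p) (≋-trans (≋-reflexive (trans (ℤₚ.pos-* (Xr q) _) (cong (+ Xr q ℤ.*_) (ℤₚ.pos-* (numRes W P q k) _))))
            (≋-* (Xr-correct q pq) (≋-* (numRes-≈ pq oq k) (≋-trans (rem-≋ (cofRes W P q k q ^ (q ∸ 2)) 1≤p) (≈-^ (q ∸ 2) (prodMod-≈ pq P (keep q))))))))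
          where
          inner : ℕ
          inner = Xr q * (numRes W P q k * rem (cofRes W P q k q ^ (q ∸ 2)) q)

      -- Modulo q all summands but one vanish, since q divides the cofactors of the other primes.
      sum-residue : odd q → q < P → sel q ≡ 1 → + S ≋ X ℤ.* + N [ + q ]
      sum-residue oq q<P sq = ≋-trans (Σ<-≈-single pq P q q<P other) (coef-inverse oq sq)
        where
        other : ∀ p → p < P → p ≢ q → coef W P Xr k p * cofactor W P k p ≈ 0
        other p p<P p≢q = ≋-trans (≈-* (≋-refl {a = + coef W P Xr k p}) (cofactor-zero p q<P sq p≢q)) (≋-reflexive (cong +_ (ℕₚ.*-zeroʳ (coef W P Xr k p))))

    excess : X ℤ.* + N ℤ.- + S ≋ ℤ.0ℤ [ + M ]
    excess = divisible-by-product P {sel} (X ℤ.* + N ℤ.- + S) (firstBlocks-bit W k) (λ p sp → proj₁ (firstBlocks-sound W k sp))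
      (λ p p<P sp → let pp , 6≤p = firstBlocks-sound W k sp in difference-≋ (≋-sym (sum-residue pp (prime-odd pp 6≤p) p<P sp)))

    abstract
      Q : ℤ
      -- X N/M minus its fractional terms is the integer `quot excess`. Adding the rounded sum r of
      -- those terms gives an integer that differs from X N/M by r - S/M.
      Q = quot excess ℤ.+ + r

      M*Q : + M ℤ.* Q ≡ X ℤ.* + N ℤ.- + S ℤ.+ + r ℤ.* + M
      M*Q = trans (lem (+ M) (quot excess) (+ r)) (cong (ℤ._+ + r ℤ.* + M) (sym (trans (diff excess) (ℤₚ.+-identityˡ (quot excess ℤ.* + M)))))
        where
        lem : ∀ M q r → M ℤ.* (q ℤ.+ r) ≡ q ℤ.* M ℤ.+ r ℤ.* M
        lem = ℤSolver.solve-∀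

    fl : ℕ → ℕ
    fl p = quo (32 * P * coef W P Xr k p) p

    F : ℕ
    F = Σ< P fl

    quo-lower : ∀ x {y} → 1 ≤ y → quo x y * y ≤ x
    quo-lower x {suc y} _ = m/n*n≤m x (suc y)

    quo-upper : ∀ x {y} → 1 ≤ y → x ≤ suc (quo x y) * y
    quo-upper x {suc y} _ = ℕₚ.≤-trans (ℕₚ.≤-reflexive (m≡m%n+[m/n]*n x (suc y))) (ℕₚ.+-monoˡ-≤ _ (ℕₚ.<⇒≤ (m%n<n x (suc y))))

    unselected : ∀ p → sel p ≡ 0 → coef W P Xr k p ≡ 0
    unselected p sp = cong (_* rem (Xr p * (numRes W P p k * rem (cofRes W P p k p ^ (p ∸ 2)) p)) p) sp

    quo-zero : ∀ y → quo 0 y ≡ 0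
    quo-zero zero    = refl
    quo-zero (suc y) = ℕₚ.n≤0⇒n≡0 (m/n≤m 0 (suc y))

    term-lower : ∀ p → p < P → fl p * M ≤ coef W P Xr k p * cofactor W P k p * (32 * P)
    term-lower p p<P with firstBlocks-bit W k p
    ... | inj₁ sp = ℕₚ.≤-trans (ℕₚ.≤-reflexive (cong (_* M) (trans (cong (λ z → quo (32 * P * z) p) (unselected p sp)) (trans (cong (λ z → quo z p) (ℕₚ.*-zeroʳ (32 * P))) (quo-zero p))))) z≤n
    ... | inj₂ sp = begin
      fl p * M                       ≡⟨ cong (fl p *_) (modulus-split p p<P sp) ⟩
      fl p * (p * C)                 ≡⟨ sym (ℕₚ.*-assoc (fl p) p C) ⟩
      fl p * p * C                   ≤⟨ ℕₚ.*-monoˡ-≤ C (quo-lower (32 * P * c) 1≤p) ⟩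
      32 * P * c * C                 ≡⟨ lem P c C ⟩
      c * C * (32 * P) ∎
      where
      open ℕₚ.≤-Reasoning
      c C : ℕ
      c = coef W P Xr k p
      C = cofactor W P k p
      1≤p : 1 ≤ p
      1≤p = ℕₚ.≤-trans (s≤s z≤n) (proj₂ (firstBlocks-sound W k sp))
      lem : ∀ P c C → 32 * P * c * C ≡ c * C * (32 * P)
      lem = ℕSolver.solve-∀

    term-upper : ∀ p → p < P → coef W P Xr k p * cofactor W P k p * (32 * P) ≤ suc (fl p) * M
    term-upper p p<P with firstBlocks-bit W k p
    ... | inj₁ sp = ℕₚ.≤-trans (ℕₚ.≤-reflexive (cong (λ z → z * cofactor W P k p * (32 * P)) (unselected p sp))) z≤n
    ... | inj₂ sp = begin
      c * C * (32 * P)               ≡⟨ lem P c C ⟩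
      32 * P * c * C                 ≤⟨ ℕₚ.*-monoˡ-≤ C (quo-upper (32 * P * c) 1≤p) ⟩
      suc (fl p) * p * C             ≡⟨ ℕₚ.*-assoc (suc (fl p)) p C ⟩
      suc (fl p) * (p * C)           ≡⟨ cong (suc (fl p) *_) (sym (modulus-split p p<P sp)) ⟩
      suc (fl p) * M ∎
      where
      open ℕₚ.≤-Reasoning
      c C : ℕ
      c = coef W P Xr k p
      C = cofactor W P k p
      1≤p : 1 ≤ p
      1≤p = ℕₚ.≤-trans (s≤s z≤n) (proj₂ (firstBlocks-sound W k sp))
      lem : ∀ P c C → c * C * (32 * P) ≡ 32 * P * c * C
      lem = ℕSolver.solve-∀

    F-lower : F * M ≤ S * (32 * P)
    F-lower = ℕₚ.≤-trans (ℕₚ.≤-reflexive (Σ<-*ʳ P fl M)) (ℕₚ.≤-trans (Σ<-mono P term-lower) (ℕₚ.≤-reflexive (sym (Σ<-*ʳ P _ (32 * P)))))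

    F-upper : S * (32 * P) ≤ (F + P) * M
    F-upper = ℕₚ.≤-trans (ℕₚ.≤-reflexive (Σ<-*ʳ P _ (32 * P))) (ℕₚ.≤-trans (Σ<-mono P term-upper) (ℕₚ.≤-reflexive (trans (sym (Σ<-*ʳ P (λ p → suc (fl p)) M)) (cong (_* M) (Σ<-suc P fl)))))

    1≤32P : 1 ≤ 32 * P
    1≤32P = ℕₚ.*-mono-≤ (s≤s (z≤n {31})) 1≤P

    -- Truncation only lowers the fractions, so r exceeds S/M by at most the 1/2 that the summand
    -- 16P contributes to the rounding.
    rank-upper : 2 * (r * M) ≤ 2 * S + M
    rank-upper = ℕₚ.*-cancelˡ-≤ (16 * P) ⦃ ℕ.>-nonZero (ℕₚ.*-mono-≤ (s≤s (z≤n {15})) 1≤P) ⦄ (begin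
      16 * P * (2 * (r * M))             ≡⟨ l1 P r M ⟩
      r * (32 * P) * M                   ≤⟨ ℕₚ.*-monoˡ-≤ M (quo-lower (F + 16 * P) 1≤32P) ⟩
      (F + 16 * P) * M                   ≡⟨ ℕₚ.*-distribʳ-+ M F (16 * P) ⟩
      F * M + 16 * P * M                 ≤⟨ ℕₚ.+-monoˡ-≤ _ F-lower ⟩
      S * (32 * P) + 16 * P * M          ≡⟨ l2 P S M ⟩
      16 * P * (2 * S + M) ∎)
      where
      open ℕₚ.≤-Reasoning
      l1 : ∀ P r M → 16 * P * (2 * (r * M)) ≡ r * (32 * P) * M
      l1 = ℕSolver.solve-∀
      l2 : ∀ P S M → S * (32 * P) + 16 * P * M ≡ 16 * P * (2 * S + M)
      l2 = ℕSolver.solve-∀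

    -- Each of P fractions loses at most 1/(32P) by truncation, altogether 1/32. With the rounding
    -- this makes 17/32.
    rank-lower : 32 * S ≤ 32 * (r * M) + 17 * M
    rank-lower = ℕₚ.*-cancelˡ-≤ P ⦃ ℕ.>-nonZero 1≤P ⦄ (ℕₚ.+-cancelʳ-≤ (16 * P * M) _ _ (begin
      P * (32 * S) + 16 * P * M                      ≡⟨ l0 P S M ⟩
      S * (32 * P) + 16 * P * M                      ≤⟨ ℕₚ.+-monoˡ-≤ _ F-upper ⟩
      (F + P) * M + 16 * P * M                       ≡⟨ l1 F P M ⟩
      (F + 16 * P) * M + P * M                       ≤⟨ ℕₚ.+-monoˡ-≤ _ (ℕₚ.*-monoˡ-≤ M (quo-upper (F + 16 * P) 1≤32P)) ⟩
      suc r * (32 * P) * M + P * M                   ≡⟨ l2 r P M ⟩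
      P * (32 * (r * M) + 17 * M) + 16 * P * M ∎))
      where
      open ℕₚ.≤-Reasoning
      l0 : ∀ P S M → P * (32 * S) + 16 * P * M ≡ S * (32 * P) + 16 * P * M
      l0 = ℕSolver.solve-∀
      l1 : ∀ F P M → (F + P) * M + 16 * P * M ≡ (F + 16 * P) * M + P * M
      l1 = ℕSolver.solve-∀
      l2 : ∀ r P M → suc r * (32 * P) * M + P * M ≡ P * (32 * (r * M) + 17 * M) + 16 * P * M
      l2 = ℕSolver.solve-∀

    -- Both 1/2 and 17/32 are below 6/10.
    rank-distance : 10 * ℤ.∣ + (r * M) ℤ.- + S ∣ ≤ 6 * M
    rank-distance = ℕₚ.≤-trans (ℕₚ.≤-reflexive (trans (sym (ℤₚ.abs-* (+ 10) (+ (r * M) ℤ.- + S))) (cong ℤ.∣_∣ (trans (l0 (+ (r * M)) (+ S)) (sym (cong₂ ℤ._-_ (ℤₚ.pos-* 10 (r * M)) (ℤₚ.pos-* 10 S)))))))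
      (distance-≤ {10 * (r * M)} {10 * S} (begin
        10 * (r * M)           ≡⟨ l1 (r * M) ⟩
        5 * (2 * (r * M))      ≤⟨ ℕₚ.*-monoʳ-≤ 5 rank-upper ⟩
        5 * (2 * S + M)        ≤⟨ ℕₚ.m≤m+n _ M ⟩
        5 * (2 * S + M) + M    ≡⟨ l2 S M ⟩
        10 * S + 6 * M ∎)
      (ℕₚ.*-cancelˡ-≤ 16 (begin
        16 * (10 * S)                    ≡⟨ l3 S ⟩
        5 * (32 * S)                     ≤⟨ ℕₚ.*-monoʳ-≤ 5 rank-lower ⟩
        5 * (32 * (r * M) + 17 * M)      ≤⟨ ℕₚ.m≤m+n _ (11 * M) ⟩
        5 * (32 * (r * M) + 17 * M) + 11 * M ≡⟨ l4 (r * M) M ⟩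
        16 * (10 * (r * M) + 6 * M) ∎)))
      where
      open ℕₚ.≤-Reasoning
      l0 : ∀ a b → (+ 10) ℤ.* (a ℤ.- b) ≡ (+ 10) ℤ.* a ℤ.- (+ 10) ℤ.* b
      l0 = ℤSolver.solve-∀
      l1 : ∀ a → 10 * a ≡ 5 * (2 * a)
      l1 = ℕSolver.solve-∀
      l2 : ∀ S M → 5 * (2 * S + M) + M ≡ 10 * S + 6 * M
      l2 = ℕSolver.solve-∀
      l3 : ∀ S → 16 * (10 * S) ≡ 5 * (32 * S)
      l3 = ℕSolver.solve-∀
      l4 : ∀ a M → 5 * (32 * a + 17 * M) + 11 * M ≡ 16 * (10 * a + 6 * M)
      l4 = ℕSolver.solve-∀

    N′ : ℕ
    N′ = 2 ^ k * N

    M≤N′ : M ≤ N′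
    M≤N′ = ℕₚ.≤-trans (ℕₚ.≤-reflexive (modulus-product k)) (ℕₚ.≤-trans (go k) (ℕₚ.≤-reflexive (sym (numerator-doubles k))))
      where
      go : ∀ k → Π< k (blockProd W P) ≤ Π< k (λ j → suc (blockProd W P j))
      go zero    = s≤s z≤n
      go (suc k) = ℕₚ.*-mono-≤ (ℕₚ.n≤1+n (blockProd W P k)) (go k)

    -- N′/M is the product of all 1 + 1/A_j with A_j ≥ 2^W. The factor 8 in W makes 2^W = y^8 for y
    -- = 2^K, which dominates 10yK + K because the latter is at most 64y² and y ≥ 2.
    gap : k ≤ K → 10 * 2 ^ K * (N′ ∸ M) ≤ M
    gap k≤K = ℕₚ.*-cancelʳ-≤ _ M K ⦃ ℕ.>-nonZero 1≤K ⦄ (begin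
      10 * 2 ^ K * δ * K        ≡⟨ l1 (2 ^ K) δ K ⟩
      δ * (10 * 2 ^ K * K)      ≤⟨ ℕₚ.*-monoʳ-≤ δ (ℕₚ.m+n≤o⇒m≤o∸n (10 * 2 ^ K * K) (ℕₚ.≤-trans (ℕₚ.+-monoʳ-≤ _ k≤K) large)) ⟩
      δ * (G ∸ k)               ≤⟨ δ-bound ⟩
      M * k                     ≤⟨ ℕₚ.*-monoʳ-≤ M k≤K ⟩
      M * K ∎)
      where
      open ℕₚ.≤-Reasoning
      δ G y : ℕ
      δ = N′ ∸ M
      G = 2 ^ W
      y = 2 ^ K
      l1 : ∀ a δ K → 10 * a * δ * K ≡ δ * (10 * a * K)
      l1 = ℕSolver.solve-∀
      K<y : K < y
      K<y = lem K
        where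
        lem : ∀ t → t < 2 ^ t
        lem zero    = s≤s z≤n
        lem (suc t) = ℕₚ.≤-trans (ℕₚ.+-mono-≤ (ℕₚ.m^n>0 2 t) (lem t)) (ℕₚ.≤-reflexive (cong (λ z → 2 ^ t + z) (sym (ℕₚ.+-identityʳ _))))
      2≤y : 2 ≤ y
      2≤y = ℕₚ.^-monoʳ-≤ 2 1≤K
      large : 10 * y * K + K ≤ G
      large = begin
        10 * y * K + K           ≤⟨ ℕₚ.+-mono-≤ (ℕₚ.*-monoʳ-≤ (10 * y) (ℕₚ.<⇒≤ K<y)) (ℕₚ.≤-trans (ℕₚ.<⇒≤ K<y) (ℕₚ.≤-trans (ℕₚ.≤-reflexive (sym (ℕₚ.*-identityʳ y))) (ℕₚ.*-monoʳ-≤ y (ℕₚ.<⇒≤ 2≤y)))) ⟩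
        10 * y * y + y * y       ≤⟨ ℕₚ.m≤m+n _ (53 * (y * y)) ⟩
        10 * y * y + y * y + 53 * (y * y) ≡⟨ l2 y ⟩
        2 ^ 6 * (y * y)          ≤⟨ ℕₚ.*-monoˡ-≤ (y * y) (ℕₚ.^-monoˡ-≤ 6 2≤y) ⟩
        y ^ 6 * (y * y)          ≡⟨ l3 y ⟩
        y ^ 8                    ≡⟨ trans (ℕₚ.^-*-assoc 2 K 8) (cong (2 ^_) (trans (ℕₚ.*-comm K 8) (sym W≡))) ⟩
        G ∎
        where
        l2 : ∀ y → 10 * y * y + y * y + 53 * (y * y) ≡ 64 * (y * y)
        l2 = ℕSolver.solve-∀
        l3 : ∀ y → y ^ 6 * (y * y) ≡ y ^ 8
        l3 y = trans (cong (λ z → y ^ 6 * (y * z)) (sym (ℕₚ.*-identityʳ y))) (sym (ℕₚ.^-distribˡ-+-* y 6 2))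
      k≤G : k ≤ G
      k≤G = ℕₚ.≤-trans k≤K (ℕₚ.≤-trans (ℕₚ.m≤n+m K (10 * y * K)) large)
      close : (M + δ) * (G ∸ k) ≤ M * ((G ∸ k) + k)
      close = begin
        (M + δ) * (G ∸ k)        ≡⟨ cong (_* (G ∸ k)) (trans (ℕₚ.m+[n∸m]≡n M≤N′) (numerator-doubles k)) ⟩
        Π< k (λ j → suc (blockProd W P j)) * (G ∸ k) ≤⟨ product-close k (λ j j<k → block-large j (ℕₚ.<-≤-trans j<k k≤K) supply) ⟩
        Π< k (blockProd W P) * G ≡⟨ cong₂ _*_ (sym (modulus-product k)) (sym (ℕₚ.m∸n+n≡m k≤G)) ⟩
        M * ((G ∸ k) + k) ∎
      δ-bound : δ * (G ∸ k) ≤ M * k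
      δ-bound = ℕₚ.+-cancelˡ-≤ (M * (G ∸ k)) _ _ (ℕₚ.≤-trans (ℕₚ.≤-reflexive (sym (ℕₚ.*-distribʳ-+ (G ∸ k) M δ))) (ℕₚ.≤-trans close (ℕₚ.≤-reflexive (ℕₚ.*-distribˡ-+ M (G ∸ k) k))))

    error : ℤ
    error = 2^ k ℤ.* Q ℤ.- X

    M*error : + M ℤ.* error ≡ X ℤ.* + (N′ ∸ M) ℤ.+ 2^ k ℤ.* (+ (r * M) ℤ.- + S)
    M*error = begin
      + M ℤ.* (2^ k ℤ.* Q ℤ.- X)                                   ≡⟨ l1 (+ M) (2^ k) Q X ⟩
      2^ k ℤ.* (+ M ℤ.* Q) ℤ.- X ℤ.* + M                            ≡⟨ cong (λ z → 2^ k ℤ.* z ℤ.- X ℤ.* + M) M*Q ⟩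
      2^ k ℤ.* (X ℤ.* + N ℤ.- + S ℤ.+ + r ℤ.* + M) ℤ.- X ℤ.* + M    ≡⟨ l2 (2^ k) X (+ N) (+ S) (+ r) (+ M) ⟩
      X ℤ.* (2^ k ℤ.* + N ℤ.- + M) ℤ.+ 2^ k ℤ.* (+ r ℤ.* + M ℤ.- + S) ≡⟨ cong₂ (λ a b → X ℤ.* a ℤ.+ 2^ k ℤ.* (b ℤ.- + S)) gap-eq (sym (ℤₚ.pos-* r M)) ⟩
      X ℤ.* + (N′ ∸ M) ℤ.+ 2^ k ℤ.* (+ (r * M) ℤ.- + S) ∎
      where
      open ≡-Reasoning
      l1 : ∀ M t Q X → M ℤ.* (t ℤ.* Q ℤ.- X) ≡ t ℤ.* (M ℤ.* Q) ℤ.- X ℤ.* M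
      l1 = ℤSolver.solve-∀
      l2 : ∀ t X N S r M → t ℤ.* (X ℤ.* N ℤ.- S ℤ.+ r ℤ.* M) ℤ.- X ℤ.* M ≡ X ℤ.* (t ℤ.* N ℤ.- M) ℤ.+ t ℤ.* (r ℤ.* M ℤ.- S)
      l2 = ℤSolver.solve-∀
      gap-eq : 2^ k ℤ.* + N ℤ.- + M ≡ + (N′ ∸ M)
      gap-eq = trans (cong (ℤ._- + M) (sym (ℤₚ.pos-* (2 ^ k) N))) (trans (ℤₚ.m-n≡m⊖n N′ M) (ℤₚ.⊖-≥ M≤N′))

    -- In units of 2^k, replacing 2^(-k) by N/M costs at most 1/10, as the gap is balanced against
    -- the size of X, and the rank costs 6/10.
    error-small : k ≤ K → 10 * ℤ.∣ error ∣ ≤ 7 * 2 ^ k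
    error-small k≤K = ℕₚ.*-cancelˡ-≤ M ⦃ ℕ.>-nonZero 1≤M ⦄ (begin
      M * (10 * ℤ.∣ error ∣)                       ≡⟨ l1 M ℤ.∣ error ∣ ⟩
      10 * (M * ℤ.∣ error ∣)                       ≡⟨ cong (10 *_) (trans (sym (ℤₚ.abs-* (+ M) error)) (cong ℤ.∣_∣ M*error)) ⟩
      10 * ℤ.∣ X ℤ.* + δ ℤ.+ 2^ k ℤ.* D ∣          ≤⟨ ℕₚ.*-monoʳ-≤ 10 (ℤₚ.∣i+j∣≤∣i∣+∣j∣ (X ℤ.* + δ) (2^ k ℤ.* D)) ⟩
      10 * (ℤ.∣ X ℤ.* + δ ∣ + ℤ.∣ 2^ k ℤ.* D ∣)    ≡⟨ cong₂ (λ a b → 10 * (a + b)) (ℤₚ.abs-* X (+ δ)) (ℤₚ.abs-* (2^ k) D) ⟩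
      10 * (ℤ.∣ X ∣ * δ + 2 ^ k * ℤ.∣ D ∣)         ≡⟨ l2 ℤ.∣ X ∣ δ (2 ^ k) ℤ.∣ D ∣ ⟩
      10 * ℤ.∣ X ∣ * δ + 2 ^ k * (10 * ℤ.∣ D ∣)    ≤⟨ ℕₚ.+-mono-≤ (ℕₚ.≤-trans (ℕₚ.*-monoˡ-≤ δ (ℕₚ.*-monoʳ-≤ 10 X-small)) (gap k≤K)) (ℕₚ.*-monoʳ-≤ (2 ^ k) rank-distance) ⟩
      M + 2 ^ k * (6 * M)                          ≤⟨ ℕₚ.+-monoˡ-≤ _ (ℕₚ.≤-trans (ℕₚ.≤-reflexive (sym (ℕₚ.+-identityʳ M))) (ℕₚ.*-monoˡ-≤ M (ℕₚ.m^n>0 2 k))) ⟩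
      2 ^ k * M + 2 ^ k * (6 * M)                  ≡⟨ l3 (2 ^ k) M ⟩
      M * (7 * 2 ^ k) ∎)
      where
      open ℕₚ.≤-Reasoning
      δ : ℕ
      δ = N′ ∸ M
      D : ℤ
      D = + (r * M) ℤ.- + S
      l1 : ∀ M e → M * (10 * e) ≡ 10 * (M * e)
      l1 = ℕSolver.solve-∀
      l2 : ∀ x δ t d → 10 * (x * δ + t * d) ≡ 10 * x * δ + t * (10 * d)
      l2 = ℕSolver.solve-∀
      l3 : ∀ t M → t * M + t * (6 * M) ≡ M * (7 * t)
      l3 = ℕSolver.solve-∀

    -- Q is within 7/10 and H within 1/10 of X/2^k. Two integers at distance at most 8/10 are equal.
    exact : k ≤ K → ∀ H → 10 * ℤ.∣ X ℤ.- 2^ k ℤ.* H ∣ ≤ 2 ^ k → Q ≡ H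
    exact k≤K H h = ℤₚ.i-j≡0⇒i≡j Q H (ℤₚ.∣i∣≡0⇒i≡0 (ℕₚ.n<1⇒n≡0 (ℕₚ.*-cancelˡ-< (10 * 2 ^ k) ℤ.∣ Q ℤ.- H ∣ 1 (begin-strict
      10 * 2 ^ k * ℤ.∣ Q ℤ.- H ∣                        ≡⟨ trans (ℕₚ.*-assoc 10 (2 ^ k) _) (cong (10 *_) (trans (sym (ℤₚ.abs-* (2^ k) (Q ℤ.- H))) (cong ℤ.∣_∣ (l1 (2^ k) Q H X)))) ⟩
      10 * ℤ.∣ error ℤ.+ (X ℤ.- 2^ k ℤ.* H) ∣          ≤⟨ ℕₚ.*-monoʳ-≤ 10 (ℤₚ.∣i+j∣≤∣i∣+∣j∣ error (X ℤ.- 2^ k ℤ.* H)) ⟩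
      10 * (ℤ.∣ error ∣ + ℤ.∣ X ℤ.- 2^ k ℤ.* H ∣)      ≡⟨ ℕₚ.*-distribˡ-+ 10 ℤ.∣ error ∣ _ ⟩
      10 * ℤ.∣ error ∣ + 10 * ℤ.∣ X ℤ.- 2^ k ℤ.* H ∣   ≤⟨ ℕₚ.+-mono-≤ (error-small k≤K) h ⟩
      7 * 2 ^ k + 2 ^ k                                  ≡⟨ l2 (2 ^ k) ⟩
      8 * 2 ^ k                                          <⟨ ℕₚ.*-monoˡ-< (2 ^ k) ⦃ ℕ.>-nonZero (ℕₚ.m^n>0 2 k) ⦄ {8} {10} (ℕₚ.m≤m+n 9 1) ⟩
      10 * 2 ^ k                                         ≡⟨ sym (ℕₚ.*-identityʳ (10 * 2 ^ k)) ⟩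
      10 * 2 ^ k * 1 ∎))))
      where
      open ℕₚ.≤-Reasoning
      l1 : ∀ t Q H X → t ℤ.* (Q ℤ.- H) ≡ t ℤ.* Q ℤ.- X ℤ.+ (X ℤ.- t ℤ.* H)
      l1 = ℤSolver.solve-∀
      l2 : ∀ t → 7 * t + t ≡ 8 * t
      l2 = ℕSolver.solve-∀

    quotient5-≋ : + quotient5 W P Xr k ≋ Q [ + 5 ]
    quotient5-≋ = ≋-trans (≋-reflexive (ℤₚ.pos-* (Xr 5 * numRes W P 5 k + 4 * Sr + r * modRes W P 5 k) (modRes W P 5 k ^ 3)))
      (≋-trans (≋-* linear (≈-^ 3 modRes-≈)) (≋-trans (≋-reflexive (trans (l1 (+ M) Q (+ (M ^ 3))) (cong (ℤ._* Q) (sym (ℤₚ.pos-* M (M ^ 3))))))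
        (≋-trans (≋-* (fermat M-unit) (≋-refl {a = Q})) (≋-reflexive (ℤₚ.*-identityˡ Q)))))
      where
      open ModPrime prime5
      l1 : ∀ M Q c → M ℤ.* Q ℤ.* c ≡ M ℤ.* c ℤ.* Q
      l1 = ℤSolver.solve-∀
      modRes-≈ : modRes W P 5 k ≈ M
      modRes-≈ = prodMod-≈ prime5 P (λ p → pick (sel p) p)
      M-unit : Unit M
      M-unit = Π<-unit prime5 P (λ p → pick-unit prime5 p (firstBlocks-bit W k p) (λ h → let pp , 6≤p = firstBlocks-sound W k h in pp , λ { refl → ℕₚ.<-irrefl refl 6≤p }))
      Sr : ℕ
      Sr = Σ< P (λ p → coef W P Xr k p * cofRes W P 5 k p)
      S-≈ : Sr ≈ S
      S-≈ = Σ<-≈ prime5 P (λ p → ≈-* (≋-refl {a = + coef W P Xr k p}) (prodMod-≈ prime5 P (keep p)))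
      linear : + (Xr 5 * numRes W P 5 k + 4 * Sr + r * modRes W P 5 k) ≋ + M ℤ.* Q [ + 5 ]
      linear = ≋-trans (≋-+ (≋-+ (≋-trans (≋-reflexive (ℤₚ.pos-* (Xr 5) _)) (≋-* (Xr-correct 5 prime5) (numRes-≈ prime5 refl k)))
          (≈-* (≋-refl {a = + 4}) S-≈)) (≈-* (≋-refl {a = + r}) modRes-≈))
        (cong-by (+ S) (trans (cong₂ (λ a b → X ℤ.* + N ℤ.+ a ℤ.+ b) (ℤₚ.pos-* 4 S) (ℤₚ.pos-* r M)) (trans (l2 (X ℤ.* + N) (+ S) (+ r ℤ.* + M)) (cong (ℤ._+ + S ℤ.* + 5) (sym M*Q)))))
        where
        l2 : ∀ x s m → x ℤ.+ (+ 4) ℤ.* s ℤ.+ m ≡ x ℤ.- s ℤ.+ m ℤ.+ s ℤ.* (+ 5)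
        l2 = ℤSolver.solve-∀

  module _ (k : ℕ) (k<K : k < K) where
    private
      module A = At k
      module B = At (suc k)

    carry : ℤ
    carry = A.Q ℤ.- + 2 ℤ.* B.Q

    -- Times 2^k the digit is a difference of two errors, at most 7/10 + 14/10 in units of 2^k,
    -- which is less than 3.
    carry-small : ℤ.∣ carry ∣ ≤ 2
    carry-small = ℕₚ.≤-pred (ℕₚ.*-cancelˡ-< (10 * 2 ^ k) ℤ.∣ carry ∣ 3 (begin-strict
      10 * 2 ^ k * ℤ.∣ carry ∣                         ≡⟨ trans (ℕₚ.*-assoc 10 (2 ^ k) _) (cong (10 *_) (trans (sym (ℤₚ.abs-* (2^ k) carry)) (cong ℤ.∣_∣ decompose))) ⟩
      10 * ℤ.∣ A.error ℤ.- B.error ∣                   ≤⟨ ℕₚ.*-monoʳ-≤ 10 (ℤₚ.∣i-j∣≤∣i∣+∣j∣ A.error B.error) ⟩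
      10 * (ℤ.∣ A.error ∣ + ℤ.∣ B.error ∣)             ≡⟨ ℕₚ.*-distribˡ-+ 10 ℤ.∣ A.error ∣ _ ⟩
      10 * ℤ.∣ A.error ∣ + 10 * ℤ.∣ B.error ∣          ≤⟨ ℕₚ.+-mono-≤ (A.error-small (ℕₚ.<⇒≤ k<K)) (B.error-small k<K) ⟩
      7 * 2 ^ k + 7 * 2 ^ suc k                        ≡⟨ l2 (2 ^ k) ⟩
      21 * 2 ^ k                                       <⟨ ℕₚ.*-monoˡ-< (2 ^ k) ⦃ ℕ.>-nonZero (ℕₚ.m^n>0 2 k) ⦄ {21} {30} (ℕₚ.m≤m+n 22 8) ⟩
      30 * 2 ^ k                                       ≡⟨ l3 (2 ^ k) ⟩
      10 * 2 ^ k * 3 ∎))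
      where
      open ℕₚ.≤-Reasoning
      l2 : ∀ t → 7 * t + 7 * (2 * t) ≡ 21 * t
      l2 = ℕSolver.solve-∀
      l3 : ∀ t → 30 * t ≡ 10 * t * 3
      l3 = ℕSolver.solve-∀
      l1 : ∀ t X a b → t ℤ.* (a ℤ.- + 2 ℤ.* b) ≡ t ℤ.* a ℤ.- X ℤ.- (+ 2 ℤ.* t ℤ.* b ℤ.- X)
      l1 = ℤSolver.solve-∀
      decompose : 2^ k ℤ.* carry ≡ A.error ℤ.- B.error
      decompose = trans (l1 (2^ k) X A.Q B.Q) (cong (λ z → A.error ℤ.- (z ℤ.* B.Q ℤ.- X)) (sym (2^-suc k)))

    digit-correct : + digit W P Xr k ≡ carry ℤ.+ + 2
    digit-correct = trans (cong +_ (<-unique (rem-< total {5} (s≤s z≤n)) (proj₂ (proj₂ shifted))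
        (≋-trans (rem-≋ total {5} (s≤s z≤n)) (≋-trans residue5 (≋-reflexive (proj₁ (proj₂ shifted))))))) (sym (proj₁ (proj₂ shifted)))
      where
      total : ℕ
      total = quotient5 W P Xr k + 3 * quotient5 W P Xr (suc k) + 2
      shift : ∀ z → ℤ.∣ z ∣ ≤ 2 → Σ ℕ λ n → z ℤ.+ + 2 ≡ + n × n < 5
      shift (+ 0) _ = 2 , refl , ℕₚ.m≤m+n 3 2
      shift (+ 1) _ = 3 , refl , ℕₚ.m≤m+n 4 1
      shift (+ 2) _ = 4 , refl , ℕₚ.≤-refl
      shift (+ suc (suc (suc _))) (s≤s (s≤s ()))
      shift -[1+ 0 ] _ = 1 , refl , ℕₚ.m≤m+n 2 3
      shift -[1+ 1 ] _ = 0 , refl , s≤s z≤n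
      shift -[1+ suc (suc _) ] (s≤s (s≤s ()))
      shifted : Σ ℕ λ n → carry ℤ.+ + 2 ≡ + n × n < 5
      shifted = shift carry carry-small
      residue5 : + total ≋ carry ℤ.+ + 2 [ + 5 ]
      residue5 = ≋-+ {b = carry} (≋-trans (≋-+ A.quotient5-≋ (≋-trans (≋-reflexive (ℤₚ.pos-* 3 (quotient5 W P Xr (suc k)))) (≋-* (≋-refl {a = + 3}) B.quotient5-≋)))
          (cong-by B.Q (l1 A.Q B.Q))) (≋-refl {a = + 2})
        where
        l1 : ∀ a b → a ℤ.+ (+ 3) ℤ.* b ≡ a ℤ.- + 2 ℤ.* b ℤ.+ b ℤ.* (+ 5)
        l1 = ℤSolver.solve-∀

-- Boolean programs for the digits

module EasyDigits (collapse : Collapse) (W P : ℕ → ℕ) (eW : ∀ {r} → Easy {r} (λ n v → W n)) (eP : ∀ {r} → Easy {r} (λ n v → P n))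
  (Xr : ℕ → ℕ → ℕ) (eXr : ∀ {r} {f : ℕ → Vec ℕ r → ℕ} → Easy f → Easy (λ n v → Xr n (f n v))) where

  private
    lit : ∀ {r} c → Easy {r} (λ n v → c)
    lit = easy-lit
    wk : ∀ {r} {f : ℕ → Vec ℕ r → ℕ} → Easy f → Easy {suc r} (λ n v → f n (tail v))
    wk = easy-weaken

  abstract
    easy-bigPrime : ∀ {r} {p : ℕ → Vec ℕ r → ℕ} → Easy p → Easy (λ n v → bigPrime (p n v))
    easy-bigPrime ep = easy-* (easy-isPrime collapse ep) (easy-le (lit 6) ep)

    easy-idx : ∀ {r} {p : ℕ → Vec ℕ r → ℕ} → Easy p → Easy (λ n v → idx (p n v))
    easy-idx ep = easy-Σ collapse ep (easy-bigPrime v0)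

    easy-pick : ∀ {r} {b p : ℕ → Vec ℕ r → ℕ} → Easy b → Easy p → Easy (λ n v → pick (b n v) (p n v))
    easy-pick eb ep = easy-+ (easy-* eb ep) (easy-∸ collapse (lit 1) eb)

    easy-firstBlocks : ∀ {r} {k p : ℕ → Vec ℕ r → ℕ} → Easy k → Easy p → Easy (λ n v → firstBlocks (W n) (k n v) (p n v))
    easy-firstBlocks ek ep = easy-* (easy-bigPrime ep) (easy-lt (easy-idx ep) (easy-* ek eW))

    easy-inBlock : ∀ {r} {j p : ℕ → Vec ℕ r → ℕ} → Easy j → Easy p → Easy (λ n v → inBlock (W n) (j n v) (p n v))
    easy-inBlock ej ep = easy-* (easy-bigPrime ep) (easy-* (easy-le (easy-* ej eW) (easy-idx ep)) (easy-lt (easy-idx ep) (easy-* (easy-suc ej) eW)))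

    easy-blockRes : ∀ {r} {q j : ℕ → Vec ℕ r → ℕ} → Easy q → Easy j → Easy (λ n v → blockRes (W n) (P n) (q n v) (j n v))
    easy-blockRes eq′ ej = easy-prodMod collapse eq′ eP (easy-pick (easy-inBlock (wk ej) v0) v0)

    easy-numRes : ∀ {r} {q k : ℕ → Vec ℕ r → ℕ} → Easy q → Easy k → Easy (λ n v → numRes (W n) (P n) (q n v) (k n v))
    easy-numRes eq′ ek = easy-prodMod collapse eq′ ek (easy-* (easy-suc (easy-blockRes (wk eq′) v0)) (easy-quo collapse (easy-suc (wk eq′)) (lit 2)))

    easy-modRes : ∀ {r} {q k : ℕ → Vec ℕ r → ℕ} → Easy q → Easy k → Easy (λ n v → modRes (W n) (P n) (q n v) (k n v))
    easy-modRes eq′ ek = easy-prodMod collapse eq′ eP (easy-pick (easy-firstBlocks (wk ek) v0) v0)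

    easy-cofRes : ∀ {r} {q k p : ℕ → Vec ℕ r → ℕ} → Easy q → Easy k → Easy p → Easy (λ n v → cofRes (W n) (P n) (q n v) (k n v) (p n v))
    easy-cofRes eq′ ek ep = easy-prodMod collapse eq′ eP (easy-pick (easy-* (easy-firstBlocks (wk ek) v0) (easy-∸ collapse (lit 1) (easy-eq (wk ep) v0))) v0)

    easy-coef : ∀ {r} {k p : ℕ → Vec ℕ r → ℕ} → Easy k → Easy p → Easy (λ n v → coef (W n) (P n) (Xr n) (k n v) (p n v))
    easy-coef ek ep = easy-* (easy-firstBlocks ek ep) (easy-rem collapse (easy-* (eXr ep) (easy-* (easy-numRes ep ek)
      (easy-powmod collapse (easy-cofRes ep ek ep) (easy-∸ collapse ep (lit 2)) ep))) ep)

    easy-rank : ∀ {r} {k : ℕ → Vec ℕ r → ℕ} → Easy k → Easy (λ n v → rank (W n) (P n) (Xr n) (k n v))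
    easy-rank ek = easy-quo collapse (easy-+ (easy-Σ collapse eP (easy-quo collapse (easy-* (easy-* (lit 32) eP) (easy-coef (wk ek) v0)) v0)) (easy-* (lit 16) eP)) (easy-* (lit 32) eP)

    easy-cube : ∀ {r} {f : ℕ → Vec ℕ r → ℕ} → Easy f → Easy (λ n v → f n v ^ 3)
    easy-cube ef = easy-* ef (easy-* ef (easy-* ef (lit 1)))

    easy-quotient5 : ∀ {r} {k : ℕ → Vec ℕ r → ℕ} → Easy k → Easy (λ n v → quotient5 (W n) (P n) (Xr n) (k n v))
    easy-quotient5 ek = easy-* (easy-+ (easy-+ (easy-* (eXr (lit 5)) (easy-numRes (lit 5) ek))
        (easy-* (lit 4) (easy-Σ collapse eP (easy-* (easy-coef (wk ek) v0) (easy-cofRes (lit 5) (wk ek) v0)))))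
        (easy-* (easy-rank ek) (easy-modRes (lit 5) ek)))
      (easy-cube (easy-modRes (lit 5) ek))

    easy-digit : ∀ {r} {k : ℕ → Vec ℕ r → ℕ} → Easy k → Easy (λ n v → digit (W n) (P n) (Xr n) (k n v))
    easy-digit ek = easy-rem collapse (easy-+ (easy-+ (easy-quotient5 ek) (easy-* (lit 3) (easy-quotient5 (easy-suc ek)))) (lit 2)) (lit 5)

-- Kronecker substitution

Term : ℕ → Set
Term v = ℤ × Vec ℕ v

power : ∀ {v} → Vec ℤ v → Vec ℕ v → ℤ
power []      []      = ℤ.1ℤ
power (x ∷ xs) (a ∷ α) = (x ℤ.^ a) ℤ.* power xs α

evalTerms : ∀ {v} → Vec ℤ v → List (Term v) → ℤ
evalTerms x []             = ℤ.0ℤ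
evalTerms x ((c , α) ∷ ts) = c ℤ.* power x α ℤ.+ evalTerms x ts

addExponents : ∀ {v} → Vec ℕ v → Vec ℕ v → Vec ℕ v
addExponents = Vec.zipWith _+_

scaleTerms : ∀ {v} → Term v → List (Term v) → List (Term v)
scaleTerms t []             = []
scaleTerms (c , α) ((d , β) ∷ ts) = (c ℤ.* d , addExponents α β) ∷ scaleTerms (c , α) ts

negTerms : ∀ {v} → List (Term v) → List (Term v)
negTerms []             = []
negTerms ((c , α) ∷ ts) = (ℤ.- c , α) ∷ negTerms ts

mulTerms : ∀ {v} → List (Term v) → List (Term v) → List (Term v)
mulTerms []       us = []
mulTerms (t ∷ ts) us = scaleTerms t us List.++ mulTerms ts us

opTerms : ∀ {v} → Op → List (Term v) → List (Term v) → List (Term v)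
opTerms plus  ts us = ts List.++ us
opTerms minus ts us = ts List.++ negTerms us
opTerms times ts us = mulTerms ts us

power-add : ∀ {v} (x : Vec ℤ v) α β → power x (addExponents α β) ≡ power x α ℤ.* power x β
power-add []      []      []      = refl
power-add (x ∷ xs) (a ∷ α) (b ∷ β) = trans (cong₂ ℤ._*_ (ℤₚ.^-distribˡ-+-* x a b) (power-add xs α β)) (lem (x ℤ.^ a) (x ℤ.^ b) (power xs α) (power xs β))
  where
  lem : ∀ a b c d → a ℤ.* b ℤ.* (c ℤ.* d) ≡ a ℤ.* c ℤ.* (b ℤ.* d)
  lem = ℤSolver.solve-∀

evalTerms-++ : ∀ {v} (x : Vec ℤ v) ts us → evalTerms x (ts List.++ us) ≡ evalTerms x ts ℤ.+ evalTerms x us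
evalTerms-++ x []       us = sym (ℤₚ.+-identityˡ _)
evalTerms-++ x ((c , α) ∷ ts) us = trans (cong (λ z → c ℤ.* power x α ℤ.+ z) (evalTerms-++ x ts us)) (sym (ℤₚ.+-assoc (c ℤ.* power x α) (evalTerms x ts) (evalTerms x us)))

evalTerms-scale : ∀ {v} (x : Vec ℤ v) c α us → evalTerms x (scaleTerms (c , α) us) ≡ c ℤ.* power x α ℤ.* evalTerms x us
evalTerms-scale x c α []             = sym (ℤₚ.*-zeroʳ (c ℤ.* power x α))
evalTerms-scale x c α ((d , β) ∷ us) = trans (cong₂ (λ p q → c ℤ.* d ℤ.* p ℤ.+ q) (power-add x α β) (evalTerms-scale x c α us)) (lem c d (power x α) (power x β) (evalTerms x us))
  where
  lem : ∀ c d a b u → c ℤ.* d ℤ.* (a ℤ.* b) ℤ.+ c ℤ.* a ℤ.* u ≡ c ℤ.* a ℤ.* (d ℤ.* b ℤ.+ u)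
  lem = ℤSolver.solve-∀

evalTerms-neg : ∀ {v} (x : Vec ℤ v) us → evalTerms x (negTerms us) ≡ ℤ.- evalTerms x us
evalTerms-neg x []             = refl
evalTerms-neg x ((d , β) ∷ us) = trans (cong (λ z → (ℤ.- d) ℤ.* power x β ℤ.+ z) (evalTerms-neg x us)) (lem d (power x β) (evalTerms x us))
  where
  lem : ∀ d b u → (ℤ.- d) ℤ.* b ℤ.+ ℤ.- u ≡ ℤ.- (d ℤ.* b ℤ.+ u)
  lem = ℤSolver.solve-∀

evalTerms-mul : ∀ {v} (x : Vec ℤ v) ts us → evalTerms x (mulTerms ts us) ≡ evalTerms x ts ℤ.* evalTerms x us
evalTerms-mul x []             us = sym (ℤₚ.*-zeroˡ (evalTerms x us))
evalTerms-mul x ((c , α) ∷ ts) us = trans (evalTerms-++ x (scaleTerms (c , α) us) (mulTerms ts us))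
  (trans (cong₂ ℤ._+_ (evalTerms-scale x c α us) (evalTerms-mul x ts us)) (sym (ℤₚ.*-distribʳ-+ (evalTerms x us) (c ℤ.* power x α) (evalTerms x ts))))

evalTerms-op : ∀ {v} (x : Vec ℤ v) o ts us → evalTerms x (opTerms o ts us) ≡ opVal o (evalTerms x ts) (evalTerms x us)
evalTerms-op x plus  ts us = evalTerms-++ x ts us
evalTerms-op x minus ts us = trans (evalTerms-++ x ts (negTerms us)) (cong (λ z → evalTerms x ts ℤ.+ z) (evalTerms-neg x us))
evalTerms-op x times ts us = evalTerms-mul x ts us

-- On lists without cancellation this bound on the coefficients is exactly additive and
-- multiplicative.
norm : ∀ {v} → List (Term v) → ℕ
norm []             = 0
norm ((c , α) ∷ ts) = ℤ.∣ c ∣ + norm ts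

norm-++ : ∀ {v} (ts us : List (Term v)) → norm (ts List.++ us) ≡ norm ts + norm us
norm-++ []             us = refl
norm-++ ((c , α) ∷ ts) us = trans (cong (λ z → ℤ.∣ c ∣ + z) (norm-++ ts us)) (sym (ℕₚ.+-assoc ℤ.∣ c ∣ (norm ts) (norm us)))

norm-scale : ∀ {v} c α (us : List (Term v)) → norm (scaleTerms (c , α) us) ≡ ℤ.∣ c ∣ * norm us
norm-scale c α []             = sym (ℕₚ.*-zeroʳ ℤ.∣ c ∣)
norm-scale c α ((d , β) ∷ us) = trans (cong₂ _+_ (ℤₚ.abs-* c d) (norm-scale c α us)) (sym (ℕₚ.*-distribˡ-+ ℤ.∣ c ∣ ℤ.∣ d ∣ (norm us)))

norm-neg : ∀ {v} (us : List (Term v)) → norm (negTerms us) ≡ norm us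
norm-neg []             = refl
norm-neg ((d , β) ∷ us) = cong₂ _+_ (ℤₚ.∣-i∣≡∣i∣ d) (norm-neg us)

norm-mul : ∀ {v} (ts us : List (Term v)) → norm (mulTerms ts us) ≡ norm ts * norm us
norm-mul []             us = refl
norm-mul ((c , α) ∷ ts) us = trans (norm-++ (scaleTerms (c , α) us) (mulTerms ts us)) (trans (cong₂ _+_ (norm-scale c α us) (norm-mul ts us)) (sym (ℕₚ.*-distribʳ-+ (norm us) ℤ.∣ c ∣ (norm ts))))

data ExponentsBelow {v} (d : ℕ) : List (Term v) → Set where
  []  : ExponentsBelow d []
  _∷_ : ∀ {c α ts} → (∀ i → lookup α i ≤ d) → ExponentsBelow d ts → ExponentsBelow d ((c , α) ∷ ts)

below-mono : ∀ {v d d′} {ts : List (Term v)} → d ≤ d′ → ExponentsBelow d ts → ExponentsBelow d′ ts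
below-mono h []       = []
below-mono h (p ∷ ps) = (λ i → ℕₚ.≤-trans (p i) h) ∷ below-mono h ps

below-++ : ∀ {v d} {ts us : List (Term v)} → ExponentsBelow d ts → ExponentsBelow d us → ExponentsBelow d (ts List.++ us)
below-++ []       qs = qs
below-++ (p ∷ ps) qs = p ∷ below-++ ps qs

below-neg : ∀ {v d} {us : List (Term v)} → ExponentsBelow d us → ExponentsBelow d (negTerms us)
below-neg []       = []
below-neg (p ∷ ps) = p ∷ below-neg ps

below-scale : ∀ {v d d′ c α} {us : List (Term v)} → (∀ i → lookup α i ≤ d) → ExponentsBelow d′ us → ExponentsBelow (d + d′) (scaleTerms (c , α) us)
below-scale p []       = []
below-scale {α = α} p (_∷_ {α = β} q qs) = (λ i → ℕₚ.≤-trans (ℕₚ.≤-reflexive (Vecₚ.lookup-zipWith _+_ i α β)) (ℕₚ.+-mono-≤ (p i) (q i))) ∷ below-scale p qs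

below-mul : ∀ {v d d′} {ts us : List (Term v)} → ExponentsBelow d ts → ExponentsBelow d′ us → ExponentsBelow (d + d′) (mulTerms ts us)
below-mul []       qs = []
below-mul (p ∷ ps) qs = below-++ (below-scale p qs) (below-mul ps qs)

-- One operation at most squares the norm bound and doubles the degree bound, which raises h by one
-- whatever the operation. An exponential sum or product over m bits is a binary tree of depth m and
-- adds only m.
record Height {v} (h : ℕ) (ts : List (Term v)) : Set where
  constructor height
  field
    norm-≤  : norm ts ≤ 2 ^ 2 ^ h
    below   : ExponentsBelow (2 ^ h) ts
open Height public

2^suc : ∀ h → 2 ^ suc h ≡ 2 ^ h + 2 ^ h
2^suc h = cong (λ z → 2 ^ h + z) (ℕₚ.+-identityʳ (2 ^ h))

2^2^-square : ∀ h → 2 ^ 2 ^ h * 2 ^ 2 ^ h ≡ 2 ^ 2 ^ suc h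
2^2^-square h = trans (sym (ℕₚ.^-distribˡ-+-* 2 (2 ^ h) (2 ^ h))) (cong (2 ^_) (sym (2^suc h)))

2^2^-double : ∀ h → 2 ^ 2 ^ h + 2 ^ 2 ^ h ≤ 2 ^ 2 ^ suc h
2^2^-double h = ℕₚ.≤-trans (ℕₚ.≤-reflexive (cong (λ z → 2 ^ 2 ^ h + z) (sym (ℕₚ.+-identityʳ (2 ^ 2 ^ h)))))
  (ℕₚ.≤-trans (ℕₚ.*-monoˡ-≤ (2 ^ 2 ^ h) (ℕₚ.^-monoʳ-≤ 2 (ℕₚ.m^n>0 2 h))) (ℕₚ.≤-reflexive (2^2^-square h)))

height-op : ∀ {v h} o {ts us : List (Term v)} → Height h ts → Height h us → Height (suc h) (opTerms o ts us)
height-op {h = h} plus {ts} {us} (height n b) (height n′ b′) = height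
  (ℕₚ.≤-trans (ℕₚ.≤-reflexive (norm-++ ts us)) (ℕₚ.≤-trans (ℕₚ.+-mono-≤ n n′) (2^2^-double h)))
  (below-mono (ℕₚ.^-monoʳ-≤ 2 (ℕₚ.n≤1+n h)) (below-++ b b′))
height-op {h = h} minus {ts} {us} (height n b) (height n′ b′) = height
  (ℕₚ.≤-trans (ℕₚ.≤-reflexive (trans (norm-++ ts (negTerms us)) (cong (λ z → norm ts + z) (norm-neg us)))) (ℕₚ.≤-trans (ℕₚ.+-mono-≤ n n′) (2^2^-double h)))
  (below-mono (ℕₚ.^-monoʳ-≤ 2 (ℕₚ.n≤1+n h)) (below-++ b (below-neg b′)))
height-op {h = h} times {ts} {us} (height n b) (height n′ b′) = height
  (ℕₚ.≤-trans (ℕₚ.≤-reflexive (norm-mul ts us)) (ℕₚ.≤-trans (ℕₚ.*-mono-≤ n n′) (ℕₚ.≤-reflexive (2^2^-square h))))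
  (subst (λ d → ExponentsBelow d (mulTerms ts us)) (sym (2^suc h)) (below-mul b b′))

height-mono : ∀ {v h h′} {ts : List (Term v)} → h ≤ h′ → Height h ts → Height h′ ts
height-mono h≤h′ (height n b) = height (ℕₚ.≤-trans n (ℕₚ.^-monoʳ-≤ 2 (ℕₚ.^-monoʳ-≤ 2 h≤h′))) (below-mono (ℕₚ.^-monoʳ-≤ 2 h≤h′) b)

height-run : ∀ {v i h} (C : Code 1 i) (ws : Vec (List (Term v)) i) → (∀ u → Height h (lookup ws u)) → Height (h + gateCount C) (head (run opTerms C ws))
height-run {h = h} (ret (u ∷ []))  ws H = subst (λ z → Height z (lookup ws u)) (sym (ℕₚ.+-identityʳ h)) (H u)
height-run {h = h} (step o a b C) ws H = subst (λ z → Height z (head (run opTerms C (opTerms o (lookup ws a) (lookup ws b) ∷ ws)))) (sym (ℕₚ.+-suc h (gateCount C)))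
  (height-run C _ (λ { zero → height-op o {lookup ws a} {lookup ws b} (H a) (H b) ; (suc u) → height-mono (ℕₚ.n≤1+n h) (H u) }))

height-cube : ∀ {v h} o m {ts : Vec Bool m → List (Term v)} → (∀ e → Height h (ts e)) → Height (h + m) (cube (opTerms o) m ts)
height-cube {h = h} o zero    H = subst (λ z → Height z _) (sym (ℕₚ.+-identityʳ h)) (H [])
height-cube {h = h} o (suc m) {ts} H = subst (λ z → Height z (cube (opTerms o) (suc m) ts)) (sym (ℕₚ.+-suc h m))
  (height-op o (height-cube o m (λ e → H (false ∷ e))) (height-cube o m (λ e → H (true ∷ e))))

kron : ∀ {v} → ℕ → Vec ℕ v → ℕ
kron D []      = 0
kron D (a ∷ α) = a + D * kron D α

-- The coordinates are 2^E, 2^(ED), 2^(ED²), and so on. For E = D a monomial takes the value 2^(Dκ),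
-- where κ reads its exponents in base D, so different monomials lie at least D bits apart.
points : ℕ → ℕ → ∀ v → Vec ℤ v
points D E zero    = []
points D E (suc v) = 2^ E ∷ points D (E * D) v

2^-^ : ∀ E a → 2^ E ℤ.^ a ≡ 2^ (E * a)
2^-^ E zero    = cong (λ z → + (2 ^ z)) (sym (ℕₚ.*-zeroʳ E))
2^-^ E (suc a) = trans (cong (2^ E ℤ.*_) (2^-^ E a)) (trans (sym (ℤₚ.pos-* (2 ^ E) (2 ^ (E * a)))) (cong +_ (trans (sym (ℕₚ.^-distribˡ-+-* 2 E (E * a))) (cong (2 ^_) (sym (ℕₚ.*-suc E a))))))

power-points : ∀ {v} D E (α : Vec ℕ v) → power (points D E v) α ≡ 2^ (E * kron D α)
power-points D E []      = cong (λ z → + (2 ^ z)) (sym (ℕₚ.*-zeroʳ E))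
power-points D E (a ∷ α) = trans (cong₂ ℤ._*_ (2^-^ E a) (power-points D (E * D) α))
  (trans (sym (ℤₚ.pos-* (2 ^ (E * a)) _)) (cong +_ (trans (sym (ℕₚ.^-distribˡ-+-* 2 (E * a) _)) (cong (2 ^_) (lem E a D (kron D α))))))
  where
  lem : ∀ E a D k → E * a + E * D * k ≡ E * (a + D * k)
  lem = ℕSolver.solve-∀

kron-< : ∀ {v D} (α : Vec ℕ v) → (∀ i → lookup α i < D) → kron D α < D ^ v
kron-< []      h = s≤s z≤n
kron-< {suc v} {D} (a ∷ α) h = begin-strict
  a + D * kron D α      <⟨ ℕₚ.+-monoˡ-< (D * kron D α) (h zero) ⟩
  D + D * kron D α      ≡⟨ sym (ℕₚ.*-suc D (kron D α)) ⟩
  D * suc (kron D α)    ≤⟨ ℕₚ.*-monoʳ-≤ D (kron-< α (λ i → h (suc i))) ⟩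
  D * D ^ v ∎
  where open ℕₚ.≤-Reasoning

Σz : ℕ → (ℕ → ℤ) → ℤ
Σz zero    h = ℤ.0ℤ
Σz (suc k) h = h k ℤ.+ Σz k h

Σz-even-odd : ∀ k h → Σz (2 * k) h ≡ Σz k (λ y → h (2 * y)) ℤ.+ Σz k (λ y → h (1 + 2 * y))
Σz-even-odd zero    h = refl
Σz-even-odd (suc k) h = trans (cong (λ m → Σz m h) (l k)) (trans (cong (λ z → h (1 + 2 * k) ℤ.+ (h (2 * k) ℤ.+ z)) (Σz-even-odd k h))
  (l2 (h (1 + 2 * k)) (h (2 * k)) (Σz k (λ y → h (2 * y))) (Σz k (λ y → h (1 + 2 * y)))))
  where
  l : ∀ k → 2 * suc k ≡ suc (suc (2 * k))
  l = ℕSolver.solve-∀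
  l2 : ∀ a b c d → a ℤ.+ (b ℤ.+ (c ℤ.+ d)) ≡ b ℤ.+ c ℤ.+ (a ℤ.+ d)
  l2 = ℤSolver.solve-∀

cube-Σz : ∀ w h → cube ℤ._+_ w (λ e → h (num e)) ≡ Σz (2 ^ w) h
cube-Σz zero    h = sym (ℤₚ.+-identityʳ _)
cube-Σz (suc w) h = trans (cong₂ ℤ._+_ (cube-Σz w (λ y → h (2 * y))) (cube-Σz w (λ y → h (1 + 2 * y)))) (sym (Σz-even-odd (2 ^ w) h))

-- Only the two ends matter: whatever the intermediate q z are, their contributions cancel.
telescope : ∀ k (q : ℕ → ℤ) → Σz k (λ z → (q z ℤ.- + 2 ℤ.* q (suc z)) ℤ.* 2^ z) ≡ q 0 ℤ.- 2^ k ℤ.* q k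
telescope zero    q = lem (q 0)
  where
  lem : ∀ a → ℤ.0ℤ ≡ a ℤ.- ℤ.1ℤ ℤ.* a
  lem = ℤSolver.solve-∀
telescope (suc k) q = trans (cong (λ z → (q k ℤ.- + 2 ℤ.* q (suc k)) ℤ.* 2^ k ℤ.+ z) (telescope k q))
  (trans (lem (q k) (q (suc k)) (2^ k) (q 0)) (cong (λ z → q 0 ℤ.- z ℤ.* q (suc k)) (sym (2^-suc k))))
  where
  lem : ∀ a b t c → (a ℤ.- + 2 ℤ.* b) ℤ.* t ℤ.+ (c ℤ.- t ℤ.* a) ≡ c ℤ.- + 2 ℤ.* t ℤ.* b
  lem = ℤSolver.solve-∀

num-++ : ∀ {m n} (u : Vec Bool m) (v : Vec Bool n) → num (u ++ v) ≡ num u + 2 ^ m * num v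
num-++ []      v = sym (ℕₚ.+-identityʳ _)
num-++ {suc m} (b ∷ u) v = trans (cong (λ z → b2n b + 2 * z) (num-++ u v)) (lem (b2n b) (num u) (2 ^ m) (num v))
  where
  lem : ∀ b u t v → b + 2 * (u + t * v) ≡ b + 2 * u + 2 * t * v
  lem = ℕSolver.solve-∀

monomial-++ : ∀ {m n} (Z e : Vec ℤ m) (Z′ e′ : Vec ℤ n) → monomial opVal ℤ.1ℤ (Z ++ Z′) (e ++ e′) ≡ monomial opVal ℤ.1ℤ Z e ℤ.* monomial opVal ℤ.1ℤ Z′ e′
monomial-++ []      []      Z′ e′ = sym (ℤₚ.*-identityˡ _)
monomial-++ (Z ∷ Zs) (e ∷ es) Z′ e′ = trans (cong (λ z → (ℤ.1ℤ ℤ.+ e ℤ.* (Z ℤ.- ℤ.1ℤ)) ℤ.* z) (monomial-++ Zs es Z′ e′)) (sym (ℤₚ.*-assoc (ℤ.1ℤ ℤ.+ e ℤ.* (Z ℤ.- ℤ.1ℤ)) (monomial opVal ℤ.1ℤ Zs es) (monomial opVal ℤ.1ℤ Z′ e′)))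

squarings : ∀ ℓ → ℤ → Vec ℤ ℓ
squarings zero    x = []
squarings (suc ℓ) x = x ∷ squarings ℓ (x ℤ.* x)

monomial-squarings : ∀ {ℓ} x (e : Vec Bool ℓ) → monomial opVal ℤ.1ℤ (squarings ℓ x) (map b2z e) ≡ x ℤ.^ num e
monomial-squarings x []      = refl
monomial-squarings x (b ∷ e) = trans (cong₂ ℤ._*_ (select b) (trans (monomial-squarings (x ℤ.* x) e) (trans (cong (λ z → (x ℤ.* z) ℤ.^ num e) (sym (ℤₚ.*-identityʳ x))) (ℤₚ.^-*-assoc x 2 (num e)))))
  (sym (ℤₚ.^-distribˡ-+-* x (b2n b) (2 * num e)))
  where
  select : ∀ b → ℤ.1ℤ ℤ.+ b2z b ℤ.* (x ℤ.- ℤ.1ℤ) ≡ x ℤ.^ b2n b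
  select false = refl
  select true  = lem x
    where
    lem : ∀ x → ℤ.1ℤ ℤ.+ ℤ.1ℤ ℤ.* (x ℤ.- ℤ.1ℤ) ≡ x ℤ.* ℤ.1ℤ
    lem = ℤSolver.solve-∀

allSquarings : ∀ {v} ℓ → Vec ℤ v → Vec ℤ (v * ℓ)
allSquarings ℓ x = concat (map (squarings ℓ) x)

exponentBits : ∀ {v} ℓ → Vec ℕ v → Vec Bool (v * ℓ)
exponentBits ℓ α = concat (map (bits ℓ) α)

num-exponentBits : ∀ {v} ℓ (α : Vec ℕ v) → (∀ i → lookup α i < 2 ^ ℓ) → num (exponentBits ℓ α) ≡ kron (2 ^ ℓ) α
num-exponentBits ℓ []      h = refl
num-exponentBits ℓ (a ∷ α) h = trans (num-++ (bits ℓ a) _) (cong₂ (λ p q → p + 2 ^ ℓ * q) (num-bits ℓ a (h zero)) (num-exponentBits ℓ α (λ i → h (suc i))))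

monomial-exponentBits : ∀ {v} ℓ (x : Vec ℤ v) (α : Vec ℕ v) → (∀ i → lookup α i < 2 ^ ℓ) →
  monomial opVal ℤ.1ℤ (allSquarings ℓ x) (map b2z (exponentBits ℓ α)) ≡ power x α
monomial-exponentBits ℓ []      []      h = refl
monomial-exponentBits ℓ (x ∷ xs) (a ∷ α) h = trans (cong (monomial opVal ℤ.1ℤ (squarings ℓ x ++ allSquarings ℓ xs)) (Vecₚ.map-++ b2z (bits ℓ a) _))
  (trans (monomial-++ (squarings ℓ x) _ (allSquarings ℓ xs) _) (cong₂ ℤ._*_ (trans (monomial-squarings x (bits ℓ a)) (cong (x ℤ.^_) (num-bits ℓ a (h zero)))) (monomial-exponentBits ℓ xs α (λ i → h (suc i)))))

cube-0 : ∀ m → cube ℤ._+_ m (λ _ → ℤ.0ℤ) ≡ ℤ.0ℤ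
cube-0 zero    = refl
cube-0 (suc m) = cong₂ ℤ._+_ (cube-0 m) (cube-0 m)

cube-+ : ∀ m (h h′ : Vec Bool m → ℤ) → cube ℤ._+_ m (λ e → h e ℤ.+ h′ e) ≡ cube ℤ._+_ m h ℤ.+ cube ℤ._+_ m h′
cube-+ zero    h h′ = refl
cube-+ (suc m) h h′ = trans (cong₂ ℤ._+_ (cube-+ m _ _) (cube-+ m _ _)) (lem (cube ℤ._+_ m (λ e → h (false ∷ e))) (cube ℤ._+_ m (λ e → h′ (false ∷ e))) (cube ℤ._+_ m (λ e → h (true ∷ e))) (cube ℤ._+_ m (λ e → h′ (true ∷ e))))
  where
  lem : ∀ a b c d → a ℤ.+ b ℤ.+ (c ℤ.+ d) ≡ a ℤ.+ c ℤ.+ (b ℤ.+ d)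
  lem = ℤSolver.solve-∀

num-injective : ∀ {m} (u v : Vec Bool m) → num u ≡ num v → u ≡ v
num-injective []      []      h = refl
num-injective (b ∷ u) (c ∷ v) h = cong₂ _∷_ (lsb b c h) (num-injective u v (rest b c (lsb b c h) h))
  where
  parity : ∀ u v → 2 * u ≢ 1 + 2 * v
  parity u v h = contradiction (trans (sym (evens u)) (trans (cong (ℕ._% 2) h) (odds v))) λ ()
    where
    evens : ∀ u → (2 * u) ℕ.% 2 ≡ 0
    evens u = n∣m⇒m%n≡0 (2 * u) 2 (m∣m*n u)
    odds : ∀ v → (1 + 2 * v) ℕ.% 2 ≡ 1
    odds v = <-unique (m%n<n (1 + 2 * v) 2) (s≤s (s≤s z≤n)) (≋-trans (rem-≋ (1 + 2 * v) {2} (s≤s z≤n))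
      (cong-by (+ v) (cong (λ z → ℤ.1ℤ ℤ.+ z) (trans (cong +_ (ℕₚ.*-comm 2 v)) (ℤₚ.pos-* v 2)))))
  lsb : ∀ b c → b2n b + 2 * num u ≡ b2n c + 2 * num v → b ≡ c
  lsb false false h = refl
  lsb true  true  h = refl
  lsb false true  h = contradiction h (parity (num u) (num v))
  lsb true  false h = contradiction (sym h) (parity (num v) (num u))
  rest : ∀ b c → b ≡ c → b2n b + 2 * num u ≡ b2n c + 2 * num v → num u ≡ num v
  rest b .b refl h = ℕₚ.*-cancelˡ-≡ (num u) (num v) 2 (ℕₚ.+-cancelˡ-≡ (b2n b) _ _ h)

cube-single : ∀ m (h : Vec Bool m → ℤ) (u : Vec Bool m) → (∀ e → e ≢ u → h e ≡ ℤ.0ℤ) → cube ℤ._+_ m h ≡ h u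
cube-single zero    h []      z = refl
cube-single (suc m) h (false ∷ u) z = trans (cong₂ ℤ._+_ (cube-single m _ u (λ e e≢u → z (false ∷ e) (λ { refl → e≢u refl }))) (trans (cube-cong ℤ._+_ m (λ e → z (true ∷ e) (λ ()))) (cube-0 m))) (ℤₚ.+-identityʳ _)
cube-single (suc m) h (true ∷ u)  z = trans (cong₂ ℤ._+_ (trans (cube-cong ℤ._+_ m (λ e → z (false ∷ e) (λ ()))) (cube-0 m)) (cube-single m _ u (λ e e≢u → z (true ∷ e) (λ { refl → e≢u refl })))) (ℤₚ.+-identityˡ _)

-- Distributivity, where the bit j selects 1 or Z_j. It makes the total contribution of a constant
-- shift of all digits computable by a short product.
cube-monomial : ∀ {m} (Z : Vec ℤ m) → cube ℤ._+_ m (λ e → monomial opVal ℤ.1ℤ Z (map b2z e)) ≡ Vec.foldr (λ _ → ℤ) (λ z p → (ℤ.1ℤ ℤ.+ z) ℤ.* p) ℤ.1ℤ Z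
cube-monomial []      = refl
cube-monomial {suc m} (z ∷ Z) = trans (cong₂ ℤ._+_ (cube-*ˡ m (ℤ.1ℤ ℤ.+ ℤ.0ℤ ℤ.* (z ℤ.- ℤ.1ℤ)) (λ e → monomial opVal ℤ.1ℤ Z (map b2z e))) (cube-*ˡ m (ℤ.1ℤ ℤ.+ ℤ.1ℤ ℤ.* (z ℤ.- ℤ.1ℤ)) (λ e → monomial opVal ℤ.1ℤ Z (map b2z e))))
  (trans (lem z (cube ℤ._+_ m (λ e → monomial opVal ℤ.1ℤ Z (map b2z e)))) (cong (λ p → (ℤ.1ℤ ℤ.+ z) ℤ.* p) (cube-monomial Z)))
  where
  lem : ∀ z s → (ℤ.1ℤ ℤ.+ ℤ.0ℤ ℤ.* (z ℤ.- ℤ.1ℤ)) ℤ.* s ℤ.+ (ℤ.1ℤ ℤ.+ ℤ.1ℤ ℤ.* (z ℤ.- ℤ.1ℤ)) ℤ.* s ≡ (ℤ.1ℤ ℤ.+ z) ℤ.* s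
  lem = ℤSolver.solve-∀

cube-swap : ∀ m n (h : Vec Bool m → Vec Bool n → ℤ) → cube ℤ._+_ m (λ a → cube ℤ._+_ n (h a)) ≡ cube ℤ._+_ n (λ b → cube ℤ._+_ m (λ a → h a b))
cube-swap zero    n h = refl
cube-swap (suc m) n h = trans (cong₂ ℤ._+_ (cube-swap m n _) (cube-swap m n _)) (sym (cube-+ n _ _))

-- A position below 2^J is written Dβ + z. Its low ℓ bits z address a place within a coefficient,
-- and the remaining v ℓ bits β spell the exponent vector in base D = 2^ℓ.
module Kronecker {v} (ℓ : ℕ) (ts : List (Term v)) (norm-small : 10 * norm ts ≤ 2 ^ 2 ^ ℓ) {d} (d<D : d < 2 ^ ℓ) (exponents : ExponentsBelow d ts) where

  D R J : ℕ
  D = 2 ^ ℓ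
  R = D ^ v
  J = suc v * ℓ

  2^J : 2 ^ J ≡ D * R
  2^J = trans (ℕₚ.^-distribˡ-+-* 2 ℓ (v * ℓ)) (cong (D *_) (trans (cong (2 ^_) (ℕₚ.*-comm v ℓ)) (sym (ℕₚ.^-*-assoc 2 ℓ v))))

  X : ℤ
  X = evalTerms (points D D v) ts

  contribution : ℤ → ℕ → ℕ → ℤ
  contribution c κ β = c ℤ.* + (le β κ * 2 ^ (D * (κ ∸ β)))

  -- X/2^(Dβ) without the terms of index below β, that is, the integer that Q at the boundary Dβ has
  -- to equal.
  quotientAt : ℕ → List (Term v) → ℤ
  quotientAt β []             = ℤ.0ℤ
  quotientAt β ((c , α) ∷ us) = contribution c (kron D α) β ℤ.+ quotientAt β us

  coefficientAt : ℕ → List (Term v) → ℤ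
  coefficientAt β []             = ℤ.0ℤ
  coefficientAt β ((c , α) ∷ us) = c ℤ.* + eq (kron D α) β ℤ.+ coefficientAt β us

  contribution-yes : ∀ c {κ β} → β ≤ κ → contribution c κ β ≡ c ℤ.* 2^ (D * (κ ∸ β))
  contribution-yes c {κ} {β} h = cong (λ z → c ℤ.* + z) (trans (cong (_* 2 ^ (D * (κ ∸ β))) (lt-yes (s≤s h))) (ℕₚ.+-identityʳ _))

  contribution-no : ∀ c {κ β} → κ < β → contribution c κ β ≡ ℤ.0ℤ
  contribution-no c {κ} {β} h = trans (cong (λ z → c ℤ.* + (z * 2 ^ (D * (κ ∸ β)))) (lt-no h)) (ℤₚ.*-zeroʳ c)

  2^-* : ∀ a b → 2^ a ℤ.* 2^ b ≡ 2^ (a + b)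
  2^-* a b = trans (sym (ℤₚ.pos-* (2 ^ a) (2 ^ b))) (cong +_ (sym (ℕₚ.^-distribˡ-+-* 2 a b)))

  contribution-shift : ∀ c {κ β} → β ≤ κ → 2^ (D * β) ℤ.* contribution c κ β ≡ c ℤ.* 2^ (D * κ)
  contribution-shift c {κ} {β} h = trans (cong (2^ (D * β) ℤ.*_) (contribution-yes c h)) (trans (lem (2^ (D * β)) c (2^ (D * (κ ∸ β))))
    (cong (c ℤ.*_) (trans (2^-* (D * β) (D * (κ ∸ β))) (cong 2^ (trans (sym (ℕₚ.*-distribˡ-+ D β (κ ∸ β))) (cong (D *_) (ℕₚ.m+[n∸m]≡n h)))))))
    where
    lem : ∀ a c b → a ℤ.* (c ℤ.* b) ≡ c ℤ.* (a ℤ.* b)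
    lem = ℤSolver.solve-∀

  -- A term of index κ ≥ β is divided exactly. A term with κ < β is dropped, and it is at most |c|
  -- 2^(Dβ) / 2^D.
  fraction : ∀ β us → ℤ.∣ evalTerms (points D D v) us ℤ.- 2^ (D * β) ℤ.* quotientAt β us ∣ * 2 ^ D ≤ norm us * 2 ^ (D * β)
  fraction β []             = ℕₚ.≤-reflexive (cong (λ z → ℤ.∣ ℤ.0ℤ ℤ.- z ∣ * 2 ^ D) (ℤₚ.*-zeroʳ (2^ (D * β))))
  fraction β ((c , α) ∷ us) = begin
    ℤ.∣ c ℤ.* power (points D D v) α ℤ.+ E ℤ.- Θ ℤ.* (contribution c κ β ℤ.+ q) ∣ * 2 ^ D
      ≡⟨ cong (λ z → ℤ.∣ z ∣ * 2 ^ D) (trans (cong (λ p → c ℤ.* p ℤ.+ E ℤ.- Θ ℤ.* (contribution c κ β ℤ.+ q)) (power-points D D α)) (lem (c ℤ.* 2^ (D * κ)) E Θ (contribution c κ β) q)) ⟩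
    ℤ.∣ (c ℤ.* 2^ (D * κ) ℤ.- Θ ℤ.* contribution c κ β) ℤ.+ (E ℤ.- Θ ℤ.* q) ∣ * 2 ^ D
      ≤⟨ ℕₚ.*-monoˡ-≤ (2 ^ D) (ℤₚ.∣i+j∣≤∣i∣+∣j∣ (c ℤ.* 2^ (D * κ) ℤ.- Θ ℤ.* contribution c κ β) (E ℤ.- Θ ℤ.* q)) ⟩
    (ℤ.∣ c ℤ.* 2^ (D * κ) ℤ.- Θ ℤ.* contribution c κ β ∣ + ℤ.∣ E ℤ.- Θ ℤ.* q ∣) * 2 ^ D
      ≡⟨ ℕₚ.*-distribʳ-+ (2 ^ D) ℤ.∣ c ℤ.* 2^ (D * κ) ℤ.- Θ ℤ.* contribution c κ β ∣ _ ⟩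
    ℤ.∣ c ℤ.* 2^ (D * κ) ℤ.- Θ ℤ.* contribution c κ β ∣ * 2 ^ D + ℤ.∣ E ℤ.- Θ ℤ.* q ∣ * 2 ^ D
      ≤⟨ ℕₚ.+-mono-≤ (first (ℕₚ.<-≤-connex κ β)) (fraction β us) ⟩
    ℤ.∣ c ∣ * 2 ^ (D * β) + norm us * 2 ^ (D * β)
      ≡⟨ sym (ℕₚ.*-distribʳ-+ (2 ^ (D * β)) ℤ.∣ c ∣ (norm us)) ⟩
    (ℤ.∣ c ∣ + norm us) * 2 ^ (D * β) ∎
    where
    open ℕₚ.≤-Reasoning
    κ : ℕ
    κ = kron D α
    E Θ q : ℤ
    E = evalTerms (points D D v) us
    Θ = 2^ (D * β)
    q = quotientAt β us
    lem : ∀ a E Θ b q → a ℤ.+ E ℤ.- Θ ℤ.* (b ℤ.+ q) ≡ (a ℤ.- Θ ℤ.* b) ℤ.+ (E ℤ.- Θ ℤ.* q)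
    lem = ℤSolver.solve-∀
    first : κ < β ⊎ β ≤ κ → ℤ.∣ c ℤ.* 2^ (D * κ) ℤ.- Θ ℤ.* contribution c κ β ∣ * 2 ^ D ≤ ℤ.∣ c ∣ * 2 ^ (D * β)
    first (inj₂ h) = ℕₚ.≤-trans (ℕₚ.≤-reflexive (cong (λ z → ℤ.∣ z ∣ * 2 ^ D) (trans (cong (λ z → c ℤ.* 2^ (D * κ) ℤ.- z) (contribution-shift c h)) (ℤₚ.+-inverseʳ (c ℤ.* 2^ (D * κ)))))) z≤n
    first (inj₁ h) = ℕₚ.≤-trans (ℕₚ.≤-reflexive (trans (cong (λ z → ℤ.∣ z ∣ * 2 ^ D) (trans (cong (λ z → c ℤ.* 2^ (D * κ) ℤ.- Θ ℤ.* z) (contribution-no c h)) (lem2 (c ℤ.* 2^ (D * κ)) Θ)))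
        (trans (cong (_* 2 ^ D) (ℤₚ.abs-* c (2^ (D * κ)))) (trans (ℕₚ.*-assoc ℤ.∣ c ∣ (2 ^ (D * κ)) (2 ^ D)) (cong (ℤ.∣ c ∣ *_) (sym (ℕₚ.^-distribˡ-+-* 2 (D * κ) D)))))))
      (ℕₚ.*-monoʳ-≤ ℤ.∣ c ∣ (ℕₚ.^-monoʳ-≤ 2 (ℕₚ.≤-trans (ℕₚ.≤-reflexive (trans (ℕₚ.+-comm (D * κ) D) (sym (ℕₚ.*-suc D κ)))) (ℕₚ.*-monoʳ-≤ D h))))
      where
      lem2 : ∀ a Θ → a ℤ.- Θ ℤ.* ℤ.0ℤ ≡ a
      lem2 = ℤSolver.solve-∀

  cancel-2^D : ∀ {a b} → a * 2 ^ D ≤ norm ts * b → 10 * a ≤ b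
  cancel-2^D {a} {b} h = ℕₚ.*-cancelʳ-≤ (10 * a) b (2 ^ D) ⦃ ℕ.>-nonZero (ℕₚ.m^n>0 2 D) ⦄ (begin
    10 * a * 2 ^ D      ≡⟨ ℕₚ.*-assoc 10 a (2 ^ D) ⟩
    10 * (a * 2 ^ D)    ≤⟨ ℕₚ.*-monoʳ-≤ 10 h ⟩
    10 * (norm ts * b)  ≡⟨ sym (ℕₚ.*-assoc 10 (norm ts) b) ⟩
    10 * norm ts * b    ≤⟨ ℕₚ.*-monoˡ-≤ b norm-small ⟩
    2 ^ D * b           ≡⟨ ℕₚ.*-comm (2 ^ D) b ⟩
    b * 2 ^ D ∎)
    where open ℕₚ.≤-Reasoning

  near-quotient : ∀ β → 10 * ℤ.∣ X ℤ.- 2^ (D * β) ℤ.* quotientAt β ts ∣ ≤ 2 ^ (D * β)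
  near-quotient β = cancel-2^D {ℤ.∣ X ℤ.- 2^ (D * β) ℤ.* quotientAt β ts ∣} (fraction β ts)

  kron-small : ∀ (α : Vec ℕ v) → (∀ i → lookup α i ≤ d) → kron D α < R
  kron-small α h = kron-< α (λ i → ℕₚ.≤-<-trans (h i) d<D)

  quotientAt-R : ∀ us → ExponentsBelow d us → quotientAt R us ≡ ℤ.0ℤ
  quotientAt-R []             _        = refl
  quotientAt-R ((c , α) ∷ us) (p ∷ ps) = cong₂ ℤ._+_ (contribution-no c (kron-small α p)) (quotientAt-R us ps)

  -- At β = R every term has been dropped, so the bound on the remainder is a bound on X itself.
  X-small : ℤ.∣ X ∣ ≤ 2 ^ 2 ^ J
  X-small = begin
    ℤ.∣ X ∣                                             ≤⟨ ℕₚ.m≤m+n _ _ ⟩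
    10 * ℤ.∣ X ∣                                        ≡⟨ cong (λ z → 10 * ℤ.∣ z ∣) (sym (trans (cong (λ z → X ℤ.- 2^ (D * R) ℤ.* z) (quotientAt-R ts exponents)) (lem X (2^ (D * R))))) ⟩
    10 * ℤ.∣ X ℤ.- 2^ (D * R) ℤ.* quotientAt R ts ∣     ≤⟨ near-quotient R ⟩
    2 ^ (D * R)                                         ≡⟨ cong (2 ^_) (sym 2^J) ⟩
    2 ^ 2 ^ J ∎
    where
    open ℕₚ.≤-Reasoning
    lem : ∀ a T → a ℤ.- T ℤ.* ℤ.0ℤ ≡ a
    lem = ℤSolver.solve-∀

  quotient-step : ∀ β us → quotientAt β us ℤ.- 2^ D ℤ.* quotientAt (suc β) us ≡ coefficientAt β us
  quotient-step β []             = trans (cong (λ z → ℤ.0ℤ ℤ.- z) (ℤₚ.*-zeroʳ (2^ D))) refl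
  quotient-step β ((c , α) ∷ us) = trans (lem (contribution c κ β) (quotientAt β us) (2^ D) (contribution c κ (suc β)) (quotientAt (suc β) us))
    (cong₂ ℤ._+_ (first (ℕₚ.<-cmp κ β)) (quotient-step β us))
    where
    κ : ℕ
    κ = kron D α
    lem : ∀ a q T b r → a ℤ.+ q ℤ.- T ℤ.* (b ℤ.+ r) ≡ (a ℤ.- T ℤ.* b) ℤ.+ (q ℤ.- T ℤ.* r)
    lem = ℤSolver.solve-∀
    first : Relation.Binary.Tri (κ < β) (κ ≡ β) (β < κ) → contribution c κ β ℤ.- 2^ D ℤ.* contribution c κ (suc β) ≡ c ℤ.* + eq κ β
    first (Relation.Binary.tri< h _ _) = trans (cong₂ (λ a b → a ℤ.- 2^ D ℤ.* b) (contribution-no c h) (contribution-no c (ℕₚ.m<n⇒m<1+n h)))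
      (trans (cong (λ z → ℤ.0ℤ ℤ.- z) (ℤₚ.*-zeroʳ (2^ D))) (sym (trans (cong (λ z → c ℤ.* + z) (eq-no (ℕₚ.<⇒≢ h))) (ℤₚ.*-zeroʳ c))))
    first (Relation.Binary.tri≈ _ h _) = trans (cong₂ (λ a b → a ℤ.- 2^ D ℤ.* b)
        (trans (contribution-yes c (ℕₚ.≤-reflexive (sym h))) (cong (λ z → c ℤ.* 2^ z) (trans (cong (D *_) (ℕₚ.m≤n⇒m∸n≡0 (ℕₚ.≤-reflexive h))) (ℕₚ.*-zeroʳ D))))
        (contribution-no c (s≤s (ℕₚ.≤-reflexive h))))
      (trans (trans (cong (λ z → c ℤ.* ℤ.1ℤ ℤ.- z) (ℤₚ.*-zeroʳ (2^ D))) (ℤₚ.+-identityʳ (c ℤ.* ℤ.1ℤ))) (cong (λ z → c ℤ.* + z) (sym (eq-yes h))))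
    first (Relation.Binary.tri> _ _ h) = trans (cong₂ (λ a b → a ℤ.- 2^ D ℤ.* b) (contribution-yes c (ℕₚ.<⇒≤ h)) (contribution-yes c h))
      (trans (cong (λ z → c ℤ.* z ℤ.- 2^ D ℤ.* (c ℤ.* 2^ (D * (κ ∸ suc β)))) split) (trans (lem2 c (2^ D) (2^ (D * (κ ∸ suc β))))
        (sym (trans (cong (λ z → c ℤ.* + z) (eq-no (λ e → ℕₚ.<⇒≢ h (sym e)))) (ℤₚ.*-zeroʳ c)))))
      where
      lem2 : ∀ c T y → c ℤ.* (T ℤ.* y) ℤ.- T ℤ.* (c ℤ.* y) ≡ ℤ.0ℤ
      lem2 = ℤSolver.solve-∀
      split : 2^ (D * (κ ∸ β)) ≡ 2^ D ℤ.* 2^ (D * (κ ∸ suc β))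
      split = trans (cong (λ z → 2^ (D * z)) (ℕₚ.+-∸-assoc 1 h)) (trans (cong 2^ (ℕₚ.*-suc D (κ ∸ suc β))) (sym (2^-* D (D * (κ ∸ suc β)))))

  module _ (x : Vec ℤ v) where

    Z : Vec ℤ (v * ℓ)
    Z = allSquarings ℓ x

    mono : Vec Bool (v * ℓ) → ℤ
    mono e = monomial opVal ℤ.1ℤ Z (map b2z e)

    coefficients-sum : ∀ us → ExponentsBelow d us → cube ℤ._+_ (v * ℓ) (λ e → mono e ℤ.* coefficientAt (num e) us) ≡ evalTerms x us
    coefficients-sum []             _        = trans (cube-cong ℤ._+_ (v * ℓ) (λ e → ℤₚ.*-zeroʳ (mono e))) (cube-0 (v * ℓ))
    coefficients-sum ((c , α) ∷ us) (p ∷ ps) = trans (cube-cong ℤ._+_ (v * ℓ) (λ e → ℤₚ.*-distribˡ-+ (mono e) (c ℤ.* + eq κ (num e)) (coefficientAt (num e) us)))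
      (trans (cube-+ (v * ℓ) _ _) (cong₂ ℤ._+_ single (coefficients-sum us ps)))
      where
      κ : ℕ
      κ = kron D α
      u : Vec Bool (v * ℓ)
      u = exponentBits ℓ α
      small′ : ∀ i → lookup α i < 2 ^ ℓ
      small′ i = ℕₚ.≤-<-trans (p i) d<D
      single : cube ℤ._+_ (v * ℓ) (λ e → mono e ℤ.* (c ℤ.* + eq κ (num e))) ≡ c ℤ.* power x α
      single = trans (cube-single (v * ℓ) _ u (λ e e≢u → trans (cong (λ z → mono e ℤ.* (c ℤ.* + z))
            (eq-no (λ h → e≢u (num-injective e u (trans (sym h) (sym (num-exponentBits ℓ α small′))))))) (trans (cong (mono e ℤ.*_) (ℤₚ.*-zeroʳ c)) (ℤₚ.*-zeroʳ (mono e)))))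
        (trans (cong₂ (λ a b → a ℤ.* (c ℤ.* + b)) (monomial-exponentBits ℓ x α small′) (eq-yes (sym (num-exponentBits ℓ α small′)))) (lem (power x α) c))
        where
        lem : ∀ a c → a ℤ.* (c ℤ.* ℤ.1ℤ) ≡ c ℤ.* a
        lem = ℤSolver.solve-∀

    module _ (q : ℕ → ℤ) (q-exact : ∀ β → β ≤ R → q (D * β) ≡ quotientAt β ts) (dig : ℕ → ℕ)
      (dig-correct : ∀ k → k < 2 ^ J → + dig k ≡ q k ℤ.- + 2 ℤ.* q (suc k) ℤ.+ + 2) where

      -- For fixed high bits β the sum over the low bits telescopes to q (Dβ) - 2^D q (D(β+1)).
      -- There q is exact, so the difference is the coefficient of the monomial β. The shift of all
      -- digits by 2 leaves 2 Π (1 + Z_j) to be subtracted.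
      digits-sum : cube ℤ._+_ J (λ e → monomial opVal ℤ.1ℤ (allSquarings ℓ (+ 2 ∷ x)) (map b2z e) ℤ.* + dig (num e))
        ≡ evalTerms x ts ℤ.+ + 2 ℤ.* Vec.foldr (λ _ → ℤ) (λ z p → (ℤ.1ℤ ℤ.+ z) ℤ.* p) ℤ.1ℤ (allSquarings ℓ (+ 2 ∷ x))
      digits-sum = begin
        cube ℤ._+_ J (λ e → m e ℤ.* + dig (num e))
          ≡⟨ cube-cong ℤ._+_ J (λ e → trans (cong (m e ℤ.*_) (dig-correct (num e) (num<2^ e))) (ℤₚ.*-distribˡ-+ (m e) (carry′ (num e)) (+ 2))) ⟩
        cube ℤ._+_ J (λ e → m e ℤ.* carry′ (num e) ℤ.+ m e ℤ.* + 2)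
          ≡⟨ cube-+ J _ _ ⟩
        cube ℤ._+_ J (λ e → m e ℤ.* carry′ (num e)) ℤ.+ cube ℤ._+_ J (λ e → m e ℤ.* + 2)
          ≡⟨ cong₂ ℤ._+_ carries twos ⟩
        evalTerms x ts ℤ.+ + 2 ℤ.* Vec.foldr (λ _ → ℤ) (λ z p → (ℤ.1ℤ ℤ.+ z) ℤ.* p) ℤ.1ℤ (allSquarings ℓ (+ 2 ∷ x)) ∎
        where
        open ≡-Reasoning
        m : Vec Bool J → ℤ
        m e = monomial opVal ℤ.1ℤ (allSquarings ℓ (+ 2 ∷ x)) (map b2z e)
        carry′ : ℕ → ℤ
        carry′ k = q k ℤ.- + 2 ℤ.* q (suc k)
        twos : cube ℤ._+_ J (λ e → m e ℤ.* + 2) ≡ + 2 ℤ.* Vec.foldr (λ _ → ℤ) (λ z p → (ℤ.1ℤ ℤ.+ z) ℤ.* p) ℤ.1ℤ (allSquarings ℓ (+ 2 ∷ x))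
        twos = trans (cube-cong ℤ._+_ J (λ e → ℤₚ.*-comm (m e) (+ 2))) (trans (cube-*ˡ J (+ 2) m) (cong (+ 2 ℤ.*_) (cube-monomial (allSquarings ℓ (+ 2 ∷ x)))))
        low : ∀ hi → cube ℤ._+_ ℓ (λ lo → m (lo ++ hi) ℤ.* carry′ (num (lo ++ hi))) ≡ mono hi ℤ.* coefficientAt (num hi) ts
        low hi = begin
          cube ℤ._+_ ℓ (λ lo → m (lo ++ hi) ℤ.* carry′ (num (lo ++ hi)))
            ≡⟨ cube-cong ℤ._+_ ℓ (λ lo → trans (cong₂ ℤ._*_ (split-mono lo) (cong carry′ (num-++ lo hi))) (lem (2^ (num lo)) (mono hi) (carry′ (num lo + s)))) ⟩
          cube ℤ._+_ ℓ (λ lo → mono hi ℤ.* (carry′ (num lo + s) ℤ.* 2^ (num lo)))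
            ≡⟨ cube-*ˡ ℓ (mono hi) (λ lo → carry′ (num lo + s) ℤ.* 2^ (num lo)) ⟩
          mono hi ℤ.* cube ℤ._+_ ℓ (λ lo → carry′ (num lo + s) ℤ.* 2^ (num lo))
            ≡⟨ cong (mono hi ℤ.*_) (trans (cube-Σz ℓ (λ z → carry′ (z + s) ℤ.* 2^ z)) (telescope D (λ z → q (z + s)))) ⟩
          mono hi ℤ.* (q s ℤ.- 2^ D ℤ.* q (D + s))
            ≡⟨ cong₂ (λ a b → mono hi ℤ.* (a ℤ.- 2^ D ℤ.* b)) (q-exact β (ℕₚ.<⇒≤ β<R)) (trans (cong q (sym (ℕₚ.*-suc D β))) (q-exact (suc β) β<R)) ⟩
          mono hi ℤ.* (quotientAt β ts ℤ.- 2^ D ℤ.* quotientAt (suc β) ts)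
            ≡⟨ cong (mono hi ℤ.*_) (quotient-step β ts) ⟩
          mono hi ℤ.* coefficientAt β ts ∎
          where
          β s : ℕ
          β = num hi
          s = D * β
          β<R : β < R
          β<R = subst (β <_) (trans (cong (2 ^_) (ℕₚ.*-comm v ℓ)) (sym (ℕₚ.^-*-assoc 2 ℓ v))) (num<2^ hi)
          lem : ∀ t m c → t ℤ.* m ℤ.* c ≡ m ℤ.* (c ℤ.* t)
          lem = ℤSolver.solve-∀
          +2^ : ∀ a → (+ 2) ℤ.^ a ≡ 2^ a
          +2^ a = trans (2^-^ 1 a) (cong 2^ (ℕₚ.+-identityʳ a))
          split-mono : ∀ lo → m (lo ++ hi) ≡ 2^ (num lo) ℤ.* mono hi
          split-mono lo = trans (cong (monomial opVal ℤ.1ℤ (squarings ℓ (+ 2) ++ Z)) (Vecₚ.map-++ b2z lo hi)) (trans (monomial-++ (squarings ℓ (+ 2)) (map b2z lo) Z (map b2z hi))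
            (cong (ℤ._* mono hi) (trans (monomial-squarings (+ 2) lo) (+2^ (num lo)))))
        carries : cube ℤ._+_ J (λ e → m e ℤ.* carry′ (num e)) ≡ evalTerms x ts
        carries = trans (cube-++ ℤ._+_ ℓ (v * ℓ) _) (trans (cube-swap ℓ (v * ℓ) _) (trans (cube-cong ℤ._+_ (v * ℓ) low) (coefficients-sum ts exponents)))

-- Circuits for a polynomial from its packed residues

easy-2^ : ∀ {u} → Bounded u → ∀ {r} → Easy {r} (λ n v → 2 ^ u n)
easy-2^ {u} uB = easy-const (proj₁ B) (λ n → 2 ^ u n) (λ n → ℕₚ.^-monoʳ-< 2 (s≤s (s≤s z≤n)) (proj₂ B n))
  where
  B : Bounded (λ n → suc (u n))
  B = Bounded-+ (Bounded-const 1) uB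

onePlus : ∀ {m} → Vec ℤ m → ℤ
onePlus = Vec.foldr (λ _ → ℤ) (λ z p → (ℤ.1ℤ ℤ.+ z) ℤ.* p) ℤ.1ℤ

module _ {I : Set} where

  squaringFs : ∀ ℓ → (I → ℤ) → Vec (I → ℤ) ℓ
  squaringFs zero    f = []
  squaringFs (suc ℓ) f = f ∷ squaringFs ℓ (λ x → f x ℤ.* f x)

  squaringFs-⟨⟩ : ∀ ℓ f x → squaringFs ℓ f ⟨ x ⟩ ≡ squarings ℓ (f x)
  squaringFs-⟨⟩ zero    f x = refl
  squaringFs-⟨⟩ (suc ℓ) f x = cong (f x ∷_) (squaringFs-⟨⟩ ℓ _ x)

  C-squarings : ∀ {i} {Γ : Vec (I → ℤ) i} ℓ {f} → Has Γ f → Computable opVal Γ ℓ (squaringFs ℓ f)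
  C-squarings zero    h = C-ret nilV
  C-squarings (suc ℓ) h = C-step times h h (C-cons (there h) (C-squarings ℓ here))

  C-allSquarings : ∀ {i u} {Γ : Vec (I → ℤ) i} ℓ {fs : Vec (I → ℤ) u} → HasV Γ fs → Computable opVal Γ (u * ℓ) (concat (map (squaringFs ℓ) fs))
  C-allSquarings ℓ {[]}     h = C-ret nilV
  C-allSquarings {u = suc u} ℓ {f ∷ fs} h = C-mono (ℕₚ.≤-reflexive (cong (λ z → ℓ + z) (ℕₚ.+-identityʳ (u * ℓ))))
    (C-let (C-squarings ℓ (headV h)) (C-let (C-allSquarings ℓ (skipV (squaringFs ℓ f) (tailV h)))
      (C-ret (appendV (skipV (concat (map (squaringFs ℓ) fs)) (hereV (squaringFs ℓ f))) (hereV (concat (map (squaringFs ℓ) fs)))))))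

  allSquarings-⟨⟩ : ∀ {u} ℓ (fs : Vec (I → ℤ) u) x → concat (map (squaringFs ℓ) fs) ⟨ x ⟩ ≡ allSquarings ℓ (fs ⟨ x ⟩)
  allSquarings-⟨⟩ ℓ fs x = trans (concat-⟨⟩ (map (squaringFs ℓ) fs) x) (cong concat (trans (sym (Vecₚ.map-∘ (_⟨ x ⟩) (squaringFs ℓ) fs))
    (trans (Vecₚ.map-cong (λ f → squaringFs-⟨⟩ ℓ f x) fs) (Vecₚ.map-∘ (squarings ℓ) (λ f → f x) fs))))

  C-onePlus : ∀ {i m} {Γ : Vec (I → ℤ) i} {Zs : Vec (I → ℤ) m} → Has Γ (const ℤ.1ℤ) → HasV Γ Zs → Computable opVal Γ (m * 2) ((λ x → onePlus (Zs ⟨ x ⟩)) ∷ [])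
  C-onePlus {Zs = []}     h1 h = C-wire h1
  C-onePlus {m = suc m} {Zs = Z ∷ Zs} h1 h = C-mono (ℕₚ.≤-reflexive (cong suc (ℕₚ.+-comm (m * 2) 1)))
    (C-op times (C-op plus (C-wire h1) (C-wire (headV h))) (C-onePlus h1 (tailV h)))

  iterSquare : ℕ → (I → ℤ) → I → ℤ
  iterSquare zero    f = f
  iterSquare (suc k) f = iterSquare k (λ x → f x ℤ.* f x)

  C-iterSquare : ∀ {i} {Γ : Vec (I → ℤ) i} k {f} → Has Γ f → Computable opVal Γ k (iterSquare k f ∷ [])
  C-iterSquare zero    h = C-wire h
  C-iterSquare (suc k) h = C-step times h h (C-iterSquare k here)

  iterSquare-2^ : ∀ k f x E → f x ≡ 2^ E → iterSquare k f x ≡ 2^ (E * 2 ^ k)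
  iterSquare-2^ zero    f x E h = trans h (cong 2^ (sym (ℕₚ.*-identityʳ E)))
  iterSquare-2^ (suc k) f x E h = trans (iterSquare-2^ k _ x (E + E) (trans (cong₂ ℤ._*_ h h) (trans (sym (ℤₚ.pos-* (2 ^ E) (2 ^ E))) (cong +_ (sym (ℕₚ.^-distribˡ-+-* 2 E E))))))
    (cong 2^ (lem E (2 ^ k)))
    where
    lem : ∀ E t → (E + E) * t ≡ E * (2 * t)
    lem = ℕSolver.solve-∀

  -- Each coordinate is the previous one raised to the power 2^ℓ, by ℓ squarings.
  pointFs : ℕ → ∀ v → (I → ℤ) → Vec (I → ℤ) v
  pointFs ℓ zero    f = []
  pointFs ℓ (suc v) f = f ∷ pointFs ℓ v (iterSquare ℓ f)

  C-points : ∀ {i} {Γ : Vec (I → ℤ) i} ℓ v {f} → Has Γ f → Computable opVal Γ (v * ℓ) (pointFs ℓ v f)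
  C-points ℓ zero    h = C-ret nilV
  C-points ℓ (suc v) {f} h = C-cons h (C-let (C-iterSquare ℓ h) (C-points ℓ v here))

  pointFs-⟨⟩ : ∀ ℓ v f x E → f x ≡ 2^ E → pointFs ℓ v f ⟨ x ⟩ ≡ points (2 ^ ℓ) E v
  pointFs-⟨⟩ ℓ zero    f x E h = refl
  pointFs-⟨⟩ ℓ (suc v) f x E h = cong₂ _∷_ h (pointFs-⟨⟩ ℓ v (iterSquare ℓ f) x (E * 2 ^ ℓ) (iterSquare-2^ ℓ f x E h))

adjust : ∀ {A : Set} {m} t → A → Vec A m → Vec A t
adjust zero    d v       = []
adjust (suc t) d []      = d ∷ adjust t d []
adjust (suc t) d (x ∷ v) = x ∷ adjust t d v

adjust-has : ∀ {I V : Set} {i m} {Γ : Vec (I → V) i} t {d} {fs : Vec (I → V) m} → Has Γ d → HasV Γ fs → HasV Γ (adjust t d fs)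
adjust-has zero             z h = nilV
adjust-has (suc t) {fs = []}     z h = consV z (adjust-has t z h)
adjust-has (suc t) {fs = f ∷ fs} z h = consV (headV h) (adjust-has t z (tailV h))

map-adjust : ∀ {A B : Set} {m} (φ : A → B) t d (v : Vec A m) → map φ (adjust t d v) ≡ adjust t (φ d) (map φ v)
map-adjust φ zero    d v       = refl
map-adjust φ (suc t) d []      = cong (φ d ∷_) (map-adjust φ t d [])
map-adjust φ (suc t) d (x ∷ v) = cong (φ x ∷_) (map-adjust φ t d v)

bits-0 : ∀ t → bits t 0 ≡ adjust t false []
bits-0 zero    = refl
bits-0 (suc t) = cong (false ∷_) (bits-0 t)

bits-num : ∀ {m} t (u : Vec Bool m) → bits t (num u) ≡ adjust t false u
bits-num zero    u       = refl
bits-num (suc t) []      = bits-0 (suc t)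
bits-num (suc t) (b ∷ u) = cong₂ _∷_ (low b) (trans (cong (bits t) (high b)) (bits-num t u))
  where
  rem-b : ∀ b → (b2n b + 2 * num u) ℕ.% 2 ≡ b2n b
  rem-b b = <-unique (m%n<n (b2n b + 2 * num u) 2) (small′ b) (≋-trans (rem-≋ (b2n b + 2 * num u) {2} (s≤s z≤n))
    (cong-by (+ num u) (cong (λ z → + b2n b ℤ.+ z) (trans (cong +_ (ℕₚ.*-comm 2 (num u))) (ℤₚ.pos-* (num u) 2)))))
    where
    small′ : ∀ b → b2n b < 2
    small′ false = s≤s z≤n
    small′ true  = s≤s (s≤s z≤n)
  low : ∀ b → ((b2n b + 2 * num u) ℕ.% 2 ℕ.≡ᵇ 1) ≡ b
  low b = trans (cong (ℕ._≡ᵇ 1) (rem-b b)) (test b)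
    where
    test : ∀ b → (b2n b ℕ.≡ᵇ 1) ≡ b
    test false = refl
    test true  = refl
  high : ∀ b → (b2n b + 2 * num u) ℕ./ 2 ≡ num u
  high b = ℕₚ.*-cancelʳ-≡ _ (num u) 2 (ℕₚ.+-cancelˡ-≡ (b2n b) _ _ (trans (cong (_+ (b2n b + 2 * num u) ℕ./ 2 * 2) (sym (rem-b b)))
    (trans (sym (m≡m%n+[m/n]*n (b2n b + 2 * num u) 2)) (cong (λ z → b2n b + z) (ℕₚ.*-comm 2 (num u))))))

adjust-exact : ∀ {A : Set} {m} d (v : Vec A m) → adjust m d v ≡ v
adjust-exact d []      = refl
adjust-exact d (x ∷ v) = cong (x ∷_) (adjust-exact d v)

reindexed : ∀ {w J} → w ≡ J → (D : Code 1 (1 + (w + 0))) (f : ℕ → ℕ) →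
  (∀ Z → run opVal D (ℤ.1ℤ ∷ Z ++ []) ≡ cube ℤ._+_ w (λ e → monomial opVal ℤ.1ℤ Z (map b2z e) ℤ.* + f (num e)) ∷ []) →
  Σ (Code 1 (1 + J)) λ D′ → gateCount D′ ≡ gateCount D ×
    (∀ Z → run opVal D′ (ℤ.1ℤ ∷ Z) ≡ cube ℤ._+_ J (λ e → monomial opVal ℤ.1ℤ Z (map b2z e) ℤ.* + f (num e)) ∷ [])
reindexed {w} refl D f h = ren τ D , gateCount-ren τ D , λ Z → trans (run-ren opVal τ D (ℤ.1ℤ ∷ Z)) (trans (cong (λ u → run opVal D (ℤ.1ℤ ∷ u))
    (trans (Vecₚ.map-++ (lookup (ℤ.1ℤ ∷ Z)) (weakenWires (allFin w)) []) (cong (_++ []) (trans (map-lookup-weaken ℤ.1ℤ Z (allFin w)) (Vecₚ.map-lookup-allFin Z))))) (h Z))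
  where
  τ : Vec (Fin (1 + w)) (1 + (w + 0))
  τ = zero ∷ weakenWires (allFin w) ++ []

-- Here the weights of `sumCodes` stay free and there are no Boolean parameters. The length J n of a
-- position must be exactly `pw a n`, being a number of summation variables.
module DigitSums (collapse : Collapse) (a : ℕ) (J : ℕ → ℕ) (J≡ : ∀ n → pw a n ≡ J n) (dig : ℕ → ℕ → ℕ) (easy-dig : Easy {1} (λ n u → dig n (head u))) where

  private
    b′ : ℕ
    b′ = proj₁ (easy-dig a)
    digWords : ∀ n → WordFunction 1 (pw a n) (pw b′ n) (proj₁ (proj₂ (easy-dig a)) n) (λ u → dig n (head u))
    digWords = proj₂ (proj₂ (proj₂ (easy-dig a)))
    digCode : ∀ n → Code (pw b′ n) (1 + (pw a n + 0))
    digCode n = code (program (digWords n))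

    digCode-value : ∀ n e → num (run opBool (digCode n) (true ∷ e ++ [])) ≡ dig n (num e)
    digCode-value n e = trans (cong (λ u → num (run opBool (digCode n) u)) (sym (inputs-⟨⟩ (e ∷ [])))) (trans (cong num (correct (program (digWords n)) (e ∷ []))) (computes (digWords n) (e ∷ [])))

    sums : Σ (∀ n → Code 1 (1 + (pw a n + 0))) λ D → Bounded (λ n → gateCount (D n)) ×
      (∀ n Z z → run opVal (D n) (ℤ.1ℤ ∷ Z ++ map b2z z) ≡ weightedSum {pw a n} (digCode n) Z z ∷ [])
    sums = sumCodes collapse a {λ _ → 0} {pw b′} (Bounded-const 0) (Bounded-pw b′) digCode
      (Bounded-≤ (λ n → small (program (digWords n))) (proj₁ (proj₂ (proj₂ (easy-dig a)))))

    indexed : ∀ n → Σ (Code 1 (1 + J n)) λ D′ → gateCount D′ ≡ gateCount (proj₁ sums n) ×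
      (∀ Z → run opVal D′ (ℤ.1ℤ ∷ Z) ≡ cube ℤ._+_ (J n) (λ e → monomial opVal ℤ.1ℤ Z (map b2z e) ℤ.* + dig n (num e)) ∷ [])
    indexed n = reindexed (J≡ n) (proj₁ sums n) (dig n) (λ Z → trans (proj₂ (proj₂ sums) n Z [])
      (cong (_∷ []) (cube-cong ℤ._+_ (pw a n) (λ e → cong (λ z → monomial opVal ℤ.1ℤ Z (map b2z e) ℤ.* + z) (digCode-value n e)))))

  abstract
    sumCode : ∀ n → Code 1 (1 + J n)
    sumCode n = proj₁ (indexed n)

    sumCode-bounded : Bounded (λ n → gateCount (sumCode n))
    sumCode-bounded = Bounded-≤ (λ n → ℕₚ.≤-reflexive (proj₁ (proj₂ (indexed n)))) (proj₁ (proj₂ sums))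

    sumCode-value : ∀ n Z → run opVal (sumCode n) (ℤ.1ℤ ∷ Z) ≡ cube ℤ._+_ (J n) (λ e → monomial opVal ℤ.1ℤ Z (map b2z e) ℤ.* + dig n (num e)) ∷ []
    sumCode-value n = proj₂ (proj₂ (indexed n))

-- Requiring 1 + v n = `pw c n` makes J n = (1 + v n) ℓ n equal to `pw (c + b) n`, the exact form
-- that the summation needs.
module FromResidues (collapse : Collapse) (b c : ℕ) (v : ℕ → ℕ) (suc-v : ∀ n → suc (v n) ≡ pw c n)
  (ts : ∀ n → List (Term (v n))) (norm-small : ∀ n → 10 * norm (ts n) ≤ 2 ^ 2 ^ pw b n)
  (d : ℕ → ℕ) (d<D : ∀ n → d n < 2 ^ pw b n) (exponents : ∀ n → ExponentsBelow (d n) (ts n))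
  (Xr : ℕ → ℕ → ℕ) (eXr : ∀ {r} {f : ℕ → Vec ℕ r → ℕ} → Easy f → Easy (λ n v → Xr n (f n v)))
  (Xr-correct : ∀ n p → Prime p → + Xr n p ≋ evalTerms (points (2 ^ pw b n) (2 ^ pw b n) (v n)) (ts n) [ + p ]) where

  ℓ J t W P : ℕ → ℕ
  ℓ = pw b
  J n = suc (v n) * ℓ n
  -- 2^t is 8 · (2^J)², the number of primes in 2^J blocks of W = 8 · 2^J primes each;
  -- `prime-supply` finds that many below P.
  t n = 2 * J n + 3
  W n = 8 * 2 ^ J n
  P n = 2 ^ (2 * t n + 12)

  J≡ : ∀ n → pw (c + b) n ≡ J n
  J≡ n = trans (sym (pw-* c b n)) (cong (_* ℓ n) (sym (suc-v n)))

  JB : Bounded J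
  JB = Bounded-≤ (λ n → ℕₚ.≤-reflexive (sym (J≡ n))) (Bounded-pw (c + b))

  vB : Bounded v
  vB = Bounded-≤ (λ n → ℕₚ.≤-trans (ℕₚ.n≤1+n (v n)) (ℕₚ.≤-reflexive (suc-v n))) (Bounded-pw c)

  supply : ∀ n → 2 ^ J n * W n ≤ idx (P n)
  supply n = ℕₚ.≤-trans (ℕₚ.≤-reflexive (trans (lem (2 ^ J n)) (trans (cong (λ z → z * 2 ^ 3) (trans (sym (ℕₚ.^-distribˡ-+-* 2 (J n) (J n))) (cong (2 ^_) (cong (λ z → J n + z) (sym (ℕₚ.+-identityʳ (J n)))))))
    (sym (ℕₚ.^-distribˡ-+-* 2 (2 * J n) 3))))) (prime-supply (t n))
    where
    lem : ∀ x → x * (8 * x) ≡ x * x * 8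
    lem = ℕSolver.solve-∀

  eW : ∀ {r} → Easy {r} (λ n u → W n)
  eW {r} = easy-* {r} {λ n u → 8} {λ n u → 2 ^ J n} (easy-lit 8) (easy-2^ JB)

  eP : ∀ {r} → Easy {r} (λ n u → P n)
  eP {r} = easy-2^ {λ n → 2 * t n + 12} (Bounded-+ (Bounded-* {λ _ → 2} {t} (Bounded-const 2) (Bounded-+ (Bounded-* {λ _ → 2} {J} (Bounded-const 2) JB) (Bounded-const 3))) (Bounded-const 12)) {r}

  easy-dig : Easy {1} (λ n u → digit (W n) (P n) (Xr n) (head u))
  easy-dig = EasyDigits.easy-digit collapse W P eW eP Xr eXr {1} {λ n u → head u} v0

  open DigitSums collapse (c + b) J J≡ (λ n → digit (W n) (P n) (Xr n)) easy-dig

  module _ (n : ℕ) where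
    private
      In : Set
      In = Vec ℤ (v n)
      xs : Vec (In → ℤ) (v n)
      xs = block id
      two : In → ℤ
      two _ = ℤ.1ℤ ℤ.+ ℤ.1ℤ
      Zs : Vec (In → ℤ) (J n)
      Zs = concat (map (squaringFs (ℓ n)) (two ∷ xs))
      D′ : Code 1 (1 + J n)
      D′ = sumCode n
      result′ : In → ℤ
      -- The sum of the shifted digits minus the contribution of the shift, written as an addition
      -- of equal terms.
      result′ x = head (run opVal D′ (ℤ.1ℤ ∷ Zs ⟨ x ⟩)) ℤ.- (onePlus (Zs ⟨ x ⟩) ℤ.+ onePlus (Zs ⟨ x ⟩))
      module Kr = Kronecker (ℓ n) (ts n) (norm-small n) (d<D n) (exponents n)
      module Digits = CRT (J n) (W n) (P n) refl (supply n) Kr.X Kr.X-small (Xr n) (Xr-correct n)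

    polynomialSize : ℕ
    polynomialSize = suc (J n + (gateCount D′ + (J n * 2 + 1 + 1)))

    polynomialCode : Computable opVal (const ℤ.1ℤ ∷ xs) polynomialSize (result′ ∷ [])
    polynomialCode = C-step plus here here (C-let (C-allSquarings (ℓ n) (consV here (thereV (thereV (hereV′ xs)))))
        (C-op minus (C-call D′ {gs = const ℤ.1ℤ ∷ Zs} (consV h1 (hereV Zs)) (λ x → single (run opVal D′ (ℤ.1ℤ ∷ Zs ⟨ x ⟩)))) (C-dup plus (C-onePlus h1 (hereV Zs)))))
      where
      hereV′ : ∀ {m} (fs : Vec (In → ℤ) m) → HasV fs fs
      hereV′ fs = allV
      h1 : Has (Zs ++ two ∷ const ℤ.1ℤ ∷ xs) (const ℤ.1ℤ)
      h1 = skip Zs (there here)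
      single : (u : Vec ℤ 1) → u ≡ head u ∷ []
      single (a ∷ []) = refl

    polynomialCode-value : ∀ x → run opVal (code polynomialCode) (ℤ.1ℤ ∷ x) ≡ evalTerms x (ts n) ∷ []
    polynomialCode-value x = trans (cong (λ u → run opVal (code polynomialCode) (ℤ.1ℤ ∷ u)) (sym (block-⟨⟩ id x))) (trans (correct polynomialCode x) (cong (_∷ []) value))
      where
      Z≡ : Zs ⟨ x ⟩ ≡ allSquarings (ℓ n) (+ 2 ∷ x)
      Z≡ = trans (allSquarings-⟨⟩ (ℓ n) (two ∷ xs) x) (cong (λ u → allSquarings (ℓ n) (+ 2 ∷ u)) (block-⟨⟩ id x))
      q : ℕ → ℤ
      q k = Digits.At.Q k
      q-exact : ∀ β → β ≤ Kr.R → q (Kr.D * β) ≡ Kr.quotientAt β (ts n)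
      q-exact β β≤R = Digits.At.exact (Kr.D * β) (subst (Kr.D * β ≤_) (sym Kr.2^J) (ℕₚ.*-monoʳ-≤ Kr.D β≤R)) (Kr.quotientAt β (ts n)) (Kr.near-quotient β)
      lem : ∀ e p → e ℤ.+ + 2 ℤ.* p ℤ.- (p ℤ.+ p) ≡ e
      lem = ℤSolver.solve-∀
      All : Vec ℤ (J n)
      All = allSquarings (ℓ n) (+ 2 ∷ x)
      weighted : head (run opVal D′ (ℤ.1ℤ ∷ Zs ⟨ x ⟩)) ≡ cube ℤ._+_ (J n) (λ e → monomial opVal ℤ.1ℤ All (map b2z e) ℤ.* + digit (W n) (P n) (Xr n) (num e))
      weighted = cong head (trans (cong (λ u → run opVal D′ (ℤ.1ℤ ∷ u)) Z≡) (sumCode-value n All))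
      -- Kept general in f, as unfolding digit is expensive.
      assemble : (f : ℕ → ℕ) → (∀ k → k < 2 ^ J n → + f k ≡ q k ℤ.- + 2 ℤ.* q (suc k) ℤ.+ + 2) →
        head (run opVal D′ (ℤ.1ℤ ∷ Zs ⟨ x ⟩)) ≡ cube ℤ._+_ (J n) (λ e → monomial opVal ℤ.1ℤ All (map b2z e) ℤ.* + f (num e)) → result′ x ≡ evalTerms x (ts n)
      assemble f hf h = trans (cong₂ ℤ._-_ (trans h (Kr.digits-sum x q q-exact f hf)) (cong (λ u → onePlus u ℤ.+ onePlus u) Z≡)) (lem (evalTerms x (ts n)) (onePlus All))
      value : result′ x ≡ evalTerms x (ts n)
      value = assemble (digit (W n) (P n) (Xr n)) Digits.digit-correct weighted

  polynomialCode-bounded : Bounded (λ n → gateCount (code (polynomialCode n)))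
  polynomialCode-bounded = Bounded-≤ (λ n → small (polynomialCode n))
    (Bounded-+ (Bounded-const 1) (Bounded-+ JB (Bounded-+ sumCode-bounded (Bounded-+ (Bounded-+ (Bounded-* JB (Bounded-const 2)) (Bounded-const 1)) (Bounded-const 1)))))

tabulateV : ∀ {I V : Set} {i m} {Γ : Vec (I → V) i} {f : Fin m → I → V} → (∀ j → Has Γ (f j)) → HasV Γ (tabulate f)
tabulateV {m = zero}  h = nilV
tabulateV {m = suc m} h = consV (h zero) (tabulateV (λ j → h (suc j)))

everywhere-++ : ∀ {A : Set} {P : A → Set} {m n} (xs : Vec A m) {ys : Vec A n} → (∀ i → P (lookup xs i)) → (∀ i → P (lookup ys i)) → ∀ i → P (lookup (xs ++ ys) i)
everywhere-++ []       p q i       = q i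
everywhere-++ (x ∷ xs) p q zero    = p zero
everywhere-++ {P = P} (x ∷ xs) {ys} p q (suc i) = everywhere-++ {P = P} xs {ys} (λ j → p (suc j)) q i

lookup-adjust : ∀ {A : Set} {k v} d (x : Vec A k) (k≤v : k ≤ v) i → lookup (adjust v d x) (inject≤ i k≤v) ≡ lookup x i
lookup-adjust d (a ∷ x) (s≤s h) zero    = refl
lookup-adjust d (a ∷ x) (s≤s h) (suc i) = lookup-adjust d x h i

Π<-even-odd : ∀ k h → Π< (2 * k) h ≡ Π< k (λ y → h (2 * y)) * Π< k (λ y → h (1 + 2 * y))
Π<-even-odd zero    h = refl
Π<-even-odd (suc k) h = trans (cong (λ m → Π< m h) (l k)) (trans (cong (λ z → h (1 + 2 * k) * (h (2 * k) * z)) (Π<-even-odd k h))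
  (l2 (h (1 + 2 * k)) (h (2 * k)) (Π< k (λ y → h (2 * y))) (Π< k (λ y → h (1 + 2 * y)))))
  where
  l : ∀ k → 2 * suc k ≡ suc (suc (2 * k))
  l = ℕSolver.solve-∀
  l2 : ∀ a b c d → a * (b * (c * d)) ≡ b * c * (a * d)
  l2 = ℕSolver.solve-∀

cube-Π< : ∀ w h → cube _*_ w (λ e → h (num e)) ≡ Π< (2 ^ w) h
cube-Π< zero    h = sym (ℕₚ.*-identityʳ _)
cube-Π< (suc w) h = trans (cong₂ _*_ (cube-Π< w (λ y → h (2 * y))) (cube-Π< w (λ y → h (1 + 2 * y)))) (sym (Π<-even-odd (2 ^ w) h))

unitExponent : ∀ {v} → Fin v → Vec ℕ v
unitExponent zero    = 1 ∷ replicate _ 0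
unitExponent (suc i) = 0 ∷ unitExponent i

power-zeros : ∀ {v} (x : Vec ℤ v) → power x (replicate v 0) ≡ ℤ.1ℤ
power-zeros []      = refl
power-zeros (x ∷ xs) = trans (ℤₚ.*-identityˡ _) (power-zeros xs)

power-unit : ∀ {v} (x : Vec ℤ v) i → power x (unitExponent i) ≡ lookup x i
power-unit (x ∷ xs) zero    = trans (cong (λ z → x ℤ.* ℤ.1ℤ ℤ.* z) (power-zeros xs)) (trans (ℤₚ.*-identityʳ _) (ℤₚ.*-identityʳ x))
power-unit (x ∷ xs) (suc i) = trans (ℤₚ.*-identityˡ _) (power-unit xs i)

unitExponent-≤1 : ∀ {v} (i j : Fin v) → lookup (unitExponent i) j ≤ 1
unitExponent-≤1 zero    zero    = ℕₚ.≤-refl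
unitExponent-≤1 zero    (suc j) = ℕₚ.≤-trans (ℕₚ.≤-reflexive (Vecₚ.lookup-replicate j 0)) z≤n
unitExponent-≤1 (suc i) zero    = z≤n
unitExponent-≤1 (suc i) (suc j) = unitExponent-≤1 i j

oneTerms : ∀ {v} → List (Term v)
oneTerms {v} = (ℤ.1ℤ , replicate v 0) ∷ []

varTerms : ∀ {v} → Fin v → List (Term v)
varTerms i = (ℤ.1ℤ , unitExponent i) ∷ []

bitTerms : ∀ {v} → Bool → List (Term v)
bitTerms false = []
bitTerms true  = oneTerms

evalTerms-one : ∀ {v} (x : Vec ℤ v) → evalTerms x oneTerms ≡ ℤ.1ℤ
evalTerms-one x = trans (ℤₚ.+-identityʳ _) (trans (ℤₚ.*-identityˡ _) (power-zeros x))

evalTerms-var : ∀ {v} (x : Vec ℤ v) i → evalTerms x (varTerms i) ≡ lookup x i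
evalTerms-var x i = trans (ℤₚ.+-identityʳ _) (trans (ℤₚ.*-identityˡ _) (power-unit x i))

evalTerms-bit : ∀ {v} (x : Vec ℤ v) b → evalTerms x (bitTerms b) ≡ b2z b
evalTerms-bit x false = refl
evalTerms-bit x true  = evalTerms-one x

height-one : ∀ {v} → Height 0 (oneTerms {v})
height-one = height (s≤s z≤n) ((λ i → ℕₚ.≤-trans (ℕₚ.≤-reflexive (Vecₚ.lookup-replicate i 0)) z≤n) ∷ [])

height-var : ∀ {v} (i : Fin v) → Height 0 (varTerms i)
height-var i = height (s≤s z≤n) (unitExponent-≤1 i ∷ [])

height-bit : ∀ {v} b → Height 0 (bitTerms {v} b)
height-bit false = height z≤n []
height-bit true  = height-one

-- Exponential sums and products of circuits

data Aggregate : Op → Set where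
  sum     : Aggregate plus
  product : Aggregate times

module CubeFamily (collapse : Collapse) {o : Op} (agg : Aggregate o) (k E : ℕ → ℕ) (kB : Bounded k) (EB : Bounded E)
  (C : ∀ n → Code 1 (1 + (k n + E n))) (CB : Bounded (λ n → gateCount (C n))) where

  c b : ℕ
  c = proj₁ (Bounded-+ (Bounded-const 1) kB)
  v h : ℕ → ℕ
  -- Dummy variables are added to the k n given ones, so that 1 + v n is exactly a power of 2 + n.
  v n = pw c n ∸ 1
  h n = gateCount (C n) + E n
  hB : Bounded (λ n → h n + 3)
  -- The extra 3 gives 8 · 2^h ≤ 2^ℓ. This makes the degrees smaller than D and leaves room for the
  -- factor 10 in `norm-small`: 10 · 2^(2^h) ≤ 2^(4 + 2^h).
  hB = Bounded-+ (Bounded-+ CB EB) (Bounded-const 3)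
  b = proj₁ hB

  suc-v : ∀ n → suc (v n) ≡ pw c n
  suc-v n = ℕₚ.m+[n∸m]≡n (1≤pw c n)

  k≤v : ∀ n → k n ≤ v n
  k≤v n = ℕₚ.∸-monoˡ-≤ 1 (proj₂ (Bounded-+ (Bounded-const 1) kB) n)

  ℓ D : ℕ → ℕ
  ℓ = pw b
  D n = 2 ^ ℓ n

  -- The circuit is run on formal polynomials, with its summation variables replaced by the bits of
  -- `e`.
  summand : ∀ n → Vec Bool (E n) → List (Term (v n))
  summand n e = head (run opTerms (C n) (oneTerms ∷ tabulate (λ i → varTerms (inject≤ i (k≤v n))) ++ map bitTerms e))

  ts : ∀ n → List (Term (v n))
  ts n = cube (opTerms o) (E n) (summand n)

  restrict : ∀ n → Vec ℤ (v n) → Vec ℤ (k n)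
  restrict n x = tabulate (λ i → lookup x (inject≤ i (k≤v n)))

  evalTerms-ts : ∀ n x → evalTerms x (ts n) ≡ cube (opVal o) (E n) (λ e → head (run opVal (C n) (ℤ.1ℤ ∷ restrict n x ++ map b2z e)))
  evalTerms-ts n x = trans (cube-hom (opTerms o) (opVal o) (evalTerms x) (evalTerms-op x o) (E n) (summand n)) (cube-cong (opVal o) (E n) point)
    where
    head-map : ∀ {A B : Set} (φ : A → B) (u : Vec A 1) → φ (head u) ≡ head (map φ u)
    head-map φ (a ∷ []) = refl
    point : ∀ e → evalTerms x (summand n e) ≡ head (run opVal (C n) (ℤ.1ℤ ∷ restrict n x ++ map b2z e))
    point e = trans (head-map (evalTerms x) (run opTerms (C n) _)) (cong head (trans (run-hom opTerms opVal (evalTerms x) (evalTerms-op x) (C n) _)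
      (cong₂ (λ a u → run opVal (C n) (a ∷ u)) (evalTerms-one x) (trans (Vecₚ.map-++ (evalTerms x) (tabulate (λ i → varTerms (inject≤ i (k≤v n)))) (map bitTerms e))
        (cong₂ _++_ (trans (sym (Vecₚ.tabulate-∘ (evalTerms x) (λ i → varTerms (inject≤ i (k≤v n))))) (Vecₚ.tabulate-cong (λ i → evalTerms-var x (inject≤ i (k≤v n)))))
          (trans (sym (Vecₚ.map-∘ (evalTerms x) bitTerms e)) (Vecₚ.map-cong (evalTerms-bit x) e)))))))

  height-ts : ∀ n → Height (h n) (ts n)
  height-ts n = height-cube o (E n) (λ e → height-run (C n) _ (inputs-height e))
    where
    inputs-height : ∀ e u → Height 0 (lookup (oneTerms ∷ tabulate (λ i → varTerms (inject≤ i (k≤v n))) ++ map bitTerms e) u)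
    inputs-height e zero    = height-one
    inputs-height e (suc u) = everywhere-++ {P = Height 0} (tabulate (λ i → varTerms (inject≤ i (k≤v n)))) {map bitTerms e}
      (λ i → subst (Height 0) (sym (Vecₚ.lookup∘tabulate (λ i → varTerms (inject≤ i (k≤v n))) i)) (height-var (inject≤ i (k≤v n))))
      (λ i → subst (Height 0) (sym (Vecₚ.lookup-map i bitTerms e)) (height-bit (lookup e i))) u

  2^h< : ∀ n → 8 * 2 ^ h n ≤ 2 ^ ℓ n
  2^h< n = ℕₚ.≤-trans (ℕₚ.≤-reflexive (trans (ℕₚ.*-comm 8 (2 ^ h n)) (sym (ℕₚ.^-distribˡ-+-* 2 (h n) 3)))) (ℕₚ.^-monoʳ-≤ 2 (proj₂ hB n))

  degree-small : ∀ n → 2 ^ h n < 2 ^ ℓ n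
  degree-small n = ℕₚ.<-≤-trans (ℕₚ.m<m*n (2 ^ h n) 8 ⦃ ℕ.>-nonZero (ℕₚ.m^n>0 2 (h n)) ⦄ (s≤s (s≤s z≤n))) (ℕₚ.≤-trans (ℕₚ.≤-reflexive (ℕₚ.*-comm (2 ^ h n) 8)) (2^h< n))

  norm-small : ∀ n → 10 * norm (ts n) ≤ 2 ^ 2 ^ ℓ n
  norm-small n = begin
    10 * norm (ts n)                ≤⟨ ℕₚ.*-mono-≤ (ℕₚ.m≤m+n 10 6) (norm-≤ (height-ts n)) ⟩
    2 ^ 4 * 2 ^ 2 ^ h n             ≡⟨ sym (ℕₚ.^-distribˡ-+-* 2 4 (2 ^ h n)) ⟩
    2 ^ (4 + 2 ^ h n)               ≤⟨ ℕₚ.^-monoʳ-≤ 2 (ℕₚ.≤-trans (ℕₚ.≤-trans (ℕₚ.+-monoˡ-≤ (2 ^ h n) (ℕₚ.*-monoʳ-≤ 4 (ℕₚ.m^n>0 2 (h n)))) (five (2 ^ h n))) (2^h< n)) ⟩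
    2 ^ 2 ^ ℓ n ∎
    where
    open ℕₚ.≤-Reasoning
    five : ∀ x → 4 * x + x ≤ 8 * x
    five x = ℕₚ.≤-trans (ℕₚ.≤-reflexive (lem x)) (ℕₚ.*-monoˡ-≤ x (ℕₚ.m≤m+n 5 3))
      where
      lem : ∀ x → 4 * x + x ≡ 5 * x
      lem = ℕSolver.solve-∀

  point : ∀ n → Vec ℤ (k n)
  point n = restrict n (points (D n) (D n) (v n))

  -- The argument y encodes the bits substituted for the summation variables. The second argument
  -- only fits the two-argument form of `easy-zmod`.
  value : ∀ n → ℕ → ℕ → ℤ
  value n y _ = head (run opVal (C n) (ℤ.1ℤ ∷ point n ++ map b2z (bits (E n) y)))

  -- The coordinates of the evaluation point have exponentially many bits, but ℓ squarings of 2 give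
  -- the first and ℓ further squarings each following one. This keeps the arithmetic program short
  -- enough for `easy-zmod`.
  module ValueCode (n w : ℕ) where
    In : Set
    In = Vec ℤ w × Vec ℤ w
    bs es : Vec (In → ℤ) w
    bs = block proj₁
    es = block proj₂
    Γ : Vec (In → ℤ) (1 + 2 * w)
    Γ = const ℤ.1ℤ ∷ bs ++ (es ++ [])
    Γ-⟨⟩ : ∀ y z → Γ ⟨ y , z ⟩ ≡ ℤ.1ℤ ∷ y ++ (z ++ [])
    Γ-⟨⟩ y z = cong (ℤ.1ℤ ∷_) (trans (Vecₚ.map-++ _ bs _) (cong₂ _++_ (block-⟨⟩ proj₁ (y , z)) (trans (Vecₚ.map-++ _ es []) (cong (_++ []) (block-⟨⟩ proj₂ (y , z))))))
    base two zeroF : In → ℤ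
    zeroF _ = ℤ.1ℤ ℤ.- ℤ.1ℤ
    two _ = ℤ.1ℤ ℤ.+ ℤ.1ℤ
    base = iterSquare (ℓ n) two
    pts : Vec (In → ℤ) (v n)
    pts = pointFs (ℓ n) (v n) base
    args : Vec (In → ℤ) (1 + (k n + E n))
    args = const ℤ.1ℤ ∷ tabulate (λ i → lookup pts (inject≤ i (k≤v n))) ++ adjust (E n) zeroF bs
    out : In → ℤ
    out x = head (run opVal (C n) (args ⟨ x ⟩))
    size′ : ℕ
    size′ = suc (suc (ℓ n + (v n * ℓ n + gateCount (C n))))
    prog : Computable opVal Γ size′ (out ∷ [])
    prog = C-step minus here here (C-step plus (there here) (there here) (C-let (C-iterSquare (ℓ n) here) (C-let (C-points (ℓ n) (v n) here)
      (C-call (C n) {gs = args} (consV (skip pts (there (there (there here))))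
        (appendV (tabulateV {f = λ i → lookup pts (inject≤ i (k≤v n))} (λ i → lookupV (hereV pts) (inject≤ i (k≤v n))))
          (adjust-has (E n) (skip pts (there (there here))) (skipV pts (thereV (thereV (thereV (thereV (hereV bs)))))))))
        (λ x → single (run opVal (C n) (args ⟨ x ⟩)))))))
      where
      single : (u : Vec ℤ 1) → u ≡ head u ∷ []
      single (a ∷ []) = refl
    args-⟨⟩ : ∀ (y : Vec Bool w) z → args ⟨ map b2z y , z ⟩ ≡ ℤ.1ℤ ∷ point n ++ map b2z (bits (E n) (num y))
    args-⟨⟩ y z = cong (ℤ.1ℤ ∷_) (trans (Vecₚ.map-++ _ (tabulate (λ i → lookup pts (inject≤ i (k≤v n)))) (adjust (E n) zeroF bs)) (cong₂ _++_
      (trans (sym (Vecₚ.tabulate-∘ (λ f → f x) (λ i → lookup pts (inject≤ i (k≤v n))))) (Vecₚ.tabulate-cong (λ i → trans (sym (Vecₚ.lookup-map (inject≤ i (k≤v n)) (λ f → f x) pts))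
        (cong (λ u → lookup u (inject≤ i (k≤v n))) (pointFs-⟨⟩ (ℓ n) (v n) base x (D n) base-value)))))
      (trans (map-adjust (λ f → f x) (E n) zeroF bs) (trans (cong (adjust (E n) ℤ.0ℤ) (block-⟨⟩ proj₁ x)) (trans (sym (map-adjust b2z (E n) false y)) (cong (map b2z) (sym (bits-num (E n) y))))))))
      where
      x : In
      x = map b2z y , z
      base-value : base x ≡ 2^ (D n)
      base-value = trans (iterSquare-2^ (ℓ n) two x 1 refl) (cong 2^ (ℕₚ.+-identityʳ (D n)))
    code-value : ∀ (y z : Vec Bool w) → run opVal (code prog) (ℤ.1ℤ ∷ map b2z (y ++ (z ++ []))) ≡ value n (num y) (num z) ∷ []
    code-value y z = trans (cong (run opVal (code prog)) (trans (cong (ℤ.1ℤ ∷_) (trans (Vecₚ.map-++ b2z y _) (cong (map b2z y ++_) (Vecₚ.map-++ b2z z [])))) (sym (Γ-⟨⟩ (map b2z y) (map b2z z)))))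
      (trans (correct prog (map b2z y , map b2z z)) (cong (λ u → head (run opVal (C n) u) ∷ []) (args-⟨⟩ y (map b2z z))))

  vB : Bounded v
  vB = Bounded-≤ (λ n → ℕₚ.m∸n≤m (pw c n) 1) (Bounded-pw c)

  easy-value : ∀ {r} {y p : ℕ → Vec ℕ r → ℕ} → Easy y → Easy p → Easy (λ n u → zmod (value n (y n u) 0) (p n u))
  easy-value ey ep = easy-zmod collapse 0 (λ a n → code (ValueCode.prog n (pw a n)))
    (λ a → Bounded-≤ (λ n → small (ValueCode.prog n (pw a n))) (Bounded-+ (Bounded-const 2) (Bounded-+ (Bounded-pw b) (Bounded-+ (Bounded-* vB (Bounded-pw b)) CB))))
    value (λ a n → ValueCode.code-value n (pw a n)) ey (easy-lit 0) ep

  -- A sum of exponentially many short residues is still short and needs no further reduction; `Xr`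
  -- has to be correct only up to congruence. A product would be too long and goes through
  -- `prodMod`.
  residue′ : Aggregate o → ℕ → ℕ → ℕ
  residue′ sum     n p = Σ< (2 ^ E n) (λ y → zmod (value n y 0) p)
  residue′ product n p = prodMod p (2 ^ E n) (λ y → zmod (value n y 0) p)

  easy-residue : ∀ a {r} {f : ℕ → Vec ℕ r → ℕ} → Easy f → Easy (λ n u → residue′ a n (f n u))
  easy-residue sum     ef = easy-Σ collapse (easy-2^ EB) (easy-value v0 (easy-weaken ef))
  easy-residue product ef = easy-prodMod collapse ef (easy-2^ EB) (easy-value v0 (easy-weaken ef))

  residue-correct : ∀ n p → Prime p → + residue′ agg n p ≋ evalTerms (points (D n) (D n) (v n)) (ts n) [ + p ]
  residue-correct n p pp = ≋-trans (go agg) (≋-reflexive (sym (trans (evalTerms-ts n (points (D n) (D n) (v n)))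
      (cube-cong (opVal o) (E n) (λ e → cong (λ u → head (run opVal (C n) (ℤ.1ℤ ∷ point n ++ map b2z u))) (sym (trans (bits-num (E n) e) (adjust-exact false e))))))))
    where
    open ModPrime pp using (1≤p)
    term : ∀ (e : Vec Bool (E n)) → + zmod (value n (num e) 0) p ≋ value n (num e) 0 [ + p ]
    term e = zmod-≋ (value n (num e) 0) 1≤p
    sums : ∀ m (f : Vec Bool m → ℕ) g → (∀ e → + f e ≋ g e [ + p ]) → + cube _+_ m f ≋ cube ℤ._+_ m g [ + p ]
    sums zero    f g r = r []
    sums (suc m) f g r = ≋-+ (sums m _ _ (λ e → r (false ∷ e))) (sums m _ _ (λ e → r (true ∷ e)))
    products : ∀ m (f : Vec Bool m → ℕ) g → (∀ e → + f e ≋ g e [ + p ]) → + cube _*_ m f ≋ cube ℤ._*_ m g [ + p ]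
    products zero    f g r = r []
    products (suc m) f g r = ≋-trans (≋-reflexive (ℤₚ.pos-* (cube _*_ m (λ e → f (false ∷ e))) (cube _*_ m (λ e → f (true ∷ e)))))
      (≋-* (products m _ _ (λ e → r (false ∷ e))) (products m _ _ (λ e → r (true ∷ e))))
    go : (a : Aggregate o) → + residue′ a n p ≋ cube (opVal o) (E n) (λ e → value n (num e) 0) [ + p ]
    go sum     = ≋-trans (≋-reflexive (cong +_ (sym (cube-Σ< (E n) (λ y → zmod (value n y 0) p))))) (sums (E n) _ _ term)
    go product = ≋-trans (prodMod-≈ pp (2 ^ E n) (λ y → zmod (value n y 0) p))
      (≋-trans (≋-reflexive (cong +_ (sym (cube-Π< (E n) (λ y → zmod (value n y 0) p))))) (products (E n) _ _ term))

  open FromResidues collapse b c v suc-v ts norm-small (λ n → 2 ^ h n) degree-small (λ n → below (height-ts n)) (residue′ agg) (easy-residue agg) residue-correct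
    using (polynomialCode; polynomialCode-value; polynomialCode-bounded)

  abstract
    aggregateCode : ∀ n → Code 1 (1 + k n)
    -- The dummy variables are connected to wire 0 and so take the value 1; the polynomial does not
    -- contain them.
    aggregateCode n = ren (zero ∷ adjust (v n) zero (weakenWires (allFin (k n)))) (code (polynomialCode n))

    aggregateCode-bounded : Bounded (λ n → gateCount (aggregateCode n))
    aggregateCode-bounded = Bounded-≤ (λ n → ℕₚ.≤-reflexive (gateCount-ren _ (code (polynomialCode n)))) polynomialCode-bounded

    aggregateCode-value : ∀ n x → run opVal (aggregateCode n) (ℤ.1ℤ ∷ x) ≡ cube (opVal o) (E n) (λ e → head (run opVal (C n) (ℤ.1ℤ ∷ x ++ map b2z e))) ∷ []
    aggregateCode-value n x = trans (run-ren opVal (zero ∷ adjust (v n) zero (weakenWires (allFin (k n)))) (code (polynomialCode n)) (ℤ.1ℤ ∷ x))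
      (trans (cong (λ u → run opVal (code (polynomialCode n)) (ℤ.1ℤ ∷ u)) (trans (map-adjust (lookup (ℤ.1ℤ ∷ x)) (v n) zero (weakenWires (allFin (k n))))
        (cong (adjust (v n) ℤ.1ℤ) (trans (map-lookup-weaken ℤ.1ℤ x (allFin (k n))) (Vecₚ.map-lookup-allFin x)))))
      (trans (polynomialCode-value n (adjust (v n) ℤ.1ℤ x)) (cong (_∷ []) (trans (evalTerms-ts n (adjust (v n) ℤ.1ℤ x))
        (cube-cong (opVal o) (E n) (λ e → cong (λ u → head (run opVal (C n) (ℤ.1ℤ ∷ u ++ map b2z e)))
          (trans (Vecₚ.tabulate-cong (λ i → lookup-adjust ℤ.1ℤ x (k≤v n) i)) (Vecₚ.tabulate∘lookup x))))))))

-- Conclusion for both kinds of families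

addDummy : ∀ {k} → Circuit k → Circuit (k + 0)
addDummy {k} C = toCircuit (ren (zero ∷ tabulate (λ i → suc (i ↑ˡ 0))) (fromCircuit C))

size-addDummy : ∀ {k} (C : Circuit k) → size (addDummy C) ≡ size C
size-addDummy C = trans (size-toCircuit (ren _ (fromCircuit C))) (trans (gateCount-ren _ (fromCircuit C)) (gateCount-fromCircuit C))

eval-addDummy : ∀ {k} (C : Circuit k) x → eval (addDummy C) x ≡ eval C (λ i → x (i ↑ˡ 0))
eval-addDummy {k} C x = Vecₚ.∷-injectiveˡ (trans (sym (eval-toCircuit (ren τ (fromCircuit C)) x)) (trans (run-ren opVal τ (fromCircuit C) _)
  (trans (cong (λ u → run opVal (fromCircuit C) (ℤ.1ℤ ∷ u)) (trans (sym (Vecₚ.tabulate-∘ (lookup (ℤ.1ℤ ∷ tabulate x)) (λ i → suc (i ↑ˡ 0)))) (Vecₚ.tabulate-cong (λ i → Vecₚ.lookup∘tabulate x (i ↑ˡ 0)))))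
    (run-fromCircuit C (λ i → x (i ↑ˡ 0))))))
  where
  τ : Vec (Fin (1 + (k + 0))) (1 + k)
  τ = zero ∷ tabulate (λ i → suc (i ↑ˡ 0))

++ᶠ-↑ˡ : ∀ {A : Set} {m n} (x : Fin m → A) (y : Fin n → A) i → (x ++ᶠ y) (i ↑ˡ n) ≡ x i
++ᶠ-↑ˡ {m = m} {n} x y i rewrite Finₚ.splitAt-↑ˡ m i n = refl

-- A family is the sum, and equally the product, of itself over the cube of dimension 0. Since the
-- empty assignment is unique only pointwise, the equation is stated for all of them.
module Trivial {F : Family} (F∈VP0nb : VP0nb F) where

  trivial : ExtFamily F []
  trivial n x = poly F n (λ i → x (i ↑ˡ 0))

  trivial∈VP0nb : VP0nb (extend F [] trivial)
  trivial∈VP0nb = let varsB , s , sB , circuits = F∈VP0nb in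
    Bounded⇒PolyBounded (Bounded-≤ (λ n → ℕₚ.≤-reflexive (ℕₚ.+-identityʳ (vars F n))) (PolyBounded⇒Bounded varsB)) , s , sB ,
    λ n → let C , C≤ , C≡ = circuits n in addDummy C , ℕₚ.≤-trans (ℕₚ.≤-reflexive (size-addDummy C)) C≤ , λ x → trans (eval-addDummy C x) (C≡ _)

  unchanged : ∀ n x (e : Fin 0 → ℤ) → poly F n x ≡ trivial n (x ++ᶠ e)
  unchanged n x e = let C , _ , C≡ = proj₂ (proj₂ (proj₂ F∈VP0nb)) n in
    trans (sym (C≡ x)) (trans (eval-cong C (λ i → sym (++ᶠ-↑ˡ x e i))) (C≡ _))

-- Sums and products are treated at once: `∑` is either cube operator, tied to the operation `o` by
-- its description over Boolean vectors.
collapsed : Collapse → ∀ {o} → Aggregate o → (∑ : (m : ℕ) → ((Fin m → ℤ) → ℤ) → ℤ) →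
  (∀ m h → Extensional h → ∑ m h ≡ cube (opVal o) m (λ e → h (λ i → b2z (lookup e i)))) →
  ∀ F (p : NatPoly) (g : ExtFamily F p) → VP0nb (extend F p g) → (∀ n x → poly F n x ≡ ∑ (evalNP p n) (λ e → g n (x ++ᶠ e))) → VP0nb F
collapsed collapse {o} agg ∑ ∑≡cube F p g (varsB , s , sB , circuits) F≡∑ =
  Bounded⇒PolyBounded kB , (λ n → gateCount (aggregateCode n)) , Bounded⇒PolyBounded aggregateCode-bounded ,
  λ n → toCircuit (aggregateCode n) , ℕₚ.≤-reflexive (size-toCircuit (aggregateCode n)) , computes′ n
  where
  k E : ℕ → ℕ
  k = vars F
  E = evalNP p
  kB : Bounded k
  kB = Bounded-≤ (λ n → ℕₚ.m≤m+n (k n) (E n)) (PolyBounded⇒Bounded varsB)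
  EB : Bounded E
  EB = Bounded-≤ (λ n → ℕₚ.m≤n+m (E n) (k n)) (PolyBounded⇒Bounded varsB)
  G : ∀ n → Circuit (k n + E n)
  G n = proj₁ (circuits n)
  G≡ : ∀ n → Computes (G n) (g n)
  G≡ n = proj₂ (proj₂ (circuits n))
  open CubeFamily collapse agg k E kB EB (λ n → fromCircuit (G n))
    (Bounded-≤ (λ n → ℕₚ.≤-trans (ℕₚ.≤-reflexive (gateCount-fromCircuit (G n))) (proj₁ (proj₂ (circuits n)))) (PolyBounded⇒Bounded sB))
    using (aggregateCode; aggregateCode-bounded; aggregateCode-value)
  computes′ : ∀ n → Computes (toCircuit (aggregateCode n)) (poly F n)
  computes′ n x = begin
    eval (toCircuit (aggregateCode n)) x
      ≡⟨ Vecₚ.∷-injectiveˡ (trans (sym (eval-toCircuit (aggregateCode n) x)) (aggregateCode-value n (tabulate x))) ⟩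
    cube (opVal o) (E n) (λ e → head (run opVal (fromCircuit (G n)) (ℤ.1ℤ ∷ tabulate x ++ map b2z e)))
      ≡⟨ cube-cong (opVal o) (E n) point′ ⟩
    cube (opVal o) (E n) (λ e → g n (x ++ᶠ (λ i → b2z (lookup e i))))
      ≡⟨ sym (∑≡cube (E n) (λ e → g n (x ++ᶠ e)) (λ {y} {z} → extensional {y} {z})) ⟩
    ∑ (E n) (λ e → g n (x ++ᶠ e))
      ≡⟨ sym (F≡∑ n x) ⟩
    poly F n x ∎
    where
    open ≡-Reasoning
    ++ᶠ-cong : ∀ {y z : Fin (E n) → ℤ} → (∀ i → y i ≡ z i) → ∀ i → (x ++ᶠ y) i ≡ (x ++ᶠ z) i
    ++ᶠ-cong h i with splitAt (k n) i
    ... | inj₁ _ = refl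
    ... | inj₂ j = h j
    extensional : Extensional (λ e → g n (x ++ᶠ e))
    extensional {y} {z} h = trans (sym (G≡ n (x ++ᶠ y))) (trans (eval-cong (G n) (++ᶠ-cong {y} {z} h)) (G≡ n (x ++ᶠ z)))
    point′ : ∀ e → head (run opVal (fromCircuit (G n)) (ℤ.1ℤ ∷ tabulate x ++ map b2z e)) ≡ g n (x ++ᶠ (λ i → b2z (lookup e i)))
    point′ e = trans (cong head (trans (cong (λ u → run opVal (fromCircuit (G n)) (ℤ.1ℤ ∷ u)) (sym (trans (tabulate-++ᶠ x (λ i → b2z (lookup e i)))
        (cong (tabulate x ++_) (trans (Vecₚ.tabulate-∘ b2z (lookup e)) (cong (map b2z) (Vecₚ.tabulate∘lookup e)))))))
      (run-fromCircuit (G n) (x ++ᶠ (λ i → b2z (lookup e i)))))) (G≡ n _)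

theorem5 : VP0 ≐ VNP0 → (VP0nb ≐ VNP0nb) × (VP0nb ≐ VΠP0)
theorem5 VP0≐VNP0 =
  (λ F → (λ F∈ → [] , Trivial.trivial F∈ , Trivial.trivial∈VP0nb F∈ , λ n x → Trivial.unchanged F∈ n x _) ,
         (λ { (p , g , g∈ , F≡) → collapsed collapse sum sumCube sumCube≡cube F p g g∈ F≡ })) ,
  (λ F → (λ F∈ → [] , Trivial.trivial F∈ , Trivial.trivial∈VP0nb F∈ , λ n x → Trivial.unchanged F∈ n x _) ,
         (λ { (p , g , g∈ , F≡) → collapsed collapse product prodCube prodCube≡cube F p g g∈ F≡ }))
  where
  collapse : Collapse
  collapse F = proj₂ (VP0≐VNP0 F)
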